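{- Let $G=(V,E)$ be an $\mathcal{M}(2,2)$-connected graph with an ear decomposition $C_1,\dots,C_t$ with $t\geq 2$, and for $1\leq i\leq t$ let $H_i=(V_i,C_i)$ be the subgraph induced by $C_i$ (with $V_i$ the set of endpoints of edges in $C_i$). Let $Y=V_t\setminus\bigcup_{i=1}^{t-1}V_i$ and $X=V_t\setminus Y$. Suppose that no 3-edge-separation $(F_1,F_2)$ of $H_t$ has the property that $|V(F_1)|,|V(F_2)|\geq 2$ and $F_i$ is a subgraph of $H_t[Y]$ for some $i\in\{1,2\}$. Then there is an admissible edge-reduction, an admissible edge-deletion or an admissible $K_4^-$-reduction of $G$.
   Context: All graphs are finite and simple. A graph is $(2,2)$-sparse if every subgraph $(V',E')$ with $E'\neq\emptyset$ has $|E'|\leq 2|V'|-2$. A $(2,2)$-circuit is a graph $(V',E')$ with $|E'|=2|V'|-1$ all of whose proper subgraphs $(V'',E'')$ with $E''\neq\emptyset$ satisfy $|E''|\leq 2|V''|-2$. $\mathcal{M}(2,2)$ is the matroid on the edges of a complete graph in which an edge set is independent iff it is empty or the graph it induces is $(2,2)$-sparse; its circuits are exactly the edge sets of $(2,2)$-circuits. A graph is $\mathcal{M}(2,2)$-connected if it has no isolated vertices, at least 2 edges, and every pair of edges lies in a common $(2,2)$-circuit subgraph. For circuits $C_1,\dots,C_t$ of $\mathcal{M}(2,2)$ restricted to $E$, let $D_i=C_1\cup\dots\cup C_i$; this is an ear decomposition of $G$ if $D_t=E$ and for all $2\leq i\leq t$: (E1) $C_i\cap D_{i-1}\neq\emptyset$;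 (E2) $C_i\setminus D_{i-1}\neq\emptyset$; (E3) no circuit $C'$ satisfying (E1),(E2) has $C'\setminus D_{i-1}\subsetneq C_i\setminus D_{i-1}$. $H[Y]$ is the induced subgraph on $Y$. A 3-edge-separation of $H$ is a pair of vertex-disjoint induced subgraphs $F_1,F_2$ of $H$ with $F_1\cup F_2=H-S$ for some edge set $S$ with $|S|=3$. A generalised vertex split chooses a vertex $v$ and a partition $N_1,N_2$ of its neighbours, deletes $v$, adds new vertices $v_1,v_2$ joined to $N_1$ and $N_2$ respectively, and adds edges $v_1v_2$ and $v_1x$ for some vertex $x\neq v$ not in $N_1$; an edge-reduction is the inverse operation (a graph $G'$ is an edge-reduction of $G$ if $G$ is a generalised vertex split of $G'$). A $K_4^-$-reduction deletes two adjacent degree-3 vertices $u_1,u_2$ with $N(u_1)\cap N(u_2)=\{v_1,v_2\}$ and $v_1v_2\notin E$, and adds the edge $v_1v_2$. An edge-deletion removes one edge. Such a reduction or deletion is admissible if the resulting graph is $\mathcal{M}(2,2)$-connected. -}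

module Defs where

open import Data.Nat using (ℕ; zero; suc; _+_; _*_; _≤_; _<_; _<ᵇ_)
open import Data.Bool using (Bool; true; false; _∧_; _∨_; not; if_then_else_)
open import Data.Fin using (Fin; zero; suc; toℕ; fromℕ)
open import Data.Product using (Σ; ∃; ∃-syntax; Σ-syntax; _×_; _,_)
open import Data.Sum using (_⊎_)
open import Relation.Nullary using (¬_)
open import Relation.Binary.PropositionalEquality using (_≡_; _≢_)
open import Function.Bundles using (_⇔_)

VS : ℕ → Set
VS n = Fin n → Bool

-- edge sets: Boolean adjacency matrices; a genuine edge set is symmetric
-- and irreflexive (IsES). The unordered pair {i,j} is an edge iff E i j ≡ true.
ES : ℕ → Set
ES n = Fin n → Fin n → Bool

IsES : ∀ {n} → ES n → Set
IsES E = (∀ i j → E i j ≡ E j i) × (∀ i → E i i ≡ false)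

sumFin : ∀ {n} → (Fin n → ℕ) → ℕ
sumFin {zero}  g = 0
sumFin {suc n} g = g zero + sumFin (λ i → g (suc i))

anyFin : ∀ {n} → (Fin n → Bool) → Bool
anyFin {zero}  f = false
anyFin {suc n} f = f zero ∨ anyFin (λ i → f (suc i))

vcount : ∀ {n} → VS n → ℕ
vcount W = sumFin (λ i → if W i then 1 else 0)

-- |E| : number of edges (each unordered pair {i,j} counted once, via i < j)
ecount : ∀ {n} → ES n → ℕ
ecount E = sumFin (λ i → vcount (λ j → E i j ∧ (toℕ i <ᵇ toℕ j)))

_⊆ᵛ_ : ∀ {n} → VS n → VS n → Set
W ⊆ᵛ W' = ∀ v → W v ≡ true → W' v ≡ true

_⊆ᵉ_ : ∀ {n} → ES n → ES n → Set
E ⊆ᵉ E' = ∀ i j → E i j ≡ true → E' i j ≡ true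

NonEmpty : ∀ {n} → ES n → Set
NonEmpty E = ∃[ i ] ∃[ j ] (E i j ≡ true)

IsEmpty : ∀ {n} → ES n → Set
IsEmpty E = ∀ i j → E i j ≡ false

IsGraph : ∀ {n} → VS n → ES n → Set
IsGraph W E = IsES E × (∀ i j → E i j ≡ true → W i ≡ true)

IsSubgraph : ∀ {n} → VS n → ES n → VS n → ES n → Set
IsSubgraph W' E' W E = IsGraph W' E' × W' ⊆ᵛ W × E' ⊆ᵉ E

IsProperSubgraph : ∀ {n} → VS n → ES n → VS n → ES n → Set
IsProperSubgraph W' E' W E = IsSubgraph W' E' W E × ¬ (W ⊆ᵛ W' × E ⊆ᵉ E')

ends : ∀ {n} → ES n → VS n
ends E v = anyFin (E v)

induce : ∀ {n} → ES n → VS n → ES n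
induce E Y i j = E i j ∧ Y i ∧ Y j

-- the graph (W , E) is (2,2)-sparse: every subgraph (W',E') with E' ≠ ∅
-- has |E'| ≤ 2|W'| - 2   (written |E'| + 2 ≤ 2|W'|)
Sparse22 : ∀ {n} → VS n → ES n → Set
Sparse22 W E = ∀ W' E' → IsSubgraph W' E' W E → NonEmpty E' →
               ecount E' + 2 ≤ 2 * vcount W'

-- the graph (W , E) is a (2,2)-circuit: |E| = 2|W| - 1 (written |E| + 1 = 2|W|)
-- and every proper subgraph with nonempty edge set is (2,2)-sparse-bounded
Circuit22 : ∀ {n} → VS n → ES n → Set
Circuit22 W E = IsGraph W E × (ecount E + 1 ≡ 2 * vcount W) ×
  (∀ W' E' → IsProperSubgraph W' E' W E → NonEmpty E' →
     ecount E' + 2 ≤ 2 * vcount W')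

Independent : ∀ {n} → ES n → Set
Independent F = IsEmpty F ⊎ Sparse22 (ends F) F

MCircuit : ∀ {n} → ES n → ES n → Set
MCircuit E C = IsES C × C ⊆ᵉ E × ¬ Independent C ×
  (∀ C' → IsES C' → C' ⊆ᵉ C → ¬ (C ⊆ᵉ C') → Independent C')

record Graph (n : ℕ) : Set where
  field
    adj    : ES n
    isES   : IsES adj
open Graph public

deg : ∀ {n} → Graph n → Fin n → ℕ
deg G v = vcount (adj G v)

MConnected : ∀ {n} → Graph n → Set
MConnected {n} G =
  (∀ v → ∃[ w ] (adj G v w ≡ true)) ×
  2 ≤ ecount (adj G) ×
  (∀ a b c d → adj G a b ≡ true → adj G c d ≡ true →
     ∃[ W ] ∃[ C ] (IsSubgraph W C (λ _ → true) (adj G) × Circuit22 W C ×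
                   C a b ≡ true × C c d ≡ true))

-- Ear decompositions. Circuits are indexed C : Fin t → ES n, where the paper's
-- C_i is C r with toℕ r = i - 1. D k = C_1 ∪ … ∪ C_k (membership predicate).

InD : ∀ {n t} → (Fin t → ES n) → ℕ → Fin n → Fin n → Set
InD C k i j = ∃[ r ] (toℕ r < k × C r i j ≡ true)

E1 : ∀ {n t} → (Fin t → ES n) → ℕ → ES n → Set
E1 C k C' = ∃[ i ] ∃[ j ] (C' i j ≡ true × InD C k i j)

E2 : ∀ {n t} → (Fin t → ES n) → ℕ → ES n → Set
E2 C k C' = ∃[ i ] ∃[ j ] (C' i j ≡ true × ¬ InD C k i j)

StrictDiffSub : ∀ {n t} → (Fin t → ES n) → ℕ → ES n → ES n → Set
StrictDiffSub C k C' C'' =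
  (∀ i j → C' i j ≡ true → ¬ InD C k i j → C'' i j ≡ true) ×
  (∃[ i ] ∃[ j ] (C'' i j ≡ true × ¬ InD C k i j × ¬ (C' i j ≡ true)))

EarDecomposition : ∀ {n} → Graph n → (t : ℕ) → (Fin t → ES n) → Set
EarDecomposition G t C =
  (∀ r → MCircuit (adj G) (C r)) ×
  (∀ i j → (adj G i j ≡ true) ⇔ InD C t i j) ×
  (∀ r → 1 ≤ toℕ r →
     E1 C (toℕ r) (C r) × E2 C (toℕ r) (C r) ×
     ¬ (∃[ C' ] (MCircuit (adj G) C' × E1 C (toℕ r) C' × E2 C (toℕ r) C' ×
                 StrictDiffSub C (toℕ r) C' (C r))))

-- 3-edge-separations of a graph H = (W , E): vertex-disjoint induced subgraphs
-- F1 = H[W1], F2 = H[W2] with F1 ∪ F2 = H - S, S ⊆ E, |S| = 3.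

ThreeEdgeSep : ∀ {n} → VS n → ES n → VS n → VS n → Set
ThreeEdgeSep W E W1 W2 =
  W1 ⊆ᵛ W × W2 ⊆ᵛ W ×
  (∀ v → W1 v ≡ true → W2 v ≡ false) ×
  (∀ v → W v ≡ true → W1 v ≡ true ⊎ W2 v ≡ true) ×
  ∃[ S ] (IsES S × S ⊆ᵉ E × ecount S ≡ 3 ×
          (∀ i j → (induce E W1 i j ∨ induce E W2 i j ≡ true) ⇔
                   (E i j ≡ true × S i j ≡ false)))

-- G (on n vertices) is a generalised vertex split of G' (on m vertices),
-- up to relabelling: f : Fin m → Fin n is the relabelling of the vertices of
-- G' (vertex v of G' becoming v1 = f v) and v₂ is the new vertex v2.
EdgeReduction : ∀ {n m} → Graph n → Graph m → Set
EdgeReduction {n} {m} G G' =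
  Σ[ v ∈ Fin m ] Σ[ N1 ∈ VS m ] Σ[ N2 ∈ VS m ] Σ[ x ∈ Fin m ]
    ((∀ w → (adj G' v w ≡ true) ⇔ (N1 w ≡ true ⊎ N2 w ≡ true)) ×
     (∀ w → N1 w ≡ true → N2 w ≡ false) ×
     x ≢ v × N1 x ≡ false ×
     Σ[ f ∈ (Fin m → Fin n) ] Σ[ v₂ ∈ Fin n ]
       ((∀ a b → f a ≡ f b → a ≡ b) ×
        (∀ a → f a ≢ v₂) ×
        (∀ w → w ≡ v₂ ⊎ ∃[ a ] (f a ≡ w)) ×
        (∀ a b → a ≢ v → b ≢ v → adj G (f a) (f b) ≡ adj G' a b) ×
        (∀ a → a ≢ v → (adj G (f v) (f a) ≡ true) ⇔ (N1 a ≡ true ⊎ a ≡ x)) ×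
        (∀ a → a ≢ v → adj G v₂ (f a) ≡ N2 a) ×
        adj G (f v) v₂ ≡ true))

EdgeDeletion : ∀ {n} → Graph n → Graph n → Set
EdgeDeletion {n} G G' =
  Σ[ e1 ∈ Fin n ] Σ[ e2 ∈ Fin n ] (adj G e1 e2 ≡ true ×
    (∀ a b → (adj G' a b ≡ true) ⇔
       (adj G a b ≡ true × ¬ ((a ≡ e1 × b ≡ e2) ⊎ (a ≡ e2 × b ≡ e1)))))

K4Reduction : ∀ {n m} → Graph n → Graph m → Set
K4Reduction {n} {m} G G' =
  Σ[ u1 ∈ Fin n ] Σ[ u2 ∈ Fin n ] Σ[ v1 ∈ Fin n ] Σ[ v2 ∈ Fin n ]
    (u1 ≢ u2 × adj G u1 u2 ≡ true × deg G u1 ≡ 3 × deg G u2 ≡ 3 ×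
     v1 ≢ v2 ×
     (∀ w → (adj G u1 w ≡ true × adj G u2 w ≡ true) ⇔ (w ≡ v1 ⊎ w ≡ v2)) ×
     adj G v1 v2 ≡ false ×
     Σ[ f ∈ (Fin m → Fin n) ]
       ((∀ a b → f a ≡ f b → a ≡ b) ×
        (∀ a → f a ≢ u1 × f a ≢ u2) ×
        (∀ w → w ≡ u1 ⊎ w ≡ u2 ⊎ ∃[ a ] (f a ≡ w)) ×
        (∀ a b → (adj G' a b ≡ true) ⇔
           (adj G (f a) (f b) ≡ true ⊎ (f a ≡ v1 × f b ≡ v2) ⊎
            (f a ≡ v2 × f b ≡ v1)))))

-- For an ear decomposition C : Fin (suc s) → ES n (t = s + 1 circuits),
-- Y = V_t \ (V_1 ∪ … ∪ V_{t-1}), where V_i = ends C_i.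
earY : ∀ {n} (s : ℕ) → (Fin (suc s) → ES n) → VS n
earY s C v = ends (C (fromℕ s)) v ∧ not (anyFin (λ r → (toℕ r <ᵇ s) ∧ ends (C r) v))

{-# OPTIONS --safe #-}
module Submission where

-- Let Y be the set of vertices that only the last ear uses, and D the union of the other ears.
-- By minimality of the ears D is connected and rigid, and if Y is empty the last ear is one edge,
-- which can be deleted.  Otherwise the 2|Y| + 1 edges at Y form a circuit of the contraction by D:
-- every nonempty S ⊆ Y is met by at least 2|S| + 1 edges and spans at most 2|S| − 2.  Conversely,
-- any graph obtained by changing the edges at Y that keeps these counts, and is still attached to D
-- at two vertices, is connected.  Hence a reduction inside Y is obstructed only by critical sets
-- (met by exactly 2|S| + 1 edges), by tight sets (spanning exactly 2|S| − 2) or by edges that are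
-- already present; the hypothesis on 3-edge-separations says that no set of two or more vertices
-- is both critical and tight.  In a minimal critical set W containing a vertex of degree at least
-- 4, failure of all reductions at the vertices of degree 3 puts each of them into a K₄.  Counting
-- degrees over the maximal tight subsets of W shows that one of these K₄ leaves W; removing its
-- part inside W gives a smaller critical set, which has too few vertices to exist.  If all
-- vertices of Y have degree 3, Y induces a tree and a leaf of the tree is reducible.

-- The constants come from contracting the rigid part `D`: a circuit that meets `D` spans at most
-- `2|R| − 2` edges on its vertices `R` outside a new set `S`, so it spends at least `2|S| + 1` of
-- its edges on `S`. Attachment at two vertices is indispensable: with a single outer vertex the
-- edges at `Y` would be a circuit by themselves, linked to nothing else. The excess of critical
-- sets is submodular and that of tight sets supermodular, so obstructions to different reductions
-- at one vertex can be intersected, united, or played against each other; a tight set crossing a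
-- critical one cuts it down to a smaller critical set. What this calculus cannot remove is an edge
-- that is already present, whence the K₄s. They are met by K₄⁻-reductions and, in one exceptional
-- configuration on a triangle of degrees 3, 3, 4, by contracting an edge at the vertex of degree 4.
-- An ear with one or two new vertices may have to vanish altogether; if the edge that should
-- replace it is already there, that edge is deleted instead. The combinatorial core refutes
-- irreducibility; since reducibility is decidable, a reduction is obtained constructively.

open import Defs
open import Data.Nat using (ℕ; zero; suc; _+_; _*_; _≤_; _<_; _≤?_; _<ᵇ_; _≤ᵇ_; z≤n; s≤s)
import Data.Nat as ℕ
open import Data.Nat.Properties hiding (_≟_)
open import Data.Nat.Tactic.RingSolver using (solve-∀)
import Data.Integer as ℤ
open import Data.Integer using (ℤ; -[1+_])
open import Data.Bool using (Bool; true; false; _∧_; _∨_; not; if_then_else_; T)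
import Data.Bool.Properties as 𝔹
open import Data.Fin using (Fin; zero; suc; toℕ; fromℕ; fromℕ<; punchIn; punchOut; _≟_)
import Data.Fin.Properties as Fin
import Data.Fin.Subset.Properties as Subset
open import Data.Maybe using (Maybe; just; nothing)
open import Data.List using (List; []; _∷_; _++_)
import Data.List as List
open import Data.Vec using (Vec; []; _∷_; lookup; tabulate; replicate; zipWith)
import Data.Vec as Vec
open import Data.Vec.N-ary using (N-ary; _$ⁿ_; ∀ⁿ; curryⁿ)
open import Data.Vec.Properties using (lookup∘tabulate)
open import Data.Product using (∃; ∃-syntax; _×_; _,_; proj₁; proj₂)
open import Data.Sum using (_⊎_; inj₁; inj₂)
open import Data.Empty using (⊥; ⊥-elim)
open import Data.Unit using (⊤; tt)
open import Relation.Nullary using (¬_; Dec; yes; no; does)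
open import Relation.Nullary.Decidable using (True; toWitness; dec-true; dec-false; decidable-stable; _×-dec_; _⊎-dec_; _→-dec_; ¬?; map′)
open import Relation.Binary.PropositionalEquality using (_≡_; _≢_; refl; sym; trans; cong; cong₂; subst; subst₂; module ≡-Reasoning)
open import Function using (_∘_; case_of_)
open import Function.Bundles using (_⇔_; mk⇔; Equivalence)

-- Linear arithmetic over ℕ

infixl 7 _⊗_
infixl 6 _⊕_
infix  4 _≼_ _≐_
infixr 2 _⇒_
infix  3 ⊢_

data Ex (n : ℕ) : Set where
  var : Fin n → Ex n
  κ   : ℕ → Ex n
  _⊕_ : Ex n → Ex n → Ex n
  _⊗_ : ℕ → Ex n → Ex n

data Fm (n : ℕ) : Set where
  _≼_ _≐_ : Ex n → Ex n → Fm n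

data Sequent (n : ℕ) : Set where
  ⊢_  : Fm n → Sequent n
  ⊢⊥  : Sequent n
  _⇒_ : Fm n → Sequent n → Sequent n

eval : ∀ {n} → Ex n → Vec ℕ n → ℕ
eval (var i) ρ = lookup ρ i
eval (κ k)   ρ = k
eval (e ⊕ f) ρ = eval e ρ + eval f ρ
eval (k ⊗ e) ρ = k * eval e ρ

evalFm : ∀ {n} → Fm n → Vec ℕ n → Set
evalFm (e ≼ f) ρ = eval e ρ ≤ eval f ρ
evalFm (e ≐ f) ρ = eval e ρ ≡ eval f ρ

evalSq : ∀ {n} → Sequent n → Vec ℕ n → Set
evalSq (⊢ φ)   ρ = evalFm φ ρ
evalSq ⊢⊥      ρ = ⊥
evalSq (φ ⇒ s) ρ = evalFm φ ρ → evalSq s ρ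

-- The head is the constant term, so evaluation is the dot product with `1 ∷ ρ`.
nf : ∀ {n} → Ex n → Vec ℕ (suc n)
nf {n} (var i) = 0 ∷ tabulate (λ j → if Fin-eq i j then 1 else 0)
  where
  Fin-eq : ∀ {n} → Fin n → Fin n → Bool
  Fin-eq zero    zero    = true
  Fin-eq zero    (suc j) = false
  Fin-eq (suc i) zero    = false
  Fin-eq (suc i) (suc j) = Fin-eq i j
nf {n} (κ k) = k ∷ replicate n 0
nf (e ⊕ f)   = zipWith _+_ (nf e) (nf f)
nf (k ⊗ e)   = Vec.map (k *_) (nf e)

dot : ∀ {n} → Vec ℕ n → Vec ℕ n → ℕ
dot []       []       = 0
dot (c ∷ cs) (x ∷ xs) = c * x + dot cs xs

dot-0 : ∀ {n} (ρ : Vec ℕ n) → dot (replicate n 0) ρ ≡ 0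
dot-0 []      = refl
dot-0 (x ∷ ρ) = dot-0 ρ

dot-+ : ∀ {n} (a b ρ : Vec ℕ n) → dot (zipWith _+_ a b) ρ ≡ dot a ρ + dot b ρ
dot-+ []      []      []      = refl
dot-+ (x ∷ a) (y ∷ b) (z ∷ ρ) rewrite dot-+ a b ρ = lem x y z (dot a ρ) (dot b ρ)
  where
  lem : ∀ x y z u v → (x + y) * z + (u + v) ≡ x * z + u + (y * z + v)
  lem = solve-∀

dot-* : ∀ {n} k (a ρ : Vec ℕ n) → dot (Vec.map (k *_) a) ρ ≡ k * dot a ρ
dot-* k []      []      = sym (*-zeroʳ k)
dot-* k (x ∷ a) (z ∷ ρ) rewrite dot-* k a ρ = lem k x z (dot a ρ)
  where
  lem : ∀ k x z u → k * x * z + k * u ≡ k * (x * z + u)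
  lem = solve-∀

nf-sound : ∀ {n} (e : Ex n) ρ → dot (nf e) (1 ∷ ρ) ≡ eval e ρ
nf-sound (var i) ρ = unit i ρ
  where
  unit : ∀ {n} (i : Fin n) (ρ : Vec ℕ n) → dot (nf (var i)) (1 ∷ ρ) ≡ lookup ρ i
  unit zero    (x ∷ ρ) = trans (cong (x + 0 +_) (zeros ρ)) (trans (+-identityʳ _) (+-identityʳ x))
    where
    zeros : ∀ {n} (ρ : Vec ℕ n) → dot (tabulate (λ _ → 0)) ρ ≡ 0
    zeros []      = refl
    zeros (x ∷ ρ) = zeros ρ
  unit (suc i) (x ∷ ρ) = unit i ρ
nf-sound (κ k)   ρ = trans (cong (k * 1 +_) (dot-0 ρ)) (trans (+-identityʳ _) (*-identityʳ k))
nf-sound (e ⊕ f) ρ = trans (dot-+ (nf e) (nf f) (1 ∷ ρ)) (cong₂ _+_ (nf-sound e ρ) (nf-sound f ρ))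
nf-sound (k ⊗ e) ρ = trans (dot-* k (nf e) (1 ∷ ρ)) (cong (k *_) (nf-sound e ρ))

_≤ⱽ_ : ∀ {n} → Vec ℕ n → Vec ℕ n → Bool
[]       ≤ⱽ []       = true
(x ∷ xs) ≤ⱽ (y ∷ ys) = (x ≤ᵇ y) ∧ (xs ≤ⱽ ys)

≤ⱽ-sound : ∀ {n} (a b ρ : Vec ℕ n) → T (a ≤ⱽ b) → dot a ρ ≤ dot b ρ
≤ⱽ-sound []      []      []      _ = z≤n
≤ⱽ-sound (x ∷ a) (y ∷ b) (z ∷ ρ) h with Equivalence.to (𝔹.T-∧ {x ≤ᵇ y}) h
... | p , q = +-mono-≤ (*-monoˡ-≤ z (≤ᵇ⇒≤ x y p)) (≤ⱽ-sound a b ρ q)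

record Hyp (n : ℕ) : Set where
  constructor hyp
  field
    isEq    : Bool
    lhs rhs : Ex n
open Hyp

HypHolds : ∀ {n} → Hyp n → Vec ℕ n → Set
HypHolds (hyp true  l r) ρ = eval l ρ ≡ eval r ρ
HypHolds (hyp false l r) ρ = eval l ρ ≤ eval r ρ

Holds : ∀ {n} → List (Hyp n) → Vec ℕ n → Set
Holds []       ρ = ⊤
Holds (h ∷ hs) ρ = HypHolds h ρ × Holds hs ρ

-- A negative multiple of a hypothesis is only meaningful for equations.
multiple : ∀ {n} → ℤ → Hyp n → Ex n × Ex n
multiple (ℤ.+ k)  (hyp _     l r) = k ⊗ l , k ⊗ r
multiple -[1+ k ] (hyp true  l r) = suc k ⊗ r , suc k ⊗ l
multiple -[1+ k ] (hyp false l r) = κ 0 , κ 0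

multiple-sound : ∀ {n} m (h : Hyp n) ρ → HypHolds h ρ →
  eval (proj₁ (multiple m h)) ρ ≤ eval (proj₂ (multiple m h)) ρ
multiple-sound (ℤ.+ k)  (hyp true  l r) ρ p = *-monoʳ-≤ k (≤-reflexive p)
multiple-sound (ℤ.+ k)  (hyp false l r) ρ p = *-monoʳ-≤ k p
multiple-sound -[1+ k ] (hyp true  l r) ρ p = *-monoʳ-≤ (suc k) (≤-reflexive (sym p))
multiple-sound -[1+ k ] (hyp false l r) ρ p = z≤n

combine : ∀ {n} → List (Hyp n) → List ℤ → Ex n × Ex n
combine []       _        = κ 0 , κ 0
combine (_ ∷ _)  []       = κ 0 , κ 0
combine (h ∷ hs) (m ∷ ms) =
  (proj₁ (multiple m h) ⊕ proj₁ (combine hs ms)) , (proj₂ (multiple m h) ⊕ proj₂ (combine hs ms))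

combine-sound : ∀ {n} (hs : List (Hyp n)) ms ρ → Holds hs ρ →
  eval (proj₁ (combine hs ms)) ρ ≤ eval (proj₂ (combine hs ms)) ρ
combine-sound []       ms       ρ _       = z≤n
combine-sound (_ ∷ _)  []       ρ _       = z≤n
combine-sound (h ∷ hs) (m ∷ ms) ρ (p , q) =
  +-mono-≤ (multiple-sound m h ρ p) (combine-sound hs ms ρ q)

-- Variables range over ℕ, so comparing coefficients is a sound test that the combined inequality
-- `L ≤ R` contradicts `1 + R ≤ L`. Only this test is verified; the search for multipliers below
-- needs no proof.
refutes : ∀ {n} → List (Hyp n) → List ℤ → Bool
refutes hs ms = nf (κ 1 ⊕ proj₂ (combine hs ms)) ≤ⱽ nf (proj₁ (combine hs ms))

refutes-sound : ∀ {n} (hs : List (Hyp n)) ms → T (refutes hs ms) → ∀ ρ → Holds hs ρ → ⊥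
refutes-sound hs ms ok ρ h = <⇒≱ (subst₂ _≤_ (nf-sound (κ 1 ⊕ R) ρ) (nf-sound L ρ)
    (≤ⱽ-sound (nf (κ 1 ⊕ R)) (nf L) (1 ∷ ρ) ok)) (combine-sound hs ms ρ h)
  where
  L = proj₁ (combine hs ms)
  R = proj₂ (combine hs ms)

-- Fourier–Motzkin elimination.  A row says const + Σ coeffᵢ xᵢ ≤ 0 (or = 0) and
-- carries the multipliers of the hypotheses it was obtained from.
record Row (n : ℕ) : Set where
  constructor row
  field
    eqn   : Bool
    const : ℤ
    coeff : Vec ℤ n
    mult  : List ℤ

addL : List ℤ → List ℤ → List ℤ
addL []       ys       = ys
addL xs       []       = xs
addL (x ∷ xs) (y ∷ ys) = (x ℤ.+ y) ∷ addL xs ys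

-- a·r + b·s, where b may be negative only if s is an equation
lincomb : ∀ {n} → ℤ → Row n → ℤ → Row n → Row n
lincomb a (row q c v m) b (row q' c' v' m') =
  row (q ∧ q') (a ℤ.* c ℤ.+ b ℤ.* c') (zipWith (λ x y → a ℤ.* x ℤ.+ b ℤ.* y) v v')
    (addL (List.map (a ℤ.*_) m) (List.map (b ℤ.*_) m'))

uncons : ∀ {n} → Row (suc n) → ℤ × Row n
uncons (row q c (x ∷ v) m) = x , row q c v m

pivot : ∀ {n} → List (ℤ × Row n) → Maybe (ℤ × Row n)
pivot [] = nothing
pivot ((ℤ.+ 0 , _) ∷ rs) = pivot rs
pivot ((x , r) ∷ rs) = if Row.eqn r then just (x , r) else pivot rs

substitute : ∀ {n} → ℤ × Row n → List (ℤ × Row n) → List (Row n)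
substitute _ [] = []
substitute p ((ℤ.+ 0 , r) ∷ rs) = r ∷ substitute p rs
substitute p@(ℤ.+ a , e) ((b , r) ∷ rs) = lincomb (ℤ.+ a) r (ℤ.- b) e ∷ substitute p rs
substitute p@(-[1+ a ] , e) ((b , r) ∷ rs) = lincomb (ℤ.+ (suc a)) r b e ∷ substitute p rs

record Signs (n : ℕ) : Set where
  constructor signs
  field
    pos neg : List (ℤ × Row n)
    zer     : List (Row n)

bySign : ∀ {n} → List (ℤ × Row n) → Signs n
bySign [] = signs [] [] []
bySign ((x , r) ∷ rs) with bySign rs | x
... | signs p q z | ℤ.+ 0       = signs p q (r ∷ z)
... | signs p q z | ℤ.+ (suc k) = signs ((ℤ.+ (suc k) , r) ∷ p) q z
... | signs p q z | -[1+ k ]    = signs p ((ℤ.+ (suc k) , r) ∷ q) z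

cross : ∀ {n} → List (ℤ × Row n) → List (ℤ × Row n) → List (Row n)
cross ps qs = List.concatMap (λ { (a , r) → List.map (λ { (b , s) → lincomb b r a s }) qs }) ps

eliminate : ∀ {n} → List (Row n) → Maybe (List ℤ)
eliminate {zero} [] = nothing
eliminate {zero} (row _ (ℤ.+ (suc _)) _ m ∷ rs) = just m
eliminate {zero} (row true -[1+ _ ] _ m ∷ rs) = just (List.map ℤ.-_ m)
eliminate {zero} (row _ _ _ _ ∷ rs) = eliminate rs
-- The extra row says `−x ≤ 0`. It carries no multipliers because `refutes` accounts for
-- nonnegativity by comparing coefficients.
eliminate {suc n} rs = step ((ℤ.- (ℤ.+ 1) , row false (ℤ.+ 0) (replicate n (ℤ.+ 0)) []) ∷ List.map uncons rs)
  where
  step : List (ℤ × Row n) → Maybe (List ℤ)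
  step us with pivot us | bySign us
  ... | just p  | _           = eliminate (substitute p us)
  ... | nothing | signs p q z = eliminate (z ++ cross p q)

toRow : ∀ {n} → List ℤ → Hyp n → Row n
toRow m (hyp q l r) with zipWith ℤ._-_ (Vec.map ℤ.+_ (nf l)) (Vec.map ℤ.+_ (nf r))
... | c ∷ v = row q c v m

toRows : ∀ {n} → List ℤ → List (Hyp n) → List (Row n)
toRows pre []       = []
toRows pre (h ∷ hs) = toRow (pre ++ ℤ.+ 1 ∷ []) h ∷ toRows (ℤ.+ 0 ∷ pre) hs

refute : ∀ {n} → List (Hyp n) → Bool
refute hs with eliminate (toRows [] hs)
... | just m  = refutes hs m
... | nothing = false

refute-sound : ∀ {n} (hs : List (Hyp n)) → T (refute hs) → ∀ ρ → Holds hs ρ → ⊥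
refute-sound hs ok ρ h with eliminate (toRows [] hs)
... | just m = refutes-sound hs m ok ρ h

_≻_ : ∀ {n} → Ex n → Ex n → Hyp n
l ≻ r = hyp false (κ 1 ⊕ r) l

valid : ∀ {n} → List (Hyp n) → Sequent n → Bool
valid hs (⊢ (l ≼ r)) = refute ((l ≻ r) ∷ hs)
valid hs (⊢ (l ≐ r)) = refute ((l ≻ r) ∷ hs) ∧ refute ((r ≻ l) ∷ hs)
valid hs ⊢⊥          = refute hs
valid hs (l ≼ r ⇒ s) = valid (hyp false l r ∷ hs) s
valid hs (l ≐ r ⇒ s) = valid (hyp true l r ∷ hs) s

valid-sound : ∀ {n} (hs : List (Hyp n)) s → T (valid hs s) → ∀ ρ → Holds hs ρ → evalSq s ρ
valid-sound hs (⊢ (l ≼ r)) ok ρ h = ≮⇒≥ (λ lt → refute-sound ((l ≻ r) ∷ hs) ok ρ (lt , h))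
valid-sound hs (⊢ (l ≐ r)) ok ρ h with Equivalence.to (𝔹.T-∧ {refute ((l ≻ r) ∷ hs)}) ok
... | p , q = ≤-antisym (≮⇒≥ (λ lt → refute-sound ((l ≻ r) ∷ hs) p ρ (lt , h)))
                        (≮⇒≥ (λ lt → refute-sound ((r ≻ l) ∷ hs) q ρ (lt , h)))
valid-sound hs ⊢⊥ ok ρ h = refute-sound hs ok ρ h
valid-sound hs (l ≼ r ⇒ s) ok ρ h = λ p → valid-sound (hyp false l r ∷ hs) s ok ρ (p , h)
valid-sound hs (l ≐ r ⇒ s) ok ρ h = λ p → valid-sound (hyp true l r ∷ hs) s ok ρ (p , h)

closed : ∀ n → N-ary n (Ex n) (Sequent n) → Sequent n
closed n f = f $ⁿ tabulate var

curry-∀ⁿ : ∀ n (P : Vec ℕ n → Set) → (∀ ρ → P ρ) → ∀ⁿ n (curryⁿ P)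
curry-∀ⁿ zero    P h = h []
curry-∀ⁿ (suc n) P h = λ x → curry-∀ⁿ n (λ ρ → P (x ∷ ρ)) (λ ρ → h (x ∷ ρ))

abstract
  -- The hidden argument is the validity check, which computes to the unit type and is filled in
  -- automatically. The search is rational, with strict inequalities sharpened to `1 + r ≤ l`;
  -- `abstract` keeps the certificates from being unfolded later.
  linear : ∀ n (f : N-ary n (Ex n) (Sequent n)) {_ : T (valid [] (closed n f))} →
    ∀ⁿ n (curryⁿ (evalSq (closed n f)))
  linear n f {ok} = curry-∀ⁿ n (evalSq (closed n f)) (λ ρ → valid-sound [] (closed n f) ok ρ tt)

-- Booleans and finite sums

⟦_⟧ : Bool → ℕ
⟦ b ⟧ = if b then 1 else 0

-- Together with `cases` this proves Boolean identities by truth table during type checking.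
∀𝔹? : {P : Bool → Set} → (∀ b → Dec (P b)) → Dec (∀ b → P b)
∀𝔹? P? with P? true | P? false
... | yes t | yes f = yes λ { true → t ; false → f }
... | no ¬t | _     = no λ h → ¬t (h true)
... | _     | no ¬f = no λ h → ¬f (h false)

cases : ∀ {A : Set} (A? : Dec A) {_ : True A?} → A
cases A? {t} = toWitness t

does⇒ : ∀ {A : Set} (A? : Dec A) → does A? ≡ true → A
does⇒ (yes a) _ = a

true≢false : ∀ {b} → b ≡ true → b ≡ false → ⊥
true≢false refl ()

≢true⇒false : ∀ {b} → ¬ (b ≡ true) → b ≡ false
≢true⇒false {true}  h = ⊥-elim (h refl)
≢true⇒false {false} h = refl

≢false⇒true : ∀ {b} → ¬ (b ≡ false) → b ≡ true
≢false⇒true {true}  h = refl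
≢false⇒true {false} h = ⊥-elim (h refl)

true⊎false : ∀ b → (b ≡ true) ⊎ (b ≡ false)
true⊎false true  = inj₁ refl
true⊎false false = inj₂ refl

∧-intro : ∀ {a b} → a ≡ true → b ≡ true → a ∧ b ≡ true
∧-intro refl refl = refl

∧-fst : ∀ {a b} → a ∧ b ≡ true → a ≡ true
∧-fst {true} h = refl

∧-snd : ∀ {a b} → a ∧ b ≡ true → b ≡ true
∧-snd {true} h = h

∨-introˡ : ∀ {a b} → a ≡ true → a ∨ b ≡ true
∨-introˡ refl = refl

∨-introʳ : ∀ {a b} → b ≡ true → a ∨ b ≡ true
∨-introʳ {true}  h = refl
∨-introʳ {false} h = h

∨-elim : ∀ {a b} → a ∨ b ≡ true → (a ≡ true) ⊎ (b ≡ true)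
∨-elim {true}  h = inj₁ refl
∨-elim {false} h = inj₂ h

∨-elimˡ : ∀ {a b} → a ∨ b ≡ true → a ≡ false → b ≡ true
∨-elimˡ h refl = h

not-true : ∀ {b} → b ≡ false → not b ≡ true
not-true refl = refl

not-true⁻ : ∀ {b} → not b ≡ true → b ≡ false
not-true⁻ {false} h = refl

iff⇒≡ : ∀ {a b} → (a ≡ true → b ≡ true) → (b ≡ true → a ≡ true) → a ≡ b
iff⇒≡ {true}  {b}     f g = sym (f refl)
iff⇒≡ {false} {true}  f g = g refl
iff⇒≡ {false} {false} f g = refl

⟦⟧-mono : ∀ {a b} → (a ≡ true → b ≡ true) → ⟦ a ⟧ ≤ ⟦ b ⟧
⟦⟧-mono {true}  h rewrite h refl = ≤-refl
⟦⟧-mono {false} h = z≤n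

_==_ : ∀ {n} → Fin n → Fin n → Bool
i == j = does (i ≟ j)

==-refl : ∀ {n} (i : Fin n) → (i == i) ≡ true
==-refl i = dec-true (i ≟ i) refl

==-true : ∀ {n} {i j : Fin n} → i ≡ j → (i == j) ≡ true
==-true {i = i} refl = ==-refl i

==⇒≡ : ∀ {n} {i j : Fin n} → (i == j) ≡ true → i ≡ j
==⇒≡ {i = i} {j} h with i ≟ j
... | yes e = e

≢⇒== : ∀ {n} {i j : Fin n} → i ≢ j → (i == j) ≡ false
≢⇒== {i = i} {j} h = dec-false (i ≟ j) h

sum-cong : ∀ {n} {f g : Fin n → ℕ} → (∀ i → f i ≡ g i) → sumFin f ≡ sumFin g
sum-cong {zero}  h = refl
sum-cong {suc n} h = cong₂ _+_ (h zero) (sum-cong (λ i → h (suc i)))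

sum-mono : ∀ {n} {f g : Fin n → ℕ} → (∀ i → f i ≤ g i) → sumFin f ≤ sumFin g
sum-mono {zero}  h = z≤n
sum-mono {suc n} h = +-mono-≤ (h zero) (sum-mono (λ i → h (suc i)))

+-interchange : ∀ a b c d → (a + b) + (c + d) ≡ (a + c) + (b + d)
+-interchange = solve-∀

sum-+ : ∀ {n} (f g : Fin n → ℕ) → sumFin (λ i → f i + g i) ≡ sumFin f + sumFin g
sum-+ {zero}  f g = refl
sum-+ {suc n} f g = trans (cong (f zero + g zero +_) (sum-+ (λ i → f (suc i)) (λ i → g (suc i))))
  (+-interchange (f zero) (g zero) _ _)

sum-0 : ∀ {n} {f : Fin n → ℕ} → (∀ i → f i ≡ 0) → sumFin f ≡ 0
sum-0 {zero}  h = refl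
sum-0 {suc n} h = cong₂ _+_ (h zero) (sum-0 (λ i → h (suc i)))

sum-* : ∀ {n} k (f : Fin n → ℕ) → sumFin (λ i → k * f i) ≡ k * sumFin f
sum-* {zero}  k f = sym (*-zeroʳ k)
sum-* {suc n} k f = trans (cong (k * f zero +_) (sum-* k (λ i → f (suc i))))
  (sym (*-distribˡ-+ k (f zero) _))

sum-swap : ∀ {m n} (f : Fin m → Fin n → ℕ) →
  sumFin (λ i → sumFin (λ j → f i j)) ≡ sumFin (λ j → sumFin (λ i → f i j))
sum-swap {zero} {n} f = sym (sum-0 {n} (λ j → refl))
sum-swap {suc m} {n} f = trans (cong (sumFin (f zero) +_) (sum-swap (λ i → f (suc i))))
  (sym (sum-+ (f zero) (λ j → sumFin (λ i → f (suc i) j))))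

sum-δ : ∀ {n} (v : Fin n) (f : Fin n → ℕ) → (∀ i → i ≢ v → f i ≡ 0) → sumFin f ≡ f v
sum-δ zero    f h = trans (cong (f zero +_) (sum-0 (λ i → h (suc i) (λ ())))) (+-identityʳ _)
sum-δ (suc v) f h = trans (cong (_+ sumFin (λ i → f (suc i))) (h zero (λ ())))
  (sum-δ v (λ i → f (suc i)) (λ i i≢v → h (suc i) (λ e → i≢v (Fin.suc-injective e))))

sum-elem : ∀ {n} (v : Fin n) (f : Fin n → ℕ) → f v ≤ sumFin f
sum-elem zero    f = m≤m+n _ _
sum-elem (suc v) f = ≤-trans (sum-elem v (λ i → f (suc i))) (m≤n+m _ _)

sum>0 : ∀ {n} (f : Fin n → ℕ) → 1 ≤ sumFin f → ∃[ i ] (1 ≤ f i)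
sum>0 {suc n} f h with 1 ≤? f zero
... | yes p = zero , p
... | no ¬p with sum>0 (λ i → f (suc i)) (subst (λ z → 1 ≤ z + sumFin (λ i → f (suc i))) (n<1⇒n≡0 (≰⇒> ¬p)) h)
...   | i , p = suc i , p

anyFin-intro : ∀ {n} (f : Fin n → Bool) i → f i ≡ true → anyFin f ≡ true
anyFin-intro f zero    h = ∨-introˡ h
anyFin-intro f (suc i) h = ∨-introʳ {f zero} (anyFin-intro (λ i → f (suc i)) i h)

anyFin-elim : ∀ {n} (f : Fin n → Bool) → anyFin f ≡ true → ∃[ i ] (f i ≡ true)
anyFin-elim {suc n} f h with ∨-elim {f zero} h
... | inj₁ p = zero , p
... | inj₂ p with anyFin-elim (λ i → f (suc i)) p
...   | i , q = suc i , q

-- Vertex and edge sets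

_∩ᵛ_ _∪ᵛ_ _∖ᵛ_ : ∀ {n} → VS n → VS n → VS n
(A ∩ᵛ B) v = A v ∧ B v
(A ∪ᵛ B) v = A v ∨ B v
(A ∖ᵛ B) v = A v ∧ not (B v)

ins rem : ∀ {n} → Fin n → VS n → VS n
ins v S w = (w == v) ∨ S w
rem v S w = not (w == v) ∧ S w

∅ᵛ : ∀ {n} → VS n
∅ᵛ _ = false

vcount-mono : ∀ {n} {A B : VS n} → A ⊆ᵛ B → vcount A ≤ vcount B
vcount-mono h = sum-mono (λ i → ⟦⟧-mono (h i))

vcount-cong : ∀ {n} {A B : VS n} → A ⊆ᵛ B → B ⊆ᵛ A → vcount A ≡ vcount B
vcount-cong h k = ≤-antisym (vcount-mono h) (vcount-mono k)

vcount-∪∩ : ∀ {n} (A B : VS n) → vcount (A ∪ᵛ B) + vcount (A ∩ᵛ B) ≡ vcount A + vcount B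
vcount-∪∩ A B = trans (sym (sum-+ (λ i → ⟦ A i ∨ B i ⟧) (λ i → ⟦ A i ∧ B i ⟧)))
  (trans (sum-cong (λ i → aux (A i) (B i))) (sum-+ (λ i → ⟦ A i ⟧) (λ i → ⟦ B i ⟧)))
  where
  aux : ∀ a b → ⟦ a ∨ b ⟧ + ⟦ a ∧ b ⟧ ≡ ⟦ a ⟧ + ⟦ b ⟧
  aux = cases (∀𝔹? λ a → ∀𝔹? λ b → ⟦ a ∨ b ⟧ + ⟦ a ∧ b ⟧ ℕ.≟ ⟦ a ⟧ + ⟦ b ⟧)

vcount-∖∩ : ∀ {n} (A B : VS n) → vcount (A ∖ᵛ B) + vcount (A ∩ᵛ B) ≡ vcount A
vcount-∖∩ A B = trans (sym (sum-+ (λ i → ⟦ A i ∧ not (B i) ⟧) (λ i → ⟦ A i ∧ B i ⟧))) (sum-cong (λ i → aux (A i) (B i)))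
  where
  aux : ∀ a b → ⟦ a ∧ not b ⟧ + ⟦ a ∧ b ⟧ ≡ ⟦ a ⟧
  aux = cases (∀𝔹? λ a → ∀𝔹? λ b → ⟦ a ∧ not b ⟧ + ⟦ a ∧ b ⟧ ℕ.≟ ⟦ a ⟧)

vcount-single : ∀ {n} (v : Fin n) → vcount (λ w → w == v) ≡ 1
vcount-single v = trans (sum-δ v _ (λ i i≢v → cong ⟦_⟧ (≢⇒== i≢v))) (cong ⟦_⟧ (==-refl v))

vcount-ins : ∀ {n} (v : Fin n) (S : VS n) → S v ≡ false → vcount (ins v S) ≡ suc (vcount S)
vcount-ins v S Sv = trans (trans (sum-cong aux) (sum-+ (λ i → ⟦ i == v ⟧) (λ i → ⟦ S i ⟧))) (cong (_+ vcount S) (vcount-single v))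
  where
  aux : ∀ i → ⟦ (i == v) ∨ S i ⟧ ≡ ⟦ i == v ⟧ + ⟦ S i ⟧
  aux i with i ≟ v
  ... | yes refl rewrite Sv = refl
  ... | no _ = refl

ins-self : ∀ {n} (v : Fin n) (S : VS n) → ins v S v ≡ true
ins-self v S = ∨-introˡ (==-refl v)

ins-old : ∀ {n} (v : Fin n) (S : VS n) {w} → S w ≡ true → ins v S w ≡ true
ins-old v S {w} h = ∨-introʳ {w == v} h

ins-elim : ∀ {n} (v : Fin n) (S : VS n) {w} → ins v S w ≡ true → w ≡ v ⊎ S w ≡ true
ins-elim v S {w} h with ∨-elim {w == v} h
... | inj₁ e = inj₁ (==⇒≡ e)
... | inj₂ s = inj₂ s

ins-not : ∀ {n} (v : Fin n) (S : VS n) {w} → w ≢ v → S w ≡ false → ins v S w ≡ false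
ins-not v S w≢v Sw rewrite ≢⇒== w≢v = Sw

rem-self : ∀ {n} (v : Fin n) (S : VS n) → rem v S v ≡ false
rem-self v S rewrite ==-refl v = refl

rem-intro : ∀ {n} (v : Fin n) (S : VS n) {w} → w ≢ v → S w ≡ true → rem v S w ≡ true
rem-intro v S w≢v Sw rewrite ≢⇒== w≢v = Sw

rem-⊆ : ∀ {n} (v : Fin n) (S : VS n) → rem v S ⊆ᵛ S
rem-⊆ v S w h = ∧-snd {not (w == v)} h

rem-≢ : ∀ {n} (v : Fin n) (S : VS n) {w} → rem v S w ≡ true → w ≢ v
rem-≢ v S h refl = true≢false h (rem-self v S)

rem-not : ∀ {n} (v : Fin n) (S : VS n) {w} → S w ≡ false → rem v S w ≡ false
rem-not v S {w} h = ≢true⇒false (λ k → true≢false (rem-⊆ v S w k) h)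

ins-rem-⊆ : ∀ {n} (v : Fin n) (S : VS n) → S v ≡ true → ins v (rem v S) ⊆ᵛ S
ins-rem-⊆ v S Sv w h with ins-elim v (rem v S) {w} h
... | inj₁ refl = Sv
... | inj₂ k    = rem-⊆ v S w k

⊆-ins-rem : ∀ {n} (v : Fin n) (S : VS n) → S ⊆ᵛ ins v (rem v S)
⊆-ins-rem v S w h with w ≟ v
... | yes _ = refl
... | no _  = h

vcount-rem : ∀ {n} (v : Fin n) (S : VS n) → S v ≡ true → vcount S ≡ suc (vcount (rem v S))
vcount-rem v S Sv = trans (vcount-cong (⊆-ins-rem v S) (ins-rem-⊆ v S Sv)) (vcount-ins v (rem v S) (rem-self v S))

vcount-pos : ∀ {n} (S : VS n) v → S v ≡ true → 1 ≤ vcount S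
vcount-pos S v Sv = subst (1 ≤_) (sym (vcount-rem v S Sv)) (s≤s z≤n)

vcount>0 : ∀ {n} (S : VS n) → 1 ≤ vcount S → ∃[ v ] (S v ≡ true)
vcount>0 S h with sum>0 (λ i → ⟦ S i ⟧) h
... | v , p = v , aux (S v) p
  where
  aux : ∀ b → 1 ≤ ⟦ b ⟧ → b ≡ true
  aux true _ = refl

vcount≡0 : ∀ {n} (S : VS n) → vcount S ≡ 0 → ∀ v → S v ≡ false
vcount≡0 S h v = ≢true⇒false (λ Sv → case subst (1 ≤_) h (vcount-pos S v Sv) of λ ())

vcount-∅ : ∀ {n} (S : VS n) → (∀ v → S v ≡ false) → vcount S ≡ 0
vcount-∅ S h = sum-0 (λ i → cong ⟦_⟧ (h i))

vcount≥2 : ∀ {n} (S : VS n) {a b} → a ≢ b → S a ≡ true → S b ≡ true → 2 ≤ vcount S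
vcount≥2 S {a} {b} a≢b Sa Sb = subst (2 ≤_) (sym (vcount-rem a S Sa))
  (s≤s (vcount-pos (rem a S) b (rem-intro a S (λ e → a≢b (sym e)) Sb)))

vcount≥3 : ∀ {n} (S : VS n) {a b c} → a ≢ b → a ≢ c → b ≢ c →
  S a ≡ true → S b ≡ true → S c ≡ true → 3 ≤ vcount S
vcount≥3 S {a} a≢b a≢c b≢c Sa Sb Sc = subst (3 ≤_) (sym (vcount-rem a S Sa))
  (s≤s (vcount≥2 (rem a S) b≢c (rem-intro a S (a≢b ∘ sym) Sb) (rem-intro a S (a≢c ∘ sym) Sc)))

vcount-strict : ∀ {n} {A B : VS n} v → A ⊆ᵛ B → A v ≡ false → B v ≡ true → vcount A < vcount B
vcount-strict {A = A} {B} v A⊆B Av Bv = subst (vcount A <_) (sym (vcount-rem v B Bv))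
  (s≤s (vcount-mono (λ w Aw → rem-intro v B (λ { refl → true≢false Aw Av }) (A⊆B w Aw))))

⊆-by-count : ∀ {n} {A B : VS n} → A ⊆ᵛ B → vcount B ≤ vcount A → B ⊆ᵛ A
⊆-by-count A⊆B le v Bv = ≢false⇒true (λ Av → <⇒≱ (vcount-strict v A⊆B Av Bv) le)

-- Sums over unordered pairs and edge counts

esum : ∀ {n} → (Fin n → Fin n → ℕ) → ℕ
esum h = sumFin (λ i → sumFin (λ j → if toℕ i <ᵇ toℕ j then h i j else 0))

ecount-esum : ∀ {n} (E : ES n) → ecount E ≡ esum (λ i j → ⟦ E i j ⟧)
ecount-esum E = sum-cong (λ i → sum-cong (λ j → aux (E i j) (toℕ i <ᵇ toℕ j)))
  where
  aux : ∀ e l → ⟦ e ∧ l ⟧ ≡ (if l then ⟦ e ⟧ else 0)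
  aux = cases (∀𝔹? λ e → ∀𝔹? λ l → ⟦ e ∧ l ⟧ ℕ.≟ (if l then ⟦ e ⟧ else 0))

<ᵇ-irrefl : ∀ k → (k <ᵇ k) ≡ false
<ᵇ-irrefl zero    = refl
<ᵇ-irrefl (suc k) = <ᵇ-irrefl k

<ᵇ-flip : ∀ {n} (i j : Fin n) → i ≢ j → (toℕ j <ᵇ toℕ i) ≡ not (toℕ i <ᵇ toℕ j)
<ᵇ-flip zero    zero    h = ⊥-elim (h refl)
<ᵇ-flip zero    (suc j) h = refl
<ᵇ-flip (suc i) zero    h = refl
<ᵇ-flip (suc i) (suc j) h = <ᵇ-flip i j (λ e → h (cong suc e))

esum-mono : ∀ {n} {h k : Fin n → Fin n → ℕ} → (∀ i j → i ≢ j → h i j ≤ k i j) → esum h ≤ esum k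
esum-mono {h = h} {k} le = sum-mono (λ i → sum-mono (λ j → aux i j))
  where
  aux : ∀ i j → (if toℕ i <ᵇ toℕ j then h i j else 0) ≤ (if toℕ i <ᵇ toℕ j then k i j else 0)
  aux i j with i ≟ j
  ... | yes refl rewrite <ᵇ-irrefl (toℕ i) = z≤n
  ... | no i≢j with toℕ i <ᵇ toℕ j
  ...   | true  = le i j i≢j
  ...   | false = z≤n

esum-cong : ∀ {n} {h k : Fin n → Fin n → ℕ} → (∀ i j → i ≢ j → h i j ≡ k i j) → esum h ≡ esum k
esum-cong eq = ≤-antisym (esum-mono (λ i j ne → ≤-reflexive (eq i j ne)))
  (esum-mono (λ i j ne → ≤-reflexive (sym (eq i j ne))))

esum-+ : ∀ {n} (h k : Fin n → Fin n → ℕ) → esum (λ i j → h i j + k i j) ≡ esum h + esum k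
esum-+ h k = trans (sum-cong (λ i → trans (sum-cong (λ j → aux (toℕ i <ᵇ toℕ j) (h i j) (k i j)))
    (sum-+ (λ j → if toℕ i <ᵇ toℕ j then h i j else 0) (λ j → if toℕ i <ᵇ toℕ j then k i j else 0))))
  (sum-+ (λ i → sumFin (λ j → if toℕ i <ᵇ toℕ j then h i j else 0))
         (λ i → sumFin (λ j → if toℕ i <ᵇ toℕ j then k i j else 0)))
  where
  aux : ∀ l x y → (if l then x + y else 0) ≡ (if l then x else 0) + (if l then y else 0)
  aux true  x y = refl
  aux false x y = refl

-- The ordered double sum splits into its upper and lower triangle, and the lower one is transposed.
-- In this way a count that charges each edge to an endpoint turns into a count of edges.
esum-sym : ∀ {n} (g : Fin n → Fin n → ℕ) → (∀ i → g i i ≡ 0) →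
  sumFin (λ i → sumFin (λ j → g i j)) ≡ esum (λ i j → g i j + g j i)
esum-sym g diag = begin
  sumFin (λ i → sumFin (λ j → g i j))
    ≡⟨ sum-cong (λ i → trans (sum-cong (λ j → split i j)) (sum-+ (up i) (down i))) ⟩
  sumFin (λ i → sumFin (λ j → up i j) + sumFin (λ j → down i j))
    ≡⟨ sum-+ (λ i → sumFin (up i)) (λ i → sumFin (down i)) ⟩
  sumFin (λ i → sumFin (λ j → up i j)) + sumFin (λ i → sumFin (λ j → down i j))
    ≡⟨ cong (sumFin (λ i → sumFin (λ j → up i j)) +_) (sum-swap down) ⟩
  esum g + esum (λ i j → g j i)
    ≡⟨ sym (esum-+ g (λ i j → g j i)) ⟩
  esum (λ i j → g i j + g j i) ∎
  where
  open ≡-Reasoning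
  up down : _ → _ → ℕ
  up   i j = if toℕ i <ᵇ toℕ j then g i j else 0
  down i j = if toℕ j <ᵇ toℕ i then g i j else 0
  split : ∀ i j → g i j ≡ up i j + down i j
  split i j with i ≟ j
  ... | yes refl rewrite <ᵇ-irrefl (toℕ i) = diag i
  ... | no i≢j rewrite <ᵇ-flip i j i≢j with toℕ i <ᵇ toℕ j
  ...   | true  = sym (+-identityʳ _)
  ...   | false = refl

-- This lemma and its variants reduce a relation between edge counts to a truth table at a single
-- pair of distinct vertices.
ecount₁≤ : ∀ {n} {A B : ES n} → (∀ i j → i ≢ j → ⟦ A i j ⟧ ≤ ⟦ B i j ⟧) → ecount A ≤ ecount B
ecount₁≤ {A = A} {B} h = subst₂ _≤_ (sym (ecount-esum A)) (sym (ecount-esum B)) (esum-mono h)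

ecount₂-esum : ∀ {n} (A B : ES n) → esum (λ i j → ⟦ A i j ⟧ + ⟦ B i j ⟧) ≡ ecount A + ecount B
ecount₂-esum A B = trans (esum-+ (λ i j → ⟦ A i j ⟧) (λ i j → ⟦ B i j ⟧)) (cong₂ _+_ (sym (ecount-esum A)) (sym (ecount-esum B)))

ecount₂≤₂ : ∀ {n} {A B A' B' : ES n} →
  (∀ i j → i ≢ j → ⟦ A i j ⟧ + ⟦ B i j ⟧ ≤ ⟦ A' i j ⟧ + ⟦ B' i j ⟧) →
  ecount A + ecount B ≤ ecount A' + ecount B'
ecount₂≤₂ {A = A} {B} {A'} {B'} h = subst₂ _≤_ (ecount₂-esum A B) (ecount₂-esum A' B') (esum-mono h)

ecount₂≡₂ : ∀ {n} {A B A' B' : ES n} →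
  (∀ i j → i ≢ j → ⟦ A i j ⟧ + ⟦ B i j ⟧ ≡ ⟦ A' i j ⟧ + ⟦ B' i j ⟧) →
  ecount A + ecount B ≡ ecount A' + ecount B'
ecount₂≡₂ {A = A} {B} {A'} {B'} h = subst₂ _≡_ (ecount₂-esum A B) (ecount₂-esum A' B') (esum-cong h)

ecount₁≡₂ : ∀ {n} {A A' B' : ES n} → (∀ i j → i ≢ j → ⟦ A i j ⟧ ≡ ⟦ A' i j ⟧ + ⟦ B' i j ⟧) →
  ecount A ≡ ecount A' + ecount B'
ecount₁≡₂ {A = A} {A'} {B'} h = subst₂ _≡_ (sym (ecount-esum A)) (ecount₂-esum A' B') (esum-cong h)

ecount-mono : ∀ {n} {A B : ES n} → A ⊆ᵉ B → ecount A ≤ ecount B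
ecount-mono h = ecount₁≤ (λ i j _ → ⟦⟧-mono (h i j))

ecount-cong : ∀ {n} {A B : ES n} → A ⊆ᵉ B → B ⊆ᵉ A → ecount A ≡ ecount B
ecount-cong h k = ≤-antisym (ecount-mono h) (ecount-mono k)

ecount-∅ : ∀ {n} {A : ES n} → (∀ i j → i ≢ j → A i j ≡ false) → ecount A ≡ 0
ecount-∅ {n} {A} h = n≤0⇒n≡0 (subst (ecount A ≤_) (sum-0 {n} (λ i → sum-0 {n} (λ j → refl)))
  (ecount₁≤ {A = A} {B = λ _ _ → false} (λ i j ne → ≤-reflexive (cong ⟦_⟧ (h i j ne)))))

-- The search runs over bit vectors. A set and its tabulation agree only pointwise, hence the demand
-- that `P` respect pointwise equality.
anyVS? : ∀ {n} {P : VS n → Set} → (∀ S → Dec (P S)) →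
  (∀ {S T} → (∀ v → S v ≡ T v) → P S → P T) → Dec (∃ P)
anyVS? P? resp with Subset.anySubset? (λ s → P? (lookup s))
... | yes (s , p) = yes (lookup s , p)
... | no ¬p = no λ { (S , p) → ¬p (tabulate S , resp (λ v → sym (lookup∘tabulate S v)) p) }

_∪ᵉ_ _∩ᵉ_ _∖ᵉ_ : ∀ {n} → ES n → ES n → ES n
(A ∪ᵉ B) i j = A i j ∨ B i j
(A ∩ᵉ B) i j = A i j ∧ B i j
(A ∖ᵉ B) i j = A i j ∧ not (B i j)

edge : ∀ {n} → Fin n → Fin n → ES n
edge u v i j = ((i == u) ∧ (j == v)) ∨ ((i == v) ∧ (j == u))

addE delE : ∀ {n} → Fin n → Fin n → ES n → ES n
addE u v E = E ∪ᵉ edge u v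
delE u v E = E ∖ᵉ edge u v

remV : ∀ {n} → Fin n → ES n → ES n
remV p E i j = E i j ∧ (not (i == p) ∧ not (j == p))

touch : ∀ {n} → ES n → VS n → ES n
touch E S i j = E i j ∧ (S i ∨ S j)

star : ∀ {n} → ES n → Fin n → VS n → ES n
star E v S i j = E i j ∧ (((i == v) ∧ S j) ∨ ((j == v) ∧ S i))

inc ind : ∀ {n} → ES n → VS n → ℕ
inc E S = ecount (touch E S)
ind E S = ecount (induce E S)

nb : ∀ {n} → ES n → Fin n → VS n → ℕ
nb E v S = vcount (λ w → E v w ∧ S w)

dg : ∀ {n} → ES n → Fin n → ℕ
dg E v = vcount (E v)

IsES-∪ : ∀ {n} {A B : ES n} → IsES A → IsES B → IsES (A ∪ᵉ B)
IsES-∪ (sA , iA) (sB , iB) = (λ i j → cong₂ _∨_ (sA i j) (sB i j)) , (λ i → cong₂ _∨_ (iA i) (iB i))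

IsES-∩ : ∀ {n} {A B : ES n} → IsES A → IsES B → IsES (A ∩ᵉ B)
IsES-∩ (sA , iA) (sB , iB) = (λ i j → cong₂ _∧_ (sA i j) (sB i j)) , (λ i → cong₂ _∧_ (iA i) (iB i))

IsES-∖ : ∀ {n} {A B : ES n} → IsES A → (∀ i j → B i j ≡ B j i) → IsES (A ∖ᵉ B)
IsES-∖ {B = B} (sA , iA) sB = (λ i j → cong₂ (λ a b → a ∧ not b) (sA i j) (sB i j)) ,
  (λ i → cong (_∧ not (B i i)) (iA i))

edge-sym : ∀ {n} (u v : Fin n) i j → edge u v i j ≡ edge u v j i
edge-sym u v i j = aux (i == u) (j == v) (i == v) (j == u)
  where
  aux : ∀ a b c d → (a ∧ b) ∨ (c ∧ d) ≡ (d ∧ c) ∨ (b ∧ a)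
  aux = cases (∀𝔹? λ a → ∀𝔹? λ b → ∀𝔹? λ c → ∀𝔹? λ d → _ 𝔹.≟ _)

edge-elim : ∀ {n} (u v : Fin n) {i j} → edge u v i j ≡ true → (i ≡ u × j ≡ v) ⊎ (i ≡ v × j ≡ u)
edge-elim u v {i} {j} h with ∨-elim {(i == u) ∧ (j == v)} h
... | inj₁ p = inj₁ (==⇒≡ (∧-fst p) , ==⇒≡ (∧-snd {i == u} p))
... | inj₂ p = inj₂ (==⇒≡ (∧-fst p) , ==⇒≡ (∧-snd {i == v} p))

edge-self : ∀ {n} (u v : Fin n) → edge u v u v ≡ true
edge-self u v rewrite ==-refl u | ==-refl v = refl

edge-flip : ∀ {n} (u v : Fin n) → edge u v v u ≡ true
edge-flip u v = trans (edge-sym u v v u) (edge-self u v)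

edge-false : ∀ {n} (u v : Fin n) {i j} → ¬ ((i ≡ u × j ≡ v) ⊎ (i ≡ v × j ≡ u)) → edge u v i j ≡ false
edge-false u v h = ≢true⇒false (λ e → h (edge-elim u v e))

IsES-edge : ∀ {n} {u v : Fin n} → u ≢ v → IsES (edge u v)
IsES-edge {u = u} {v} u≢v = edge-sym u v , λ i → edge-false u v {i} {i}
  λ { (inj₁ (refl , refl)) → u≢v refl ; (inj₂ (refl , refl)) → u≢v refl }

IsES-addE : ∀ {n} {u v : Fin n} {E : ES n} → u ≢ v → IsES E → IsES (addE u v E)
IsES-addE u≢v es = IsES-∪ es (IsES-edge u≢v)

IsES-delE : ∀ {n} (u v : Fin n) {E : ES n} → IsES E → IsES (delE u v E)
IsES-delE u v es = IsES-∖ es (edge-sym u v)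

IsES-remV : ∀ {n} (p : Fin n) {E : ES n} → IsES E → IsES (remV p E)
IsES-remV p {E} (s , ir) =
  (λ i j → aux (E i j) (E j i) (not (i == p)) (not (j == p)) (s i j)) ,
  (λ i → cong (_∧ (not (i == p) ∧ not (i == p))) (ir i))
  where
  aux : ∀ a b c d → a ≡ b → a ∧ (c ∧ d) ≡ b ∧ (d ∧ c)
  aux a .a true  true  refl = refl
  aux a .a true  false refl = refl
  aux a .a false true  refl = refl
  aux a .a false false refl = refl

IsES-induce : ∀ {n} {E : ES n} (S : VS n) → IsES E → IsES (induce E S)
IsES-induce {E = E} S (s , ir) =
  (λ i j → aux (E i j) (E j i) (S i) (S j) (s i j)) , (λ i → cong (_∧ (S i ∧ S i)) (ir i))
  where
  aux : ∀ a b c d → a ≡ b → a ∧ (c ∧ d) ≡ b ∧ (d ∧ c)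
  aux a .a true  true  refl = refl
  aux a .a true  false refl = refl
  aux a .a false true  refl = refl
  aux a .a false false refl = refl

IsES-touch : ∀ {n} {E : ES n} (S : VS n) → IsES E → IsES (touch E S)
IsES-touch {E = E} S (s , ir) =
  (λ i j → aux (E i j) (E j i) (S i) (S j) (s i j)) , (λ i → cong (_∧ (S i ∨ S i)) (ir i))
  where
  aux : ∀ a b c d → a ≡ b → a ∧ (c ∨ d) ≡ b ∧ (d ∨ c)
  aux a .a true  true  refl = refl
  aux a .a true  false refl = refl
  aux a .a false true  refl = refl
  aux a .a false false refl = refl

ES-≢ : ∀ {n} {E : ES n} → IsES E → ∀ {i j} → E i j ≡ true → i ≢ j
ES-≢ (s , ir) h refl = true≢false h (ir _)

ES-sym : ∀ {n} {E : ES n} → IsES E → ∀ {i j} → E i j ≡ true → E j i ≡ true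
ES-sym (s , ir) {i} {j} h = trans (s j i) h

ES-symᶠ : ∀ {n} {E : ES n} → IsES E → ∀ {i j} → E i j ≡ false → E j i ≡ false
ES-symᶠ (s , ir) {i} {j} h = trans (s j i) h

ends-intro : ∀ {n} (E : ES n) {i j} → E i j ≡ true → ends E i ≡ true
ends-intro E {i} {j} h = anyFin-intro (E i) j h

ends-elim : ∀ {n} (E : ES n) {i} → ends E i ≡ true → ∃[ j ] (E i j ≡ true)
ends-elim E {i} h = anyFin-elim (E i) h

ends-mono : ∀ {n} {A B : ES n} → A ⊆ᵉ B → ends A ⊆ᵛ ends B
ends-mono {A = A} {B} h v p with ends-elim A p
... | j , q = ends-intro B (h v j q)

induce-intro : ∀ {n} (E : ES n) (S : VS n) {i j} → E i j ≡ true → S i ≡ true → S j ≡ true → induce E S i j ≡ true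
induce-intro E S p q r = ∧-intro p (∧-intro q r)

induce-elim : ∀ {n} (E : ES n) (S : VS n) {i j} → induce E S i j ≡ true → E i j ≡ true × S i ≡ true × S j ≡ true
induce-elim E S {i} {j} h = ∧-fst h , ∧-fst (∧-snd {E i j} h) , ∧-snd {S i} (∧-snd {E i j} h)

touch-elim : ∀ {n} (E : ES n) (S : VS n) {i j} → touch E S i j ≡ true → E i j ≡ true × (S i ≡ true ⊎ S j ≡ true)
touch-elim E S {i} {j} h = ∧-fst h , ∨-elim (∧-snd {E i j} h)

touch-introˡ : ∀ {n} (E : ES n) (S : VS n) {i j} → E i j ≡ true → S i ≡ true → touch E S i j ≡ true
touch-introˡ E S p q = ∧-intro p (∨-introˡ q)

touch-introʳ : ∀ {n} (E : ES n) (S : VS n) {i j} → E i j ≡ true → S j ≡ true → touch E S i j ≡ true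
touch-introʳ E S {i} p q = ∧-intro p (∨-introʳ {S i} q)

ind-mono : ∀ {n} {A B : ES n} {S T : VS n} → A ⊆ᵉ B → S ⊆ᵛ T → ind A S ≤ ind B T
ind-mono {A = A} {B} {S} {T} h k = ecount-mono (λ i j p → case induce-elim A S p of
  λ { (a , b , c) → induce-intro B T (h i j a) (k i b) (k j c) })

inc-mono : ∀ {n} {A B : ES n} {S T : VS n} → A ⊆ᵉ B → S ⊆ᵛ T → inc A S ≤ inc B T
inc-mono {A = A} {B} {S} {T} h k = ecount-mono (λ i j p → case touch-elim A S p of
  λ { (a , inj₁ b) → touch-introˡ B T (h i j a) (k i b)
    ; (a , inj₂ c) → touch-introʳ B T (h i j a) (k j c) })

⊆ᵉ-refl : ∀ {n} {A : ES n} → A ⊆ᵉ A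
⊆ᵉ-refl i j p = p

ind-ext : ∀ {n} (E : ES n) {S T : VS n} → S ⊆ᵛ T → T ⊆ᵛ S → ind E S ≡ ind E T
ind-ext E h k = ≤-antisym (ind-mono {A = E} {E} (⊆ᵉ-refl {A = E}) h) (ind-mono {A = E} {E} (⊆ᵉ-refl {A = E}) k)

inc-ext : ∀ {n} (E : ES n) {S T : VS n} → S ⊆ᵛ T → T ⊆ᵛ S → inc E S ≡ inc E T
inc-ext E h k = ≤-antisym (inc-mono {A = E} {E} (⊆ᵉ-refl {A = E}) h) (inc-mono {A = E} {E} (⊆ᵉ-refl {A = E}) k)

sum-strict : ∀ {n} {f g : Fin n → ℕ} v → (∀ i → f i ≤ g i) → f v < g v → sumFin f < sumFin g
sum-strict zero    h lt = +-mono-<-≤ lt (sum-mono (λ i → h (suc i)))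
sum-strict (suc v) h lt = +-mono-≤-< (h zero) (sum-strict v (λ i → h (suc i)) lt)

ecount-strict : ∀ {n} {A B : ES n} → IsES A → IsES B → A ⊆ᵉ B → ∀ {a c} →
  A a c ≡ false → B a c ≡ true → ecount A < ecount B
ecount-strict {A = A} {B} esA esB A⊆B {a} {c} Aac Bac = case true⊎false (toℕ a <ᵇ toℕ c) of λ
  { (inj₁ lt) → oriented a c lt Aac Bac
  ; (inj₂ ge) → oriented c a (trans (<ᵇ-flip a c (ES-≢ esB Bac)) (cong not ge)) (ES-symᶠ esA Aac) (ES-sym esB Bac) }
  where
  oriented : ∀ a c → (toℕ a <ᵇ toℕ c) ≡ true → A a c ≡ false → B a c ≡ true → ecount A < ecount B
  oriented a c lt Aac Bac = sum-strict a
    (λ i → vcount-mono (λ j h → ∧-intro (A⊆B i j (∧-fst h)) (∧-snd {A i j} h)))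
    (vcount-strict c (λ j h → ∧-intro (A⊆B a j (∧-fst h)) (∧-snd {A a j} h))
      (subst (λ b → b ∧ (toℕ a <ᵇ toℕ c) ≡ false) (sym Aac) refl) (∧-intro Bac lt))

⊆ᵉ-by-count : ∀ {n} {A B : ES n} → IsES A → IsES B → A ⊆ᵉ B → ecount B ≤ ecount A → B ⊆ᵉ A
⊆ᵉ-by-count esA esB A⊆B le i j Bij = ≢false⇒true (λ Aij → <⇒≱ (ecount-strict esA esB A⊆B Aij Bij) le)

ecount-pos : ∀ {n} {A : ES n} → IsES A → ∀ {i j} → A i j ≡ true → 1 ≤ ecount A
ecount-pos {A = A} es {i} {j} h = ≤-trans (s≤s z≤n)
  (ecount-strict {A = λ _ _ → false} ((λ _ _ → refl) , (λ _ → refl)) es (λ _ _ ()) {i} {j} refl h)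

ecount>0 : ∀ {n} (A : ES n) → 1 ≤ ecount A → NonEmpty A
ecount>0 A h with sum>0 _ h
... | i , p with vcount>0 (λ j → A i j ∧ (toℕ i <ᵇ toℕ j)) p
...   | j , q = i , j , ∧-fst q

ecount-∪∩ : ∀ {n} (A B : ES n) → ecount (A ∪ᵉ B) + ecount (A ∩ᵉ B) ≡ ecount A + ecount B
ecount-∪∩ A B = ecount₂≡₂ {A = A ∪ᵉ B} {A ∩ᵉ B} {A} {B} (λ i j _ → aux (A i j) (B i j))
  where
  aux : ∀ a b → ⟦ a ∨ b ⟧ + ⟦ a ∧ b ⟧ ≡ ⟦ a ⟧ + ⟦ b ⟧
  aux = cases (∀𝔹? λ a → ∀𝔹? λ b → ⟦ a ∨ b ⟧ + ⟦ a ∧ b ⟧ ℕ.≟ ⟦ a ⟧ + ⟦ b ⟧)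

ecount-∖∩ : ∀ {n} (A B : ES n) → ecount A ≡ ecount (A ∖ᵉ B) + ecount (A ∩ᵉ B)
ecount-∖∩ A B = ecount₁≡₂ {A = A} {A ∖ᵉ B} {A ∩ᵉ B} (λ i j _ → aux (A i j) (B i j))
  where
  aux : ∀ a b → ⟦ a ⟧ ≡ ⟦ a ∧ not b ⟧ + ⟦ a ∧ b ⟧
  aux = cases (∀𝔹? λ a → ∀𝔹? λ b → ⟦ a ⟧ ℕ.≟ ⟦ a ∧ not b ⟧ + ⟦ a ∧ b ⟧)

ecount-edge∩ : ∀ {n} {u v : Fin n} (P : ES n) → u ≢ v → P u v ≡ P v u →
  ecount (edge u v ∩ᵉ P) ≡ ⟦ P u v ⟧
ecount-edge∩ {n} {u} {v} P u≢v Psym = begin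
  ecount (edge u v ∩ᵉ P)                     ≡⟨ ecount-esum (edge u v ∩ᵉ P) ⟩
  esum (λ i j → ⟦ edge u v i j ∧ P i j ⟧)    ≡⟨ esum-cong pointwise ⟩
  esum (λ i j → g i j + g j i)               ≡⟨ sym (esum-sym g diag) ⟩
  sumFin (λ i → sumFin (λ j → g i j))        ≡⟨ sum-δ u _ (λ i i≢u → sum-0 (λ j → off i j i≢u)) ⟩
  sumFin (λ j → g u j)                       ≡⟨ sum-δ v _ (λ j j≢v → off' j j≢v) ⟩
  g u v                                      ≡⟨ cong ⟦_⟧ (cong₂ (λ a b → a ∧ (b ∧ P u v)) (==-refl u) (==-refl v)) ⟩
  ⟦ P u v ⟧ ∎
  where
  open ≡-Reasoning
  g : Fin n → Fin n → ℕ
  g i j = ⟦ (i == u) ∧ ((j == v) ∧ P u v) ⟧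
  off : ∀ i j → i ≢ u → g i j ≡ 0
  off i j i≢u rewrite ≢⇒== i≢u = refl
  off' : ∀ j → j ≢ v → g u j ≡ 0
  off' j j≢v rewrite ==-refl u | ≢⇒== j≢v = refl
  diag : ∀ i → g i i ≡ 0
  diag i with i ≟ u
  ... | no _ = refl
  ... | yes refl rewrite ≢⇒== u≢v = refl
  pointwise : ∀ i j → i ≢ j → ⟦ edge u v i j ∧ P i j ⟧ ≡ g i j + g j i
  pointwise i j i≢j with i ≟ u | j ≟ v | i ≟ v | j ≟ u
  ... | yes refl | yes refl | yes refl | _        = ⊥-elim (u≢v refl)
  ... | yes refl | yes refl | no _     | yes refl = ⊥-elim (u≢v refl)
  ... | yes refl | yes refl | no _     | no _     = sym (+-identityʳ _)
  ... | yes refl | no _     | _        | yes refl = ⊥-elim (i≢j refl)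
  ... | yes refl | no _     | yes refl | no _     = refl
  ... | yes refl | no _     | no _     | no _     = refl
  ... | no _     | yes refl | yes refl | _        = ⊥-elim (i≢j refl)
  ... | no _     | yes refl | no _     | yes refl = refl
  ... | no _     | yes refl | no _     | no _     = refl
  ... | no _     | no _     | yes refl | yes refl = cong ⟦_⟧ (sym Psym)
  ... | no _     | no _     | yes refl | no _     = refl
  ... | no _     | no _     | no _     | yes refl = refl
  ... | no _     | no _     | no _     | no _     = refl

ecount-edge : ∀ {n} {u v : Fin n} → u ≢ v → ecount (edge u v) ≡ 1
ecount-edge {u = u} {v} u≢v = trans
  (ecount-cong {B = edge u v ∩ᵉ (λ _ _ → true)} (λ i j h → ∧-intro h refl) (λ i j h → ∧-fst h))
  (ecount-edge∩ (λ _ _ → true) u≢v refl)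

ecount-star : ∀ {n} {E : ES n} → IsES E → ∀ v (S : VS n) → ecount (star E v S) ≡ nb E v S
ecount-star {n} {E} (s , ir) v S = begin
  ecount (star E v S)                         ≡⟨ ecount-esum (star E v S) ⟩
  esum (λ i j → ⟦ star E v S i j ⟧)           ≡⟨ esum-cong pointwise ⟩
  esum (λ i j → g i j + g j i)                ≡⟨ sym (esum-sym g diag) ⟩
  sumFin (λ i → sumFin (λ j → g i j))         ≡⟨ sum-δ v _ (λ i i≢v → sum-0 (λ j → off i j i≢v)) ⟩
  sumFin (λ j → g v j)                        ≡⟨ sum-cong (λ j → cong (λ b → ⟦ b ∧ (E v j ∧ S j) ⟧) (==-refl v)) ⟩
  nb E v S ∎
  where
  open ≡-Reasoning
  g : Fin n → Fin n → ℕ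
  g i j = ⟦ (i == v) ∧ (E i j ∧ S j) ⟧
  off : ∀ i j → i ≢ v → g i j ≡ 0
  off i j i≢v rewrite ≢⇒== i≢v = refl
  diag : ∀ i → g i i ≡ 0
  diag i rewrite ir i with i == v
  ... | true  = refl
  ... | false = refl
  aux₁ : ∀ e s t → ⟦ e ∧ ((true ∧ s) ∨ (false ∧ t)) ⟧ ≡ ⟦ true ∧ (e ∧ s) ⟧ + ⟦ false ∧ (e ∧ t) ⟧
  aux₁ = cases (∀𝔹? λ e → ∀𝔹? λ s → ∀𝔹? λ t → _ ℕ.≟ _)
  aux₂ : ∀ e s t → ⟦ e ∧ ((false ∧ s) ∨ (true ∧ t)) ⟧ ≡ ⟦ false ∧ (e ∧ s) ⟧ + ⟦ true ∧ (e ∧ t) ⟧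
  aux₂ = cases (∀𝔹? λ e → ∀𝔹? λ s → ∀𝔹? λ t → _ ℕ.≟ _)
  aux₃ : ∀ e s t → ⟦ e ∧ ((false ∧ s) ∨ (false ∧ t)) ⟧ ≡ ⟦ false ∧ (e ∧ s) ⟧ + ⟦ false ∧ (e ∧ t) ⟧
  aux₃ = cases (∀𝔹? λ e → ∀𝔹? λ s → ∀𝔹? λ t → _ ℕ.≟ _)
  pointwise : ∀ i j → i ≢ j → ⟦ star E v S i j ⟧ ≡ g i j + g j i
  pointwise i j i≢j rewrite s j i with i ≟ v | j ≟ v
  ... | yes refl | yes refl = ⊥-elim (i≢j refl)
  ... | yes _    | no _     = aux₁ (E i j) (S j) (S i)
  ... | no _     | yes _    = aux₂ (E i j) (S j) (S i)
  ... | no _     | no _     = aux₃ (E i j) (S j) (S i)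

nb-all : ∀ {n} (E : ES n) v → nb E v (λ _ → true) ≡ dg E v
nb-all E v = vcount-cong {A = λ w → E v w ∧ true} {E v} (λ w h → ∧-fst h) (λ w h → ∧-intro h refl)

nb≤dg : ∀ {n} (E : ES n) v S → nb E v S ≤ dg E v
nb≤dg E v S = vcount-mono {A = λ w → E v w ∧ S w} {E v} (λ w h → ∧-fst h)

-- Counts under insertion and removal of vertices and edges

module _ {n} {E : ES n} (es : IsES E) where

  -- All edges at `v` are new except those into `S`, which were counted before. Like the other count
  -- identities this is stated additively, to avoid truncated subtraction.
  inc-ins : ∀ v (S : VS n) → S v ≡ false → inc E (ins v S) + nb E v S ≡ inc E S + dg E v
  inc-ins v S Sv = subst₂ (λ x y → inc E (ins v S) + x ≡ inc E S + y)
    (ecount-star es v S) (trans (ecount-star es v (λ _ → true)) (nb-all E v))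
    (ecount₂≡₂ {A = touch E (ins v S)} {star E v S} {touch E S} {star E v (λ _ → true)} pointwise)
    where
    aux₁ : ∀ e s t → s ≡ false → ⟦ e ∧ ((true ∨ s) ∨ (false ∨ t)) ⟧ + ⟦ e ∧ ((true ∧ t) ∨ (false ∧ s)) ⟧
      ≡ ⟦ e ∧ (s ∨ t) ⟧ + ⟦ e ∧ ((true ∧ true) ∨ (false ∧ true)) ⟧
    aux₁ true  .false true  refl = refl
    aux₁ true  .false false refl = refl
    aux₁ false .false t     refl = refl
    aux₂ : ∀ e s t → t ≡ false → ⟦ e ∧ ((false ∨ s) ∨ (true ∨ t)) ⟧ + ⟦ e ∧ ((false ∧ t) ∨ (true ∧ s)) ⟧
      ≡ ⟦ e ∧ (s ∨ t) ⟧ + ⟦ e ∧ ((false ∧ true) ∨ (true ∧ true)) ⟧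
    aux₂ true  true  .false refl = refl
    aux₂ true  false .false refl = refl
    aux₂ false s     .false refl = refl
    aux₃ : ∀ e s t → ⟦ e ∧ ((false ∨ s) ∨ (false ∨ t)) ⟧ + ⟦ e ∧ ((false ∧ t) ∨ (false ∧ s)) ⟧
      ≡ ⟦ e ∧ (s ∨ t) ⟧ + ⟦ e ∧ ((false ∧ true) ∨ (false ∧ true)) ⟧
    aux₃ = cases (∀𝔹? λ e → ∀𝔹? λ s → ∀𝔹? λ t → _ ℕ.≟ _)
    pointwise : ∀ i j → i ≢ j → ⟦ touch E (ins v S) i j ⟧ + ⟦ star E v S i j ⟧
      ≡ ⟦ touch E S i j ⟧ + ⟦ star E v (λ _ → true) i j ⟧
    pointwise i j i≢j with i ≟ v | j ≟ v
    ... | yes refl | yes refl = ⊥-elim (i≢j refl)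
    ... | yes refl | no _     = aux₁ (E i j) (S i) (S j) Sv
    ... | no _     | yes refl = aux₂ (E i j) (S i) (S j) Sv
    ... | no _     | no _     = aux₃ (E i j) (S i) (S j)

  ind-ins : ∀ v (S : VS n) → S v ≡ false → ind E (ins v S) ≡ ind E S + nb E v S
  ind-ins v S Sv = subst (λ x → ind E (ins v S) ≡ ind E S + x) (ecount-star es v S)
    (ecount₁≡₂ {A = induce E (ins v S)} {induce E S} {star E v S} pointwise)
    where
    aux₁ : ∀ e s t → s ≡ false → ⟦ e ∧ (true ∧ (false ∨ t)) ⟧ ≡ ⟦ e ∧ (s ∧ t) ⟧ + ⟦ e ∧ ((true ∧ t) ∨ (false ∧ s)) ⟧
    aux₁ true  .false true  refl = refl
    aux₁ true  .false false refl = refl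
    aux₁ false .false t     refl = refl
    aux₂ : ∀ e s t → t ≡ false → ⟦ e ∧ ((false ∨ s) ∧ (true ∨ t)) ⟧ ≡ ⟦ e ∧ (s ∧ t) ⟧ + ⟦ e ∧ ((false ∧ t) ∨ (true ∧ s)) ⟧
    aux₂ true  true  .false refl = refl
    aux₂ true  false .false refl = refl
    aux₂ false s     .false refl = refl
    aux₃ : ∀ e s t → ⟦ e ∧ (s ∧ t) ⟧ ≡ ⟦ e ∧ (s ∧ t) ⟧ + ⟦ e ∧ ((false ∧ t) ∨ (false ∧ s)) ⟧
    aux₃ = cases (∀𝔹? λ e → ∀𝔹? λ s → ∀𝔹? λ t → _ ℕ.≟ _)
    pointwise : ∀ i j → i ≢ j → ⟦ induce E (ins v S) i j ⟧ ≡ ⟦ induce E S i j ⟧ + ⟦ star E v S i j ⟧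
    pointwise i j i≢j with i ≟ v | j ≟ v
    ... | yes refl | yes refl = ⊥-elim (i≢j refl)
    ... | yes refl | no _     = aux₁ (E i j) (S i) (S j) Sv
    ... | no _     | yes refl = aux₂ (E i j) (S i) (S j) Sv
    ... | no _     | no _     = aux₃ (E i j) (S i) (S j)

  inc-rem : ∀ v (S : VS n) → S v ≡ true → inc E S + nb E v (rem v S) ≡ inc E (rem v S) + dg E v
  inc-rem v S Sv = trans (cong (_+ nb E v (rem v S)) (inc-ext E (⊆-ins-rem v S) (ins-rem-⊆ v S Sv)))
    (inc-ins v (rem v S) (rem-self v S))

  ind-rem : ∀ v (S : VS n) → S v ≡ true → ind E S ≡ ind E (rem v S) + nb E v (rem v S)
  ind-rem v S Sv = trans (ind-ext E (⊆-ins-rem v S) (ins-rem-⊆ v S Sv)) (ind-ins v (rem v S) (rem-self v S))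

  nb-rem : ∀ v (S : VS n) → nb E v (rem v S) ≡ nb E v S
  nb-rem v S = vcount-cong {A = λ w → E v w ∧ rem v S w} {λ w → E v w ∧ S w} (λ w h → ∧-intro (∧-fst {E v w} h) (rem-⊆ v S w (∧-snd {E v w} h)))
    (λ w h → ∧-intro (∧-fst {E v w} h) (rem-intro v S (λ { refl → true≢false (∧-fst {E v w} h) (proj₂ es v) }) (∧-snd {E v w} h)))

  inc-remV : ∀ p (S : VS n) → inc E (ins p S) ≡ inc (remV p E) S + dg E p
  inc-remV p S = trans
    (ecount₁≡₂ {A = touch E (ins p S)} {touch (remV p E) S} {star E p (λ _ → true)} (λ i j _ → aux (E i j) (i == p) (j == p) (S i) (S j)))
    (cong (inc (remV p E) S +_) (trans (ecount-star es p (λ _ → true)) (nb-all E p)))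
    where
    aux : ∀ e a b s t → ⟦ e ∧ ((a ∨ s) ∨ (b ∨ t)) ⟧ ≡
      ⟦ (e ∧ (not a ∧ not b)) ∧ (s ∨ t) ⟧ + ⟦ e ∧ ((a ∧ true) ∨ (b ∧ true)) ⟧
    aux = cases (∀𝔹? λ e → ∀𝔹? λ a → ∀𝔹? λ b → ∀𝔹? λ s → ∀𝔹? λ t → _ ℕ.≟ _)

  inc-remV' : ∀ p (S : VS n) → S p ≡ false → inc E S ≡ inc (remV p E) S + nb E p S
  inc-remV' p S Sp = linear 5 (λ a b c d e → a ⊕ d ≐ b ⊕ e ⇒ a ≐ c ⊕ e ⇒ ⊢ b ≐ c ⊕ d)
    (inc E (ins p S)) (inc E S) (inc (remV p E) S) (nb E p S) (dg E p) (inc-ins p S Sp) (inc-remV p S)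

  ind-remV : ∀ p (S : VS n) → S p ≡ false → ind (remV p E) S ≡ ind E S
  ind-remV p S Sp = ecount-cong {A = induce (remV p E) S} {induce E S}
    (λ i j h → case induce-elim (remV p E) S h of λ { (a , b , c) → induce-intro E S (∧-fst a) b c })
    (λ i j h → case induce-elim E S h of λ { (a , b , c) → induce-intro (remV p E) S
      (∧-intro a (∧-intro (not-true (≢⇒== {i = i} {p} (λ { refl → true≢false b Sp }))) (not-true (≢⇒== {i = j} {p} (λ { refl → true≢false c Sp }))))) b c })

  inc-addE : ∀ {u v} (S : VS n) → u ≢ v → E u v ≡ false → inc (addE u v E) S ≡ inc E S + ⟦ S u ∨ S v ⟧
  inc-addE {u} {v} S u≢v Euv = trans
    (ecount₁≡₂ {A = touch (addE u v E) S} {touch E S} {edge u v ∩ᵉ P} pointwise)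
    (cong (inc E S +_) (ecount-edge∩ P u≢v (𝔹.∨-comm (S u) (S v))))
    where
    P : ES n
    P i j = S i ∨ S j
    pointwise : ∀ i j → i ≢ j → ⟦ (E i j ∨ edge u v i j) ∧ (S i ∨ S j) ⟧ ≡ ⟦ E i j ∧ (S i ∨ S j) ⟧ + ⟦ edge u v i j ∧ (S i ∨ S j) ⟧
    pointwise i j _ with edge u v i j in eq
    ... | false rewrite 𝔹.∨-identityʳ (E i j) = sym (+-identityʳ _)
    ... | true with edge-elim u v {i} {j} eq
    ...   | inj₁ (refl , refl) rewrite Euv = refl
    ...   | inj₂ (refl , refl) rewrite ES-symᶠ es Euv = refl

  ind-addE : ∀ {u v} (S : VS n) → u ≢ v → E u v ≡ false → ind (addE u v E) S ≡ ind E S + ⟦ S u ∧ S v ⟧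
  ind-addE {u} {v} S u≢v Euv = trans
    (ecount₁≡₂ {A = induce (addE u v E) S} {induce E S} {edge u v ∩ᵉ P} pointwise)
    (cong (ind E S +_) (ecount-edge∩ P u≢v (𝔹.∧-comm (S u) (S v))))
    where
    P : ES n
    P i j = S i ∧ S j
    pointwise : ∀ i j → i ≢ j → ⟦ (E i j ∨ edge u v i j) ∧ (S i ∧ S j) ⟧ ≡ ⟦ E i j ∧ (S i ∧ S j) ⟧ + ⟦ edge u v i j ∧ (S i ∧ S j) ⟧
    pointwise i j _ with edge u v i j in eq
    ... | false rewrite 𝔹.∨-identityʳ (E i j) = sym (+-identityʳ _)
    ... | true with edge-elim u v {i} {j} eq
    ...   | inj₁ (refl , refl) rewrite Euv = refl
    ...   | inj₂ (refl , refl) rewrite ES-symᶠ es Euv = refl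

  degree-sum : ∀ (S : VS n) → sumFin (λ v → if S v then dg E v else 0) ≡ inc E S + ind E S
  degree-sum S = begin
    sumFin (λ v → if S v then dg E v else 0)     ≡⟨ sum-cong row-sum ⟩
    sumFin (λ v → sumFin (λ w → g v w))          ≡⟨ esum-sym g diag ⟩
    esum (λ i j → g i j + g j i)                 ≡⟨ esum-cong (λ i j _ → pointwise i j) ⟩
    esum (λ i j → ⟦ touch E S i j ⟧ + ⟦ induce E S i j ⟧) ≡⟨ ecount₂-esum (touch E S) (induce E S) ⟩
    inc E S + ind E S ∎
    where
    open ≡-Reasoning
    g : Fin n → Fin n → ℕ
    g v w = ⟦ S v ∧ E v w ⟧
    row-sum : ∀ v → (if S v then dg E v else 0) ≡ sumFin (λ w → g v w)
    row-sum v with S v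
    ... | true  = refl
    ... | false = sym (sum-0 {n} (λ _ → refl))
    diag : ∀ i → g i i ≡ 0
    diag i rewrite proj₂ es i with S i
    ... | true  = refl
    ... | false = refl
    aux : ∀ e s t → ⟦ s ∧ e ⟧ + ⟦ t ∧ e ⟧ ≡ ⟦ e ∧ (s ∨ t) ⟧ + ⟦ e ∧ (s ∧ t) ⟧
    aux = cases (∀𝔹? λ e → ∀𝔹? λ s → ∀𝔹? λ t → _ ℕ.≟ _)
    pointwise : ∀ i j → g i j + g j i ≡ ⟦ touch E S i j ⟧ + ⟦ induce E S i j ⟧
    pointwise i j rewrite proj₁ es j i = aux (E i j) (S i) (S j)

  handshake : ∀ (S : VS n) → sumFin (λ v → if S v then nb E v S else 0) ≡ 2 * ind E S
  handshake S = begin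
    sumFin (λ v → if S v then nb E v S else 0)   ≡⟨ sum-cong row-sum ⟩
    sumFin (λ v → sumFin (λ w → g v w))          ≡⟨ esum-sym g diag ⟩
    esum (λ i j → g i j + g j i)                 ≡⟨ esum-cong (λ i j _ → pointwise i j) ⟩
    esum (λ i j → ⟦ induce E S i j ⟧ + ⟦ induce E S i j ⟧) ≡⟨ ecount₂-esum (induce E S) (induce E S) ⟩
    ind E S + ind E S                            ≡⟨ linear 1 (λ x → ⊢ x ⊕ x ≐ 2 ⊗ x) (ind E S) ⟩
    2 * ind E S ∎
    where
    open ≡-Reasoning
    g : Fin n → Fin n → ℕ
    g v w = ⟦ S v ∧ (E v w ∧ S w) ⟧
    row-sum : ∀ v → (if S v then nb E v S else 0) ≡ sumFin (λ w → g v w)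
    row-sum v with S v
    ... | true  = refl
    ... | false = sym (sum-0 {n} (λ _ → refl))
    diag : ∀ i → g i i ≡ 0
    diag i rewrite proj₂ es i with S i
    ... | true  = refl
    ... | false = refl
    aux : ∀ e s t → ⟦ s ∧ (e ∧ t) ⟧ + ⟦ t ∧ (e ∧ s) ⟧ ≡ ⟦ e ∧ (s ∧ t) ⟧ + ⟦ e ∧ (s ∧ t) ⟧
    aux = cases (∀𝔹? λ e → ∀𝔹? λ s → ∀𝔹? λ t → _ ℕ.≟ _)
    pointwise : ∀ i j → g i j + g j i ≡ ⟦ induce E S i j ⟧ + ⟦ induce E S i j ⟧
    pointwise i j rewrite proj₁ es j i = aux (E i j) (S i) (S j)

-- Submodularity and uncrossing of edge counts

between : ∀ {n} → ES n → VS n → VS n → ES n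
between E S T i j = E i j ∧ (((S ∖ᵛ T) i ∧ (T ∖ᵛ S) j) ∨ ((T ∖ᵛ S) i ∧ (S ∖ᵛ T) j))

-- The defect of submodularity is exactly the number of edges between the two differences. Keeping
-- it in the equation yields both the weak form and, from one such edge, the strict form.
inc-submod : ∀ {n} (E : ES n) (S T : VS n) →
  inc E (S ∪ᵛ T) + ecount (touch E (S ∩ᵛ T) ∪ᵉ between E S T) ≡ inc E S + inc E T
inc-submod E S T = ecount₂≡₂ {A = touch E (S ∪ᵛ T)} {touch E (S ∩ᵛ T) ∪ᵉ between E S T} {touch E S} {touch E T}
  (λ i j _ → aux (E i j) (S i) (S j) (T i) (T j))
  where
  aux : ∀ e s s' t t' → ⟦ e ∧ ((s ∨ t) ∨ (s' ∨ t')) ⟧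
    + ⟦ (e ∧ ((s ∧ t) ∨ (s' ∧ t'))) ∨ (e ∧ (((s ∧ not t) ∧ (t' ∧ not s')) ∨ ((t ∧ not s) ∧ (s' ∧ not t')))) ⟧
    ≡ ⟦ e ∧ (s ∨ s') ⟧ + ⟦ e ∧ (t ∨ t') ⟧
  aux = cases (∀𝔹? λ e → ∀𝔹? λ s → ∀𝔹? λ s' → ∀𝔹? λ t → ∀𝔹? λ t' → _ ℕ.≟ _)

inc-submod≤ : ∀ {n} (E : ES n) (S T : VS n) → inc E (S ∪ᵛ T) + inc E (S ∩ᵛ T) ≤ inc E S + inc E T
inc-submod≤ E S T = ≤-trans (+-monoʳ-≤ (inc E (S ∪ᵛ T))
  (ecount-mono {A = touch E (S ∩ᵛ T)} {touch E (S ∩ᵛ T) ∪ᵉ between E S T} (λ i j h → ∨-introˡ h)))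
  (≤-reflexive (inc-submod E S T))

inc-submod< : ∀ {n} {E : ES n} → IsES E → (S T : VS n) → ∀ {a c} → S a ≡ true → T a ≡ false → T c ≡ true → S c ≡ false →
  E a c ≡ true → inc E (S ∪ᵛ T) + inc E (S ∩ᵛ T) < inc E S + inc E T
inc-submod< {n} {E} es S T {a} {c} Sa Ta Tc Sc Eac = subst (suc (inc E (S ∪ᵛ T) + inc E (S ∩ᵛ T)) ≤_) (inc-submod E S T)
  (≤-trans (≤-reflexive (sym (+-suc (inc E (S ∪ᵛ T)) (inc E (S ∩ᵛ T)))))
    (+-monoʳ-≤ (inc E (S ∪ᵛ T)) (ecount-strict {A = touch E (S ∩ᵛ T)} {touch E (S ∩ᵛ T) ∪ᵉ between E S T}
      (IsES-touch (S ∩ᵛ T) es) (IsES-∪ (IsES-touch (S ∩ᵛ T) es) between-ES) (λ i j h → ∨-introˡ h) {a} {c} touch-ac union-ac)))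
  where
  aux : ∀ a b c d → (a ∧ b) ∨ (c ∧ d) ≡ (d ∧ c) ∨ (b ∧ a)
  aux = cases (∀𝔹? λ a → ∀𝔹? λ b → ∀𝔹? λ c → ∀𝔹? λ d → _ 𝔹.≟ _)
  between-ES : IsES (between E S T)
  between-ES = (λ i j → cong₂ _∧_ (proj₁ es i j) (aux ((S ∖ᵛ T) i) ((T ∖ᵛ S) j) ((T ∖ᵛ S) i) ((S ∖ᵛ T) j))) ,
    (λ i → cong (_∧ _) (proj₂ es i))
  touch-ac : touch E (S ∩ᵛ T) a c ≡ false
  touch-ac rewrite Sa | Ta | Sc | Eac = refl
  union-ac : (touch E (S ∩ᵛ T) ∪ᵉ between E S T) a c ≡ true
  union-ac rewrite Sa | Ta | Sc | Tc | Eac = refl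

ind-supermod : ∀ {n} (E : ES n) (S T : VS n) → ind E S + ind E T ≤ ind E (S ∪ᵛ T) + ind E (S ∩ᵛ T)
ind-supermod E S T = ecount₂≤₂ {A = induce E S} {induce E T} {induce E (S ∪ᵛ T)} {induce E (S ∩ᵛ T)}
  (λ i j _ → aux (E i j) (S i) (S j) (T i) (T j))
  where
  aux : ∀ e s s' t t' → ⟦ e ∧ (s ∧ s') ⟧ + ⟦ e ∧ (t ∧ t') ⟧ ≤ ⟦ e ∧ ((s ∨ t) ∧ (s' ∨ t')) ⟧ + ⟦ e ∧ ((s ∧ t) ∧ (s' ∧ t')) ⟧
  aux = cases (∀𝔹? λ e → ∀𝔹? λ s → ∀𝔹? λ s' → ∀𝔹? λ t → ∀𝔹? λ t' → _ ≤? _)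

-- No edge is counted twice on the left, since an edge inside `Z` does not touch `W ∖ᵛ Z`; and an
-- edge inside `Z` either touches `W` or lies inside `Z ∖ᵛ W`.
inc-ind-uncross : ∀ {n} (E : ES n) (W Z : VS n) → inc E (W ∖ᵛ Z) + ind E Z ≤ inc E W + ind E (Z ∖ᵛ W)
inc-ind-uncross E W Z = ecount₂≤₂ {A = touch E (W ∖ᵛ Z)} {induce E Z} {touch E W} {induce E (Z ∖ᵛ W)}
  (λ i j _ → aux (E i j) (W i) (W j) (Z i) (Z j))
  where
  aux : ∀ e s s' t t' → ⟦ e ∧ ((s ∧ not t) ∨ (s' ∧ not t')) ⟧ + ⟦ e ∧ (t ∧ t') ⟧ ≤ ⟦ e ∧ (s ∨ s') ⟧ + ⟦ e ∧ ((t ∧ not s) ∧ (t' ∧ not s')) ⟧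
  aux = cases (∀𝔹? λ e → ∀𝔹? λ s → ∀𝔹? λ s' → ∀𝔹? λ t → ∀𝔹? λ t' → _ ≤? _)

-- (2,2)-circuits

Edge : ℕ → Set
Edge n = Fin n × Fin n

_∋_ _∌_ : ∀ {n} → ES n → Edge n → Set
C ∋ (i , j) = C i j ≡ true
C ∌ (i , j) = C i j ≡ false

⊆ᵉ⊎witness : ∀ {n} (A B : ES n) → A ⊆ᵉ B ⊎ (∃[ e ] (A ∋ e × B ∌ e))
⊆ᵉ⊎witness A B with true⊎false (anyFin (λ i → anyFin (λ j → A i j ∧ not (B i j))))
... | inj₁ h with anyFin-elim _ h
...   | i , hi with anyFin-elim _ hi
...     | j , hij = inj₂ ((i , j) , ∧-fst hij , not-true⁻ (∧-snd {A i j} hij))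
⊆ᵉ⊎witness A B | inj₂ h = inj₁ λ i j Aij → ≢false⇒true (λ Bij → true≢false
  (anyFin-intro _ i (anyFin-intro (λ j → A i j ∧ not (B i j)) j (∧-intro Aij (not-true Bij)))) h)

⊆ᵛ⊎witness : ∀ {n} (A B : VS n) → A ⊆ᵛ B ⊎ (∃[ v ] (A v ≡ true × B v ≡ false))
⊆ᵛ⊎witness A B with true⊎false (anyFin (λ i → A i ∧ not (B i)))
... | inj₁ h with anyFin-elim _ h
...   | i , hi = inj₂ (i , ∧-fst hi , not-true⁻ (∧-snd {A i} hi))
⊆ᵛ⊎witness A B | inj₂ h = inj₁ λ i Ai → ≢false⇒true (λ Bi → true≢false
  (anyFin-intro (λ i → A i ∧ not (B i)) i (∧-intro Ai (not-true Bi))) h)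

ind-all : ∀ {n} (A : ES n) (S : VS n) → IsES A → (∀ i j → A i j ≡ true → S i ≡ true) → ind A S ≡ ecount A
ind-all A S es h = ecount-cong {A = induce A S} {A} (λ i j p → ∧-fst p)
  (λ i j p → induce-intro A S p (h i j p) (h j i (ES-sym es p)))

ind≤ecount : ∀ {n} (A : ES n) S → ind A S ≤ ecount A
ind≤ecount A S = ecount-mono {A = induce A S} {A} (λ i j p → ∧-fst p)

ecount-delE : ∀ {n} {A : ES n} → IsES A → ∀ {a b} → A a b ≡ true → ecount A ≡ suc (ecount (delE a b A))
ecount-delE {A = A} es {a} {b} Aab = begin
  ecount A                                      ≡⟨ ecount-∖∩ A (edge a b) ⟩
  ecount (delE a b A) + ecount (A ∩ᵉ edge a b)  ≡⟨ cong (ecount (delE a b A) +_) (ecount-cong {A = A ∩ᵉ edge a b} {edge a b ∩ᵉ A}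
      (λ i j h → ∧-intro (∧-snd {A i j} h) (∧-fst h)) (λ i j h → ∧-intro (∧-snd {edge a b i j} h) (∧-fst h))) ⟩
  ecount (delE a b A) + ecount (edge a b ∩ᵉ A)  ≡⟨ cong (ecount (delE a b A) +_) (ecount-edge∩ A (ES-≢ es Aab) (proj₁ es a b)) ⟩
  ecount (delE a b A) + ⟦ A a b ⟧               ≡⟨ cong (λ x → ecount (delE a b A) + ⟦ x ⟧) Aab ⟩
  ecount (delE a b A) + 1                       ≡⟨ +-comm _ 1 ⟩
  suc (ecount (delE a b A)) ∎
  where open ≡-Reasoning

delE-self : ∀ {n} (A : ES n) a b → delE a b A a b ≡ false
delE-self A a b rewrite edge-self a b = 𝔹.∧-zeroʳ (A a b)

delE-⊆ : ∀ {n} (A : ES n) a b → delE a b A ⊆ᵉ A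
delE-⊆ A a b i j h = ∧-fst h

-- This is dependence in the matroid. Induced subgraphs have the most edges on given vertices, so
-- testing them suffices and dependence becomes a decidable search over vertex sets.
Overfull : ∀ {n} → ES n → Set
Overfull E = ∃[ S ] (1 ≤ vcount S × 2 * vcount S ≤ ind E S + 1)

overfull? : ∀ {n} (E : ES n) → Dec (Overfull E)
overfull? E = anyVS? (λ S → (1 ≤? vcount S) ×-dec (2 * vcount S ≤? ind E S + 1))
  λ {S} {T} eq (p , q) →
    let S⊆T : S ⊆ᵛ T
        S⊆T v h = trans (sym (eq v)) h
        T⊆S : T ⊆ᵛ S
        T⊆S v h = trans (eq v) h
    in subst (1 ≤_) (vcount-cong S⊆T T⊆S) p ,
       subst₂ (λ x y → 2 * x ≤ y + 1) (vcount-cong S⊆T T⊆S) (ind-ext E S⊆T T⊆S) q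

overfull-mono : ∀ {n} {A B : ES n} → A ⊆ᵉ B → Overfull A → Overfull B
overfull-mono {A = A} {B} h (S , p , q) = S , p ,
  ≤-trans q (+-monoˡ-≤ 1 (ind-mono {A = A} {B} {S} {S} h (λ _ x → x)))

¬overfull⇒sparse : ∀ {n} (A : ES n) → ¬ Overfull A → ∀ S → 1 ≤ vcount S → ind A S + 2 ≤ 2 * vcount S
¬overfull⇒sparse A h S p = linear 2 (λ a b → a ⊕ κ 2 ≼ b ⇒ ⊢ a ⊕ κ 2 ≼ b) (ind A S) (2 * vcount S)
  (subst (_≤ 2 * vcount S) (lem (ind A S)) (≰⇒> (λ q → h (S , p , q))))
  where
  lem : ∀ x → suc (x + 1) ≡ x + 2
  lem = linear 1 (λ x → ⊢ κ 1 ⊕ (x ⊕ κ 1) ≐ x ⊕ κ 2)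

-- Only vertex sets that miss an endpoint need a bound: a proper subgraph that keeps all vertices
-- has lost an edge, and then `circ-count` gives the bound.
record IsCirc {n} (C : ES n) : Set where
  field
    circ-es     : IsES C
    circ-count  : ecount C + 1 ≡ 2 * vcount (ends C)
    circ-sparse : ∀ S → 1 ≤ vcount S → ¬ (ends C ⊆ᵛ S) → ind C S + 2 ≤ 2 * vcount S
open IsCirc public

ends-within : ∀ {n} (A : ES n) i j → A i j ≡ true → ends A i ≡ true
ends-within A i j h = ends-intro A h

circ-ends-pos : ∀ {n} {C : ES n} → IsCirc C → 1 ≤ vcount (ends C)
circ-ends-pos {C = C} c with vcount (ends C) | circ-count c
... | zero  | eq = case trans (sym (+-comm (ecount C) 1)) eq of λ ()
... | suc k | eq = s≤s z≤n

circ-overfull : ∀ {n} {C : ES n} → IsCirc C → Overfull C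
circ-overfull {C = C} c = ends C , circ-ends-pos c ,
  ≤-reflexive (trans (sym (circ-count c)) (cong (_+ 1) (sym (ind-all C (ends C) (circ-es c) (ends-within C)))))

circ-proper-sparse : ∀ {n} {C A : ES n} → IsCirc C → IsES A → A ⊆ᵉ C → ∀ {e} → C ∋ e → A ∌ e → ¬ Overfull A
circ-proper-sparse {C = C} {A} c esA A⊆C Ce Ae (S , p , q) with ⊆ᵛ⊎witness (ends C) S
... | inj₁ sub = linear 5 (λ iA eA eC vC vS → iA ≼ eA ⇒ κ 1 ⊕ eA ≼ eC ⇒ eC ⊕ κ 1 ≐ 2 ⊗ vC ⇒ vC ≼ vS ⇒ 2 ⊗ vS ≼ iA ⊕ κ 1 ⇒ ⊢⊥)
    (ind A S) (ecount A) (ecount C) (vcount (ends C)) (vcount S)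
    (ind≤ecount A S) (ecount-strict esA (circ-es c) A⊆C Ae Ce) (circ-count c) (vcount-mono sub) q
... | inj₂ (v , cv , sv) = linear 3 (λ iA iC vS → iA ≼ iC ⇒ iC ⊕ κ 2 ≼ 2 ⊗ vS ⇒ 2 ⊗ vS ≼ iA ⊕ κ 1 ⇒ ⊢⊥)
    (ind A S) (ind C S) (vcount S) (ind-mono {A = A} {C} {S} {S} A⊆C (λ _ x → x))
    (circ-sparse c S p (λ sub → true≢false (sub v cv) sv)) q

-- An overfull set contains every endpoint, because an edge with an end outside it could be deleted
-- without harm. More than `2|V| − 1` edges would likewise leave one to spare, so the count is
-- exact.
minimal-overfull⇒circ : ∀ {n} {E : ES n} → IsES E → Overfull E →
  (∀ e → E ∋ e → ¬ Overfull (delE (proj₁ e) (proj₂ e) E)) → IsCirc E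
minimal-overfull⇒circ {n} {E} es (S , p , q) minl = record
  { circ-es = es ; circ-count = count ; circ-sparse = sparse }
  where
  keep : ∀ {a b} T → E a b ≡ true → T a ≡ false → ind (delE a b E) T ≡ ind E T
  keep {a} {b} T Eab Ta = ecount-cong {A = induce (delE a b E) T} {induce E T}
    (λ i j h → case induce-elim (delE a b E) T h of λ { (x , y , z) → induce-intro E T (∧-fst x) y z })
    (λ i j h → case induce-elim E T h of λ { (x , y , z) → induce-intro (delE a b E) T
      (∧-intro x (not-true (edge-false a b {i} {j} λ { (inj₁ (refl , refl)) → true≢false y Ta ; (inj₂ (refl , refl)) → true≢false z Ta }))) y z })
  inside : ∀ T → 1 ≤ vcount T → 2 * vcount T ≤ ind E T + 1 → ends E ⊆ᵛ T
  inside T p q v ev = ≢false⇒true λ Tv → case ends-elim E ev of λ { (w , Evw) →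
    minl (v , w) Evw (T , p , subst (λ x → 2 * vcount T ≤ x + 1) (sym (keep T Evw Tv)) q) }
  S⊇ : ends E ⊆ᵛ S
  S⊇ = inside S p q
  big : 2 * vcount S ≤ ecount E + 1
  big = ≤-trans q (+-monoˡ-≤ 1 (ind≤ecount E S))
  nonempty : NonEmpty E
  nonempty = ecount>0 E (linear 2 (λ s e → κ 1 ≼ s ⇒ 2 ⊗ s ≼ e ⊕ κ 1 ⇒ ⊢ κ 1 ≼ e) (vcount S) (ecount E) p big)
  small : ecount E + 1 ≤ 2 * vcount (ends E)
  small with nonempty
  ... | a , b , Eab = ≮⇒≥ λ lt → minl (a , b) Eab (ends E ,
      vcount-pos (ends E) a (ends-intro E Eab) ,
      subst (λ x → 2 * vcount (ends E) ≤ x + 1)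
        (sym (ind-all (delE a b E) (ends E) (IsES-delE a b es) (λ i j h → ends-intro E (delE-⊆ E a b i j h))))
        (linear 3 (λ v e d → κ 1 ⊕ v ≼ e ⊕ κ 1 ⇒ e ≐ κ 1 ⊕ d ⇒ ⊢ v ≼ d ⊕ κ 1) (2 * vcount (ends E)) (ecount E) (ecount (delE a b E))
          lt (ecount-delE es Eab)))
  count : ecount E + 1 ≡ 2 * vcount (ends E)
  count = ≤-antisym small (≤-trans (*-monoʳ-≤ 2 (vcount-mono S⊇)) big)
  sparse : ∀ T → 1 ≤ vcount T → ¬ (ends E ⊆ᵛ T) → ind E T + 2 ≤ 2 * vcount T
  sparse T p h = subst (_≤ 2 * vcount T) (linear 1 (λ x → ⊢ κ 1 ⊕ (x ⊕ κ 1) ≐ x ⊕ κ 2) (ind E T))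
    (≰⇒> (λ q → h (inside T p q)))

abstract
  overfull⇒circ : ∀ {n} {E : ES n} → IsES E → Overfull E → ∃[ C ] (IsCirc C × C ⊆ᵉ E)
  overfull⇒circ {n} {E} es o = go (ecount E) E es ≤-refl o
    where
    go : ∀ k (E : ES n) → IsES E → ecount E ≤ k → Overfull E → ∃[ C ] (IsCirc C × C ⊆ᵉ E)
    go k E es le o with Fin.any? (λ a → Fin.any? (λ b → (E a b 𝔹.≟ true) ×-dec overfull? (delE a b E)))
    ... | no minl = E , minimal-overfull⇒circ es o (λ { (a , b) Eab o' → minl (a , b , Eab , o') }) , (λ _ _ h → h)
    go zero E es le o | yes (a , b , Eab , o') = case subst (_≤ 0) (ecount-delE es Eab) le of λ ()
    go (suc k) E es le o | yes (a , b , Eab , o') with go k (delE a b E) (IsES-delE a b es)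
        (≤-pred (subst (_≤ suc k) (ecount-delE es Eab) le)) o'
    ... | C , c , sub = C , c , (λ i j h → delE-⊆ E a b i j (sub i j h))

-- If C₁ and C₂ are distinct circuits sharing an edge, |C₁ ∩ C₂| ≤ 2|V₁ ∩ V₂| − 2,
-- hence |C₁ ∪ C₂| ≥ 2|V₁ ∪ V₂| and one edge can be spared.
weak-elimination : ∀ {n} {C₁ C₂ : ES n} → IsCirc C₁ → IsCirc C₂ → ∀ {e} a b →
  C₁ a b ≡ true → C₂ a b ≡ true → C₁ ∋ e → C₂ ∌ e →
  ∃[ C ] (IsCirc C × C ⊆ᵉ delE a b (C₁ ∪ᵉ C₂))
weak-elimination {n} {C₁} {C₂} c₁ c₂ {e} a b h₁ h₂ e₁ e₂ =
  overfull⇒circ (IsES-delE a b esU) (V₁ ∪ᵛ V₂ , vcount-pos (V₁ ∪ᵛ V₂) a (∨-introˡ (ends-intro C₁ h₁)) , bound)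
  where
  V₁ V₂ : VS n
  V₁ = ends C₁
  V₂ = ends C₂
  esU : IsES (C₁ ∪ᵉ C₂)
  esU = IsES-∪ (circ-es c₁) (circ-es c₂)
  esI : IsES (C₁ ∩ᵉ C₂)
  esI = IsES-∩ (circ-es c₁) (circ-es c₂)
  Ie : (C₁ ∩ᵉ C₂) ∌ e
  Ie = trans (cong (C₁ (proj₁ e) (proj₂ e) ∧_) e₂) (𝔹.∧-zeroʳ _)
  inter : ecount (C₁ ∩ᵉ C₂) + 2 ≤ 2 * vcount (V₁ ∩ᵛ V₂)
  inter = subst (λ x → x + 2 ≤ 2 * vcount (V₁ ∩ᵛ V₂))
    (ind-all (C₁ ∩ᵉ C₂) (V₁ ∩ᵛ V₂) esI (λ i j h → ∧-intro (ends-intro C₁ (∧-fst h)) (ends-intro C₂ (∧-snd {C₁ i j} h))))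
    (¬overfull⇒sparse (C₁ ∩ᵉ C₂) (circ-proper-sparse c₁ esI (λ i j h → ∧-fst h) {e} e₁ Ie) (V₁ ∩ᵛ V₂)
      (vcount-pos (V₁ ∩ᵛ V₂) a (∧-intro (ends-intro C₁ h₁) (ends-intro C₂ h₂))))
  within : ∀ i j → delE a b (C₁ ∪ᵉ C₂) i j ≡ true → (V₁ ∪ᵛ V₂) i ≡ true
  within i j h with ∨-elim {C₁ i j} (∧-fst h)
  ... | inj₁ p = ∨-introˡ (ends-intro C₁ p)
  ... | inj₂ p = ∨-introʳ {V₁ i} (ends-intro C₂ p)
  bound : 2 * vcount (V₁ ∪ᵛ V₂) ≤ ind (delE a b (C₁ ∪ᵉ C₂)) (V₁ ∪ᵛ V₂) + 1
  bound = subst (λ x → 2 * vcount (V₁ ∪ᵛ V₂) ≤ x + 1) (sym (ind-all (delE a b (C₁ ∪ᵉ C₂)) (V₁ ∪ᵛ V₂) (IsES-delE a b esU) within))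
    (linear 9 (λ vu vi v1 v2 eu ei e1 e2 d → ei ⊕ κ 2 ≼ 2 ⊗ vi ⇒ vu ⊕ vi ≐ v1 ⊕ v2 ⇒ eu ⊕ ei ≐ e1 ⊕ e2 ⇒
        e1 ⊕ κ 1 ≐ 2 ⊗ v1 ⇒ e2 ⊕ κ 1 ≐ 2 ⊗ v2 ⇒ eu ≐ κ 1 ⊕ d ⇒ ⊢ 2 ⊗ vu ≼ d ⊕ κ 1)
      (vcount (V₁ ∪ᵛ V₂)) (vcount (V₁ ∩ᵛ V₂)) (vcount V₁) (vcount V₂)
      (ecount (C₁ ∪ᵉ C₂)) (ecount (C₁ ∩ᵉ C₂)) (ecount C₁) (ecount C₂) (ecount (delE a b (C₁ ∪ᵉ C₂)))
      inter (vcount-∪∩ V₁ V₂) (ecount-∪∩ C₁ C₂) (circ-count c₁) (circ-count c₂)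
      (ecount-delE esU (∨-introˡ h₁)))

circ-not-within : ∀ {n} {C A : ES n} → IsCirc C → IsCirc A → ∀ {e} → C ∋ e → A ∌ e → ∃[ f ] (A ∋ f × C ∌ f)
circ-not-within {C = C} {A} c a {e} Ce Ae with ⊆ᵉ⊎witness A C
... | inj₁ sub = ⊥-elim (circ-proper-sparse c (circ-es a) sub {e} Ce Ae (circ-overfull a))
... | inj₂ w = w

-- Induction on the size of the union. Weak elimination of `h` gives `C₃`; if it misses `e`, choose
-- `f` in `C₃` outside `C₁`, hence in `C₂`. The union of `C₂` and `C₃` misses `e`, so by induction
-- `f` can be eliminated there while keeping `h`; the result `C₄` misses `f`. Now `C₁ ∪ᵉ C₄` misses
-- `f`, and `h` can be eliminated there while keeping `e`.
strong-elim-bounded : ∀ {n} k {C₁ C₂ : ES n} → IsCirc C₁ → IsCirc C₂ → ecount (C₁ ∪ᵉ C₂) ≤ k → ∀ {h e} →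
  C₁ ∋ h → C₂ ∋ h → C₁ ∋ e → C₂ ∌ e → ∃[ C ] (IsCirc C × C ⊆ᵉ (C₁ ∪ᵉ C₂) × C ∌ h × C ∋ e)
strong-elim-bounded zero {C₁} {C₂} c₁ c₂ le {h} h₁ h₂ e₁ e₂ =
  case ≤-trans (ecount-pos (IsES-∪ (circ-es c₁) (circ-es c₂)) {proj₁ h} {proj₂ h} (∨-introˡ h₁)) le of λ ()
strong-elim-bounded (suc k) {C₁} {C₂} c₁ c₂ le {ha , hb} {e} h₁ h₂ e₁ e₂
  with weak-elimination c₁ c₂ {e} ha hb h₁ h₂ e₁ e₂
... | C₃ , c₃ , sub₃ with true⊎false (C₃ (proj₁ e) (proj₂ e))
...   | inj₁ e₃ = C₃ , c₃ , (λ i j x → delE-⊆ (C₁ ∪ᵉ C₂) ha hb i j (sub₃ i j x)) , C₃h , e₃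
  where
  C₃h : C₃ ha hb ≡ false
  C₃h = ≢true⇒false (λ x → true≢false (sub₃ ha hb x) (delE-self (C₁ ∪ᵉ C₂) ha hb))
...   | inj₂ e₃ = C₅ , c₅ , C₅⊆ , C₅h , C₅e
  where
  C₃h : C₃ ha hb ≡ false
  C₃h = ≢true⇒false (λ x → true≢false (sub₃ ha hb x) (delE-self (C₁ ∪ᵉ C₂) ha hb))
  sub₃' : C₃ ⊆ᵉ (C₁ ∪ᵉ C₂)
  sub₃' i j x = delE-⊆ (C₁ ∪ᵉ C₂) ha hb i j (sub₃ i j x)
  fw = circ-not-within c₁ c₃ {ha , hb} h₁ C₃h
  f = proj₁ fw
  f₃ : C₃ ∋ f
  f₃ = proj₁ (proj₂ fw)
  f₁ : C₁ ∌ f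
  f₁ = proj₂ (proj₂ fw)
  f₂ : C₂ ∋ f
  f₂ = ∨-elimˡ (sub₃' (proj₁ f) (proj₂ f) f₃) f₁
  smaller₁ : ecount (C₂ ∪ᵉ C₃) ≤ k
  smaller₁ = ≤-pred (≤-trans (ecount-strict {A = C₂ ∪ᵉ C₃} {C₁ ∪ᵉ C₂} (IsES-∪ (circ-es c₂) (circ-es c₃)) (IsES-∪ (circ-es c₁) (circ-es c₂))
    (λ i j x → case ∨-elim {C₂ i j} x of λ { (inj₁ y) → ∨-introʳ {C₁ i j} y ; (inj₂ y) → sub₃' i j y })
    {proj₁ e} {proj₂ e} (cong₂ _∨_ e₂ e₃) (∨-introˡ e₁)) le)
  r₄ = strong-elim-bounded k c₂ c₃ smaller₁ {f} {ha , hb} f₂ f₃ h₂ C₃h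
  C₄ = proj₁ r₄
  c₄ = proj₁ (proj₂ r₄)
  C₄⊆ : C₄ ⊆ᵉ (C₂ ∪ᵉ C₃)
  C₄⊆ = proj₁ (proj₂ (proj₂ r₄))
  C₄f : C₄ ∌ f
  C₄f = proj₁ (proj₂ (proj₂ (proj₂ r₄)))
  C₄h : C₄ ha hb ≡ true
  C₄h = proj₂ (proj₂ (proj₂ (proj₂ r₄)))
  C₄e : C₄ ∌ e
  C₄e = ≢true⇒false (λ x → true≢false (C₄⊆ (proj₁ e) (proj₂ e) x) (cong₂ _∨_ e₂ e₃))
  C₁₄⊆ : (C₁ ∪ᵉ C₄) ⊆ᵉ (C₁ ∪ᵉ C₂)
  C₁₄⊆ i j x = case ∨-elim {C₁ i j} x of λ
    { (inj₁ y) → ∨-introˡ y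
    ; (inj₂ y) → case ∨-elim {C₂ i j} (C₄⊆ i j y) of λ { (inj₁ z) → ∨-introʳ {C₁ i j} z ; (inj₂ z) → sub₃' i j z } }
  smaller₂ : ecount (C₁ ∪ᵉ C₄) ≤ k
  smaller₂ = ≤-pred (≤-trans (ecount-strict {A = C₁ ∪ᵉ C₄} {C₁ ∪ᵉ C₂} (IsES-∪ (circ-es c₁) (circ-es c₄)) (IsES-∪ (circ-es c₁) (circ-es c₂))
    C₁₄⊆ {proj₁ f} {proj₂ f} (cong₂ _∨_ f₁ C₄f) (∨-introʳ {C₁ (proj₁ f) (proj₂ f)} f₂)) le)
  r₅ = strong-elim-bounded k c₁ c₄ smaller₂ {ha , hb} {e} h₁ C₄h e₁ C₄e
  C₅ = proj₁ r₅
  c₅ = proj₁ (proj₂ r₅)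
  C₅⊆ : C₅ ⊆ᵉ (C₁ ∪ᵉ C₂)
  C₅⊆ i j x = C₁₄⊆ i j (proj₁ (proj₂ (proj₂ r₅)) i j x)
  C₅h : C₅ ha hb ≡ false
  C₅h = proj₁ (proj₂ (proj₂ (proj₂ r₅)))
  C₅e : C₅ ∋ e
  C₅e = proj₂ (proj₂ (proj₂ (proj₂ r₅)))

abstract
  strong-elimination : ∀ {n} {C₁ C₂ : ES n} → IsCirc C₁ → IsCirc C₂ → ∀ {h e} →
    C₁ ∋ h → C₂ ∋ h → C₁ ∋ e → C₂ ∌ e →
    ∃[ C ] (IsCirc C × C ⊆ᵉ (C₁ ∪ᵉ C₂) × C ∌ h × C ∋ e)
  strong-elimination {n} {C₁} {C₂} c₁ c₂ = strong-elim-bounded (ecount (C₁ ∪ᵉ C₂)) c₁ c₂ ≤-refl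

-- Edges in a common circuit

Linked : ∀ {n} → ES n → Edge n → Edge n → Set
Linked E e f = ∃[ C ] (IsCirc C × C ⊆ᵉ E × C ∋ e × C ∋ f)

Connected : ∀ {n} → ES n → Set
Connected E = ∀ e f → E ∋ e → E ∋ f → Linked E e f

linked-sym : ∀ {n} {E : ES n} {e f} → Linked E e f → Linked E f e
linked-sym (C , c , s , p , q) = C , c , s , q , p

linked-mono : ∀ {n} {E E' : ES n} {e f} → E ⊆ᵉ E' → Linked E e f → Linked E' e f
linked-mono h (C , c , s , p , q) = C , c , (λ i j x → h i j (s i j x)) , p , q

-- Induction on the size of the union. `C₃` and `C₄` arise by eliminating `h` while keeping `e` and
-- `g` respectively. If `C₃ ∪ᵉ C₂` is smaller, `C₃` replaces `C₁`. Otherwise `C₃` contains all of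
-- `C₁` outside `C₂`, where `C₄` also has an edge; so `C₃` and `C₄` share an edge, and their union
-- is smaller because both avoid `h`.
merge-bounded : ∀ {n} k {C₁ C₂ : ES n} → IsCirc C₁ → IsCirc C₂ → ecount (C₁ ∪ᵉ C₂) ≤ k → ∀ {e h g} →
  C₁ ∋ e → C₁ ∋ h → C₂ ∋ h → C₂ ∋ g → Linked (C₁ ∪ᵉ C₂) e g
merge-bounded zero {C₁} {C₂} c₁ c₂ le {e} e₁ h₁ h₂ g₂ =
  case ≤-trans (ecount-pos (IsES-∪ (circ-es c₁) (circ-es c₂)) {proj₁ e} {proj₂ e} (∨-introˡ e₁)) le of λ ()
merge-bounded (suc k) {C₁} {C₂} c₁ c₂ le {e} {h} {g} e₁ h₁ h₂ g₂
  with true⊎false (C₂ (proj₁ e) (proj₂ e)) | true⊎false (C₁ (proj₁ g) (proj₂ g))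
... | inj₁ e₂ | _ = C₂ , c₂ , (λ i j x → ∨-introʳ {C₁ i j} x) , e₂ , g₂
... | inj₂ _ | inj₁ g₁ = C₁ , c₁ , (λ i j x → ∨-introˡ x) , e₁ , g₁
... | inj₂ e₂ | inj₂ g₁
  with strong-elimination c₁ c₂ {h} {e} h₁ h₂ e₁ e₂ | strong-elimination c₂ c₁ {h} {g} h₂ h₁ g₂ g₁
...   | C₃ , c₃ , s₃ , h₃ , e₃ | C₄ , c₄ , s₄ , h₄ , g₄
  with ⊆ᵉ⊎witness (C₁ ∪ᵉ C₂) (C₃ ∪ᵉ C₂)
...     | inj₂ (m , m∈ , m∉) = linked-mono sub (merge-bounded k c₃ c₂ smaller {e} {f} {g} e₃ f₃ f₂ g₂)
  where
  fw = circ-not-within c₁ c₃ {h} h₁ h₃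
  f = proj₁ fw
  f₃ : C₃ ∋ f
  f₃ = proj₁ (proj₂ fw)
  f₂ : C₂ ∋ f
  f₂ = ∨-elimˡ (s₃ (proj₁ f) (proj₂ f) f₃) (proj₂ (proj₂ fw))
  sub : (C₃ ∪ᵉ C₂) ⊆ᵉ (C₁ ∪ᵉ C₂)
  sub i j x = case ∨-elim {C₃ i j} x of λ { (inj₁ y) → s₃ i j y ; (inj₂ y) → ∨-introʳ {C₁ i j} y }
  smaller : ecount (C₃ ∪ᵉ C₂) ≤ k
  smaller = ≤-pred (≤-trans (ecount-strict {A = C₃ ∪ᵉ C₂} {C₁ ∪ᵉ C₂} (IsES-∪ (circ-es c₃) (circ-es c₂)) (IsES-∪ (circ-es c₁) (circ-es c₂))
    sub {proj₁ m} {proj₂ m} m∉ m∈) le)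
...     | inj₁ all = linked-mono sub (merge-bounded k c₃ c₄ smaller {e} {f} {g} e₃ f₃ f₄ g₄)
  where
  fw = circ-not-within c₂ c₄ {h} h₂ h₄
  f = proj₁ fw
  f₄ : C₄ ∋ f
  f₄ = proj₁ (proj₂ fw)
  f₁ : C₁ ∋ f
  f₁ = ∨-elimˡ (s₄ (proj₁ f) (proj₂ f) f₄) (proj₂ (proj₂ fw))
  f₃ : C₃ ∋ f
  f₃ = case ∨-elim {C₃ (proj₁ f) (proj₂ f)} (all (proj₁ f) (proj₂ f) (∨-introˡ f₁)) of λ
    { (inj₁ x) → x ; (inj₂ x) → ⊥-elim (true≢false x (proj₂ (proj₂ fw))) }
  sub : (C₃ ∪ᵉ C₄) ⊆ᵉ (C₁ ∪ᵉ C₂)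
  sub i j x = case ∨-elim {C₃ i j} x of λ
    { (inj₁ y) → s₃ i j y
    ; (inj₂ y) → case ∨-elim {C₂ i j} (s₄ i j y) of λ { (inj₁ z) → ∨-introʳ {C₁ i j} z ; (inj₂ z) → ∨-introˡ z } }
  smaller : ecount (C₃ ∪ᵉ C₄) ≤ k
  smaller = ≤-pred (≤-trans (ecount-strict {A = C₃ ∪ᵉ C₄} {C₁ ∪ᵉ C₂} (IsES-∪ (circ-es c₃) (circ-es c₄)) (IsES-∪ (circ-es c₁) (circ-es c₂))
    sub {proj₁ h} {proj₂ h} (cong₂ _∨_ h₃ h₄) (∨-introˡ h₁)) le)

abstract
  circuits-merge : ∀ {n} {C₁ C₂ : ES n} → IsCirc C₁ → IsCirc C₂ → ∀ {e h g} →
    C₁ ∋ e → C₁ ∋ h → C₂ ∋ h → C₂ ∋ g → Linked (C₁ ∪ᵉ C₂) e g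
  circuits-merge {n} {C₁} {C₂} c₁ c₂ = merge-bounded (ecount (C₁ ∪ᵉ C₂)) c₁ c₂ ≤-refl

linked-trans : ∀ {n} {E : ES n} {e f g} → Linked E e f → Linked E f g → Linked E e g
linked-trans {e = e} {f} {g} (C₁ , c₁ , s₁ , e₁ , f₁) (C₂ , c₂ , s₂ , f₂ , g₂) =
  linked-mono (λ i j x → case ∨-elim {C₁ i j} x of λ { (inj₁ y) → s₁ i j y ; (inj₂ y) → s₂ i j y })
    (circuits-merge c₁ c₂ {e} {f} {g} e₁ f₁ f₂ g₂)

circ-ecount≥3 : ∀ {n} {C : ES n} → IsCirc C → ∀ {i j} → C i j ≡ true → 3 ≤ ecount C
circ-ecount≥3 {C = C} c {i} {j} h = linear 2 (λ e v → e ⊕ κ 1 ≐ 2 ⊗ v ⇒ κ 2 ≼ v ⇒ ⊢ κ 3 ≼ e)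
  (ecount C) (vcount (ends C)) (circ-count c)
  (vcount≥2 (ends C) (ES-≢ (circ-es c) h) (ends-intro C h) (ends-intro C (ES-sym (circ-es c) h)))

-- Agreement with the given notions of circuit and independence

circ⇒Circuit22 : ∀ {n} {C : ES n} → IsCirc C → Circuit22 (ends C) C
circ⇒Circuit22 {n} {C} c = (circ-es c , ends-within C) , circ-count c , proper
  where
  proper : ∀ W' E' → IsProperSubgraph W' E' (ends C) C → NonEmpty E' → ecount E' + 2 ≤ 2 * vcount W'
  proper W' E' (((es' , within) , _ , E'⊆C) , ¬all) (i , j , e') with ⊆ᵛ⊎witness (ends C) W' | ⊆ᵉ⊎witness C E'
  ... | inj₁ p | inj₁ q = ⊥-elim (¬all (p , q))
  ... | inj₂ (v , cv , wv) | _ = ≤-trans (+-monoˡ-≤ 2 (≤-trans (≤-reflexive (sym (ind-all E' W' es' within)))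
        (ind-mono {A = E'} {C} {W'} {W'} E'⊆C (λ _ x → x))))
      (circ-sparse c W' (vcount-pos W' i (within i j e')) (λ sub → true≢false (sub v cv) wv))
  ... | _ | inj₂ (f , Cf , E'f) = subst (λ x → x + 2 ≤ 2 * vcount W') (ind-all E' W' es' within)
      (¬overfull⇒sparse E' (circ-proper-sparse c es' E'⊆C {f} Cf E'f) W' (vcount-pos W' i (within i j e')))

independent⇒¬overfull : ∀ {n} {F : ES n} → IsES F → Independent F → ¬ Overfull F
independent⇒¬overfull {F = F} es (inj₁ empty) (S , p , q) =
  linear 2 (λ s i → κ 1 ≼ s ⇒ 2 ⊗ s ≼ i ⊕ κ 1 ⇒ i ≐ κ 0 ⇒ ⊢⊥) (vcount S) (ind F S) p q
    (ecount-∅ {A = induce F S} (λ i j _ → cong (_∧ (S i ∧ S j)) (empty i j)))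
independent⇒¬overfull {n} {F} es (inj₂ sparse) (S , p , q) =
  linear 3 (λ s t i → i ⊕ κ 2 ≼ 2 ⊗ t ⇒ t ≼ s ⇒ 2 ⊗ s ≼ i ⊕ κ 1 ⇒ ⊢⊥) (vcount S) (vcount (ends F ∩ᵛ S)) (ind F S)
    -- Independence bounds only subgraphs of the graph on `ends F`, so the vertices of `S` that `F`
    -- does not cover are dropped.
    (sparse (ends F ∩ᵛ S) (induce F S)
      ((IsES-induce S es , (λ i j h → case induce-elim F S h of λ { (x , y , z) → ∧-intro (ends-intro F x) y })) ,
       (λ v h → ∧-fst h) , (λ i j h → ∧-fst h))
      (ecount>0 (induce F S) (linear 2 (λ s i → κ 1 ≼ s ⇒ 2 ⊗ s ≼ i ⊕ κ 1 ⇒ ⊢ κ 1 ≼ i) (vcount S) (ind F S) p q)))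
    (vcount-mono (λ v h → ∧-snd {ends F v} h)) q

¬overfull⇒independent : ∀ {n} {F : ES n} → ¬ Overfull F → Independent F
¬overfull⇒independent {F = F} h = inj₂ λ { W' E' ((es' , within) , _ , E'⊆F) (i , j , e') →
  ≤-trans (+-monoˡ-≤ 2 (≤-trans (≤-reflexive (sym (ind-all E' W' es' within))) (ind-mono {A = E'} {F} {W'} {W'} E'⊆F (λ _ x → x))))
    (¬overfull⇒sparse F h W' (vcount-pos W' i (within i j e'))) }

MCircuit⇒circ : ∀ {n} {E C : ES n} → MCircuit E C → IsCirc C
MCircuit⇒circ {C = C} (es , _ , dep , minl) with overfull? C
... | no ¬o = ⊥-elim (dep (¬overfull⇒independent ¬o))
... | yes o = minimal-overfull⇒circ es o λ { (a , b) Cab → independent⇒¬overfull (IsES-delE a b es)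
      (minl (delE a b C) (IsES-delE a b es) (delE-⊆ C a b) (λ sub → true≢false (sub a b Cab) (delE-self C a b))) }

circ⇒MCircuit : ∀ {n} {E C : ES n} → IsCirc C → C ⊆ᵉ E → MCircuit E C
circ⇒MCircuit {C = C} c C⊆E = circ-es c , C⊆E ,
  (λ ind → independent⇒¬overfull (circ-es c) ind (circ-overfull c)) ,
  λ C' es' sub ¬sup → case ⊆ᵉ⊎witness C C' of λ
    { (inj₁ sup) → ⊥-elim (¬sup sup)
    ; (inj₂ (f , Cf , C'f)) → ¬overfull⇒independent (circ-proper-sparse c es' sub {f} Cf C'f) }

-- Attaching vertices to a connected graph

_ᶜ : ∀ {n} → VS n → VS n
(Y ᶜ) v = not (Y v)

connected-ext : ∀ {n} {A B : ES n} → A ⊆ᵉ B → B ⊆ᵉ A → Connected A → Connected B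
connected-ext A⊆B B⊆A conn e f Be Bf =
  linked-mono A⊆B (conn e f (B⊆A (proj₁ e) (proj₂ e) Be) (B⊆A (proj₁ f) (proj₂ f) Bf))

-- The basis has the largest possible number 2|U| − 2 of edges.
record Base {n} (D : ES n) (U : VS n) : Set where
  field
    base-es     : IsES D
    connected   : Connected D
    basis       : ES n
    basis-es    : IsES basis
    basis⊆      : basis ⊆ᵉ D
    basis-indep : ¬ Overfull basis
    basis-count : 2 * vcount U ≤ ecount basis + 2

-- `U` stands for the vertices of the rigid part. The field `attached` excludes a single outer
-- vertex `x`: there the `2|Y| + 1` edges on `Y` and `x` would be a circuit of their own.
record Attached {n} (E : ES n) (U Y : VS n) : Set where
  field
    es       : IsES E
    covered  : ∀ i j → E i j ≡ true → (U ∪ᵛ Y) i ≡ true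
    disjoint : ∀ v → U v ≡ true → Y v ≡ false
    nonempty : 1 ≤ vcount Y
    full     : inc E Y ≡ 2 * vcount Y + 1
    lower    : ∀ S → S ⊆ᵛ Y → 1 ≤ vcount S → 2 * vcount S + 1 ≤ inc E S
    upper    : ∀ S → S ⊆ᵛ Y → 1 ≤ vcount S → ind E S + 2 ≤ 2 * vcount S
    attached : ∃[ x ] ∃[ x' ] ∃[ w ] ∃[ w' ] (x ≢ x' × Y x ≡ false × Y x' ≡ false ×
                 Y w ≡ true × Y w' ≡ true × E w x ≡ true × E w' x' ≡ true)

split-touch : ∀ {n} (A : ES n) (Y : VS n) → ecount A ≡ inc A Y + ind A (Y ᶜ)
split-touch A Y = ecount₁≡₂ {A = A} {touch A Y} {induce A (Y ᶜ)} (λ i j _ → aux (A i j) (Y i) (Y j))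
  where
  aux : ∀ e s t → ⟦ e ⟧ ≡ ⟦ e ∧ (s ∨ t) ⟧ + ⟦ e ∧ (not s ∧ not t) ⟧
  aux = cases (∀𝔹? λ e → ∀𝔹? λ s → ∀𝔹? λ t → _ ℕ.≟ _)

touch⊎induce : ∀ {n} (A : ES n) (Y : VS n) {i j} → A i j ≡ true → touch A Y i j ≡ true ⊎ induce A (Y ᶜ) i j ≡ true
touch⊎induce A Y {i} {j} h with true⊎false (Y i) | true⊎false (Y j)
... | inj₁ p | _      = inj₁ (touch-introˡ A Y h p)
... | inj₂ _ | inj₁ q = inj₁ (touch-introʳ A Y h q)
... | inj₂ p | inj₂ q = inj₂ (induce-intro A (Y ᶜ) h (not-true p) (not-true q))

module _ {n} {E : ES n} {U Y : VS n} (att : Attached E U Y) where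
  open Attached att

  -- A circuit using an edge at Y uses all of them: the edges at Y form a circuit
  -- of the contraction by everything outside Y.
  circ-touching : ∀ {Q} → IsCirc Q → Q ⊆ᵉ E → NonEmpty (touch Q Y) →
    touch E Y ⊆ᵉ Q × Y ⊆ᵛ ends Q
  circ-touching {Q} c Q⊆E (i₀ , j₀ , t₀) = touch⊆Q , Y⊆ends
    where
    V R K I : VS n
    V = ends Q
    R = Y ∖ᵛ V
    K = V ∖ᵛ Y
    I = V ∩ᵛ Y
    y₀ : ∃[ v ] (V v ≡ true × Y v ≡ true)
    y₀ with touch-elim Q Y t₀
    ... | q , inj₁ h = i₀ , ends-intro Q q , h
    ... | q , inj₂ h = j₀ , ends-intro Q (ES-sym (circ-es c) q) , h
    -- Edges at `R` are not in `Q`, whose endpoints all lie in `V`.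
    missing : inc Q Y + inc E R ≤ inc E Y
    missing = subst (inc Q Y + inc E R ≤_) (+-identityʳ _) (subst (λ x → inc Q Y + inc E R ≤ inc E Y + x)
        (ecount-∅ {A = λ (_ _ : Fin n) → false} (λ _ _ _ → refl))
        (ecount₂≤₂ {A = touch Q Y} {touch E R} {touch E Y} {λ _ _ → false} pointwise))
      where
      aux : ∀ e y y' v v' → ⟦ e ∧ ((y ∧ not v) ∨ (y' ∧ not v')) ⟧ ≤ ⟦ e ∧ (y ∨ y') ⟧ + 0
      aux = cases (∀𝔹? λ e → ∀𝔹? λ y → ∀𝔹? λ y' → ∀𝔹? λ v → ∀𝔹? λ v' → _ ≤? _)
      aux' : ∀ y y' → ⟦ y ∨ y' ⟧ + ⟦ (y ∧ false) ∨ (y' ∧ false) ⟧ ≤ ⟦ y ∨ y' ⟧ + 0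
      aux' = cases (∀𝔹? λ y → ∀𝔹? λ y' → _ ≤? _)
      pointwise : ∀ i j → i ≢ j → ⟦ touch Q Y i j ⟧ + ⟦ touch E R i j ⟧ ≤ ⟦ touch E Y i j ⟧ + 0
      pointwise i j _ with Q i j in eq
      ... | false = aux (E i j) (Y i) (Y j) (V i) (V j)
      ... | true rewrite Q⊆E i j eq | ends-intro Q eq | ends-intro Q (ES-sym (circ-es c) eq) = aux' (Y i) (Y j)
    indK : ind Q (Y ᶜ) ≡ ind Q K
    indK = ecount-cong {A = induce Q (Y ᶜ)} {induce Q K}
      (λ i j h → case induce-elim Q (Y ᶜ) h of λ { (q , a , b) →
        induce-intro Q K q (∧-intro (ends-intro Q q) a) (∧-intro (ends-intro Q (ES-sym (circ-es c) q)) b) })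
      (λ i j h → case induce-elim Q K h of λ { (q , a , b) → induce-intro Q (Y ᶜ) q (∧-snd {V i} a) (∧-snd {V j} b) })
    -- Otherwise `Q` would lie inside `Y`, with `2|V| − 1` edges against the bound `upper`.
    K-pos : 1 ≤ vcount K
    K-pos = ≮⇒≥ λ lt →
      let K∅ = vcount≡0 K (n<1⇒n≡0 lt)
          V⊆Y : V ⊆ᵛ Y
          V⊆Y v h = ≢false⇒true (λ Yv → true≢false (∧-intro h (not-true Yv)) (K∅ v))
      in linear 3 (λ q i v → q ≼ i ⇒ i ⊕ κ 2 ≼ 2 ⊗ v ⇒ q ⊕ κ 1 ≐ 2 ⊗ v ⇒ ⊢⊥) (ecount Q) (ind E V) (vcount V)
        (≤-trans (≤-reflexive (sym (ind-all Q V (circ-es c) (ends-within Q)))) (ind-mono {A = Q} {E} {V} {V} Q⊆E (λ _ x → x)))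
        (upper V V⊆Y (circ-ends-pos c)) (circ-count c)
    sparseK : ind Q K + 2 ≤ 2 * vcount K
    sparseK = circ-sparse c K K-pos (λ sub → case y₀ of λ { (v , Vv , Yv) →
      true≢false Yv (not-true⁻ (∧-snd {V v} (sub v Vv))) })
    -- `K` is a proper part of `V`, so at least `2|V| − 1 − (2|K| − 2)` edges of `Q` are at `Y`. If
    -- `R` were nonempty, its own `2|R| + 1` edges would exceed the total `2|Y| + 1`.
    many : 2 * vcount I + 1 ≤ inc Q Y
    many = linear 7 (λ q iQ iK k v i iC → q ≐ iQ ⊕ iC ⇒ iC ≐ iK ⇒ iK ⊕ κ 2 ≼ 2 ⊗ k ⇒ q ⊕ κ 1 ≐ 2 ⊗ v ⇒ k ⊕ i ≐ v ⇒ ⊢ 2 ⊗ i ⊕ κ 1 ≼ iQ)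
      (ecount Q) (inc Q Y) (ind Q K) (vcount K) (vcount V) (vcount I) (ind Q (Y ᶜ))
      (split-touch Q Y) indK sparseK (circ-count c) (vcount-∖∩ V Y)
    I≡ : vcount R + vcount I ≡ vcount Y
    I≡ = trans (cong (vcount R +_) (vcount-cong {A = I} {Y ∩ᵛ V}
      (λ v h → ∧-intro (∧-snd {V v} h) (∧-fst h)) (λ v h → ∧-intro (∧-snd {Y v} h) (∧-fst h)))) (vcount-∖∩ Y V)
    R∅ : vcount R ≡ 0
    R∅ = n<1⇒n≡0 (≰⇒> λ R-pos → linear 6 (λ iQ iR iY r i y → iQ ⊕ iR ≼ iY ⇒ iY ≐ 2 ⊗ y ⊕ κ 1 ⇒ r ⊕ i ≐ y ⇒
        2 ⊗ i ⊕ κ 1 ≼ iQ ⇒ 2 ⊗ r ⊕ κ 1 ≼ iR ⇒ ⊢⊥)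
      (inc Q Y) (inc E R) (inc E Y) (vcount R) (vcount I) (vcount Y)
      missing full I≡ many (lower R (λ v h → ∧-fst h) R-pos))
    Y⊆ends : Y ⊆ᵛ ends Q
    Y⊆ends v Yv = ≢false⇒true (λ Vv → true≢false (∧-intro Yv (not-true Vv)) (vcount≡0 R R∅ v))
    touch⊆Q : touch E Y ⊆ᵉ Q
    touch⊆Q i j h = ∧-fst (⊆ᵉ-by-count {A = touch Q Y} {touch E Y} (IsES-touch Y (circ-es c)) (IsES-touch Y es)
      (λ i j h → ∧-intro (Q⊆E i j (∧-fst h)) (∧-snd {Q i j} h))
      (linear 5 (λ iQ iY r i y → iY ≐ 2 ⊗ y ⊕ κ 1 ⇒ r ⊕ i ≐ y ⇒ r ≐ κ 0 ⇒ 2 ⊗ i ⊕ κ 1 ≼ iQ ⇒ ⊢ iY ≼ iQ)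
        (inc Q Y) (inc E Y) (vcount R) (vcount I) (vcount Y) full I≡ R∅ many) i j h)

  -- The edges at `Y` take up exactly `2|Y| + 1` edges of `Q`, which leaves a tight count on its
  -- outer vertices.
  circ-touching-ecount : ∀ {Q} → IsCirc Q → Q ⊆ᵉ E → touch E Y ⊆ᵉ Q → Y ⊆ᵛ ends Q →
    ind Q (Y ᶜ) + 2 ≡ 2 * vcount (ends Q ∖ᵛ Y)
  circ-touching-ecount {Q} c Q⊆E tQ YQ = linear 7
    (λ q iQ iC v k i y → q ≐ iQ ⊕ iC ⇒ q ⊕ κ 1 ≐ 2 ⊗ v ⇒ k ⊕ i ≐ v ⇒ i ≐ y ⇒ iQ ≐ 2 ⊗ y ⊕ κ 1 ⇒ ⊢ iC ⊕ κ 2 ≐ 2 ⊗ k)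
    (ecount Q) (inc Q Y) (ind Q (Y ᶜ)) (vcount (ends Q)) (vcount (ends Q ∖ᵛ Y)) (vcount (ends Q ∩ᵛ Y)) (vcount Y)
    (split-touch Q Y) (circ-count c) (vcount-∖∩ (ends Q) Y)
    (vcount-cong {A = ends Q ∩ᵛ Y} {Y} (λ v h → ∧-snd {ends Q v} h) (λ v h → ∧-intro (YQ v h) h))
    (trans (ecount-cong {A = touch Q Y} {touch E Y} (λ i j h → ∧-intro (Q⊆E i j (∧-fst h)) (∧-snd {Q i j} h))
      (λ i j h → ∧-intro (tQ i j h) (∧-snd {E i j} h))) full)

  -- Attachment puts two outer vertices into `Q`, and a tight count on two or more vertices is
  -- positive. The resulting outer edge is what links the edges at `Y` with the rest.
  circ-touching-meets : ∀ {Q} → IsCirc Q → Q ⊆ᵉ E → touch E Y ⊆ᵉ Q → Y ⊆ᵛ ends Q → NonEmpty (induce Q (Y ᶜ))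
  circ-touching-meets {Q} c Q⊆E tQ YQ with attached
  ... | x , x' , w , w' , x≢x' , Yx , Yx' , Yw , Yw' , Ewx , Ewx' = ecount>0 (induce Q (Y ᶜ))
    (linear 2 (λ i k → i ⊕ κ 2 ≐ 2 ⊗ k ⇒ κ 2 ≼ k ⇒ ⊢ κ 1 ≼ i) (ind Q (Y ᶜ)) (vcount (ends Q ∖ᵛ Y))
      (circ-touching-ecount c Q⊆E tQ YQ)
      (vcount≥2 (ends Q ∖ᵛ Y) x≢x' (outer Yx Yw Ewx) (outer Yx' Yw' Ewx')))
    where
    outer : ∀ {x w} → Y x ≡ false → Y w ≡ true → E w x ≡ true → (ends Q ∖ᵛ Y) x ≡ true
    outer {x} {w} Yx Yw Ewx = ∧-intro (ends-intro Q (ES-sym (circ-es c) (tQ w x (touch-introˡ E Y Ewx Yw)))) (not-true Yx)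

  -- The basis and the edges at `Y` together number at least `2|U| − 2 + 2|Y| + 1 = 2|U ∪ Y| − 1`,
  -- so they contain a circuit. As it is not inside the basis, it contains all edges at `Y` and an
  -- outer edge, through which every edge is linked to every other.
  attached-connected : Base (induce E (Y ᶜ)) U → Connected E
  attached-connected base = conn
    where
    open Base base
    F : ES n
    F = basis ∪ᵉ touch E Y
    F⊆E : F ⊆ᵉ E
    F⊆E i j h with ∨-elim {basis i j} h
    ... | inj₁ p = ∧-fst (basis⊆ i j p)
    ... | inj₂ p = ∧-fst p
    esF : IsES F
    esF = IsES-∪ basis-es (IsES-touch Y es)
    F-count : ecount F ≡ ecount basis + inc E Y
    F-count = ecount₁≡₂ {A = F} {basis} {touch E Y} (λ i j _ → aux (basis i j) (E i j) (Y i) (Y j) (λ p → case induce-elim E (Y ᶜ) (basis⊆ i j p) of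
        λ { (_ , a , b) → cong₂ _∨_ (not-true⁻ a) (not-true⁻ b) }))
      where
      aux : ∀ b e y y' → (b ≡ true → y ∨ y' ≡ false) → ⟦ b ∨ (e ∧ (y ∨ y')) ⟧ ≡ ⟦ b ⟧ + ⟦ e ∧ (y ∨ y') ⟧
      aux false e y y' h = refl
      aux true e y y' h rewrite h refl | 𝔹.∧-zeroʳ e = refl
    UY : vcount (U ∪ᵛ Y) ≡ vcount U + vcount Y
    UY = trans (sym (+-identityʳ _)) (trans (cong (vcount (U ∪ᵛ Y) +_) (sym (vcount-∅ (U ∩ᵛ Y)
      (λ v → ≢true⇒false (λ h → true≢false (∧-snd {U v} h) (disjoint v (∧-fst h))))))) (vcount-∪∩ U Y))
    overfull : Overfull F
    overfull = U ∪ᵛ Y ,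
      ≤-trans nonempty (vcount-mono {A = Y} {U ∪ᵛ Y} (λ v h → ∨-introʳ {U v} h)) ,
      linear 7 (λ uy iF eF b iY u y → uy ≐ u ⊕ y ⇒ iF ≐ eF ⇒ eF ≐ b ⊕ iY ⇒ iY ≐ 2 ⊗ y ⊕ κ 1 ⇒ 2 ⊗ u ≼ b ⊕ κ 2 ⇒ ⊢ 2 ⊗ uy ≼ iF ⊕ κ 1)
        (vcount (U ∪ᵛ Y)) (ind F (U ∪ᵛ Y)) (ecount F) (ecount basis) (inc E Y) (vcount U) (vcount Y)
        UY (ind-all F (U ∪ᵛ Y) esF (λ i j h → covered i j (F⊆E i j h))) F-count full basis-count
    to-all : ∀ {Q} → IsCirc Q → Q ⊆ᵉ E → touch E Y ⊆ᵉ Q → NonEmpty (induce Q (Y ᶜ)) → Connected E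
    to-all {Q} c Q⊆E tQ (u , v , h) e f Ee Ef = linked-trans {f = u , v} (to-g e Ee) (linked-sym (to-g f Ef))
      where
      Dg : induce E (Y ᶜ) u v ≡ true
      Dg = ∧-intro (Q⊆E u v (∧-fst h)) (∧-snd {Q u v} h)
      to-g : ∀ e → E ∋ e → Linked E e (u , v)
      to-g (i , j) Eij with touch⊎induce E Y Eij
      ... | inj₁ t = Q , c , Q⊆E , tQ i j t , ∧-fst h
      ... | inj₂ d = linked-mono (λ i j x → ∧-fst x) (connected (i , j) (u , v) d Dg)
    touches : ∀ {Q} → IsCirc Q → Q ⊆ᵉ F → NonEmpty (touch Q Y)
    touches {Q} c Q⊆F with ⊆ᵉ⊎witness Q basis
    ... | inj₁ sub = ⊥-elim (basis-indep (overfull-mono sub (circ-overfull c)))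
    ... | inj₂ ((i , j) , Qe , Be) = i , j , ∧-intro Qe (∧-snd {E i j} (∨-elimˡ (Q⊆F i j Qe) Be))
    conn : Connected E
    conn = case overfull⇒circ esF overfull of λ { (Q , c , Q⊆F) →
      let Q⊆E : Q ⊆ᵉ E
          Q⊆E i j h = F⊆E i j (Q⊆F i j h)
      in case circ-touching c Q⊆E (touches c Q⊆F) of λ { (tQ , YQ) →
        to-all c Q⊆E tQ (circ-touching-meets c Q⊆E tQ YQ) } }

-- A basis of full size becomes dependent when `ab` is added. The circuit that appears uses `ab`
-- and, having at least three edges, also an edge of `D`.
add-edge-connected : ∀ {n} {D : ES n} {U : VS n} → Base D U → (∀ i j → D i j ≡ true → U i ≡ true) →
  ∀ {a b} → a ≢ b → U a ≡ true → U b ≡ true → D a b ≡ false → Connected (addE a b D)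
add-edge-connected {n} {D} {U} base within {a} {b} a≢b Ua Ub Dab = conn
  where
  open Base base
  F : ES n
  F = addE a b basis
  esF : IsES F
  esF = IsES-addE a≢b basis-es
  Bab : basis a b ≡ false
  Bab = ≢true⇒false (λ h → true≢false (basis⊆ a b h) Dab)
  edge-within : ∀ i j → edge a b i j ≡ true → U i ≡ true
  edge-within i j h with edge-elim a b {i} {j} h
  ... | inj₁ (refl , _) = Ua
  ... | inj₂ (refl , _) = Ub
  F-within : ∀ i j → F i j ≡ true → U i ≡ true
  F-within i j h with ∨-elim {basis i j} h
  ... | inj₁ p = within i j (basis⊆ i j p)
  ... | inj₂ p = edge-within i j p
  F-count : ind F U ≡ ecount basis + 1
  F-count = trans (ind-addE basis-es U a≢b Bab)
    (cong₂ (λ x y → x + ⟦ y ⟧) (ind-all basis U basis-es (λ i j h → within i j (basis⊆ i j h))) (∧-intro Ua Ub))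
  overfull : Overfull F
  overfull = U , vcount-pos U a Ua ,
    linear 3 (λ u i b → i ≐ b ⊕ κ 1 ⇒ 2 ⊗ u ≼ b ⊕ κ 2 ⇒ ⊢ 2 ⊗ u ≼ i ⊕ κ 1) (vcount U) (ind F U) (ecount basis) F-count basis-count
  through : ∀ {Q} → IsCirc Q → Q ⊆ᵉ F → Q a b ≡ true
  through {Q} c Q⊆F with ⊆ᵉ⊎witness Q basis
  ... | inj₁ sub = ⊥-elim (basis-indep (overfull-mono sub (circ-overfull c)))
  ... | inj₂ ((i , j) , Qe , Be) with edge-elim a b {i} {j} (∨-elimˡ (Q⊆F i j Qe) Be)
  ...   | inj₁ (refl , refl) = Qe
  ...   | inj₂ (refl , refl) = ES-sym (circ-es c) Qe
  other : ∀ {Q} → IsCirc Q → Q ⊆ᵉ F → Q a b ≡ true → ∃[ g ] (Q ∋ g × D ∋ g)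
  other {Q} c Q⊆F Qab with ⊆ᵉ⊎witness Q (edge a b)
  ... | inj₁ sub = ⊥-elim (linear 2 (λ q e → κ 3 ≼ q ⇒ q ≼ e ⇒ e ≐ κ 1 ⇒ ⊢⊥) (ecount Q) (ecount (edge a b))
      (circ-ecount≥3 c Qab) (ecount-mono sub) (ecount-edge a≢b))
  ... | inj₂ ((i , j) , Qe , no-edge) with ∨-elim {basis i j} (Q⊆F i j Qe)
  ...   | inj₁ d = (i , j) , Qe , basis⊆ i j d
  ...   | inj₂ d = ⊥-elim (true≢false d no-edge)
  to-all : ∀ {Q} → IsCirc Q → Q ⊆ᵉ F → Q a b ≡ true → ∃[ g ] (Q ∋ g × D ∋ g) → Connected (addE a b D)
  to-all {Q} c Q⊆F Qab (g , Qg , Dg) e f Ee Ef = linked-trans {f = g} (to-g e Ee) (linked-sym (to-g f Ef))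
    where
    Q⊆ : Q ⊆ᵉ addE a b D
    Q⊆ i j h with ∨-elim {basis i j} (Q⊆F i j h)
    ... | inj₁ p = ∨-introˡ (basis⊆ i j p)
    ... | inj₂ p = ∨-introʳ {D i j} p
    to-g : ∀ e → addE a b D ∋ e → Linked (addE a b D) e g
    to-g (i , j) h with ∨-elim {D i j} h
    ... | inj₁ d = linked-mono (λ i j x → ∨-introˡ x) (connected (i , j) g d Dg)
    ... | inj₂ d with edge-elim a b {i} {j} d
    ...   | inj₁ (refl , refl) = Q , c , Q⊆ , Qab , Qg
    ...   | inj₂ (refl , refl) = Q , c , Q⊆ , ES-sym (circ-es c) Qab , Qg
  conn : Connected (addE a b D)
  conn = case overfull⇒circ esF overfull of λ { (Q , c , Q⊆F) →
    to-all c Q⊆F (through c Q⊆F) (other c Q⊆F (through c Q⊆F)) }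

module _ {n} {E : ES n} {U Y : VS n} (att : Attached E U Y) where
  open Attached att

  -- Q is L with the edge bc replaced by the edges at Y.
  reroute : ∀ {L b c} → IsCirc L → L ⊆ᵉ induce E (Y ᶜ) → L b c ≡ true →
    (∃[ w ] (Y w ≡ true × E w b ≡ true)) → (∃[ w ] (Y w ≡ true × E w c ≡ true)) →
    (∀ w x → Y w ≡ true → Y x ≡ false → E w x ≡ true → ends L x ≡ true) →
    ∃[ Q ] (IsCirc Q × Q ⊆ᵉ delE b c E × touch E Y ⊆ᵉ Q × delE b c L ⊆ᵉ Q)
  reroute {L} {b} {c} cL L⊆D Lbc (wb , Ywb , Ewb) (wc , Ywc , Ewc) nbrs = result
    where
    esL = circ-es cL
    Yb : Y b ≡ false
    Yb = not-true⁻ (proj₁ (proj₂ (induce-elim E (Y ᶜ) (L⊆D b c Lbc))))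
    Yc : Y c ≡ false
    Yc = not-true⁻ (proj₂ (proj₂ (induce-elim E (Y ᶜ) (L⊆D b c Lbc))))
    F : ES n
    F = delE b c L ∪ᵉ touch E Y
    esF : IsES F
    esF = IsES-∪ (IsES-delE b c esL) (IsES-touch Y es)
    S : VS n
    S = ends L ∪ᵛ Y
    F⊆ : F ⊆ᵉ delE b c E
    F⊆ i j h with ∨-elim {delE b c L i j} h
    ... | inj₁ p = ∧-intro (∧-fst (L⊆D i j (∧-fst p))) (∧-snd {L i j} p)
    ... | inj₂ p = ∧-intro (∧-fst p) (not-true (edge-false b c {i} {j} λ
        { (inj₁ (refl , refl)) → true≢false (∧-snd {E i j} p) (cong₂ _∨_ Yb Yc)
        ; (inj₂ (refl , refl)) → true≢false (∧-snd {E i j} p) (cong₂ _∨_ Yc Yb) }))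
    F-within : ∀ i j → F i j ≡ true → S i ≡ true
    F-within i j h with ∨-elim {delE b c L i j} h
    ... | inj₁ p = ∨-introˡ (ends-intro L (∧-fst p))
    ... | inj₂ p with true⊎false (Y i) | touch-elim E Y p
    ...   | inj₁ Yi | _ = ∨-introʳ {ends L i} Yi
    ...   | inj₂ Yi | _ , inj₁ Yi' = ∨-introʳ {ends L i} Yi'
    ...   | inj₂ Yi | Eij , inj₂ Yj = ∨-introˡ (nbrs j i Yj Yi (ES-sym es Eij))
    F-count : ecount F ≡ ecount (delE b c L) + inc E Y
    F-count = ecount₁≡₂ {A = F} {delE b c L} {touch E Y} (λ i j _ → aux (delE b c L i j) (E i j) (Y i) (Y j) (λ p → case induce-elim E (Y ᶜ) (L⊆D i j (∧-fst p)) of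
        λ { (_ , a , b) → cong₂ _∨_ (not-true⁻ a) (not-true⁻ b) }))
      where
      aux : ∀ b e y y' → (b ≡ true → y ∨ y' ≡ false) → ⟦ b ∨ (e ∧ (y ∨ y')) ⟧ ≡ ⟦ b ⟧ + ⟦ e ∧ (y ∨ y') ⟧
      aux false e y y' h = refl
      aux true e y y' h rewrite h refl | 𝔹.∧-zeroʳ e = refl
    L∩Y : vcount S ≡ vcount (ends L) + vcount Y
    L∩Y = trans (sym (+-identityʳ _)) (trans (cong (vcount S +_) (sym (vcount-∅ (ends L ∩ᵛ Y)
      (λ v → ≢true⇒false (λ h → case ends-elim L (∧-fst h) of λ { (w , Lvw) →
        true≢false (∧-snd {ends L v} h) (not-true⁻ (proj₁ (proj₂ (induce-elim E (Y ᶜ) (L⊆D v w Lvw))))) }))))) (vcount-∪∩ (ends L) Y))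
    overfull : Overfull F
    overfull = S , ≤-trans nonempty (vcount-mono {A = Y} {S} (λ v h → ∨-introʳ {ends L v} h)) ,
      linear 8 (λ s iF eF d iY l y eL → s ≐ l ⊕ y ⇒ iF ≐ eF ⇒ eF ≐ d ⊕ iY ⇒ iY ≐ 2 ⊗ y ⊕ κ 1 ⇒ eL ≐ κ 1 ⊕ d ⇒ eL ⊕ κ 1 ≐ 2 ⊗ l ⇒ ⊢ 2 ⊗ s ≼ iF ⊕ κ 1)
        (vcount S) (ind F S) (ecount F) (ecount (delE b c L)) (inc E Y) (vcount (ends L)) (vcount Y) (ecount L)
        L∩Y (ind-all F S esF F-within) F-count full (ecount-delE esL Lbc) (circ-count cL)
    touches : ∀ {Q} → IsCirc Q → Q ⊆ᵉ F → NonEmpty (touch Q Y)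
    touches {Q} cQ Q⊆F with ⊆ᵉ⊎witness Q (delE b c L)
    ... | inj₁ sub = ⊥-elim (circ-proper-sparse cL (IsES-delE b c esL) (delE-⊆ L b c) {b , c} Lbc (delE-self L b c)
        (overfull-mono sub (circ-overfull cQ)))
    ... | inj₂ ((i , j) , Qe , Be) = i , j , ∧-intro Qe (∧-snd {E i j} (∨-elimˡ (Q⊆F i j Qe) Be))
    keeps : ∀ {Q} → IsCirc Q → Q ⊆ᵉ F → touch E Y ⊆ᵉ Q → Y ⊆ᵛ ends Q → delE b c L ⊆ᵉ Q
    keeps {Q} cQ Q⊆F tQ YQ = L⊆Q
      where
      Q⊆E : Q ⊆ᵉ E
      Q⊆E i j h = ∧-fst (F⊆ i j (Q⊆F i j h))
      K : VS n
      K = ends Q ∖ᵛ Y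
      QD : ES n
      QD = induce Q (Y ᶜ)
      QD⊆L : QD ⊆ᵉ delE b c L
      QD⊆L i j h with induce-elim Q (Y ᶜ) h
      ... | q , a , a' with ∨-elim {delE b c L i j} (Q⊆F i j q)
      ...   | inj₁ p = p
      ...   | inj₂ p = ⊥-elim (true≢false (∧-snd {E i j} p) (cong₂ _∨_ (not-true⁻ a) (not-true⁻ a')))
      K-count : ind Q (Y ᶜ) + 2 ≡ 2 * vcount K
      K-count = circ-touching-ecount att cQ Q⊆E tQ YQ
      K-pos : 1 ≤ vcount K
      K-pos = linear 2 (λ i k → i ⊕ κ 2 ≐ 2 ⊗ k ⇒ ⊢ κ 1 ≼ k) (ind Q (Y ᶜ)) (vcount K) K-count
      -- If `K` missed a vertex of `L`, then `L` would span at most `2|K| − 2` edges on `K`. The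
      -- outer part of `Q` already supplies that many without `bc`, and `b` and `c` lie in `K`.
      L⊆K : ends L ⊆ᵛ K
      L⊆K with ⊆ᵛ⊎witness (ends L) K
      ... | inj₁ sub = sub
      ... | inj₂ (v , Lv , Kv) = ⊥-elim (linear 3 (λ q l k → κ 1 ⊕ q ≼ l ⇒ l ⊕ κ 2 ≼ 2 ⊗ k ⇒ q ⊕ κ 2 ≐ 2 ⊗ k ⇒ ⊢⊥)
          (ind Q (Y ᶜ)) (ind L K) (vcount K) strict (circ-sparse cL K K-pos (λ sub → true≢false (sub v Lv) Kv)) K-count)
        where
        K-nbr : ∀ {x} → Y x ≡ false → ∀ w → Y w ≡ true → E w x ≡ true → K x ≡ true
        K-nbr {x} Yx w Yw Ewx = ∧-intro (ends-intro Q (ES-sym (circ-es cQ) (tQ w x (touch-introˡ E Y Ewx Yw)))) (not-true Yx)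
        QD⊆LK : QD ⊆ᵉ induce L K
        QD⊆LK i j h with induce-elim Q (Y ᶜ) h
        ... | q , a , a' = induce-intro L K (∧-fst (QD⊆L i j h)) (∧-intro (ends-intro Q q) a) (∧-intro (ends-intro Q (ES-sym (circ-es cQ) q)) a')
        strict : suc (ind Q (Y ᶜ)) ≤ ind L K
        strict = ecount-strict {A = QD} {induce L K} (IsES-induce (Y ᶜ) (circ-es cQ)) (IsES-induce K esL) QD⊆LK {b} {c}
          (≢true⇒false (λ h → true≢false (QD⊆L b c h) (delE-self L b c)))
          (induce-intro L K Lbc (K-nbr Yb wb Ywb Ewb) (K-nbr Yc wc Ywc Ewc))
      L⊆Q : delE b c L ⊆ᵉ Q
      L⊆Q i j h = ∧-fst (⊆ᵉ-by-count {A = QD} {delE b c L} (IsES-induce (Y ᶜ) (circ-es cQ)) (IsES-delE b c esL) QD⊆L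
        (linear 5 (λ d l v k q → l ≐ κ 1 ⊕ d ⇒ l ⊕ κ 1 ≐ 2 ⊗ v ⇒ v ≼ k ⇒ q ⊕ κ 2 ≐ 2 ⊗ k ⇒ ⊢ d ≼ q)
          (ecount (delE b c L)) (ecount L) (vcount (ends L)) (vcount K) (ind Q (Y ᶜ))
          (ecount-delE esL Lbc) (circ-count cL) (vcount-mono L⊆K) K-count) i j h)
    result : ∃[ Q ] (IsCirc Q × Q ⊆ᵉ delE b c E × touch E Y ⊆ᵉ Q × delE b c L ⊆ᵉ Q)
    result = case overfull⇒circ esF overfull of λ { (Q , cQ , Q⊆F) →
      case circ-touching att cQ (λ i j h → ∧-fst (F⊆ i j (Q⊆F i j h))) (touches cQ Q⊆F) of λ { (tQ , YQ) →
        Q , cQ , (λ i j h → F⊆ i j (Q⊆F i j h)) , tQ , keeps cQ Q⊆F tQ YQ } }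

  -- The vertices `b`, `c`, `x` include all outer neighbours of `Y`. A circuit of the outer part
  -- through `bc` and an edge at `x` therefore covers them all, and can be rerouted through `Y` to a
  -- circuit `Q` avoiding `bc`. Every remaining edge is linked to `Q`.
  delete-edge-connected : Connected (induce E (Y ᶜ)) → ∀ {b c x} → induce E (Y ᶜ) b c ≡ true →
    (∃[ w ] (Y w ≡ true × E w b ≡ true)) → (∃[ w ] (Y w ≡ true × E w c ≡ true)) →
    (∃[ g ] (induce E (Y ᶜ) x g ≡ true)) →
    (∀ w z → Y w ≡ true → Y z ≡ false → E w z ≡ true → z ≡ b ⊎ z ≡ c ⊎ z ≡ x) →
    Connected (delE b c E)
  delete-edge-connected conn {b} {c} {x} Dbc nb-b@(w , Yw , Ewb) nb-c (g , Dxg) nbrs =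
    case conn (b , c) (x , g) Dbc Dxg of λ { (L₃ , c₃ , L₃⊆D , L₃bc , L₃xg) →
      case reroute c₃ L₃⊆D L₃bc nb-b nb-c (λ w z Yw Yz Ewz → case nbrs w z Yw Yz Ewz of λ
        { (inj₁ refl) → ends-intro L₃ L₃bc
        ; (inj₂ (inj₁ refl)) → ends-intro L₃ (ES-sym (circ-es c₃) L₃bc)
        ; (inj₂ (inj₂ refl)) → ends-intro L₃ L₃xg }) of λ { (Q , cQ , Q⊆ , tQ , L₃⊆Q) →
      λ e f Ee Ef → linked-trans {f = w , b} (to-p c₃ L₃⊆D L₃bc cQ Q⊆ tQ L₃⊆Q e Ee)
        (linked-sym (to-p c₃ L₃⊆D L₃bc cQ Q⊆ tQ L₃⊆Q f Ef)) } }
    where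
    D : ES n
    D = induce E (Y ᶜ)
    to-p : ∀ {L₃ Q} → IsCirc L₃ → L₃ ⊆ᵉ D → L₃ b c ≡ true → IsCirc Q → Q ⊆ᵉ delE b c E → touch E Y ⊆ᵉ Q → delE b c L₃ ⊆ᵉ Q →
      ∀ e → delE b c E ∋ e → Linked (delE b c E) e (w , b)
    to-p {L₃} {Q} c₃ L₃⊆D L₃bc cQ Q⊆ tQ L₃⊆Q (i , j) h = cases-of (touch⊎induce E Y (∧-fst h)) (true⊎false (L₃ i j))
      where
      Qp : Q w b ≡ true
      Qp = tQ w b (touch-introˡ E Y Ewb Yw)
      cases-of : touch E Y i j ≡ true ⊎ D i j ≡ true → L₃ i j ≡ true ⊎ L₃ i j ≡ false → Linked (delE b c E) (i , j) (w , b)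
      cases-of (inj₁ t) _ = Q , cQ , Q⊆ , tQ i j t , Qp
      cases-of (inj₂ d) (inj₁ l) = Q , cQ , Q⊆ , L₃⊆Q i j (∧-intro l (∧-snd {E i j} h)) , Qp
      -- Eliminating `bc` from `L` and `L₃` while keeping `ij` gives `M`. Since `M` is not contained
      -- in `L`, it shares with `L₃`, and hence with `Q`, an edge other than `bc`.
      cases-of (inj₂ d) (inj₂ l) = case conn (i , j) (b , c) d Dbc of λ { (L , cL , L⊆D , Lij , Lbc) →
        case strong-elimination cL c₃ {b , c} {i , j} Lbc L₃bc Lij l of λ { (M , cM , M⊆ , Mbc , Mij) →
        case circ-not-within cL cM {b , c} Lbc Mbc of λ { ((u , v) , Muv , Luv) →
          let avoid : ∀ i j → M i j ≡ true → not (edge b c i j) ≡ true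
              avoid i j m = not-true (edge-false b c {i} {j} λ
                { (inj₁ (refl , refl)) → true≢false m Mbc
                ; (inj₂ (refl , refl)) → true≢false (ES-sym (circ-es cM) m) Mbc })
              M⊆del : M ⊆ᵉ delE b c E
              M⊆del i j m = ∧-intro (case ∨-elim {L i j} (M⊆ i j m) of λ
                { (inj₁ y) → ∧-fst (L⊆D i j y) ; (inj₂ y) → ∧-fst (L₃⊆D i j y) }) (avoid i j m)
          in linked-trans {f = u , v} (M , cM , M⊆del , Mij , Muv)
            (Q , cQ , Q⊆ , L₃⊆Q u v (∧-intro (∨-elimˡ (M⊆ u v Muv) Luv) (avoid u v Muv)) , Qp) } } }

-- Counting neighbours; vertices of degree 3 and 4

∅⊆ : ∀ {n} {S : VS n} → ∅ᵛ ⊆ᵛ S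
∅⊆ v ()

ins-⊆ : ∀ {n} {S T : VS n} v → S ⊆ᵛ T → T v ≡ true → ins v S ⊆ᵛ T
ins-⊆ {S = S} v S⊆T Tv w h with ins-elim v S {w} h
... | inj₁ refl = Tv
... | inj₂ s    = S⊆T w s

vcount≥4 : ∀ {n} (S : VS n) {a b c d} → a ≢ b → a ≢ c → a ≢ d → b ≢ c → b ≢ d → c ≢ d →
  S a ≡ true → S b ≡ true → S c ≡ true → S d ≡ true → 4 ≤ vcount S
vcount≥4 S {a} ab ac ad bc bd cd Sa Sb Sc Sd = subst (4 ≤_) (sym (vcount-rem a S Sa))
  (s≤s (vcount≥3 (rem a S) bc bd cd (rem-intro a S (ab ∘ sym) Sb) (rem-intro a S (ac ∘ sym) Sc) (rem-intro a S (ad ∘ sym) Sd)))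

vcount≥5 : ∀ {n} (S : VS n) {a b c d e} → a ≢ b → a ≢ c → a ≢ d → a ≢ e → b ≢ c → b ≢ d → b ≢ e → c ≢ d → c ≢ e → d ≢ e →
  S a ≡ true → S b ≡ true → S c ≡ true → S d ≡ true → S e ≡ true → 5 ≤ vcount S
vcount≥5 S {a} ab ac ad ae bc bd be cd ce de Sa Sb Sc Sd Se = subst (5 ≤_) (sym (vcount-rem a S Sa))
  (s≤s (vcount≥4 (rem a S) bc bd be cd ce de (rem-intro a S (ab ∘ sym) Sb) (rem-intro a S (ac ∘ sym) Sc)
    (rem-intro a S (ad ∘ sym) Sd) (rem-intro a S (ae ∘ sym) Se)))

vcount≤1 : ∀ {n} (S : VS n) a → (∀ w → S w ≡ true → w ≡ a) → vcount S ≤ 1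
vcount≤1 S a h = ≤-trans (vcount-mono {A = S} {λ w → w == a} (λ w s → ==-true (h w s))) (≤-reflexive (vcount-single a))

nb≤vcount : ∀ {n} (E : ES n) v S → nb E v S ≤ vcount S
nb≤vcount E v S = vcount-mono {A = λ w → E v w ∧ S w} {S} (λ w h → ∧-snd {E v w} h)

nb-ins< : ∀ {n} (E : ES n) v S {x} → E v x ≡ true → S x ≡ false → suc (nb E v S) ≤ nb E v (ins x S)
nb-ins< E v S {x} Evx Sx = vcount-strict {A = λ w → E v w ∧ S w} {λ w → E v w ∧ ins x S w} x
  (λ w h → ∧-intro (∧-fst {E v w} h) (ins-old x S (∧-snd {E v w} h)))
  (trans (cong (E v x ∧_) Sx) (𝔹.∧-zeroʳ _)) (∧-intro Evx (ins-self x S))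

nb-out₁ : ∀ {n} (E : ES n) v S {x} → E v x ≡ true → S x ≡ false → 1 + nb E v S ≤ dg E v
nb-out₁ E v S {x} Evx Sx = ≤-trans (nb-ins< E v S Evx Sx) (nb≤dg E v (ins x S))

nb-out₂ : ∀ {n} (E : ES n) v S {x y} → x ≢ y → E v x ≡ true → S x ≡ false → E v y ≡ true → S y ≡ false →
  2 + nb E v S ≤ dg E v
nb-out₂ E v S {x} {y} x≢y Evx Sx Evy Sy = ≤-trans (s≤s (nb-ins< E v S Evx Sx))
  (nb-out₁ E v (ins x S) Evy (ins-not x S (x≢y ∘ sym) Sy))

nb-out₃ : ∀ {n} (E : ES n) v S {x y z} → x ≢ y → x ≢ z → y ≢ z → E v x ≡ true → S x ≡ false →
  E v y ≡ true → S y ≡ false → E v z ≡ true → S z ≡ false → 3 + nb E v S ≤ dg E v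
nb-out₃ E v S {x} x≢y x≢z y≢z Evx Sx Evy Sy Evz Sz = ≤-trans (s≤s (s≤s (nb-ins< E v S Evx Sx)))
  (nb-out₂ E v (ins x S) y≢z Evy (ins-not x S (x≢y ∘ sym) Sy) Evz (ins-not x S (x≢z ∘ sym) Sz))

nb-out₄ : ∀ {n} (E : ES n) v S {x y z t} → x ≢ y → x ≢ z → x ≢ t → y ≢ z → y ≢ t → z ≢ t →
  E v x ≡ true → S x ≡ false → E v y ≡ true → S y ≡ false → E v z ≡ true → S z ≡ false → E v t ≡ true → S t ≡ false →
  4 + nb E v S ≤ dg E v
nb-out₄ E v S {x} xy xz xt yz yt zt Evx Sx Evy Sy Evz Sz Evt St = ≤-trans (s≤s (s≤s (s≤s (nb-ins< E v S Evx Sx))))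
  (nb-out₃ E v (ins x S) yz yt zt Evy (ins-not x S (xy ∘ sym) Sy) Evz (ins-not x S (xz ∘ sym) Sz) Evt (ins-not x S (xt ∘ sym) St))

vcount-∅ᵛ : ∀ {n} → vcount {n} ∅ᵛ ≡ 0
vcount-∅ᵛ {n} = vcount-∅ {n} ∅ᵛ (λ _ → refl)

vcount-one : ∀ {n} (v : Fin n) → vcount (ins v ∅ᵛ) ≡ 1
vcount-one {n} v = trans (vcount-ins v ∅ᵛ refl) (cong suc (vcount-∅ᵛ {n}))

vcount-ins≤ : ∀ {n} (v : Fin n) (S : VS n) → vcount (ins v S) ≤ suc (vcount S)
vcount-ins≤ v S = ≤-trans (m≤m+n _ _) (≤-reflexive (trans (vcount-∪∩ (λ w → w == v) S) (cong (_+ vcount S) (vcount-single v))))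

-- The three neighbours of a vertex of degree 3 carry names, so that symmetric cases follow by
-- permuting them.
record Nbr3 {n} (E : ES n) (p a b c : Fin n) : Set where
  constructor nbr3
  field
    a≢b : a ≢ b
    a≢c : a ≢ c
    b≢c : b ≢ c
    pa : E p a ≡ true
    pb : E p b ≡ true
    pc : E p c ≡ true
    only : ∀ w → E p w ≡ true → w ≡ a ⊎ w ≡ b ⊎ w ≡ c

record Nbr4 {n} (E : ES n) (p a b c d : Fin n) : Set where
  constructor nbr4
  field
    a≢b : a ≢ b
    a≢c : a ≢ c
    a≢d : a ≢ d
    b≢c : b ≢ c
    b≢d : b ≢ d
    c≢d : c ≢ d
    pa : E p a ≡ true
    pb : E p b ≡ true
    pc : E p c ≡ true
    pd : E p d ≡ true
    only : ∀ w → E p w ≡ true → w ≡ a ⊎ w ≡ b ⊎ w ≡ c ⊎ w ≡ d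

module _ {n} {E : ES n} {p a b c : Fin n} where
  nbr-acb : Nbr3 E p a b c → Nbr3 E p a c b
  nbr-acb (nbr3 ab ac bc pa pb pc only) = nbr3 ac ab (bc ∘ sym) pa pc pb λ w h → case only w h of λ
    { (inj₁ e) → inj₁ e ; (inj₂ (inj₁ e)) → inj₂ (inj₂ e) ; (inj₂ (inj₂ e)) → inj₂ (inj₁ e) }

  nbr-bca : Nbr3 E p a b c → Nbr3 E p b c a
  nbr-bca (nbr3 ab ac bc pa pb pc only) = nbr3 bc (ab ∘ sym) (ac ∘ sym) pb pc pa λ w h → case only w h of λ
    { (inj₁ e) → inj₂ (inj₂ e) ; (inj₂ (inj₁ e)) → inj₁ e ; (inj₂ (inj₂ e)) → inj₂ (inj₁ e) }

nbr-cab : ∀ {n} {E : ES n} {p a b c} → Nbr3 E p a b c → Nbr3 E p c a b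
nbr-cab N = nbr-bca (nbr-bca N)

nbr-bac : ∀ {n} {E : ES n} {p a b c} → Nbr3 E p a b c → Nbr3 E p b a c
nbr-bac N = nbr-acb (nbr-bca N)

nbr3⇒dg : ∀ {n} {E : ES n} {p a b c} → Nbr3 E p a b c → dg E p ≡ 3
nbr3⇒dg {n} {E} {p} {a} {b} {c} (nbr3 a≢b a≢c b≢c pa pb pc only) = ≤-antisym
  (≤-trans (vcount-mono {A = E p} {ins a (ins b (ins c ∅ᵛ))} (λ w h → case only w h of λ
      { (inj₁ refl) → ins-self a (ins b (ins c ∅ᵛ))
      ; (inj₂ (inj₁ refl)) → ins-old a (ins b (ins c ∅ᵛ)) {w} (ins-self b (ins c ∅ᵛ))
      ; (inj₂ (inj₂ refl)) → ins-old a (ins b (ins c ∅ᵛ)) {w} (ins-old b (ins c ∅ᵛ) {w} (ins-self c ∅ᵛ)) }))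
    (≤-trans (vcount-ins≤ a (ins b (ins c ∅ᵛ))) (s≤s (≤-trans (vcount-ins≤ b (ins c ∅ᵛ)) (s≤s (≤-reflexive (vcount-one c)))))))
  (vcount≥3 (E p) a≢b a≢c b≢c pa pb pc)

nbr4⇒dg : ∀ {n} {E : ES n} {p a b c d} → Nbr4 E p a b c d → dg E p ≡ 4
nbr4⇒dg {n} {E} {p} {a} {b} {c} {d} (nbr4 a≢b a≢c a≢d b≢c b≢d c≢d pa pb pc pd only) = ≤-antisym
  (≤-trans (vcount-mono {A = E p} {ins a (ins b (ins c (ins d ∅ᵛ)))} (λ w h → case only w h of λ
      { (inj₁ refl) → ins-self a (ins b (ins c (ins d ∅ᵛ)))
      ; (inj₂ (inj₁ refl)) → ins-old a (ins b (ins c (ins d ∅ᵛ))) {w} (ins-self b (ins c (ins d ∅ᵛ)))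
      ; (inj₂ (inj₂ (inj₁ refl))) → ins-old a (ins b (ins c (ins d ∅ᵛ))) {w} (ins-old b (ins c (ins d ∅ᵛ)) {w} (ins-self c (ins d ∅ᵛ)))
      ; (inj₂ (inj₂ (inj₂ refl))) → ins-old a (ins b (ins c (ins d ∅ᵛ))) {w} (ins-old b (ins c (ins d ∅ᵛ)) {w} (ins-old c (ins d ∅ᵛ) {w} (ins-self d ∅ᵛ))) }))
    (≤-trans (vcount-ins≤ a (ins b (ins c (ins d ∅ᵛ)))) (s≤s (≤-trans (vcount-ins≤ b (ins c (ins d ∅ᵛ)))
      (s≤s (≤-trans (vcount-ins≤ c (ins d ∅ᵛ)) (s≤s (≤-reflexive (vcount-one d)))))))))
  (vcount≥4 (E p) a≢b a≢c a≢d b≢c b≢d c≢d pa pb pc pd)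

dg≡3⇒only : ∀ {n} {E : ES n} {p a b c} → dg E p ≡ 3 → a ≢ b → a ≢ c → b ≢ c →
  E p a ≡ true → E p b ≡ true → E p c ≡ true → Nbr3 E p a b c
dg≡3⇒only {n} {E} {p} {a} {b} {c} d ab ac bc pa pb pc = nbr3 ab ac bc pa pb pc only
  where
  only : ∀ w → E p w ≡ true → w ≡ a ⊎ w ≡ b ⊎ w ≡ c
  only w h with w ≟ a | w ≟ b | w ≟ c
  ... | yes e | _ | _ = inj₁ e
  ... | no _ | yes e | _ = inj₂ (inj₁ e)
  ... | no _ | no _ | yes e = inj₂ (inj₂ e)
  ... | no wa | no wb | no wc = ⊥-elim (<⇒≱ (subst (_< 4) (sym d) ≤-refl)
      (vcount≥4 (E p) ab ac (wa ∘ sym) bc (wb ∘ sym) (wc ∘ sym) pa pb pc h))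

dg≡4⇒only : ∀ {n} {E : ES n} {p a b c d} → dg E p ≡ 4 → a ≢ b → a ≢ c → a ≢ d → b ≢ c → b ≢ d → c ≢ d →
  E p a ≡ true → E p b ≡ true → E p c ≡ true → E p d ≡ true → Nbr4 E p a b c d
dg≡4⇒only {n} {E} {p} {a} {b} {c} {d} dg4 ab ac ad bc bd cd pa pb pc pd = nbr4 ab ac ad bc bd cd pa pb pc pd only
  where
  only : ∀ w → E p w ≡ true → w ≡ a ⊎ w ≡ b ⊎ w ≡ c ⊎ w ≡ d
  only w h with w ≟ a | w ≟ b | w ≟ c | w ≟ d
  ... | yes e | _ | _ | _ = inj₁ e
  ... | no _ | yes e | _ | _ = inj₂ (inj₁ e)
  ... | no _ | no _ | yes e | _ = inj₂ (inj₂ (inj₁ e))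
  ... | no _ | no _ | no _ | yes e = inj₂ (inj₂ (inj₂ e))
  ... | no wa | no wb | no wc | no wd = ⊥-elim (<⇒≱ (subst (_< 5) (sym dg4) ≤-refl)
      (vcount≥5 (E p) ab ac ad (wa ∘ sym) bc bd (wb ∘ sym) cd (wc ∘ sym) (wd ∘ sym) pa pb pc pd h))

third-nbr : ∀ {n} {E : ES n} {p a b} → dg E p ≡ 3 → a ≢ b → E p a ≡ true → E p b ≡ true → ∃[ c ] Nbr3 E p a b c
third-nbr {n} {E} {p} {a} {b} d a≢b pa pb with ⊆ᵛ⊎witness (E p) (ins a (ins b ∅ᵛ))
... | inj₁ sub = ⊥-elim (<⇒≱ (subst (2 <_) (sym d) ≤-refl) (≤-trans (vcount-mono sub)
    (≤-reflexive (trans (vcount-ins a (ins b ∅ᵛ) (ins-not b ∅ᵛ a≢b refl))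
      (cong suc (trans (vcount-ins b ∅ᵛ refl) (cong suc (vcount-∅ {n} ∅ᵛ (λ _ → refl)))))))))
... | inj₂ (c , pc , c∉) = c , dg≡3⇒only d a≢b
    (λ { refl → true≢false (ins-self a (ins b ∅ᵛ)) c∉ })
    (λ { refl → true≢false (ins-old a (ins b ∅ᵛ) {b} (ins-self b ∅ᵛ)) c∉ }) pa pb pc

two-nbrs : ∀ {n} {E : ES n} {p a} → dg E p ≡ 3 → E p a ≡ true → ∃[ b ] ∃[ c ] Nbr3 E p a b c
two-nbrs {n} {E} {p} {a} d pa with ⊆ᵛ⊎witness (E p) (ins a ∅ᵛ)
... | inj₁ sub = ⊥-elim (<⇒≱ (subst (1 <_) (sym d) (s≤s (s≤s z≤n))) (≤-trans (vcount-mono sub)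
    (≤-reflexive (trans (vcount-ins a ∅ᵛ refl) (cong suc (vcount-∅ {n} ∅ᵛ (λ _ → refl)))))))
... | inj₂ (b , pb , b∉) = b , third-nbr d (λ { refl → true≢false (ins-self a ∅ᵛ) b∉ }) pa pb

three-nbrs : ∀ {n} {E : ES n} {p} → dg E p ≡ 3 → ∃[ a ] ∃[ b ] ∃[ c ] Nbr3 E p a b c
three-nbrs {n} {E} {p} d with vcount>0 (E p) (subst (1 ≤_) (sym d) (s≤s z≤n))
... | a , pa = a , two-nbrs d pa

sum-if≥ : ∀ {n} k (S : VS n) (f : Fin n → ℕ) → (∀ v → S v ≡ true → k ≤ f v) →
  k * vcount S ≤ sumFin (λ v → if S v then f v else 0)
sum-if≥ k S f h = subst (_≤ sumFin (λ v → if S v then f v else 0)) (sum-* k (λ v → ⟦ S v ⟧)) (sum-mono (λ v → aux v))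
  where
  aux : ∀ v → k * ⟦ S v ⟧ ≤ (if S v then f v else 0)
  aux v with S v in eq
  ... | true  = subst (_≤ f v) (sym (*-identityʳ k)) (h v eq)
  ... | false = ≤-reflexive (*-zeroʳ k)

sum-if≤ : ∀ {n} k (S : VS n) (f : Fin n → ℕ) → (∀ v → S v ≡ true → f v ≤ k) →
  sumFin (λ v → if S v then f v else 0) ≤ k * vcount S
sum-if≤ k S f h = subst (sumFin (λ v → if S v then f v else 0) ≤_) (sum-* k (λ v → ⟦ S v ⟧)) (sum-mono (λ v → aux v))
  where
  aux : ∀ v → (if S v then f v else 0) ≤ k * ⟦ S v ⟧
  aux v with S v in eq
  ... | true  = subst (f v ≤_) (sym (*-identityʳ k)) (h v eq)
  ... | false = z≤n

sum-if-split : ∀ {n} (S T : VS n) (f : Fin n → ℕ) → S ⊆ᵛ T →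
  sumFin (λ v → if T v then f v else 0) ≡ sumFin (λ v → if S v then f v else 0) + sumFin (λ v → if (T ∖ᵛ S) v then f v else 0)
sum-if-split S T f S⊆T = trans (sum-cong aux) (sum-+ (λ v → if S v then f v else 0) (λ v → if (T ∖ᵛ S) v then f v else 0))
  where
  aux : ∀ v → (if T v then f v else 0) ≡ (if S v then f v else 0) + (if (T ∖ᵛ S) v then f v else 0)
  aux v with T v in eqT | S v in eqS
  ... | true  | true  = sym (+-identityʳ _)
  ... | true  | false = refl
  ... | false | true  = ⊥-elim (true≢false (S⊆T v eqS) eqT)
  ... | false | false = refl

-- Reducible configurations

-- `upper⁺` is sparsity of the last ear on new vertices together with one outer vertex. In
-- `no-3-cut`, a critical set that is also tight would be left by `(2|S| + 1) − (2|S| − 2) = 3`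
-- edges.
record Ear {n} (E : ES n) (Y : VS n) : Set where
  field
    es       : IsES E
    nonempty : 1 ≤ vcount Y
    full     : inc E Y ≡ 2 * vcount Y + 1
    lower    : ∀ S → S ⊆ᵛ Y → 1 ≤ vcount S → 2 * vcount S + 1 ≤ inc E S
    upper    : ∀ S → S ⊆ᵛ Y → 1 ≤ vcount S → ind E S + 2 ≤ 2 * vcount S
    upper⁺   : ∀ S x → S ⊆ᵛ Y → 1 ≤ vcount S → Y x ≡ false → ind E (ins x S) ≤ 2 * vcount S
    no-3-cut : ∀ S → S ⊆ᵛ Y → 2 ≤ vcount S → inc E S ≡ 2 * vcount S + 1 → ind E S + 3 ≤ 2 * vcount S

Critical Tight : ∀ {n} → ES n → VS n → VS n → Set
Critical E Y S = S ⊆ᵛ Y × inc E S ≡ 2 * vcount S + 1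
Tight    E Y S = S ⊆ᵛ Y × ind E S + 2 ≡ 2 * vcount S

-- Deleting the degree-3 vertex p and adding ab is obstructed by a critical set which
-- loses the edge pc, or by a tight set which gains the edge ab.
Unblocked : ∀ {n} → ES n → VS n → (p a b c : Fin n) → Set
Unblocked E Y p a b c =
  ¬ (∃[ S ] (Critical E Y S × S p ≡ true × S c ≡ true × S a ≡ false × S b ≡ false)) ×
  ¬ (∃[ S ] (Tight E Y S × S a ≡ true × S b ≡ true × S p ≡ false × S c ≡ false))

-- The condition on c ensures that the reduced ear is still attached at two vertices.
Reducible₁ Reducible₂ Reducible₃ Reducible₄ : ∀ {n} → ES n → VS n → (p a b c : Fin n) → Set
Reducible₁ E Y p a b c = Y p ≡ true × Y a ≡ true × Nbr3 E p a b c × E a b ≡ false × Unblocked E Y p a b c ×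
  (Y c ≡ true ⊎ E a c ≡ true ⊎ (Y b ≡ false × ∃[ w ] ∃[ z ] (w ≢ p × z ≢ b × Y w ≡ true × Y z ≡ false × E w z ≡ true)))
-- A K₄⁻-reduction that deletes `p` and `a` and adds `bc`; no blocking set can occur.
Reducible₂ E Y p a b c = Y p ≡ true × Y a ≡ true × Y b ≡ true × Nbr3 E p a b c × Nbr3 E a p b c × E b c ≡ false
-- Here and in `Reducible₄` the whole ear is removed, or, if the edge to be added is present, that
-- edge is deleted.
Reducible₃ E Y p a b c = Y p ≡ true × (∀ w → Y w ≡ true → w ≡ p) × Nbr3 E p a b c
Reducible₄ E Y p a b c = Y p ≡ true × Y a ≡ true × (∀ w → Y w ≡ true → w ≡ p ⊎ w ≡ a) × Nbr3 E p a b c × Nbr3 E a p b c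

-- `bd` is contracted and `bc` dropped. The configuration arises when a critical set is just the
-- triangle `p`, `a`, `b`, with degrees 3, 3, 4.
Reducible₅ : ∀ {n} → ES n → VS n → (p a b c d : Fin n) → Set
Reducible₅ E Y p a b c d = Y p ≡ true × Y a ≡ true × Y b ≡ true × Nbr3 E p a b c × Nbr3 E a p b c ×
  E b c ≡ true × Nbr4 E b p a c d

Reducible : ∀ {n} → ES n → VS n → Set
Reducible E Y = ∃[ p ] ∃[ a ] ∃[ b ] ∃[ c ] (Reducible₁ E Y p a b c ⊎ Reducible₂ E Y p a b c ⊎
  Reducible₃ E Y p a b c ⊎ Reducible₄ E Y p a b c ⊎ ∃[ d ] Reducible₅ E Y p a b c d)

-- Calculus of critical and tight sets

module EarFacts {n} {E : ES n} {Y : VS n} (ear : Ear E Y) where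
  open Ear ear

  Crit Tgt : VS n → Set
  Crit = Critical E Y
  Tgt  = Tight E Y

  inc-∅ : inc E ∅ᵛ ≡ 0
  inc-∅ = ecount-∅ {A = touch E ∅ᵛ} (λ i j _ → 𝔹.∧-zeroʳ (E i j))

  ind-∅ : ind E ∅ᵛ ≡ 0
  ind-∅ = ecount-∅ {A = induce E ∅ᵛ} (λ i j _ → 𝔹.∧-zeroʳ (E i j))

  nb-∅ : ∀ v → nb E v ∅ᵛ ≡ 0
  nb-∅ v = vcount-∅ (λ w → E v w ∧ false) (λ w → 𝔹.∧-zeroʳ (E v w))

  inc-one : ∀ v → inc E (ins v ∅ᵛ) ≡ dg E v
  inc-one v = linear 4 (λ i n i0 d → i ⊕ n ≐ i0 ⊕ d ⇒ n ≐ κ 0 ⇒ i0 ≐ κ 0 ⇒ ⊢ i ≐ d)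
    (inc E (ins v ∅ᵛ)) (nb E v ∅ᵛ) (inc E ∅ᵛ) (dg E v) (inc-ins es v ∅ᵛ refl) (nb-∅ v) inc-∅

  ind-one : ∀ v → ind E (ins v ∅ᵛ) ≡ 0
  ind-one v = trans (ind-ins es v ∅ᵛ refl) (cong₂ _+_ ind-∅ (nb-∅ v))

  dg≥3 : ∀ {v} → Y v ≡ true → 3 ≤ dg E v
  dg≥3 {v} Yv = linear 3 (λ s i d → s ≐ κ 1 ⇒ i ≐ d ⇒ 2 ⊗ s ⊕ κ 1 ≼ i ⇒ ⊢ κ 3 ≼ d)
    (vcount (ins v ∅ᵛ)) (inc E (ins v ∅ᵛ)) (dg E v) (vcount-one v) (inc-one v)
    (lower (ins v ∅ᵛ) (ins-⊆ v ∅⊆ Yv) (≤-reflexive (sym (vcount-one v))))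

  node⊎big : ∀ {v} → Y v ≡ true → dg E v ≡ 3 ⊎ 4 ≤ dg E v
  node⊎big {v} Yv with 4 ≤? dg E v
  ... | yes p = inj₂ p
  ... | no ¬p = inj₁ (≤-antisym (≤-pred (≰⇒> ¬p)) (dg≥3 Yv))

  bound : ∀ S x → S ⊆ᵛ Y → 1 ≤ vcount S → S x ≡ false → ind E (ins x S) ≤ 2 * vcount S
  bound S x S⊆Y pos Sx with true⊎false (Y x)
  ... | inj₂ Yx = upper⁺ S x S⊆Y pos Yx
  ... | inj₁ Yx = linear 3 (λ i s s' → i ⊕ κ 2 ≼ 2 ⊗ s' ⇒ s' ≐ κ 1 ⊕ s ⇒ ⊢ i ≼ 2 ⊗ s) (ind E (ins x S)) (vcount S) (vcount (ins x S))
      (upper (ins x S) (ins-⊆ x S⊆Y Yx) (vcount-pos (ins x S) x (ins-self x S))) (vcount-ins x S Sx)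

  -- The excess `inc S − 2|S| − 1` is nonnegative on nonempty subsets of `Y` and, for sets that
  -- meet, submodular. So it vanishes on the intersection, and in `no-cross` an edge between the
  -- differences would make the inequality strict.
  crit-∩ : ∀ {S T v} → Crit S → Crit T → S v ≡ true → T v ≡ true → Crit (S ∩ᵛ T)
  crit-∩ {S} {T} {v} (S⊆Y , cS) (T⊆Y , cT) Sv Tv = sub , ≤-antisym
      (linear 8 (λ iu ii is it u i s t → iu ⊕ ii ≼ is ⊕ it ⇒ u ⊕ i ≐ s ⊕ t ⇒ is ≐ 2 ⊗ s ⊕ κ 1 ⇒ it ≐ 2 ⊗ t ⊕ κ 1 ⇒
          2 ⊗ u ⊕ κ 1 ≼ iu ⇒ ⊢ ii ≼ 2 ⊗ i ⊕ κ 1)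
        (inc E (S ∪ᵛ T)) (inc E (S ∩ᵛ T)) (inc E S) (inc E T) (vcount (S ∪ᵛ T)) (vcount (S ∩ᵛ T)) (vcount S) (vcount T)
        (inc-submod≤ E S T) (vcount-∪∩ S T) cS cT
        (lower (S ∪ᵛ T) (λ w h → case ∨-elim {S w} h of λ { (inj₁ p) → S⊆Y w p ; (inj₂ p) → T⊆Y w p })
          (vcount-pos (S ∪ᵛ T) v (∨-introˡ Sv))))
      (lower (S ∩ᵛ T) sub (vcount-pos (S ∩ᵛ T) v (∧-intro Sv Tv)))
    where
    sub : (S ∩ᵛ T) ⊆ᵛ Y
    sub w h = S⊆Y w (∧-fst h)

  no-cross : ∀ {S T v a c} → Crit S → Crit T → S v ≡ true → T v ≡ true →
    S a ≡ true → T a ≡ false → T c ≡ true → S c ≡ false → E a c ≡ false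
  no-cross {S} {T} {v} {a} {c} (S⊆Y , cS) (T⊆Y , cT) Sv Tv Sa Ta Tc Sc = ≢true⇒false λ Eac →
    linear 8 (λ iu ii is it u i s t → κ 1 ⊕ (iu ⊕ ii) ≼ is ⊕ it ⇒ u ⊕ i ≐ s ⊕ t ⇒ is ≐ 2 ⊗ s ⊕ κ 1 ⇒ it ≐ 2 ⊗ t ⊕ κ 1 ⇒
          2 ⊗ u ⊕ κ 1 ≼ iu ⇒ 2 ⊗ i ⊕ κ 1 ≼ ii ⇒ ⊢⊥)
        (inc E (S ∪ᵛ T)) (inc E (S ∩ᵛ T)) (inc E S) (inc E T) (vcount (S ∪ᵛ T)) (vcount (S ∩ᵛ T)) (vcount S) (vcount T)
        (inc-submod< es S T Sa Ta Tc Sc Eac) (vcount-∪∩ S T) cS cT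
        (lower (S ∪ᵛ T) (λ w h → case ∨-elim {S w} h of λ { (inj₁ p) → S⊆Y w p ; (inj₂ p) → T⊆Y w p })
          (vcount-pos (S ∪ᵛ T) v (∨-introˡ Sv)))
        (lower (S ∩ᵛ T) (λ w h → S⊆Y w (∧-fst h)) (vcount-pos (S ∩ᵛ T) v (∧-intro Sv Tv)))

  -- The dual argument with the supermodular count; the common vertex makes `upper` available for
  -- the intersection.
  tight-∪ : ∀ {S T v} → Tgt S → Tgt T → S v ≡ true → T v ≡ true → Tgt (S ∪ᵛ T)
  tight-∪ {S} {T} {v} (S⊆Y , tS) (T⊆Y , tT) Sv Tv = sub , ≤-antisym
      (upper (S ∪ᵛ T) sub (vcount-pos (S ∪ᵛ T) v (∨-introˡ Sv)))
      (linear 8 (λ iu ii is it u i s t → is ⊕ it ≼ iu ⊕ ii ⇒ u ⊕ i ≐ s ⊕ t ⇒ is ⊕ κ 2 ≐ 2 ⊗ s ⇒ it ⊕ κ 2 ≐ 2 ⊗ t ⇒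
          ii ⊕ κ 2 ≼ 2 ⊗ i ⇒ ⊢ 2 ⊗ u ≼ iu ⊕ κ 2)
        (ind E (S ∪ᵛ T)) (ind E (S ∩ᵛ T)) (ind E S) (ind E T) (vcount (S ∪ᵛ T)) (vcount (S ∩ᵛ T)) (vcount S) (vcount T)
        (ind-supermod E S T) (vcount-∪∩ S T) tS tT
        (upper (S ∩ᵛ T) (λ w h → S⊆Y w (∧-fst h)) (vcount-pos (S ∩ᵛ T) v (∧-intro Sv Tv))))
    where
    sub : (S ∪ᵛ T) ⊆ᵛ Y
    sub w h = case ∨-elim {S w} h of λ { (inj₁ p) → S⊆Y w p ; (inj₂ p) → T⊆Y w p }

  -- `Z ∖ᵛ W` spans at most `2|Z ∖ᵛ W| − 2` edges, so tightness of `Z` forces `W` to lose at least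
  -- `2|W ∩ᵛ Z|` edges when `Z` is removed from it. The witnesses `b` and `z` keep both differences
  -- nonempty.
  uncross : ∀ {W Z b z} → Crit W → Tgt Z → W b ≡ true → Z b ≡ false → Z z ≡ true → W z ≡ false → Crit (W ∖ᵛ Z)
  uncross {W} {Z} {b} {z} (W⊆Y , cW) (Z⊆Y , tZ) Wb Zb Zz Wz = sub , ≤-antisym
      (linear 9 (λ iwz iz iw izw w z' wz zw m → iwz ⊕ iz ≼ iw ⊕ izw ⇒ iz ⊕ κ 2 ≐ 2 ⊗ z' ⇒ iw ≐ 2 ⊗ w ⊕ κ 1 ⇒ izw ⊕ κ 2 ≼ 2 ⊗ zw ⇒
          wz ⊕ m ≐ w ⇒ zw ⊕ m ≐ z' ⇒ ⊢ iwz ≼ 2 ⊗ wz ⊕ κ 1)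
        (inc E (W ∖ᵛ Z)) (ind E Z) (inc E W) (ind E (Z ∖ᵛ W)) (vcount W) (vcount Z) (vcount (W ∖ᵛ Z)) (vcount (Z ∖ᵛ W)) (vcount (W ∩ᵛ Z))
        (inc-ind-uncross E W Z) tZ cW
        (upper (Z ∖ᵛ W) (λ v h → Z⊆Y v (∧-fst h)) (vcount-pos (Z ∖ᵛ W) z (∧-intro Zz (not-true Wz))))
        (vcount-∖∩ W Z)
        (trans (cong (vcount (Z ∖ᵛ W) +_) (vcount-cong {A = W ∩ᵛ Z} {Z ∩ᵛ W}
          (λ v h → ∧-intro (∧-snd {W v} h) (∧-fst h)) (λ v h → ∧-intro (∧-snd {Z v} h) (∧-fst h)))) (vcount-∖∩ Z W)))
      (lower (W ∖ᵛ Z) sub (vcount-pos (W ∖ᵛ Z) b (∧-intro Wb (not-true Zb))))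
    where
    sub : (W ∖ᵛ Z) ⊆ᵛ Y
    sub v h = W⊆Y v (∧-fst h)

  nb₁ : ∀ v S {a} → E v a ≡ true → S a ≡ true → 1 ≤ nb E v S
  nb₁ v S {a} e s = vcount-pos (λ w → E v w ∧ S w) a (∧-intro e s)

  nb₂ : ∀ v S {a b} → a ≢ b → E v a ≡ true → S a ≡ true → E v b ≡ true → S b ≡ true → 2 ≤ nb E v S
  nb₂ v S ab ea sa eb sb = vcount≥2 (λ w → E v w ∧ S w) ab (∧-intro ea sa) (∧-intro eb sb)

  nb₃ : ∀ v S {a b c} → a ≢ b → a ≢ c → b ≢ c → E v a ≡ true → S a ≡ true → E v b ≡ true → S b ≡ true →
    E v c ≡ true → S c ≡ true → 3 ≤ nb E v S
  nb₃ v S ab ac bc ea sa eb sb ec sc =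
    vcount≥3 (λ w → E v w ∧ S w) ab ac bc (∧-intro ea sa) (∧-intro eb sb) (∧-intro ec sc)

  -- The bound on `Z` drops by two when `a` is removed, so at least two edges must go with it.
  tight-dg : ∀ {Z a x} → Tgt Z → Z a ≡ true → Z x ≡ true → x ≢ a → 2 ≤ nb E a Z
  tight-dg {Z} {a} {x} (Z⊆Y , tZ) Za Zx x≢a = linear 6 (λ i i' nr nz z z' → i ⊕ κ 2 ≐ 2 ⊗ z ⇒ i ≐ i' ⊕ nr ⇒ nr ≐ nz ⇒ z ≐ κ 1 ⊕ z' ⇒
      i' ⊕ κ 2 ≼ 2 ⊗ z' ⇒ ⊢ κ 2 ≼ nz)
    (ind E Z) (ind E (rem a Z)) (nb E a (rem a Z)) (nb E a Z) (vcount Z) (vcount (rem a Z))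
    tZ (ind-rem es a Z Za) (nb-rem es a Z) (vcount-rem a Z Za)
    (upper (rem a Z) (λ v h → Z⊆Y v (rem-⊆ a Z v h)) (vcount-pos (rem a Z) x (rem-intro a Z x≢a Zx)))

  tight-ins : ∀ {Z p} → Tgt Z → Y p ≡ true → Z p ≡ false → 1 ≤ vcount Z → 2 ≤ nb E p Z → Tgt (ins p Z)
  tight-ins {Z} {p} (Z⊆Y , tZ) Yp Zp pos two = sub , ≤-antisym
      (upper (ins p Z) sub (vcount-pos (ins p Z) p (ins-self p Z)))
      (linear 5 (λ i i' z z' k → i ⊕ κ 2 ≐ 2 ⊗ z ⇒ i' ≐ i ⊕ k ⇒ κ 2 ≼ k ⇒ z' ≐ κ 1 ⊕ z ⇒ ⊢ 2 ⊗ z' ≼ i' ⊕ κ 2)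
        (ind E Z) (ind E (ins p Z)) (vcount Z) (vcount (ins p Z)) (nb E p Z) tZ (ind-ins es p Z Zp) two (vcount-ins p Z Zp))
    where
    sub : ins p Z ⊆ᵛ Y
    sub = ins-⊆ p Z⊆Y Yp

  -- Three more edges on one more vertex would exceed the sparsity bound.
  tight-nb≤2 : ∀ {Z p} → Tgt Z → Z p ≡ false → 1 ≤ vcount Z → 3 ≤ nb E p Z → ⊥
  tight-nb≤2 {Z} {p} (Z⊆Y , tZ) Zp pos three =
    linear 4 (λ i i' z k → i ⊕ κ 2 ≐ 2 ⊗ z ⇒ i' ≐ i ⊕ k ⇒ κ 3 ≼ k ⇒ i' ≼ 2 ⊗ z ⇒ ⊢⊥)
      (ind E Z) (ind E (ins p Z)) (vcount Z) (nb E p Z) tZ (ind-ins es p Z Zp) three (bound Z p Z⊆Y pos Zp)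

  -- Tight obstructions to two of the reductions at `p` share a neighbour of `p`; their union is
  -- tight and would contain all three neighbours.
  two-tight : ∀ {Z₁ Z₂ p a b c} → Nbr3 E p a b c → Tgt Z₁ → Tgt Z₂ → Z₁ a ≡ true → Z₁ b ≡ true → Z₂ a ≡ true → Z₂ c ≡ true →
    Z₁ p ≡ false → Z₂ p ≡ false → ⊥
  two-tight {Z₁} {Z₂} {p} {a} {b} {c} N t₁ t₂ a₁ b₁ a₂ c₂ p₁ p₂ =
    tight-nb≤2 (tight-∪ t₁ t₂ a₁ a₂) (cong₂ _∨_ p₁ p₂) (vcount-pos (Z₁ ∪ᵛ Z₂) a (∨-introˡ a₁))
      (nb₃ p (Z₁ ∪ᵛ Z₂) a≢b a≢c b≢c pa (∨-introˡ a₁) pb (∨-introˡ b₁) pc (∨-introʳ {Z₁ c} c₂))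
    where open Nbr3 N

  -- `p` can be absorbed into `Z` because of `a` and `b`; then `x` has the three neighbours `a`,
  -- `b`, `p` in a tight set.
  tight-wheel : ∀ {Z p a b x} → Tgt Z → Y p ≡ true → Z p ≡ false → Z x ≡ false → x ≢ p → a ≢ b → Z a ≡ true → Z b ≡ true →
    E p a ≡ true → E p b ≡ true → E x a ≡ true → E x b ≡ true → E x p ≡ true → ⊥
  tight-wheel {Z} {p} {a} {b} {x} t@(Z⊆Y , _) Yp Zp Zx x≢p a≢b Za Zb pa pb xa xb xp =
    tight-nb≤2 (tight-ins t Yp Zp (vcount-pos Z a Za) (nb₂ p Z a≢b pa Za pb Zb)) (ins-not p Z x≢p Zx)
      (vcount-pos (ins p Z) p (ins-self p Z))
      (nb₃ x (ins p Z) a≢b (λ { refl → true≢false Za Zp }) (λ { refl → true≢false Zb Zp })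
        xa (ins-old p Z Za) xb (ins-old p Z Zb) xp (ins-self p Z))

  tight-node : ∀ {Z a x p q} → Tgt Z → dg E a ≡ 3 → Z a ≡ true → Z x ≡ true → x ≢ a → p ≢ q →
    E a p ≡ true → Z p ≡ false → E a q ≡ true → Z q ≡ false → ⊥
  tight-node {Z} {a} t d Za Zx x≢a p≢q ap Zp aq Zq =
    linear 2 (λ k d → κ 2 ≼ k ⇒ κ 2 ⊕ k ≼ d ⇒ d ≐ κ 3 ⇒ ⊢⊥) (nb E a Z) (dg E a)
      (tight-dg t Za Zx x≢a) (nb-out₂ E a Z p≢q ap Zp aq Zq) d

-- A minimal critical set containing a vertex of degree at least 4

module MinimalCritical {n} {E : ES n} {Y : VS n} (ear : Ear E Y) (irr : ¬ Reducible E Y)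
  (W : VS n) (critW : Critical E Y W) (v₀ : Fin n) (Wv₀ : W v₀ ≡ true) (big₀ : 4 ≤ dg E v₀)
  (minl : ∀ W' → Critical E Y W' → vcount W' < vcount W → ∀ v → W' v ≡ true → dg E v ≡ 3) where
  open Ear ear
  open EarFacts ear

  W⊆Y : W ⊆ᵛ Y
  W⊆Y = proj₁ critW

  big⇒¬node : ∀ {v} → 4 ≤ dg E v → dg E v ≡ 3 → ⊥
  big⇒¬node p q = <⇒≱ p (≤-reflexive q)

  -- A vertex of degree 3 with at most one neighbour in `W` takes at least two edges with it, so
  -- removing it would leave a smaller critical set still containing `v₀`.
  node-nb : ∀ {p} → W p ≡ true → dg E p ≡ 3 → 2 ≤ nb E p W
  node-nb {p} Wp d = ≮⇒≥ λ lt → big⇒¬node big₀ (minl (rem p W) (crit lt)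
      (≤-reflexive (sym (vcount-rem p W Wp))) v₀ v₀∈)
    where
    v₀∈ : rem p W v₀ ≡ true
    v₀∈ = rem-intro p W (λ { refl → big⇒¬node big₀ d }) Wv₀
    crit : nb E p W < 2 → Critical E Y (rem p W)
    crit lt = (λ v h → W⊆Y v (rem-⊆ p W v h)) , ≤-antisym
      (linear 7 (λ i i' k k' d w w' → i ⊕ k' ≐ i' ⊕ d ⇒ k' ≐ k ⇒ κ 1 ⊕ k ≼ κ 2 ⇒ d ≐ κ 3 ⇒ i ≐ 2 ⊗ w ⊕ κ 1 ⇒ w ≐ κ 1 ⊕ w' ⇒ ⊢ i' ≼ 2 ⊗ w' ⊕ κ 1)
        (inc E W) (inc E (rem p W)) (nb E p W) (nb E p (rem p W)) (dg E p) (vcount W) (vcount (rem p W))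
        (inc-rem es p W Wp) (nb-rem es p W) lt d (proj₂ critW) (vcount-rem p W Wp))
      (lower (rem p W) (λ v h → W⊆Y v (rem-⊆ p W v h)) (vcount-pos (rem p W) v₀ v₀∈))

  -- `S ∩ᵛ W` would be critical, smaller than `W` because of `a`, and contain the big vertex `b`.
  -- This disposes of the critical obstructions that contain a big vertex of `W`.
  unseparated : ∀ {S p a b} → Crit S → W p ≡ true → S p ≡ true → W b ≡ true → S b ≡ true → 4 ≤ dg E b →
    W a ≡ true → S a ≡ false → ⊥
  unseparated {S} {p} {a} {b} cS Wp Sp Wb Sb big Wa Sa = big⇒¬node big
    (minl (S ∩ᵛ W) (crit-∩ cS critW Sp Wp)
      (vcount-strict {A = S ∩ᵛ W} {W} a (λ v h → ∧-snd {S v} h) (cong (_∧ W a) Sa) Wa) b (∧-intro Sb Wb))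

  irr₁ : ∀ {p a b c} → Reducible₁ E Y p a b c → ⊥
  irr₁ {p} {a} {b} {c} r = irr (p , a , b , c , inj₁ r)

  irr₂ : ∀ {p a b c} → Reducible₂ E Y p a b c → ⊥
  irr₂ {p} {a} {b} {c} r = irr (p , a , b , c , inj₂ (inj₁ r))

  irr₅ : ∀ {p a b c d} → Reducible₅ E Y p a b c d → ⊥
  irr₅ {p} {a} {b} {c} {d} r = irr (p , a , b , c , inj₂ (inj₂ (inj₂ (inj₂ (d , r)))))

  -- Each of the three reductions at `p` fails, and the obstructions are excluded edge by edge. The
  -- edge `ac` comes first: the reduction that adds `ab` loses `pc`, and since `c` may be an old
  -- vertex, the edge `ac` is needed to keep the reduced ear attached.
  module K4 {p a b c} (N : Nbr3 E p a b c) (Wp : W p ≡ true) (Wa : W a ≡ true) (Wb : W b ≡ true)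
    (big-b : 4 ≤ dg E b) (big-c : W c ≡ true → 4 ≤ dg E c) where
    open Nbr3 N

    ap = ES-sym es pa
    bp = ES-sym es pb
    cp = ES-sym es pc
    a≢p = ES-≢ es ap
    b≢p = ES-≢ es bp
    c≢p = ES-≢ es cp
    Yp = W⊆Y p Wp
    Ya = W⊆Y a Wa
    Yb = W⊆Y b Wb

    -- A critical obstruction to adding `bc` contains `p` and the big vertex `a`, so only tight
    -- obstructions remain, and these are left to the caller.
    bc-tight : 4 ≤ dg E a → (∀ Z → Tgt Z → Z b ≡ true → Z c ≡ true → Z p ≡ false → Z a ≡ false → ⊥) → E b c ≡ true
    bc-tight big-a noZ = ≢false⇒true λ bc → irr₁ (Yp , Yb , nbr-bca N , bc ,
      ((λ { (S , cS , Sp , Sa , Sb , Sc) → unseparated {a = b} cS Wp Sp Wa Sa big-a Wb Sb }) ,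
       (λ { (Z , tZ , Zb , Zc , Zp , Za) → noZ Z tZ Zb Zc Zp Za })) , inj₁ Ya)

    edge-ac : E a c ≡ true
    edge-ac = ≢false⇒true λ ac → irr₁ (Yp , Ya , nbr-acb N , ac ,
      ((λ { (S , cS , Sp , Sb , Sa , Sc) → unseparated {a = a} cS Wp Sp Wb Sb big-b Wa Sa }) ,
       (λ { (Z , tZ , Za , Zc , Zp , Zb) → tight-ac Z tZ Za Zc Zp Zb (true⊎false (W c)) })) , inj₁ Yb)
      where
      tight-ac : ∀ Z → Tgt Z → Z a ≡ true → Z c ≡ true → Z p ≡ false → Z b ≡ false → W c ≡ true ⊎ W c ≡ false → ⊥
      -- `Z` absorbs `p`, whose neighbours `a` and `c` it contains. As `c` is outside `W`, removing
      -- the enlarged set from `W` leaves a smaller critical set with the big vertex `b`.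
      tight-ac Z tZ Za Zc Zp Zb (inj₂ Wc) = big⇒¬node big-b (minl (W ∖ᵛ ins p Z)
          (uncross critW (tight-ins tZ Yp Zp (vcount-pos Z a Za) (nb₂ p Z a≢c pa Za pc Zc)) Wb b∉ (ins-old p Z Zc) Wc)
          (vcount-strict {A = W ∖ᵛ ins p Z} {W} p (λ v h → ∧-fst h)
            (trans (cong (λ x → W p ∧ not x) (ins-self p Z)) (𝔹.∧-zeroʳ (W p))) Wp) b (∧-intro Wb (not-true b∉)))
        where
        b∉ : ins p Z b ≡ false
        b∉ = ins-not p Z b≢p Zb
      -- Now `ab` is an edge, a tight obstruction to it being incompatible with `Z`. If `a` has
      -- degree 3, it has too many neighbours outside `Z`; if `a` is big, `bc` is an edge as well
      -- and `b` closes a wheel.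
      tight-ac Z tZ Za Zc Zp Zb (inj₁ Wc) = case node⊎big Ya of λ
          { (inj₁ d) → tight-node tZ d Za Zc (a≢c ∘ sym) (b≢p ∘ sym) ap Zp ab Zb
          ; (inj₂ big-a) → tight-wheel tZ Yp Zp Zb b≢p a≢c Za Zc pa pc (ES-sym es ab)
              (bc-tight big-a λ Z' tZ' b' c' p' a' → two-tight (nbr-cab N) tZ tZ' Zc Za c' b' Zp p') bp }
        where
        ab : E a b ≡ true
        ab = ≢false⇒true λ ab → irr₁ (Yp , Ya , N , ab ,
          ((λ { (S , cS , Sp , Sc , Sa , Sb) → unseparated {a = a} cS Wp Sp Wc Sc (big-c Wc) Wa Sa }) ,
           (λ { (Z' , tZ' , a' , b' , p' , c') → two-tight N tZ' tZ a' b' Za Zc p' Zp })) , inj₁ (W⊆Y c Wc))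

    -- The edge `ac` serves three purposes: it keeps the reduced ear attached, it joins the two
    -- differences if a critical obstruction crosses `W`, and it leaves any tight obstruction.
    edge-ab : E a b ≡ true
    edge-ab = ≢false⇒true λ ab → irr₁ (Yp , Ya , N , ab ,
      ((λ { (S , cS , Sp , Sc , Sa , Sb) → noS S cS Sp Sc Sa Sb (true⊎false (W c)) }) ,
       (λ { (Z , tZ , Za , Zb , Zp , Zc) → noZ Z tZ Za Zb Zp Zc (node⊎big Ya) })) , inj₂ (inj₁ edge-ac))
      where
      noS : ∀ S → Crit S → S p ≡ true → S c ≡ true → S a ≡ false → S b ≡ false → W c ≡ true ⊎ W c ≡ false → ⊥
      noS S cS Sp Sc Sa Sb (inj₁ Wc) = unseparated {a = a} cS Wp Sp Wc Sc (big-c Wc) Wa Sa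
      noS S cS Sp Sc Sa Sb (inj₂ Wc) = true≢false edge-ac (no-cross critW cS Wp Sp Wa Sa Sc Wc)
      noZ : ∀ Z → Tgt Z → Z a ≡ true → Z b ≡ true → Z p ≡ false → Z c ≡ false → dg E a ≡ 3 ⊎ 4 ≤ dg E a → ⊥
      noZ Z tZ Za Zb Zp Zc (inj₁ d) = tight-node tZ d Za Zb (a≢b ∘ sym) (c≢p ∘ sym) ap Zp edge-ac Zc
      noZ Z tZ Za Zb Zp Zc (inj₂ big-a) = tight-wheel tZ Yp Zp Zc c≢p a≢b Za Zb pa pb (ES-sym es edge-ac)
        (ES-sym es (bc-tight big-a λ Z' tZ' b' c' p' a' → two-tight (nbr-bac N) tZ tZ' Zb Za b' c' Zp p')) cp

    -- If `a` has degree 3, then `p` and `a` share the neighbours `b` and `c`, and a missing `bc`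
    -- would allow a K₄⁻-reduction. If `a` is big, a tight obstruction is excluded by the wheel at
    -- `a`.
    edge-bc : E b c ≡ true
    edge-bc = case node⊎big Ya of λ
      { (inj₁ d) → ≢false⇒true λ bc → irr₂ (Yp , Ya , Yb , N ,
          dg≡3⇒only d (b≢p ∘ sym) (c≢p ∘ sym) b≢c ap edge-ab edge-ac , bc)
      ; (inj₂ big-a) → bc-tight big-a λ Z tZ Zb Zc Zp Za →
          tight-wheel tZ Yp Zp Za a≢p b≢c Zb Zc pb pc edge-ab edge-ac ap }

  isNode : VS n
  isNode v = W v ∧ does (dg E v ℕ.≟ 3)

  isNode-intro : ∀ {v} → W v ≡ true → dg E v ≡ 3 → isNode v ≡ true
  isNode-intro {v} Wv d = ∧-intro Wv (dec-true (dg E v ℕ.≟ 3) d)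

  isNode-elim : ∀ {v} → isNode v ≡ true → W v ≡ true × dg E v ≡ 3
  isNode-elim {v} h = ∧-fst h , does⇒ (dg E v ℕ.≟ 3) (∧-snd {W v} h)

  nonNode-big : ∀ {v} → isNode v ≡ false → W v ≡ true → 4 ≤ dg E v
  nonNode-big {v} h Wv = case node⊎big (W⊆Y v Wv) of λ
    { (inj₁ d) → ⊥-elim (true≢false (isNode-intro Wv d) h) ; (inj₂ b) → b }

  nodes : Fin n → ℕ
  nodes v = nb E v isNode

  -- By the K₄ property v and w have the same further neighbours, and those of w do not count.
  lone-node-nbr : ∀ {v w} → isNode v ≡ true → isNode w ≡ true → E w v ≡ true → nodes w ≤ 1 → nodes v ≤ 1
  lone-node-nbr {v} {w} nv nw wv le = case two-nbrs (proj₂ (isNode-elim nw)) wv of λ { (b , c , N) → go N }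
    where
    Ww = proj₁ (isNode-elim nw)
    Wv = proj₁ (isNode-elim nv)
    notNode : ∀ {x} → x ≢ v → E w x ≡ true → isNode x ≡ false
    notNode x≢v wx = ≢true⇒false λ nx → <⇒≱ (nb₂ w isNode x≢v wx nx wv nv) le
    result : ∀ {b c} → Nbr3 E w v b c → W b ≡ true → nodes v ≤ 1
    result {b} {c} N Wb = vcount≤1 (λ x → E v x ∧ isNode x) w λ x h →
        case Nbr3.only Nv x (∧-fst {E v x} h) of λ
        { (inj₁ e) → e
        ; (inj₂ (inj₁ refl)) → ⊥-elim (true≢false (∧-snd {E v x} h) (notNode (a≢b ∘ sym) pb))
        ; (inj₂ (inj₂ refl)) → ⊥-elim (true≢false (∧-snd {E v x} h) (notNode (a≢c ∘ sym) pc)) }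
      where
      open Nbr3 N
      open K4 N Ww Wv Wb (nonNode-big (notNode (a≢b ∘ sym) pb) Wb) (nonNode-big (notNode (a≢c ∘ sym) pc))
      Nv : Nbr3 E v w b c
      Nv = dg≡3⇒only (proj₂ (isNode-elim nv)) (ES-≢ es pb) (ES-≢ es pc) b≢c (ES-sym es wv) edge-ab edge-ac
    go : ∀ {b c} → Nbr3 E w v b c → nodes v ≤ 1
    go {b} {c} N = case true⊎false (W b) of λ
      { (inj₁ Wb) → result N Wb
      ; (inj₂ Wb) → case true⊎false (W c) of λ
        { (inj₁ Wc) → result (nbr-acb N) Wc
        ; (inj₂ Wc) → ⊥-elim (<⇒≱ (node-nb Ww (proj₂ (isNode-elim nw))) (vcount≤1 (λ x → E w x ∧ W x) v λ x h →
            case Nbr3.only N x (∧-fst {E w x} h) of λ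
            { (inj₁ e) → e
            ; (inj₂ (inj₁ refl)) → ⊥-elim (true≢false (∧-snd {E w x} h) Wb)
            ; (inj₂ (inj₂ refl)) → ⊥-elim (true≢false (∧-snd {E w x} h) Wc) })) } }

  -- The vertices of degree 3 with two neighbours of degree 3 would induce minimum degree 2.
  nodes≤1 : ∀ {v} → isNode v ≡ true → nodes v ≤ 1
  nodes≤1 {p} np = ≮⇒≥ λ lt →
      linear 5 (λ i j v s h → 2 ⊗ v ≼ h ⇒ h ≐ 2 ⊗ j ⇒ s ≼ 3 ⊗ v ⇒ s ≐ i ⊕ j ⇒ 2 ⊗ v ⊕ κ 1 ≼ i ⇒ ⊢⊥)
        (inc E J) (ind E J) (vcount J) (sumFin (λ v → if J v then dg E v else 0)) (sumFin (λ v → if J v then nb E v J else 0))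
        (sum-if≥ 2 J (λ v → nb E v J) J-nb) (handshake es J)
        (sum-if≤ 3 J (dg E) (λ v h → ≤-reflexive (proj₂ (isNode-elim (proj₁ (J-elim h)))))) (degree-sum es J)
        (lower J (λ v h → W⊆Y v (proj₁ (isNode-elim (proj₁ (J-elim h))))) (vcount-pos J p (J-intro np lt)))
    where
    J : VS n
    J v = isNode v ∧ does (2 ≤? nodes v)
    J-intro : ∀ {v} → isNode v ≡ true → 2 ≤ nodes v → J v ≡ true
    J-intro {v} h k = ∧-intro h (dec-true (2 ≤? nodes v) k)
    J-elim : ∀ {v} → J v ≡ true → isNode v ≡ true × 2 ≤ nodes v
    J-elim {v} h = ∧-fst h , does⇒ (2 ≤? nodes v) (∧-snd {isNode v} h)
    -- By `lone-node-nbr`, all node neighbours of a vertex of `J` are in `J`; hence `ind E J` is at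
    -- least `|J|` and `inc E J` at most `2|J|`.
    J-nb : ∀ v → J v ≡ true → 2 ≤ nb E v J
    J-nb v h = ≤-trans (proj₂ (J-elim h)) (vcount-mono {A = λ w → E v w ∧ isNode w} {λ w → E v w ∧ J w}
      λ w k → ∧-intro (∧-fst {E v w} k) (J-intro (∧-snd {E v w} k)
        (≰⇒> λ le → <⇒≱ (proj₂ (J-elim h)) (lone-node-nbr (proj₁ (J-elim h)) (∧-snd {E v w} k) (ES-sym es (∧-fst {E v w} k)) le))))

  -- `c` may lie inside or outside `W`: inside, the K₄ is a tight subset of `W`; outside, it is cut
  -- off in `Boundary`.
  record NodeK4 (y a b c : Fin n) : Set where
    field
      N  : Nbr3 E y a b c
      Wy : W y ≡ true
      dy : dg E y ≡ 3
      Wa : W a ≡ true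
      Wb : W b ≡ true
      big-b : 4 ≤ dg E b
      ab : E a b ≡ true
      ac : E a c ≡ true
      bc : E b c ≡ true

  -- At least two neighbours of `y` are in `W` and at most one of those has degree 3. Labels can
  -- therefore be chosen so that it is `a`, if there is one, and the remaining neighbours in `W` are
  -- big.
  nodeK4 : ∀ {y} → W y ≡ true → dg E y ≡ 3 → ∃[ a ] ∃[ b ] ∃[ c ] NodeK4 y a b c
  nodeK4 {y} Wy dy = case three-nbrs dy of λ { (x₁ , x₂ , x₃ , N) → arrange N (true⊎false (W x₁)) (true⊎false (W x₂)) (true⊎false (W x₃)) }
    where
    ny : isNode y ≡ true
    ny = isNode-intro Wy dy
    make : ∀ {a b c} → Nbr3 E y a b c → W a ≡ true → W b ≡ true → 4 ≤ dg E b → (W c ≡ true → 4 ≤ dg E c) →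
      ∃[ a ] ∃[ b ] ∃[ c ] NodeK4 y a b c
    make N Wa Wb big-b big-c = _ , _ , _ , record { N = N ; Wy = Wy ; dy = dy ; Wa = Wa ; Wb = Wb ; big-b = big-b
      ; ab = edge-ab ; ac = edge-ac ; bc = edge-bc }
      where open K4 N Wy Wa Wb big-b big-c
    one-of : ∀ {u v} → u ≢ v → E y u ≡ true → E y v ≡ true → W u ≡ true → W v ≡ true → 4 ≤ dg E u ⊎ 4 ≤ dg E v
    one-of {u} {v} u≢v yu yv Wu Wv = case node⊎big (W⊆Y u Wu) of λ
      { (inj₂ b) → inj₁ b
      ; (inj₁ du) → case node⊎big (W⊆Y v Wv) of λ
        { (inj₂ b) → inj₂ b
        ; (inj₁ dv) → ⊥-elim (<⇒≱ (nb₂ y isNode u≢v yu (isNode-intro Wu du) yv (isNode-intro Wv dv)) (nodes≤1 ny)) } }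
    two : ∀ {a b c} → Nbr3 E y a b c → W a ≡ true → W b ≡ true → W c ≡ false → ∃[ a ] ∃[ b ] ∃[ c ] NodeK4 y a b c
    two N Wa Wb Wc = case one-of a≢b pa pb Wa Wb of λ
        { (inj₁ big) → make (nbr-bac N) Wb Wa big (λ h → ⊥-elim (true≢false h Wc))
        ; (inj₂ big) → make N Wa Wb big (λ h → ⊥-elim (true≢false h Wc)) }
      where open Nbr3 N
    few : ∀ {a b c} → Nbr3 E y a b c → W b ≡ false → W c ≡ false → ⊥
    few {a} N Wb Wc = <⇒≱ (node-nb Wy dy) (vcount≤1 (λ x → E y x ∧ W x) a λ x h → case Nbr3.only N x (∧-fst {E y x} h) of λ
      { (inj₁ e) → e
      ; (inj₂ (inj₁ refl)) → ⊥-elim (true≢false (∧-snd {E y x} h) Wb)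
      ; (inj₂ (inj₂ refl)) → ⊥-elim (true≢false (∧-snd {E y x} h) Wc) })
    arrange : ∀ {x₁ x₂ x₃} → Nbr3 E y x₁ x₂ x₃ → W x₁ ≡ true ⊎ W x₁ ≡ false → W x₂ ≡ true ⊎ W x₂ ≡ false →
      W x₃ ≡ true ⊎ W x₃ ≡ false → ∃[ a ] ∃[ b ] ∃[ c ] NodeK4 y a b c
    arrange N (inj₂ w₁) (inj₂ w₂) _ = ⊥-elim (few (nbr-cab N) w₁ w₂)
    arrange N (inj₂ w₁) (inj₁ w₂) (inj₂ w₃) = ⊥-elim (few (nbr-bac N) w₁ w₃)
    arrange N (inj₁ w₁) (inj₂ w₂) (inj₂ w₃) = ⊥-elim (few N w₂ w₃)
    arrange N (inj₁ w₁) (inj₁ w₂) (inj₂ w₃) = two N w₁ w₂ w₃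
    arrange N (inj₁ w₁) (inj₂ w₂) (inj₁ w₃) = two (nbr-acb N) w₁ w₃ w₂
    arrange N (inj₂ w₁) (inj₁ w₂) (inj₁ w₃) = two (nbr-bca N) w₂ w₃ w₁
    arrange N (inj₁ w₁) (inj₁ w₂) (inj₁ w₃) = case one-of b≢c pb pc w₂ w₃ of λ
        { (inj₁ big₂) → case one-of a≢c pa pc w₁ w₃ of λ
          { (inj₂ big₃) → make N w₁ w₂ big₂ (λ _ → big₃)
          ; (inj₁ big₁) → make (nbr-cab N) w₃ w₁ big₁ (λ _ → big₂) }
        ; (inj₂ big₃) → case one-of a≢b pa pb w₁ w₂ of λ
          { (inj₁ big₁) → make (nbr-bac N) w₂ w₁ big₁ (λ _ → big₃)
          ; (inj₂ big₂) → make N w₁ w₂ big₂ (λ _ → big₃) } }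
      where open Nbr3 N

  -- A critical singleton is met by three edges, but `v₀` by at least four. The bound is needed to
  -- apply `no-3-cut` to `W`.
  v₀-not-alone : 2 ≤ vcount W
  v₀-not-alone = ≮⇒≥ λ lt → linear 3 (λ i d w → i ≐ d ⇒ κ 4 ≼ d ⇒ i ≐ 2 ⊗ w ⊕ κ 1 ⇒ κ 1 ⊕ w ≼ κ 2 ⇒ ⊢⊥)
      (inc E W) (dg E v₀) (vcount W)
      (trans (inc-ext E (⊆-by-count {A = ins v₀ ∅ᵛ} {W} one⊆ (≤-trans (≤-pred lt) (≤-reflexive (sym (vcount-one v₀))))) one⊆) (inc-one v₀))
      big₀ (proj₂ critW) lt
    where
    one⊆ : ins v₀ ∅ᵛ ⊆ᵛ W
    one⊆ = ins-⊆ v₀ ∅⊆ Wv₀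

  degrees : VS n → ℕ
  degrees S = sumFin (λ v → if S v then dg E v else 0)

  tight-one : ∀ {v} → W v ≡ true → Tgt (ins v ∅ᵛ)
  tight-one {v} Wv = ins-⊆ v ∅⊆ (W⊆Y v Wv) ,
    linear 2 (λ i s → i ≐ κ 0 ⇒ s ≐ κ 1 ⇒ ⊢ i ⊕ κ 2 ≐ 2 ⊗ s) (ind E (ins v ∅ᵛ)) (vcount (ins v ∅ᵛ)) (ind-one v) (vcount-one v)

  -- The six edges of a K₄ attain the bound `2 · 4 − 2`.
  K4-tight : ∀ {y a b c} → NodeK4 y a b c → W c ≡ true → ∃[ Z ] (Tgt Z × Z ⊆ᵛ W × Z y ≡ true × 2 ≤ vcount Z)
  K4-tight {y} {a} {b} {c} K Wc = Z , (Z⊆Y , tight) , Z⊆W , ins-self y Z₃ ,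
      linear 2 (λ s z → z ≐ s ⇒ s ≐ κ 4 ⇒ ⊢ κ 2 ≼ z) (suc (vcount Z₃)) (vcount Z) (vcount-ins y Z₃ y∉) (cong suc size₃)
    where
    open NodeK4 K
    open Nbr3 N
    Z₁ Z₂ Z₃ Z : VS n
    Z₁ = ins c ∅ᵛ
    Z₂ = ins b Z₁
    Z₃ = ins a Z₂
    Z  = ins y Z₃
    b∉ : Z₁ b ≡ false
    b∉ = ins-not c ∅ᵛ b≢c refl
    a∉ : Z₂ a ≡ false
    a∉ = ins-not b Z₁ a≢b (ins-not c ∅ᵛ a≢c refl)
    y∉ : Z₃ y ≡ false
    y∉ = ins-not a Z₂ (ES-≢ es pa) (ins-not b Z₁ (ES-≢ es pb) (ins-not c ∅ᵛ (ES-≢ es pc) refl))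
    Z⊆W : Z ⊆ᵛ W
    Z⊆W = ins-⊆ y (ins-⊆ a (ins-⊆ b (ins-⊆ c ∅⊆ Wc) Wb) Wa) Wy
    Z⊆Y : Z ⊆ᵛ Y
    Z⊆Y v h = W⊆Y v (Z⊆W v h)
    size₂ : vcount Z₂ ≡ 2
    size₂ = trans (vcount-ins b Z₁ b∉) (cong suc (vcount-one c))
    size₃ : vcount Z₃ ≡ 3
    size₃ = trans (vcount-ins a Z₂ a∉) (cong suc size₂)
    c₁ : Z₁ c ≡ true
    c₁ = ins-self c ∅ᵛ
    c₂ : Z₂ c ≡ true
    c₂ = ins-old b Z₁ {c} c₁
    b₂ : Z₂ b ≡ true
    b₂ = ins-self b Z₁
    tight : ind E Z + 2 ≡ 2 * vcount Z
    tight = ≤-antisym (upper Z Z⊆Y (vcount-pos Z y (ins-self y Z₃)))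
      (linear 9 (λ i₁ i₂ i₃ i k₁ k₂ k₃ s₃ s → i₂ ≐ i₁ ⊕ k₁ ⇒ i₃ ≐ i₂ ⊕ k₂ ⇒ i ≐ i₃ ⊕ k₃ ⇒ κ 1 ≼ k₁ ⇒ κ 2 ≼ k₂ ⇒ κ 3 ≼ k₃ ⇒
          s ≐ κ 1 ⊕ s₃ ⇒ s₃ ≐ κ 3 ⇒ ⊢ 2 ⊗ s ≼ i ⊕ κ 2)
        (ind E Z₁) (ind E Z₂) (ind E Z₃) (ind E Z) (nb E b Z₁) (nb E a Z₂) (nb E y Z₃) (vcount Z₃) (vcount Z)
        (ind-ins es b Z₁ b∉) (ind-ins es a Z₂ a∉) (ind-ins es y Z₃ y∉)
        (nb₁ b Z₁ bc c₁) (nb₂ a Z₂ b≢c ab b₂ ac c₂)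
        (nb₃ y Z₃ a≢b a≢c b≢c pa (ins-self a Z₂) pb (ins-old a Z₂ {b} b₂) pc (ins-old a Z₂ {c} c₂))
        (vcount-ins y Z₃ y∉) size₃)

  -- If every vertex of degree 3 of W had its neighbours in W, all of them would lie in
  -- tight subsets of W.  The maximal tight subsets partition W and have at least four
  -- outgoing edges each, so the average degree on W would be at least 4.
  module _ (closed-nbrs : ∀ y → W y ≡ true → dg E y ≡ 3 → ∀ w → E y w ≡ true → W w ≡ true) where

    -- Such a set is a union of maximal tight subsets of `W`. These are disjoint, since tight sets
    -- that meet have a tight union, and each can be split off in turn.
    Saturated : VS n → Set
    Saturated T = ∀ Z → Tgt Z → Z ⊆ᵛ W → ∀ v → Z v ≡ true → T v ≡ true → Z ⊆ᵛ T

    -- The degree sum is `inc + ind`. On two or more vertices `ind` is `2|Z| − 2`, and `no-3-cut`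
    -- raises `inc` to at least `2|Z| + 2`. A singleton that is maximal has degree at least 4,
    -- because a vertex of degree 3 lies in a tight K₄.
    tight-degrees : ∀ {Z v} → Tgt Z → Z ⊆ᵛ W → Z v ≡ true →
      (∀ Z' → Tgt Z' → Z' ⊆ᵛ W → Z' v ≡ true → vcount Z < vcount Z' → ⊥) → 4 * vcount Z ≤ degrees Z
    tight-degrees {Z} {v} (Z⊆Y , tZ) Z⊆W Zv maxl with 2 ≤? vcount Z
    ... | yes two = linear 4 (λ s i j d → d ≐ i ⊕ j ⇒ j ⊕ κ 2 ≐ 2 ⊗ s ⇒ 2 ⊗ s ⊕ κ 2 ≼ i ⇒ ⊢ 4 ⊗ s ≼ d)
        (vcount Z) (inc E Z) (ind E Z) (degrees Z) (degree-sum es Z) tZ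
        (linear 2 (λ s i → κ 1 ⊕ (s ⊕ κ 1) ≼ i ⇒ ⊢ s ⊕ κ 2 ≼ i) (2 * vcount Z) (inc E Z)
          (≤∧≢⇒< (lower Z Z⊆Y (vcount-pos Z v Zv)) λ eq →
            linear 2 (λ j s → j ⊕ κ 2 ≐ s ⇒ j ⊕ κ 3 ≼ s ⇒ ⊢⊥) (ind E Z) (2 * vcount Z) tZ (no-3-cut Z Z⊆Y two (sym eq))))
    ... | no ¬two = ≤-trans (*-monoʳ-≤ 4 (≤-pred (≰⇒> ¬two))) (≤-trans big-v
        (subst (λ b → (if b then dg E v else 0) ≤ degrees Z) Zv (sum-elem v (λ v → if Z v then dg E v else 0))))
      where
      big-v : 4 ≤ dg E v
      big-v = case node⊎big (Z⊆Y v Zv) of λ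
        { (inj₂ b) → b
        ; (inj₁ d) → ⊥-elim (case nodeK4 (Z⊆W v Zv) d of λ { (a , b , c , K) →
            case K4-tight K (closed-nbrs v (Z⊆W v Zv) d c (Nbr3.pc (NodeK4.N K))) of λ { (Z' , t' , s' , v' , two) →
              maxl Z' t' s' v' (<-≤-trans (≰⇒> ¬two) two) } }) }

    saturated-degrees : ∀ k T → T ⊆ᵛ W → vcount T ≤ k → Saturated T → 4 * vcount T ≤ degrees T
    saturated-degrees zero T T⊆W le sat = subst (λ x → 4 * x ≤ degrees T) (sym (n≤0⇒n≡0 le)) z≤n
    saturated-degrees (suc k) T T⊆W le sat with ⊆ᵛ⊎witness T ∅ᵛ
    ... | inj₁ empty = subst (λ x → 4 * x ≤ degrees T) (sym (vcount-∅ T (λ v → ≢true⇒false (λ h → true≢false (empty v h) refl)))) z≤n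
    -- The inequality is decidable, so it may be assumed to fail; a maximal tight set is then
    -- reached by enlarging `Z` as long as it is not maximal.
    ... | inj₂ (v , Tv , _) = decidable-stable (4 * vcount T ≤? degrees T) λ fail →
        grow fail (suc (vcount W)) (ins v ∅ᵛ) (tight-one (T⊆W v Tv)) (ins-⊆ v ∅⊆ (T⊆W v Tv)) (ins-self v ∅ᵛ) (m≤n+m _ _)
      where
      finish : ¬ (4 * vcount T ≤ degrees T) → ∀ Z → Tgt Z → Z ⊆ᵛ W → Z v ≡ true →
        (∀ Z' → Tgt Z' → Z' ⊆ᵛ W → Z' v ≡ true → vcount Z < vcount Z' → ⊥) → ⊥
      finish fail Z tZ Z⊆W Zv maxl = fail (linear 6 (λ t z r dt dz dr → r ⊕ z ≐ t ⇒ dt ≐ dz ⊕ dr ⇒ 4 ⊗ z ≼ dz ⇒ 4 ⊗ r ≼ dr ⇒ ⊢ 4 ⊗ t ≼ dt)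
          (vcount T) (vcount Z) (vcount R) (degrees T) (degrees Z) (degrees R)
          size (sum-if-split Z T (dg E) Z⊆T) (tight-degrees tZ Z⊆W Zv maxl)
          (saturated-degrees k R (λ w h → T⊆W w (∧-fst h)) smaller sat'))
        where
        Z⊆T : Z ⊆ᵛ T
        Z⊆T = sat Z tZ Z⊆W v Zv Tv
        R : VS n
        R = T ∖ᵛ Z
        size : vcount R + vcount Z ≡ vcount T
        size = trans (cong (vcount R +_) (vcount-cong {A = Z} {T ∩ᵛ Z} (λ w h → ∧-intro (Z⊆T w h) h) (λ w h → ∧-snd {T w} h))) (vcount-∖∩ T Z)
        smaller : vcount R ≤ k
        smaller = linear 4 (λ r z t k → r ⊕ z ≐ t ⇒ κ 1 ≼ z ⇒ t ≼ κ 1 ⊕ k ⇒ ⊢ r ≼ k) (vcount R) (vcount Z) (vcount T) k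
          size (vcount-pos Z v Zv) le
        sat' : Saturated R
        sat' Z' t' s' u Z'u Ru w Z'w = ∧-intro (sat Z' t' s' u Z'u (∧-fst Ru) w Z'w) (not-true (≢true⇒false λ Zw →
          maxl (Z ∪ᵛ Z') (tight-∪ tZ t' Zw Z'w) (λ x h → case ∨-elim {Z x} h of λ { (inj₁ p) → Z⊆W x p ; (inj₂ p) → s' x p })
            (∨-introˡ Zv) (vcount-strict {A = Z} {Z ∪ᵛ Z'} u (λ x h → ∨-introˡ h) (not-true⁻ (∧-snd {T u} Ru)) (∨-introʳ {Z u} Z'u))))
      -- The fuel `m` bounds how many vertices of `W` the set `Z` can still gain.
      grow : ¬ (4 * vcount T ≤ degrees T) → ∀ m Z → Tgt Z → Z ⊆ᵛ W → Z v ≡ true → suc (vcount W) ≤ vcount Z + m → ⊥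
      grow fail zero Z tZ Z⊆W Zv lt = <⇒≱ (subst (suc (vcount W) ≤_) (+-identityʳ (vcount Z)) lt) (vcount-mono Z⊆W)
      grow fail (suc m) Z tZ Z⊆W Zv lt = finish fail Z tZ Z⊆W Zv λ Z' t' s' v' bigger →
        grow fail m Z' t' s' v' (linear 4 (λ w z z' m → κ 1 ⊕ w ≼ z ⊕ (κ 1 ⊕ m) ⇒ κ 1 ⊕ z ≼ z' ⇒ ⊢ κ 1 ⊕ w ≼ z' ⊕ m)
          (vcount W) (vcount Z) (vcount Z') m lt bigger)

    -- The degree sum over `W` would be at least `4|W|`, yet it is at most
    -- `(2|W| + 1) + (2|W| − 3)`, as `W` is critical and hence not tight.
    closed-absurd : ⊥
    closed-absurd = linear 4 (λ w i j d → 4 ⊗ w ≼ d ⇒ d ≐ i ⊕ j ⇒ i ≐ 2 ⊗ w ⊕ κ 1 ⇒ j ⊕ κ 3 ≼ 2 ⊗ w ⇒ ⊢⊥)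
      (vcount W) (inc E W) (ind E W) (degrees W)
      (saturated-degrees (vcount W) W (λ _ h → h) ≤-refl (λ Z _ s _ _ _ → s)) (degree-sum es W) (proj₂ critW)
      (no-3-cut W W⊆Y v₀-not-alone (proj₂ critW))

  -- The triangle `y`, `a`, `b` lies in `W`, and `c` outside `W` is adjacent to all of it. One or
  -- two further vertices of `W` with enough adjacencies would contradict the sparsity bound on the
  -- set together with `c`.
  module Dense {y a b c} (K : NodeK4 y a b c) (Wc : W c ≡ false) where
    open NodeK4 K
    open Nbr3 N

    ya = ES-≢ es pa
    yb = ES-≢ es pb
    yc = ES-≢ es pc

    S₁ S₂ S₃ : VS n
    S₁ = ins a ∅ᵛ
    S₂ = ins b S₁
    S₃ = ins y S₂

    S₃-not : ∀ {x} → x ≢ y → x ≢ b → x ≢ a → S₃ x ≡ false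
    S₃-not xy xb xa = ins-not y S₂ xy (ins-not b S₁ xb (ins-not a ∅ᵛ xa refl))
    a₃ : S₃ a ≡ true
    a₃ = ins-old y S₂ {a} (ins-old b S₁ {a} (ins-self a ∅ᵛ))
    b₃ : S₃ b ≡ true
    b₃ = ins-old y S₂ {b} (ins-self b S₁)
    y₃ : S₃ y ≡ true
    y₃ = ins-self y S₂
    S₃⊆ : S₃ ⊆ᵛ Y
    S₃⊆ = ins-⊆ y (ins-⊆ b (ins-⊆ a ∅⊆ (W⊆Y a Wa)) (W⊆Y b Wb)) (W⊆Y y Wy)
    size₃ : vcount S₃ ≡ 3
    size₃ = trans (vcount-ins y S₂ (ins-not b S₁ yb (ins-not a ∅ᵛ ya refl)))
      (cong suc (trans (vcount-ins b S₁ (ins-not a ∅ᵛ (a≢b ∘ sym) refl)) (cong suc (vcount-one a))))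
    ind₃ : 3 ≤ ind E S₃
    ind₃ = linear 5 (λ i₁ i₂ i₃ k₁ k₂ → i₂ ≐ i₁ ⊕ k₁ ⇒ i₃ ≐ i₂ ⊕ k₂ ⇒ κ 1 ≼ k₁ ⇒ κ 2 ≼ k₂ ⇒ ⊢ κ 3 ≼ i₃)
      (ind E S₁) (ind E S₂) (ind E S₃) (nb E b S₁) (nb E y S₂)
      (ind-ins es b S₁ (ins-not a ∅ᵛ (a≢b ∘ sym) refl)) (ind-ins es y S₂ (ins-not b S₁ yb (ins-not a ∅ᵛ ya refl)))
      (nb₁ b S₁ (ES-sym es ab) (ins-self a ∅ᵛ))
      (nb₂ y S₂ a≢b pa (ins-old b S₁ {a} (ins-self a ∅ᵛ)) pb (ins-self b S₁))
    c∉₃ : S₃ c ≡ false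
    c∉₃ = S₃-not (yc ∘ sym) (b≢c ∘ sym) (a≢c ∘ sym)

    add-c : ∀ S k j → S ⊆ᵛ Y → 1 ≤ vcount S → S c ≡ false → vcount S ≡ k → j ≤ ind E S → suc (2 * k) ≤ j + nb E c S → ⊥
    add-c S k j S⊆Y pos Sc size low many = linear 6 (λ i i' s k j m → i' ≐ i ⊕ m ⇒ i' ≼ 2 ⊗ s ⇒ s ≐ k ⇒ j ≼ i ⇒ κ 1 ⊕ 2 ⊗ k ≼ j ⊕ m ⇒ ⊢⊥)
      (ind E S) (ind E (ins c S)) (vcount S) k j (nb E c S) (ind-ins es c S Sc) (bound S c S⊆Y pos Sc) size low many

    -- These five vertices would carry K₅ without the edge `wy`: nine edges, one more than allowed.
    five : ∀ {w} → W w ≡ true → w ≢ y → w ≢ a → w ≢ b → E w a ≡ true → E w b ≡ true → E w c ≡ true → ⊥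
    five {w} Ww wy wa wb ea eb ec = add-c S 4 5 (ins-⊆ w S₃⊆ (W⊆Y w Ww)) (vcount-pos S w (ins-self w S₃))
        (ins-not w S₃ (ES-≢ es (ES-sym es ec)) c∉₃) (trans (vcount-ins w S₃ w∉) (cong suc size₃))
        (linear 3 (λ i i' k → i' ≐ i ⊕ k ⇒ κ 3 ≼ i ⇒ κ 2 ≼ k ⇒ ⊢ κ 5 ≼ i') (ind E S₃) (ind E S) (nb E w S₃)
          (ind-ins es w S₃ w∉) ind₃ (nb₂ w S₃ a≢b ea a₃ eb b₃))
        (+-monoʳ-≤ 5 (vcount≥4 (λ x → E c x ∧ S x) (ya ∘ sym) a≢b (wa ∘ sym) yb (wy ∘ sym) (wb ∘ sym)
          (∧-intro (ES-sym es ac) (ins-old w S₃ {a} a₃)) (∧-intro (ES-sym es pc) (ins-old w S₃ {y} y₃))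
          (∧-intro (ES-sym es bc) (ins-old w S₃ {b} b₃)) (∧-intro (ES-sym es ec) (ins-self w S₃))))
      where
      S : VS n
      S = ins w S₃
      w∉ : S₃ w ≡ false
      w∉ = S₃-not wy wb wa

    module Six {w z} (Ww : W w ≡ true) (Wz : W z ≡ true) (wy : w ≢ y) (wa : w ≢ a) (wb : w ≢ b)
      (zy : z ≢ y) (za : z ≢ a) (zb : z ≢ b) (wz : E w z ≡ true) where
      S₄ S : VS n
      S₄ = ins w S₃
      S  = ins z S₄
      w∉ : S₃ w ≡ false
      w∉ = S₃-not wy wb wa
      z∉ : S₄ z ≡ false
      z∉ = ins-not w S₃ (ES-≢ es (ES-sym es wz)) (S₃-not zy zb za)
      S⊆ : S ⊆ᵛ Y
      S⊆ = ins-⊆ z (ins-⊆ w S₃⊆ (W⊆Y w Ww)) (W⊆Y z Wz)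
      size : vcount S ≡ 5
      size = trans (vcount-ins z S₄ z∉) (cong suc (trans (vcount-ins w S₃ w∉) (cong suc size₃)))
      c∉ : S c ≡ false
      c∉ = ins-not z S₄ {c} (λ { refl → true≢false Wz Wc }) (ins-not w S₃ {c} (λ { refl → true≢false Ww Wc }) c∉₃)
      old : ∀ {x} → S₃ x ≡ true → S x ≡ true
      old {x} h = ins-old z S₄ {x} (ins-old w S₃ {x} h)
      ind-S : ∀ j k → j ≤ nb E w S₃ → k ≤ nb E z S₄ → 3 + j + k ≤ ind E S
      ind-S j k p q = linear 7 (λ i₃ i₄ i m l j k → i₄ ≐ i₃ ⊕ m ⇒ i ≐ i₄ ⊕ l ⇒ κ 3 ≼ i₃ ⇒ j ≼ m ⇒ k ≼ l ⇒ ⊢ κ 3 ⊕ j ⊕ k ≼ i)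
        (ind E S₃) (ind E S₄) (ind E S) (nb E w S₃) (nb E z S₄) j k (ind-ins es w S₃ w∉) (ind-ins es z S₄ z∉) ind₃ p q

      -- The five vertices of `S` span at least `3 + 2 + 3` edges and `c` adds three: eleven edges
      -- on six vertices, where ten are allowed.
      both : E w a ≡ true → E w b ≡ true → E z a ≡ true → E z b ≡ true → ⊥
      both wa' wb' za' zb' = add-c S 5 8 S⊆ (vcount-pos S z (ins-self z S₄)) c∉ size
        (ind-S 2 3 (nb₂ w S₃ a≢b wa' a₃ wb' b₃)
          (nb₃ z S₄ a≢b (wa ∘ sym) (wb ∘ sym) za' (ins-old w S₃ {a} a₃) zb' (ins-old w S₃ {b} b₃) (ES-sym es wz) (ins-self w S₃)))
        (+-monoʳ-≤ 8 (nb₃ c S (ya ∘ sym) a≢b yb (ES-sym es ac) (old {a} a₃) (ES-sym es pc) (old {y} y₃) (ES-sym es bc) (old {b} b₃)))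

      -- Eleven edges on six vertices again: `3 + 1 + 2` inside `S`, and five from `c` to all of
      -- `S`.
      single : ∀ {q} → S₃ q ≡ true → E w q ≡ true → E z q ≡ true → E w c ≡ true → E z c ≡ true → ⊥
      single {q} q₃ wq zq wc zc = add-c S 5 6 S⊆ (vcount-pos S z (ins-self z S₄)) c∉ size
        (ind-S 1 2 (nb₁ w S₃ wq q₃) (nb₂ z S₄ (ES-≢ es (ES-sym es wq)) zq (ins-old w S₃ {q} q₃) (ES-sym es wz) (ins-self w S₃)))
        (+-monoʳ-≤ 6 (vcount≥5 (λ x → E c x ∧ S x) (ya ∘ sym) a≢b (wa ∘ sym) (za ∘ sym) yb (wy ∘ sym) (zy ∘ sym) (wb ∘ sym) (zb ∘ sym) (ES-≢ es wz)
          (∧-intro (ES-sym es ac) (old {a} a₃)) (∧-intro (ES-sym es pc) (old {y} y₃)) (∧-intro (ES-sym es bc) (old {b} b₃))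
          (∧-intro (ES-sym es wc) (ins-old z S₄ {w} (ins-self w S₃))) (∧-intro (ES-sym es zc) (ins-self z S₄))))

  -- Removing y, a, b from W loses at least six edges, so what remains is critical again.
  module Boundary {y a b c} (K : NodeK4 y a b c) (Wc : W c ≡ false) where
    open NodeK4 K
    open Nbr3 N
    open Dense K Wc using (five; module Six; a₃; b₃)

    W₁ W₂ W₃ : VS n
    W₁ = rem y W
    W₂ = rem a W₁
    W₃ = rem b W₂
    y≢a = ES-≢ es pa
    y≢b = ES-≢ es pb
    y≢c = ES-≢ es pc
    a₁ : W₁ a ≡ true
    a₁ = rem-intro y W (y≢a ∘ sym) Wa
    b₂ : W₂ b ≡ true
    b₂ = rem-intro a W₁ (a≢b ∘ sym) (rem-intro y W (y≢b ∘ sym) Wb)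
    y∉₂ : W₂ y ≡ false
    y∉₂ = rem-not a W₁ (rem-self y W)
    c∉₁ : W₁ c ≡ false
    c∉₁ = rem-not y W Wc
    c∉₂ : W₂ c ≡ false
    c∉₂ = rem-not a W₁ c∉₁
    y∉₃ : W₃ y ≡ false
    y∉₃ = rem-not b W₂ {y} y∉₂
    a∉₃ : W₃ a ≡ false
    a∉₃ = rem-not b W₂ {a} (rem-self a W₁)
    c∉₃ : W₃ c ≡ false
    c∉₃ = rem-not b W₂ {c} c∉₂
    W₃⊆W : W₃ ⊆ᵛ W
    W₃⊆W v h = rem-⊆ y W v (rem-⊆ a W₁ v (rem-⊆ b W₂ v h))
    size : vcount W ≡ 3 + vcount W₃
    size = trans (vcount-rem y W Wy) (cong suc (trans (vcount-rem a W₁ a₁) (cong suc (vcount-rem b W₂ b₂))))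
    loss-y : inc E W + nb E y W₁ ≡ inc E W₁ + dg E y
    loss-y = inc-rem es y W Wy
    loss-a : inc E W₁ + nb E a W₂ ≡ inc E W₂ + dg E a
    loss-a = inc-rem es a W₁ a₁
    loss-b : inc E W₂ + nb E b W₃ ≡ inc E W₃ + dg E b
    loss-b = inc-rem es b W₂ b₂
    out-y : 1 + nb E y W₁ ≤ dg E y
    out-y = nb-out₁ E y W₁ pc c∉₁
    out-a : 2 + nb E a W₂ ≤ dg E a
    out-a = nb-out₂ E a W₂ y≢c (ES-sym es pa) y∉₂ ac c∉₂
    out-b : 3 + nb E b W₃ ≤ dg E b
    out-b = nb-out₃ E b W₃ y≢a y≢c a≢c (ES-sym es pb) y∉₃ (ES-sym es ab) a∉₃ bc c∉₃

    -- Here `W` is the triangle `y`, `a`, `b` met by seven edges. Its degrees sum to `7 + 3`, so `a`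
    -- has degree 3 and `b` degree 4, which is the configuration `Reducible₅`.
    empty-case : vcount W₃ ≡ 0 → ⊥
    empty-case none = case ⊆ᵛ⊎witness (E b) (ins y (ins a (ins c ∅ᵛ))) of λ
      { (inj₁ sub) → <⇒≱ big-b (≤-trans (vcount-mono sub) (≤-reflexive size-yac))
      ; (inj₂ (d , bd , d∉)) → irr₅ (W⊆Y y Wy , W⊆Y a Wa , W⊆Y b Wb , N ,
          dg≡3⇒only da y≢b y≢c b≢c (ES-sym es pa) ab ac , bc ,
          dg≡4⇒only db y≢a y≢c
            (λ { refl → true≢false (ins-self y (ins a (ins c ∅ᵛ))) d∉ }) a≢c
            (λ { refl → true≢false (ins-old y (ins a (ins c ∅ᵛ)) {a} (ins-self a (ins c ∅ᵛ))) d∉ })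
            (λ { refl → true≢false (ins-old y (ins a (ins c ∅ᵛ)) {c} (ins-old a (ins c ∅ᵛ) {c} (ins-self c ∅ᵛ))) d∉ })
            (ES-sym es pb) (ES-sym es ab) bc bd) }
      where
      size-yac : vcount (ins y (ins a (ins c ∅ᵛ))) ≡ 3
      size-yac = trans (vcount-ins y (ins a (ins c ∅ᵛ)) (ins-not a (ins c ∅ᵛ) y≢a (ins-not c ∅ᵛ y≢c refl)))
        (cong suc (trans (vcount-ins a (ins c ∅ᵛ) (ins-not c ∅ᵛ a≢c refl)) (cong suc (vcount-one c))))
      few-a : nb E a W₂ ≤ 1 + vcount W₃
      few-a = ≤-trans (nb≤vcount E a W₂) (≤-reflexive (vcount-rem b W₂ b₂))
      few-b : nb E b W₃ ≤ vcount W₃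
      few-b = nb≤vcount E b W₃
      sum≤7 : dg E a + dg E b ≤ 7
      sum≤7 = linear 12 (λ iw ky i1 dy ka i2 da kb i3 db w w3 → iw ⊕ ky ≐ i1 ⊕ dy ⇒ i1 ⊕ ka ≐ i2 ⊕ da ⇒ i2 ⊕ kb ≐ i3 ⊕ db ⇒
          κ 1 ⊕ ky ≼ dy ⇒ ka ≼ κ 1 ⊕ w3 ⇒ kb ≼ w3 ⇒ iw ≐ 2 ⊗ w ⊕ κ 1 ⇒ w ≐ κ 3 ⊕ w3 ⇒ w3 ≐ κ 0 ⇒ ⊢ da ⊕ db ≼ κ 7)
        (inc E W) (nb E y W₁) (inc E W₁) (dg E y) (nb E a W₂) (inc E W₂) (dg E a) (nb E b W₃) (inc E W₃) (dg E b) (vcount W) (vcount W₃)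
        loss-y loss-a loss-b out-y few-a few-b (proj₂ critW) size none
      da : dg E a ≡ 3
      da = linear 2 (λ a b → κ 3 ≼ a ⇒ κ 4 ≼ b ⇒ a ⊕ b ≼ κ 7 ⇒ ⊢ a ≐ κ 3) (dg E a) (dg E b) (dg≥3 (W⊆Y a Wa)) big-b sum≤7
      db : dg E b ≡ 4
      db = linear 2 (λ a b → κ 3 ≼ a ⇒ κ 4 ≼ b ⇒ a ⊕ b ≼ κ 7 ⇒ ⊢ b ≐ κ 4) (dg E a) (dg E b) (dg≥3 (W⊆Y a Wa)) big-b sum≤7

    -- `lower` for `W₃` forces every estimate of lost edges to be an equality. So apart from `y`,
    -- `c` and each other, `a` and `b` have neighbours only in `W₃`; and by minimality of `W` all of
    -- `W₃` has degree 3.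
    module NonemptyCase w (w₃ : W₃ w ≡ true) where
      pos : 1 ≤ vcount W₃
      pos = vcount-pos W₃ w w₃
      W₃⊆Y : W₃ ⊆ᵛ Y
      W₃⊆Y v h = W⊆Y v (W₃⊆W v h)
      low : 2 * vcount W₃ + 1 ≤ inc E W₃
      low = lower W₃ W₃⊆Y pos
      crit₃ : Critical E Y W₃
      crit₃ = W₃⊆Y , ≤-antisym (linear 12 (λ iw ky i1 dy ka i2 da kb i3 db w w3 → iw ⊕ ky ≐ i1 ⊕ dy ⇒ i1 ⊕ ka ≐ i2 ⊕ da ⇒ i2 ⊕ kb ≐ i3 ⊕ db ⇒
          κ 1 ⊕ ky ≼ dy ⇒ κ 2 ⊕ ka ≼ da ⇒ κ 3 ⊕ kb ≼ db ⇒ iw ≐ 2 ⊗ w ⊕ κ 1 ⇒ w ≐ κ 3 ⊕ w3 ⇒ ⊢ i3 ≼ 2 ⊗ w3 ⊕ κ 1)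
        (inc E W) (nb E y W₁) (inc E W₁) (dg E y) (nb E a W₂) (inc E W₂) (dg E a) (nb E b W₃) (inc E W₃) (dg E b) (vcount W) (vcount W₃)
        loss-y loss-a loss-b out-y out-a out-b (proj₂ critW) size) low
      exact-a : dg E a ≤ 2 + nb E a W₂
      exact-a = linear 12 (λ iw ky i1 dy ka i2 da kb i3 db w w3 → iw ⊕ ky ≐ i1 ⊕ dy ⇒ i1 ⊕ ka ≐ i2 ⊕ da ⇒ i2 ⊕ kb ≐ i3 ⊕ db ⇒
          κ 1 ⊕ ky ≼ dy ⇒ κ 3 ⊕ kb ≼ db ⇒ iw ≐ 2 ⊗ w ⊕ κ 1 ⇒ w ≐ κ 3 ⊕ w3 ⇒ 2 ⊗ w3 ⊕ κ 1 ≼ i3 ⇒ ⊢ da ≼ κ 2 ⊕ ka)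
        (inc E W) (nb E y W₁) (inc E W₁) (dg E y) (nb E a W₂) (inc E W₂) (dg E a) (nb E b W₃) (inc E W₃) (dg E b) (vcount W) (vcount W₃)
        loss-y loss-a loss-b out-y out-b (proj₂ critW) size low
      exact-b : dg E b ≤ 3 + nb E b W₃
      exact-b = linear 12 (λ iw ky i1 dy ka i2 da kb i3 db w w3 → iw ⊕ ky ≐ i1 ⊕ dy ⇒ i1 ⊕ ka ≐ i2 ⊕ da ⇒ i2 ⊕ kb ≐ i3 ⊕ db ⇒
          κ 1 ⊕ ky ≼ dy ⇒ κ 2 ⊕ ka ≼ da ⇒ iw ≐ 2 ⊗ w ⊕ κ 1 ⇒ w ≐ κ 3 ⊕ w3 ⇒ 2 ⊗ w3 ⊕ κ 1 ≼ i3 ⇒ ⊢ db ≼ κ 3 ⊕ kb)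
        (inc E W) (nb E y W₁) (inc E W₁) (dg E y) (nb E a W₂) (inc E W₂) (dg E a) (nb E b W₃) (inc E W₃) (dg E b) (vcount W) (vcount W₃)
        loss-y loss-a loss-b out-y out-a (proj₂ critW) size low
      node₃ : ∀ v → W₃ v ≡ true → dg E v ≡ 3
      node₃ = minl W₃ crit₃ (subst (vcount W₃ <_) (sym size) (s≤s (m≤n+m _ 2)))

      nbrs-a : ∀ {t} → E a t ≡ true → t ≢ b → t ≢ y → t ≢ c → W₃ t ≡ true
      nbrs-a {t} at t≢b t≢y t≢c = rem-intro b W₂ t≢b (≢false⇒true λ t∉ →
        <⇒≱ (nb-out₃ E a W₂ (t≢y ∘ sym) y≢c t≢c (ES-sym es pa) y∉₂ at t∉ ac c∉₂) exact-a)
      nbrs-b : ∀ {t} → E b t ≡ true → t ≢ a → t ≢ y → t ≢ c → W₃ t ≡ true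
      nbrs-b {t} bt t≢a t≢y t≢c = ≢false⇒true λ t∉ →
        <⇒≱ (nb-out₄ E b W₃ y≢a y≢c (t≢y ∘ sym) a≢c (t≢a ∘ sym) (t≢c ∘ sym) (ES-sym es pb) y∉₃ (ES-sym es ab) a∉₃ bc c∉₃ bt t∉) exact-b

      module Distinct v (v₃ : W₃ v ≡ true) where
        v≢y : v ≢ y
        v≢y refl = true≢false v₃ y∉₃
        v≢a : v ≢ a
        v≢a refl = true≢false v₃ a∉₃
        v≢b : v ≢ b
        v≢b refl = true≢false v₃ (rem-self b W₂)
        v≢c : v ≢ c
        v≢c refl = true≢false v₃ c∉₃
        ¬vy : E v y ≡ true → ⊥
        ¬vy e = case only v (ES-sym es e) of λ
          { (inj₁ q) → v≢a q ; (inj₂ (inj₁ q)) → v≢b q ; (inj₂ (inj₂ q)) → v≢c q }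

      inner : ∀ x → W x ≡ true → x ≢ y → x ≢ a → x ≢ b → W₃ x ≡ true
      inner x Wx xy xa xb = rem-intro b W₂ xb (rem-intro a W₁ xa (rem-intro y W xy Wx))

      open Distinct w w₃ using (v≢y; v≢a; v≢b; ¬vy)

      six : ∀ z → W₃ z ≡ true → E w z ≡ true → (E w a ≡ true × E w b ≡ true × E z a ≡ true × E z b ≡ true) ⊎
        (∃[ q ] (Dense.S₃ K Wc q ≡ true × E w q ≡ true × E z q ≡ true × E w c ≡ true × E z c ≡ true)) → ⊥
      six z z₃ wz h = case h of λ
          { (inj₁ (p , q , r , s)) → both p q r s ; (inj₂ (q , q₃ , r , s , t , u)) → single q₃ r s t u }
        where
        open Distinct z z₃ renaming (v≢y to z≢y; v≢a to z≢a; v≢b to z≢b) using ()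
        open Six (W₃⊆W w w₃) (W₃⊆W z z₃) v≢y v≢a v≢b z≢y z≢a z≢b wz

      -- `q` is the one of `a`, `b` that is a big neighbour of `w` in its K₄, and `q'` is the other
      -- one. Each of `a'` and `c'` is `q'`, possibly `c` in the case of `c'`, or a vertex of `W₃`;
      -- every combination gives a forbidden dense subgraph or two neighbours of `w` of degree 3.
      finish : ∀ {q q' a' c'} → Nbr3 E w a' q c' → W a' ≡ true → E a' q ≡ true → E a' c' ≡ true → E q c' ≡ true →
        Dense.S₃ K Wc q ≡ true → E w q ≡ true → (q ≡ a × q' ≡ b ⊎ q ≡ b × q' ≡ a) → ⊥
      finish {q} {q'} {a'} {c'} Nw Wa' a'q a'c' qc' q₃ wq ends = case (a' ≟ q') of λ
          { (yes refl) → case (c' ≟ c) of λ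
            { (yes refl) → five (W₃⊆W w w₃) v≢y v≢a v≢b (to-a ends pa') (to-b ends pa') pc'
            ; (no c'≢c) → six c' (c'₃ c'≢c (λ { refl → a'≢c' refl })) pc' (inj₁ (to-a ends pa' , to-b ends pa' ,
                ES-sym es (from-a ends (ES-sym es a'c') (ES-sym es qc')) , ES-sym es (from-b ends (ES-sym es a'c') (ES-sym es qc')))) }
          ; (no a'≢q') → case (c' ≟ q') of λ
            { (yes refl) → six a' (a'₃ a'≢q') pa' (inj₁ (to-a ends pc' , to-b ends pc' , other-a ends a'q a'c' , other-b ends a'q a'c'))
            ; (no c'≢q') → case (c' ≟ c) of λ
              { (yes refl) → six a' (a'₃ a'≢q') pa' (inj₂ (q , q₃ , wq , a'q , pc' , a'c'))
              ; (no c'≢c) → <⇒≱ (nb₂ w isNode a'≢c' pa' (node∈ a' (a'₃ a'≢q')) pc' (node∈ c' (c'₃ c'≢c c'≢q')))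
                  (nodes≤1 {w} (node∈ w w₃)) } } }
        where
        open Nbr3 Nw renaming (a≢b to a'≢q; a≢c to a'≢c'; b≢c to q≢c'; pa to pa'; pb to pq'; pc to pc') using ()
        node∈ : ∀ x → W₃ x ≡ true → isNode x ≡ true
        node∈ x h = isNode-intro (W₃⊆W x h) (node₃ x h)
        a'₃ : a' ≢ q' → W₃ a' ≡ true
        a'₃ a'≢q' = inner a' Wa' (λ { refl → ¬vy pa' })
          (λ { refl → case ends of λ { (inj₁ (refl , _)) → a'≢q refl ; (inj₂ (_ , refl)) → a'≢q' refl } })
          (λ { refl → case ends of λ { (inj₁ (_ , refl)) → a'≢q' refl ; (inj₂ (refl , _)) → a'≢q refl } })
        c'₃ : c' ≢ c → c' ≢ q' → W₃ c' ≡ true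
        c'₃ c'≢c c'≢q' = case ends of λ
          { (inj₁ (refl , refl)) → nbrs-a qc' c'≢q' (λ { refl → ¬vy pc' }) c'≢c
          ; (inj₂ (refl , refl)) → nbrs-b qc' c'≢q' (λ { refl → ¬vy pc' }) c'≢c }
        to-a : (q ≡ a × q' ≡ b ⊎ q ≡ b × q' ≡ a) → E w q' ≡ true → E w a ≡ true
        to-a (inj₁ (refl , refl)) _ = wq
        to-a (inj₂ (refl , refl)) e = e
        to-b : (q ≡ a × q' ≡ b ⊎ q ≡ b × q' ≡ a) → E w q' ≡ true → E w b ≡ true
        to-b (inj₁ (refl , refl)) e = e
        to-b (inj₂ (refl , refl)) _ = wq
        from-a : (q ≡ a × q' ≡ b ⊎ q ≡ b × q' ≡ a) → E c' q' ≡ true → E c' q ≡ true → E a c' ≡ true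
        from-a (inj₁ (refl , refl)) e f = ES-sym es f
        from-a (inj₂ (refl , refl)) e f = ES-sym es e
        from-b : (q ≡ a × q' ≡ b ⊎ q ≡ b × q' ≡ a) → E c' q' ≡ true → E c' q ≡ true → E b c' ≡ true
        from-b (inj₁ (refl , refl)) e f = ES-sym es e
        from-b (inj₂ (refl , refl)) e f = ES-sym es f
        other-a : (q ≡ a × q' ≡ b ⊎ q ≡ b × q' ≡ a) → E a' q ≡ true → E a' q' ≡ true → E a' a ≡ true
        other-a (inj₁ (refl , refl)) e f = e
        other-a (inj₂ (refl , refl)) e f = f
        other-b : (q ≡ a × q' ≡ b ⊎ q ≡ b × q' ≡ a) → E a' q ≡ true → E a' q' ≡ true → E a' b ≡ true
        other-b (inj₁ (refl , refl)) e f = f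
        other-b (inj₂ (refl , refl)) e f = e

      absurd : ⊥
      absurd = case nodeK4 (W₃⊆W w w₃) (node₃ w w₃) of λ { (a' , b' , c' , K') → go K' }
        where
        go : ∀ {a' b' c'} → NodeK4 w a' b' c' → ⊥
        go {a'} {b'} {c'} K' = case (b' ≟ a) of λ
            { (yes refl) → finish (NodeK4.N K') (NodeK4.Wa K') (NodeK4.ab K') (NodeK4.ac K') (NodeK4.bc K') a₃ pb' (inj₁ (refl , refl))
            ; (no b'≢a) → case (b' ≟ b) of λ
              { (yes refl) → finish (NodeK4.N K') (NodeK4.Wa K') (NodeK4.ab K') (NodeK4.ac K') (NodeK4.bc K') b₃ pb' (inj₂ (refl , refl))
              -- `b'` is big, while all remaining candidates for it lie in `W₃` and have degree 3.
              ; (no b'≢b) → big⇒¬node (NodeK4.big-b K') (node₃ b' (inner b' (NodeK4.Wb K') (λ { refl → ¬vy pb' }) b'≢a b'≢b)) } }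
          where
          pb' : E w b' ≡ true
          pb' = Nbr3.pb (NodeK4.N K')

    boundary-absurd : ⊥
    boundary-absurd = case ⊆ᵛ⊎witness W₃ ∅ᵛ of λ
      { (inj₁ empty) → empty-case (vcount-∅ W₃ (λ v → ≢true⇒false (λ h → true≢false (empty v h) refl)))
      ; (inj₂ (w , w₃ , _)) → NonemptyCase.absurd w w₃ }

  absurd : ⊥
  absurd = closed-absurd λ y Wy dy w yw → ≢false⇒true λ Ww → case nodeK4 Wy dy of λ { (a , b , c , K) →
    case Nbr3.only (NodeK4.N K) w yw of λ
      { (inj₁ refl) → true≢false (NodeK4.Wa K) Ww
      ; (inj₂ (inj₁ refl)) → true≢false (NodeK4.Wb K) Ww
      ; (inj₂ (inj₂ refl)) → Boundary.boundary-absurd K Ww } }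

-- Induction on the size of `W` supplies the minimality that `MinimalCritical` asks for.
no-big : ∀ {n} {E : ES n} {Y : VS n} → Ear E Y → ¬ Reducible E Y →
  ∀ k W → vcount W ≤ k → Critical E Y W → ∀ v → W v ≡ true → 4 ≤ dg E v → ⊥
no-big ear irr zero W le crit v Wv big = case ≤-trans (vcount-pos W v Wv) le of λ ()
no-big {E = E} ear irr (suc k) W le crit v Wv big = MinimalCritical.absurd ear irr W crit v Wv big
  λ W' crit' lt u W'u → case EarFacts.node⊎big ear (proj₁ crit' u W'u) of λ
    { (inj₁ d) → d ; (inj₂ b) → ⊥-elim (no-big ear irr k W' (≤-pred (≤-trans lt le)) crit' u W'u b) }

-- Ears whose new vertices all have degree 3

module AllNodes {n} {E : ES n} {Y : VS n} (ear : Ear E Y) (irr : ¬ Reducible E Y)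
  (node : ∀ v → Y v ≡ true → dg E v ≡ 3) where
  open Ear ear
  open EarFacts ear

  hasTwo : VS n
  hasTwo v = does (2 ≤? nb E v Y)

  hasTwo-elim : ∀ {v} → hasTwo v ≡ true → 2 ≤ nb E v Y
  hasTwo-elim {v} h = does⇒ (2 ≤? nb E v Y) h

  hasTwo-false : ∀ {v} → hasTwo v ≡ false → nb E v Y ≤ 1
  hasTwo-false {v} h = ≮⇒≥ λ p → true≢false (dec-true (2 ≤? nb E v Y) p) h

  -- From `3|Y| = inc + ind` and `inc = 2|Y| + 1` it follows that `Y` spans `|Y| − 1` edges, as a
  -- tree does. This count is all that is used to find leaves.
  inner-sum : sumFin (λ v → if Y v then nb E v Y else 0) + 2 ≡ 2 * vcount Y
  inner-sum = linear 5 (λ h i j y s → h ≐ 2 ⊗ j ⇒ s ≐ i ⊕ j ⇒ i ≐ 2 ⊗ y ⊕ κ 1 ⇒ s ≼ 3 ⊗ y ⇒ 3 ⊗ y ≼ s ⇒ ⊢ h ⊕ κ 2 ≐ 2 ⊗ y)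
    (sumFin (λ v → if Y v then nb E v Y else 0)) (inc E Y) (ind E Y) (vcount Y) (sumFin (λ v → if Y v then dg E v else 0))
    (handshake es Y) (degree-sum es Y) full
    (sum-if≤ 3 Y (dg E) (λ v h → ≤-reflexive (node v h))) (sum-if≥ 3 Y (dg E) (λ v h → ≤-reflexive (sym (node v h))))

  leaf : ∃[ p ] (Y p ≡ true × nb E p Y ≤ 1)
  leaf with ⊆ᵛ⊎witness Y hasTwo
  ... | inj₂ (p , Yp , h) = p , Yp , hasTwo-false h
  ... | inj₁ all = ⊥-elim (linear 2 (λ h y → h ⊕ κ 2 ≐ 2 ⊗ y ⇒ 2 ⊗ y ≼ h ⇒ ⊢⊥) _ (vcount Y) inner-sum
      (sum-if≥ 2 Y (λ v → nb E v Y) (λ v h → hasTwo-elim {v} (all v h))))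

  another-leaf : ∀ {p} → Y p ≡ true → nb E p Y ≡ 1 → ∃[ p' ] (p' ≢ p × Y p' ≡ true × nb E p' Y ≤ 1)
  another-leaf {p} Yp one with ⊆ᵛ⊎witness (rem p Y) hasTwo
  ... | inj₂ (p' , h , k) = p' , rem-≢ p Y h , rem-⊆ p Y p' h , hasTwo-false k
  ... | inj₁ all = ⊥-elim (linear 6 (λ h y r s₁ s₂ k → h ⊕ κ 2 ≐ 2 ⊗ y ⇒ h ≐ s₁ ⊕ s₂ ⇒ k ≼ s₁ ⇒ k ≐ κ 1 ⇒ 2 ⊗ r ≼ s₂ ⇒ y ≐ κ 1 ⊕ r ⇒ ⊢⊥)
      (sumFin (λ v → if Y v then nb E v Y else 0)) (vcount Y) (vcount (Y ∖ᵛ P)) (sumFin (λ v → if P v then nb E v Y else 0))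
      (sumFin (λ v → if (Y ∖ᵛ P) v then nb E v Y else 0)) (nb E p Y)
      inner-sum (sum-if-split P Y (λ v → nb E v Y) (λ v h → subst (λ x → Y x ≡ true) (sym (==⇒≡ h)) Yp))
      (subst (λ b → (if b then nb E p Y else 0) ≤ sumFin (λ v → if P v then nb E v Y else 0)) (==-refl p)
        (sum-elem p (λ v → if P v then nb E v Y else 0))) one
      (sum-if≥ 2 (Y ∖ᵛ P) (λ v → nb E v Y) (λ v h → hasTwo-elim {v} (all v (rem-intro p Y
        (λ e → true≢false (==-true e) (not-true⁻ (∧-snd {Y v} h))) (∧-fst h)))))
      (trans (sym (vcount-∖∩ Y P)) (trans (cong (vcount (Y ∖ᵛ P) +_) (trans
        (vcount-cong {A = Y ∩ᵛ P} {P} (λ v h → ∧-snd {Y v} h) (λ v h → ∧-intro (subst (λ x → Y x ≡ true) (sym (==⇒≡ h)) Yp) h))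
        (vcount-single p))) (+-comm _ 1))))
    where
    P : VS n
    P v = v == p

  -- All three edges at `p` leave `Y`. Any other new vertices would be met by only `2(|Y| − 1)`
  -- edges, so there are none.
  isolated-case : ∀ {p} → Y p ≡ true → nb E p Y ≡ 0 → ⊥
  isolated-case {p} Yp none = case ⊆ᵛ⊎witness (rem p Y) ∅ᵛ of λ
    { (inj₁ empty) → case three-nbrs (node p Yp) of λ { (a , b , c , N) →
        irr (p , a , b , c , inj₂ (inj₂ (inj₁ (Yp , (λ w Yw → decidable-stable (w ≟ p) (λ w≢p → true≢false (empty w (rem-intro p Y w≢p Yw)) refl)) , N)))) }
    ; (inj₂ (v , h , _)) → linear 7 (λ i i' k k' d y r → i ⊕ k' ≐ i' ⊕ d ⇒ k' ≐ k ⇒ k ≐ κ 0 ⇒ d ≐ κ 3 ⇒ i ≐ 2 ⊗ y ⊕ κ 1 ⇒ y ≐ κ 1 ⊕ r ⇒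
          2 ⊗ r ⊕ κ 1 ≼ i' ⇒ ⊢⊥)
        (inc E Y) (inc E (rem p Y)) (nb E p Y) (nb E p (rem p Y)) (dg E p) (vcount Y) (vcount (rem p Y))
        (inc-rem es p Y Yp) (nb-rem es p Y) none (node p Yp) full (vcount-rem p Y Yp)
        (lower (rem p Y) (rem-⊆ p Y) (vcount-pos (rem p Y) v h)) }

  module LeafCase {p a b c} (N : Nbr3 E p a b c) (Yp : Y p ≡ true) (Ya : Y a ≡ true) (one : nb E p Y ≡ 1) where
    open Nbr3 N

    outside : ∀ {x} → x ≢ a → E p x ≡ true → Y x ≡ false
    outside x≢a px = ≢true⇒false λ Yx → <⇒≱ (nb₂ p Y x≢a px Yx pa Ya) (≤-reflexive one)

    -- `b` and `c` are old vertices, so neither kind of blocking set exists for the reduction adding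
    -- `ab`. Attachment is kept by a second leaf: it has at least two old neighbours, one of which
    -- differs from `b`.
    must : ∀ {b c} → Nbr3 E p a b c → E a b ≡ true
    must {b} {c} N' = ≢false⇒true λ ab → case another-leaf Yp one of λ { (p' , p'≢p , Yp' , le) →
      case ⊆ᵛ⊎witness (E p') (ins b Y) of λ
      { (inj₁ sub) → linear 3 (λ d k m → d ≐ κ 3 ⇒ k ≼ κ 1 ⇒ d ≼ m ⇒ m ≼ k ⊕ κ 1 ⇒ ⊢⊥) (dg E p') (nb E p' Y) (nb E p' (ins b Y))
          (node p' Yp') le
          (vcount-mono {A = E p'} {λ w → E p' w ∧ ins b Y w} (λ w h → ∧-intro h (sub w h)))
          (nb-ins≤ p' b)
      ; (inj₂ (z , p'z , z∉)) → irr (p , a , b , c , inj₁ (Yp , Ya , N' , ab ,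
          ((λ { (S , (S⊆Y , _) , _ , Sc , _) → true≢false (S⊆Y c Sc) (outside (Nbr3.a≢c N' ∘ sym) (Nbr3.pc N')) }) ,
           (λ { (Z , (Z⊆Y , _) , _ , Zb , _) → true≢false (Z⊆Y b Zb) (outside (Nbr3.a≢b N' ∘ sym) (Nbr3.pb N')) })) ,
          inj₂ (inj₂ (outside (Nbr3.a≢b N' ∘ sym) (Nbr3.pb N') , p' , z , p'≢p ,
            (λ { refl → true≢false (ins-self b Y) z∉ }) , Yp' ,
            ≢true⇒false (λ Yz → true≢false (ins-old b Y Yz) z∉) , p'z)))) } }
      where
      nb-ins≤ : ∀ v x → nb E v (ins x Y) ≤ nb E v Y + 1
      nb-ins≤ v x = ≤-trans (≤-trans (vcount-mono {A = λ w → E v w ∧ ins x Y w} {λ w → ins x (λ w → E v w ∧ Y w) w}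
          (λ w h → case ins-elim x Y {w} (∧-snd {E v w} h) of λ
            { (inj₁ refl) → ins-self x (λ w → E v w ∧ Y w)
            ; (inj₂ Yw) → ins-old x (λ w → E v w ∧ Y w) {w} (∧-intro (∧-fst {E v w} h) Yw) }))
          (≤-trans (m≤m+n _ _) (≤-reflexive (vcount-∪∩ (λ w → w == x) (λ w → E v w ∧ Y w)))))
        (≤-reflexive (trans (cong (_+ nb E v Y) (vcount-single x)) (+-comm 1 _)))

    -- `a` is adjacent to `p`, `b`, `c` only, so `p` and `a` together account for five edges. The
    -- other new vertices would be left with `2(|Y| − 2)` edges, one too few, unless there are none.
    absurd : ⊥
    absurd = case ⊆ᵛ⊎witness R₂ ∅ᵛ of λ
        { (inj₁ empty) → irr (p , a , b , c , inj₂ (inj₂ (inj₂ (inj₁ (Yp , Ya , only-two empty , N , Na)))))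
        ; (inj₂ (v , h , _)) → linear 11 (λ i i₁ i₂ k₁ k₁' k₂ dp da y r₁ r₂ → i ⊕ k₁' ≐ i₁ ⊕ dp ⇒ k₁' ≐ k₁ ⇒ k₁ ≐ κ 1 ⇒ i₁ ⊕ k₂ ≐ i₂ ⊕ da ⇒ k₂ ≐ κ 0 ⇒
              dp ≐ κ 3 ⇒ da ≐ κ 3 ⇒ i ≐ 2 ⊗ y ⊕ κ 1 ⇒ y ≐ κ 1 ⊕ r₁ ⇒ r₁ ≐ κ 1 ⊕ r₂ ⇒ 2 ⊗ r₂ ⊕ κ 1 ≼ i₂ ⇒ ⊢⊥)
            (inc E Y) (inc E R₁) (inc E R₂) (nb E p Y) (nb E p R₁) (nb E a R₂) (dg E p) (dg E a) (vcount Y) (vcount R₁) (vcount R₂)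
            (inc-rem es p Y Yp) (nb-rem es p Y) one (inc-rem es a R₁ a₁) none-a (node p Yp) (node a Ya) full
            (vcount-rem p Y Yp) (vcount-rem a R₁ a₁)
            (lower R₂ (λ w h → rem-⊆ p Y w (rem-⊆ a R₁ w h)) (vcount-pos R₂ v h)) }
      where
      R₁ R₂ : VS n
      R₁ = rem p Y
      R₂ = rem a R₁
      p≢a = ES-≢ es pa
      a₁ : R₁ a ≡ true
      a₁ = rem-intro p Y (p≢a ∘ sym) Ya
      Na : Nbr3 E a p b c
      Na = dg≡3⇒only (node a Ya) (ES-≢ es pb) (ES-≢ es pc) b≢c (ES-sym es pa) (must N) (must (nbr-acb N))
      none-a : nb E a R₂ ≡ 0
      none-a = vcount-∅ (λ w → E a w ∧ R₂ w) λ w → ≢true⇒false λ h → case Nbr3.only Na w (∧-fst {E a w} h) of λ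
        { (inj₁ refl) → rem-≢ p Y (rem-⊆ a R₁ w (∧-snd {E a w} h)) refl
        ; (inj₂ (inj₁ refl)) → true≢false (rem-⊆ p Y w (rem-⊆ a R₁ w (∧-snd {E a w} h))) (outside (a≢b ∘ sym) pb)
        ; (inj₂ (inj₂ refl)) → true≢false (rem-⊆ p Y w (rem-⊆ a R₁ w (∧-snd {E a w} h))) (outside (a≢c ∘ sym) pc) }
      only-two : R₂ ⊆ᵛ ∅ᵛ → ∀ w → Y w ≡ true → w ≡ p ⊎ w ≡ a
      only-two empty w Yw with w ≟ p | w ≟ a
      ... | yes e | _ = inj₁ e
      ... | no _ | yes e = inj₂ e
      ... | no wp | no wa = ⊥-elim (true≢false (empty w (rem-intro a R₁ wa (rem-intro p Y wp Yw))) refl)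

  absurd : ⊥
  absurd = case leaf of λ { (p , Yp , le) → go p Yp le }
    where
    go : ∀ p → Y p ≡ true → nb E p Y ≤ 1 → ⊥
    go p Yp le with 1 ≤? nb E p Y
    ... | no ¬one = isolated-case Yp (n<1⇒n≡0 (≰⇒> ¬one))
    ... | yes one = case vcount>0 (λ w → E p w ∧ Y w) one of λ { (a , h) →
        case two-nbrs (node p Yp) (∧-fst {E p a} h) of λ { (b , c , N) →
          LeafCase.absurd N Yp (∧-snd {E p a} h) (≤-antisym le one) } }

¬¬reducible : ∀ {n} {E : ES n} {Y : VS n} → Ear E Y → ¬ ¬ Reducible E Y
¬¬reducible {E = E} {Y} ear irr = AllNodes.absurd ear irr λ v Yv → case EarFacts.node⊎big ear Yv of λ
  { (inj₁ d) → d
  ; (inj₂ b) → ⊥-elim (no-big ear irr (vcount Y) Y ≤-refl ((λ _ h → h) , Ear.full ear) v Yv b) }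

-- Decidability of reducibility

⊆ᵛ? : ∀ {n} (S T : VS n) → Dec (S ⊆ᵛ T)
⊆ᵛ? S T = Fin.all? (λ v → (S v 𝔹.≟ true) →-dec (T v 𝔹.≟ true))

module _ {n} {E : ES n} {Y : VS n} where

  private
    _≗_ : VS n → VS n → Set
    S ≗ T = ∀ v → S v ≡ T v

    ⊆₁ : ∀ {S T} → S ≗ T → S ⊆ᵛ T
    ⊆₁ eq v h = trans (sym (eq v)) h

    ⊆₂ : ∀ {S T} → S ≗ T → T ⊆ᵛ S
    ⊆₂ eq v h = trans (eq v) h

  critical-resp : ∀ {S T} → S ≗ T → Critical E Y S → Critical E Y T
  critical-resp {S} {T} eq (sub , c) = (λ v h → sub v (⊆₂ eq v h)) ,
    trans (inc-ext E (⊆₂ eq) (⊆₁ eq)) (trans c (cong (λ x → 2 * x + 1) (vcount-cong (⊆₁ eq) (⊆₂ eq))))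

  tight-resp : ∀ {S T} → S ≗ T → Tight E Y S → Tight E Y T
  tight-resp {S} {T} eq (sub , c) = (λ v h → sub v (⊆₂ eq v h)) ,
    trans (cong (_+ 2) (ind-ext E (⊆₂ eq) (⊆₁ eq))) (trans c (cong (2 *_) (vcount-cong (⊆₁ eq) (⊆₂ eq))))

  unblocked? : ∀ p a b c → Dec (Unblocked E Y p a b c)
  unblocked? p a b c =
    ¬? (anyVS? (λ S → (⊆ᵛ? S Y ×-dec (_ ℕ.≟ _)) ×-dec (S p 𝔹.≟ true) ×-dec (S c 𝔹.≟ true) ×-dec (S a 𝔹.≟ false) ×-dec (S b 𝔹.≟ false))
      λ { eq (x , y , z , u , v) → critical-resp eq x , ⊆₁ eq p y , ⊆₁ eq c z , trans (sym (eq a)) u , trans (sym (eq b)) v }) ×-dec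
    ¬? (anyVS? (λ S → (⊆ᵛ? S Y ×-dec (_ ℕ.≟ _)) ×-dec (S a 𝔹.≟ true) ×-dec (S b 𝔹.≟ true) ×-dec (S p 𝔹.≟ false) ×-dec (S c 𝔹.≟ false))
      λ { eq (x , y , z , u , v) → tight-resp eq x , ⊆₁ eq a y , ⊆₁ eq b z , trans (sym (eq p)) u , trans (sym (eq c)) v })

  nbr3? : ∀ p a b c → Dec (Nbr3 E p a b c)
  nbr3? p a b c = map′
    (λ { (x , y , z , u , v , w , o) → nbr3 x y z u v w o })
    (λ { (nbr3 x y z u v w o) → x , y , z , u , v , w , o })
    (¬? (a ≟ b) ×-dec ¬? (a ≟ c) ×-dec ¬? (b ≟ c) ×-dec (E p a 𝔹.≟ true) ×-dec (E p b 𝔹.≟ true) ×-dec (E p c 𝔹.≟ true) ×-dec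
      Fin.all? (λ w → (E p w 𝔹.≟ true) →-dec ((w ≟ a) ⊎-dec (w ≟ b) ⊎-dec (w ≟ c))))

  nbr4? : ∀ p a b c d → Dec (Nbr4 E p a b c d)
  nbr4? p a b c d = map′
    (λ { (x , y , z , x' , y' , z' , u , v , w , t , o) → nbr4 x y z x' y' z' u v w t o })
    (λ { (nbr4 x y z x' y' z' u v w t o) → x , y , z , x' , y' , z' , u , v , w , t , o })
    (¬? (a ≟ b) ×-dec ¬? (a ≟ c) ×-dec ¬? (a ≟ d) ×-dec ¬? (b ≟ c) ×-dec ¬? (b ≟ d) ×-dec ¬? (c ≟ d) ×-dec
      (E p a 𝔹.≟ true) ×-dec (E p b 𝔹.≟ true) ×-dec (E p c 𝔹.≟ true) ×-dec (E p d 𝔹.≟ true) ×-dec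
      Fin.all? (λ w → (E p w 𝔹.≟ true) →-dec ((w ≟ a) ⊎-dec (w ≟ b) ⊎-dec (w ≟ c) ⊎-dec (w ≟ d))))

  reducible? : Dec (Reducible E Y)
  reducible? = Fin.any? λ p → Fin.any? λ a → Fin.any? λ b → Fin.any? λ c →
    ((Y p 𝔹.≟ true) ×-dec (Y a 𝔹.≟ true) ×-dec nbr3? p a b c ×-dec (E a b 𝔹.≟ false) ×-dec unblocked? p a b c ×-dec
      ((Y c 𝔹.≟ true) ⊎-dec (E a c 𝔹.≟ true) ⊎-dec ((Y b 𝔹.≟ false) ×-dec Fin.any? λ w → Fin.any? λ z →
        ¬? (w ≟ p) ×-dec ¬? (z ≟ b) ×-dec (Y w 𝔹.≟ true) ×-dec (Y z 𝔹.≟ false) ×-dec (E w z 𝔹.≟ true)))) ⊎-dec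
    ((Y p 𝔹.≟ true) ×-dec (Y a 𝔹.≟ true) ×-dec (Y b 𝔹.≟ true) ×-dec nbr3? p a b c ×-dec nbr3? a p b c ×-dec (E b c 𝔹.≟ false)) ⊎-dec
    ((Y p 𝔹.≟ true) ×-dec Fin.all? (λ w → (Y w 𝔹.≟ true) →-dec (w ≟ p)) ×-dec nbr3? p a b c) ⊎-dec
    ((Y p 𝔹.≟ true) ×-dec (Y a 𝔹.≟ true) ×-dec Fin.all? (λ w → (Y w 𝔹.≟ true) →-dec ((w ≟ p) ⊎-dec (w ≟ a))) ×-dec nbr3? p a b c ×-dec nbr3? a p b c) ⊎-dec
    Fin.any? λ d → (Y p 𝔹.≟ true) ×-dec (Y a 𝔹.≟ true) ×-dec (Y b 𝔹.≟ true) ×-dec nbr3? p a b c ×-dec nbr3? a p b c ×-dec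
      (E b c 𝔹.≟ true) ×-dec nbr4? b p a c d

abstract
  reducible : ∀ {n} {E : ES n} {Y : VS n} → Ear E Y → Reducible E Y
  reducible ear = decidable-stable reducible? (¬¬reducible ear)

-- The reduced graphs are connected

base-ext : ∀ {n} {D D' : ES n} {U : VS n} → Base D U → IsES D' → D ⊆ᵉ D' → D' ⊆ᵉ D → Base D' U
base-ext b es' D⊆ D'⊆ = record
  { base-es = es' ; connected = connected-ext D⊆ D'⊆ connected ; basis = basis ; basis-es = basis-es
  ; basis⊆ = λ i j h → D⊆ i j (basis⊆ i j h) ; basis-indep = basis-indep ; basis-count = basis-count }
  where open Base b

attached-nbr : ∀ {n} {E : ES n} {U Y : VS n} → Attached E U Y → ∀ {v} → Y v ≡ true → ∃[ w ] (E v w ≡ true)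
attached-nbr {n} {E} {U} {Y} att {v} Yv = case ecount>0 (touch E (ins v ∅ᵛ)) pos of λ { (i , j , h) → nbr i j h }
  where
  open Attached att
  pos : 1 ≤ inc E (ins v ∅ᵛ)
  pos = ≤-trans (m≤n+m 1 _) (lower (ins v ∅ᵛ) (ins-⊆ v ∅⊆ Yv) (vcount-pos (ins v ∅ᵛ) v (ins-self v ∅ᵛ)))
  nbr : ∀ i j → touch E (ins v ∅ᵛ) i j ≡ true → ∃[ w ] (E v w ≡ true)
  nbr i j h with touch-elim E (ins v ∅ᵛ) h
  ... | e , inj₁ k = case ins-elim v ∅ᵛ {i} k of λ { (inj₁ refl) → j , e }
  ... | e , inj₂ k = case ins-elim v ∅ᵛ {j} k of λ { (inj₁ refl) → i , ES-sym es e }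

dg-remV : ∀ {n} {E : ES n} {p v} → v ≢ p → E v p ≡ true → dg E v ≡ suc (dg (remV p E) v)
dg-remV {n} {E} {p} {v} v≢p vp = trans (vcount-rem p (E v) vp) (cong suc (vcount-cong {A = rem p (E v)} {remV p E v}
  (λ w h → ∧-intro (rem-⊆ p (E v) w h) (∧-intro (not-true (≢⇒== v≢p)) (∧-fst {not (w == p)} h)))
  (λ w h → ∧-intro (∧-snd {not (v == p)} (∧-snd {E v w} h)) (∧-fst h))))

remV-elim : ∀ {n} (E : ES n) p {i j} → remV p E i j ≡ true → E i j ≡ true × i ≢ p × j ≢ p
remV-elim E p {i} {j} h = ∧-fst h ,
  (λ e → true≢false (==-true e) (not-true⁻ (∧-fst (∧-snd {E i j} h)))) ,
  (λ e → true≢false (==-true e) (not-true⁻ (∧-snd {not (i == p)} (∧-snd {E i j} h))))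

remV-intro : ∀ {n} (E : ES n) p {i j} → E i j ≡ true → i ≢ p → j ≢ p → remV p E i j ≡ true
remV-intro E p h i≢p j≢p = ∧-intro h (∧-intro (not-true (≢⇒== i≢p)) (not-true (≢⇒== j≢p)))

remV-false : ∀ {n} (E : ES n) p {i j} → E i j ≡ false → remV p E i j ≡ false
remV-false E p {i} {j} h = cong (_∧ (not (i == p) ∧ not (j == p))) h

addE-elim : ∀ {n} (u v : Fin n) (E : ES n) {i j} → addE u v E i j ≡ true → E i j ≡ true ⊎ (i ≡ u × j ≡ v) ⊎ (i ≡ v × j ≡ u)
addE-elim u v E {i} {j} h with ∨-elim {E i j} h
... | inj₁ p = inj₁ p
... | inj₂ p = inj₂ (edge-elim u v {i} {j} p)

addE-new : ∀ {n} (u v : Fin n) (E : ES n) → addE u v E u v ≡ true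
addE-new u v E = ∨-introʳ {E u v} (edge-self u v)

addE-new' : ∀ {n} (u v : Fin n) (E : ES n) → addE u v E v u ≡ true
addE-new' u v E = ∨-introʳ {E v u} (edge-flip u v)

addE-old : ∀ {n} (u v : Fin n) (E : ES n) {i j} → E i j ≡ true → addE u v E i j ≡ true
addE-old u v E h = ∨-introˡ h

-- `V` marks the vertices that survive; a deleted vertex remains in the index type as an isolated
-- one until it is punched out.
record Connects {n} (E : ES n) (V : VS n) : Set where
  field
    c-es   : IsES E
    c-conn : Connected E
    c-nbr  : ∀ v → V v ≡ true → ∃[ w ] (E v w ≡ true)
open Connects public

module Realise {n} {E : ES n} {Y : VS n} (ear : Ear E Y) (base : Base (induce E (Y ᶜ)) (Y ᶜ))
  (grounded : ∀ v → Y v ≡ false → ∃[ w ] (induce E (Y ᶜ) v w ≡ true)) where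
  open Ear ear
  open EarFacts ear

  D : ES n
  D = induce E (Y ᶜ)

  -- If all edges at `Y` ended in `Y` or at `x`, then `ins x Y` would span `2|Y| + 1` edges, against
  -- `upper⁺`.
  anchor : ∀ x → ∃[ w ] ∃[ z ] (Y w ≡ true × Y z ≡ false × z ≢ x × E w z ≡ true)
  anchor x with ⊆ᵉ⊎witness (touch E Y) (induce E (ins x Y))
  ... | inj₁ sub = ⊥-elim (linear 3 (λ i j y → i ≼ j ⇒ j ≼ 2 ⊗ y ⇒ i ≐ 2 ⊗ y ⊕ κ 1 ⇒ ⊢⊥) (inc E Y) (ind E (ins x Y)) (vcount Y)
      (ecount-mono sub) few full)
    where
    few : ind E (ins x Y) ≤ 2 * vcount Y
    few = case true⊎false (Y x) of λ
      { (inj₂ Yx) → upper⁺ Y x (λ _ h → h) nonempty Yx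
      ; (inj₁ Yx) → ≤-trans (ind-mono {A = E} {E} {ins x Y} {Y} (λ _ _ h → h) (ins-⊆ x (λ _ h → h) Yx))
          (≤-trans (m≤m+n _ 2) (upper Y (λ _ h → h) nonempty)) }
  ... | inj₂ ((i , j) , t , no-ind) with touch-elim E Y {i} {j} t
  ...   | e , inj₁ Yi = i , j , Yi , ≢true⇒false (λ Yj → out (ins-old x Y Yj)) , (λ { refl → out (ins-self x Y) }) , e
    where
    out : ins x Y j ≡ true → ⊥
    out h = true≢false (induce-intro E (ins x Y) {i} {j} e (ins-old x Y Yi) h) no-ind
  ...   | e , inj₂ Yj = j , i , Yj , ≢true⇒false (λ Yi → out (ins-old x Y Yi)) , (λ { refl → out (ins-self x Y) }) , ES-sym es e
    where
    out : ins x Y i ≡ true → ⊥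
    out h = true≢false (induce-intro E (ins x Y) {i} {j} e h (ins-old x Y Yj)) no-ind

  Anchored : ES n → VS n → Set
  Anchored E' Y' = ∃[ x ] ∃[ x' ] ∃[ w ] ∃[ w' ] (x ≢ x' × Y' x ≡ false × Y' x' ≡ false ×
    Y' w ≡ true × Y' w' ≡ true × E' w x ≡ true × E' w' x' ≡ true)

  -- Two distinct old neighbours exist by `anchor`. It suffices that each old neighbour of `Y`
  -- retains some neighbour among the surviving new vertices.
  anchored : ∀ {E' Y'} → Y' ⊆ᵛ Y → (∀ w x → Y w ≡ true → Y x ≡ false → E w x ≡ true → ∃[ w' ] (Y' w' ≡ true × E' w' x ≡ true)) →
    Anchored E' Y'
  anchored {E'} {Y'} Y'⊆Y persist = case vcount>0 Y nonempty of λ { (y , Yy) →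
    case anchor y of λ { (w₁ , x₁ , Yw₁ , Yx₁ , _ , e₁) →
    case anchor x₁ of λ { (w₂ , x₂ , Yw₂ , Yx₂ , x₂≢x₁ , e₂) →
    case persist w₁ x₁ Yw₁ Yx₁ e₁ of λ { (w₁' , Yw₁' , e₁') →
    case persist w₂ x₂ Yw₂ Yx₂ e₂ of λ { (w₂' , Yw₂' , e₂') →
      x₁ , x₂ , w₁' , w₂' , (λ e → x₂≢x₁ (sym e)) , not-in Yx₁ , not-in Yx₂ , Yw₁' , Yw₂' , e₁' , e₂' } } } } }
    where
    not-in : ∀ {x} → Y x ≡ false → Y' x ≡ false
    not-in {x} h = ≢true⇒false (λ k → true≢false (Y'⊆Y x k) h)

  attached-self : Attached E (Y ᶜ) Y
  attached-self = record
    { es = es ; covered = λ i j h → complement (Y i) ; disjoint = λ v h → not-true⁻ h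
    ; nonempty = nonempty ; full = full ; lower = lower ; upper = upper
    ; attached = anchored {E} {Y} (λ _ h → h) (λ w x Yw _ e → w , Yw , e) }
    where
    complement : ∀ b → not b ∨ b ≡ true
    complement true  = refl
    complement false = refl

  attached-reduced : ∀ {E' Y'} → Attached E' (Y ᶜ) Y' → Y' ⊆ᵛ Y → (∀ i j → D i j ≡ true → E' i j ≡ true) →
    (∀ i j → E' i j ≡ true → Y' i ≡ false → Y' j ≡ false → D i j ≡ true) → Connected E'
  attached-reduced {E'} {Y'} att Y'⊆Y keep new = attached-connected att
    (base-ext base (IsES-induce (Y' ᶜ) (Attached.es att))
      (λ i j h → case induce-elim E (Y ᶜ) {i} {j} h of λ { (_ , a , b) → induce-intro E' (Y' ᶜ) (keep i j h) (widen i a) (widen j b) })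
      (λ i j h → case induce-elim E' (Y' ᶜ) {i} {j} h of λ { (e , a , b) → new i j e (not-true⁻ a) (not-true⁻ b) }))
    where
    widen : ∀ v → (Y ᶜ) v ≡ true → (Y' ᶜ) v ≡ true
    widen v h = not-true (≢true⇒false (λ k → true≢false (Y'⊆Y v k) (not-true⁻ h)))

  module Reduce₁ {p a b c} (r : Reducible₁ E Y p a b c) where
    Yp = proj₁ r
    Ya = proj₁ (proj₂ r)
    N = proj₁ (proj₂ (proj₂ r))
    ab = proj₁ (proj₂ (proj₂ (proj₂ r)))
    noS = proj₁ (proj₁ (proj₂ (proj₂ (proj₂ (proj₂ r)))))
    noZ = proj₂ (proj₁ (proj₂ (proj₂ (proj₂ (proj₂ r)))))
    keep-c = proj₂ (proj₂ (proj₂ (proj₂ (proj₂ r))))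
    open Nbr3 N
    p≢a = ES-≢ es pa
    p≢b = ES-≢ es pb

    E₀ E' : ES n
    E₀ = remV p E
    E' = addE a b E₀
    Y' : VS n
    Y' = rem p Y
    es₀ : IsES E₀
    es₀ = IsES-remV p es
    ab₀ : E₀ a b ≡ false
    ab₀ = remV-false E p ab
    es' : IsES E'
    es' = IsES-addE a≢b es₀
    a' : Y' a ≡ true
    a' = rem-intro p Y (p≢a ∘ sym) Ya

    dp : dg E p ≡ 3
    dp = nbr3⇒dg N

    inc' : ∀ S → inc E' S ≡ inc E₀ S + ⟦ S a ∨ S b ⟧
    inc' S = inc-addE es₀ S a≢b ab₀

    full' : inc E' Y' ≡ 2 * vcount Y' + 1
    full' = linear 8 (λ i i₀ j j' d y y' t → i ≐ i₀ ⊕ t ⇒ t ≐ κ 1 ⇒ j' ≐ i₀ ⊕ d ⇒ j' ≐ j ⇒ j ≐ 2 ⊗ y ⊕ κ 1 ⇒ d ≐ κ 3 ⇒ y ≐ κ 1 ⊕ y' ⇒ ⊢ i ≐ 2 ⊗ y' ⊕ κ 1)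
      (inc E' Y') (inc E₀ Y') (inc E Y) (inc E (ins p Y')) (dg E p) (vcount Y) (vcount Y') ⟦ Y' a ∨ Y' b ⟧
      (inc' Y') (cong ⟦_⟧ (∨-introˡ {Y' a} {Y' b} a')) (inc-remV es p Y') (inc-ext E (ins-rem-⊆ p Y Yp) (⊆-ins-rem p Y)) full dp (vcount-rem p Y Yp)

    -- The count is compared with that of `S` and `p` together: three edges go with `p`, and `ab`
    -- returns one if `S` contains `a` or `b`. Only when `S` contains `c` but neither of these is a
    -- critical set the obstruction.
    lower' : ∀ S → S ⊆ᵛ Y' → 1 ≤ vcount S → 2 * vcount S + 1 ≤ inc E' S
    lower' S S⊆ pos = go (true⊎false (S a ∨ S b)) (true⊎false (S c))
      where
      Sp : S p ≡ false
      Sp = ≢true⇒false (λ h → true≢false (S⊆ p h) (rem-self p Y))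
      S⊆Y : S ⊆ᵛ Y
      S⊆Y v h = rem-⊆ p Y v (S⊆ v h)
      size : vcount (ins p S) ≡ suc (vcount S)
      size = vcount-ins p S Sp
      low : 2 * vcount (ins p S) + 1 ≤ inc E (ins p S)
      low = lower (ins p S) (ins-⊆ p S⊆Y Yp) (vcount-pos (ins p S) p (ins-self p S))
      go : S a ∨ S b ≡ true ⊎ S a ∨ S b ≡ false → S c ≡ true ⊎ S c ≡ false → 2 * vcount S + 1 ≤ inc E' S
      go (inj₁ t) _ = linear 7 (λ i i₀ j d s s' t → i ≐ i₀ ⊕ t ⇒ t ≐ κ 1 ⇒ j ≐ i₀ ⊕ d ⇒ d ≐ κ 3 ⇒ 2 ⊗ s' ⊕ κ 1 ≼ j ⇒ s' ≐ κ 1 ⊕ s ⇒ ⊢ 2 ⊗ s ⊕ κ 1 ≼ i)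
        (inc E' S) (inc E₀ S) (inc E (ins p S)) (dg E p) (vcount S) (vcount (ins p S)) ⟦ S a ∨ S b ⟧
        (inc' S) (cong ⟦_⟧ t) (inc-remV es p S) dp low size
      go (inj₂ t) (inj₂ Sc) = linear 6 (λ i i₀ j k s t → i ≐ i₀ ⊕ t ⇒ j ≐ i₀ ⊕ k ⇒ k ≐ κ 0 ⇒ 2 ⊗ s ⊕ κ 1 ≼ j ⇒ ⊢ 2 ⊗ s ⊕ κ 1 ≼ i)
        (inc E' S) (inc E₀ S) (inc E S) (nb E p S) (vcount S) ⟦ S a ∨ S b ⟧
        (inc' S) (inc-remV' es p S Sp) (vcount-∅ (λ w → E p w ∧ S w) λ w → ≢true⇒false λ h → case only w (∧-fst {E p w} h) of λ
          { (inj₁ refl) → true≢false (∨-introˡ (∧-snd {E p w} h)) t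
          ; (inj₂ (inj₁ refl)) → true≢false (∨-introʳ {S a} (∧-snd {E p w} h)) t
          ; (inj₂ (inj₂ refl)) → true≢false (∧-snd {E p w} h) Sc })
        (lower S S⊆Y pos)
      go (inj₂ t) (inj₁ Sc) = linear 7 (λ i i₀ j d s s' t → i ≐ i₀ ⊕ t ⇒ j ≐ i₀ ⊕ d ⇒ d ≐ κ 3 ⇒ κ 1 ⊕ (2 ⊗ s' ⊕ κ 1) ≼ j ⇒ s' ≐ κ 1 ⊕ s ⇒ ⊢ 2 ⊗ s ⊕ κ 1 ≼ i)
        (inc E' S) (inc E₀ S) (inc E (ins p S)) (dg E p) (vcount S) (vcount (ins p S)) ⟦ S a ∨ S b ⟧
        (inc' S) (inc-remV es p S) dp
        (≤∧≢⇒< low λ eq → noS (ins p S , (ins-⊆ p S⊆Y Yp , sym eq) , ins-self p S , ins-old p S Sc ,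
          ins-not p S (p≢a ∘ sym) (≢true⇒false λ h → true≢false (∨-introˡ h) t) ,
          ins-not p S (p≢b ∘ sym) (≢true⇒false λ h → true≢false (∨-introʳ {S a} h) t))) size

    -- The new edge matters only if `S` contains `a` and `b`. If it also contains `c`, then `p` has
    -- three neighbours in it and `S` already has slack; otherwise tightness is excluded by
    -- hypothesis.
    upper' : ∀ S → S ⊆ᵛ Y' → 1 ≤ vcount S → ind E' S + 2 ≤ 2 * vcount S
    upper' S S⊆ pos = go (true⊎false (S a ∧ S b)) (true⊎false (S c))
      where
      Sp : S p ≡ false
      Sp = ≢true⇒false (λ h → true≢false (S⊆ p h) (rem-self p Y))
      S⊆Y : S ⊆ᵛ Y
      S⊆Y v h = rem-⊆ p Y v (S⊆ v h)
      ind' : ind E' S ≡ ind E S + ⟦ S a ∧ S b ⟧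
      ind' = trans (ind-addE es₀ S a≢b ab₀) (cong (_+ ⟦ S a ∧ S b ⟧) (ind-remV es p S Sp))
      go : S a ∧ S b ≡ true ⊎ S a ∧ S b ≡ false → S c ≡ true ⊎ S c ≡ false → ind E' S + 2 ≤ 2 * vcount S
      go (inj₂ t) _ = linear 4 (λ i j s t → i ≐ j ⊕ t ⇒ t ≐ κ 0 ⇒ j ⊕ κ 2 ≼ 2 ⊗ s ⇒ ⊢ i ⊕ κ 2 ≼ 2 ⊗ s)
        (ind E' S) (ind E S) (vcount S) ⟦ S a ∧ S b ⟧ ind' (cong ⟦_⟧ t) (upper S S⊆Y pos)
      go (inj₁ t) (inj₁ Sc) = linear 6 (λ i j j' k s t → i ≐ j ⊕ t ⇒ t ≐ κ 1 ⇒ j' ≐ j ⊕ k ⇒ κ 3 ≼ k ⇒ j' ≼ 2 ⊗ s ⇒ ⊢ i ⊕ κ 2 ≼ 2 ⊗ s)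
        (ind E' S) (ind E S) (ind E (ins p S)) (nb E p S) (vcount S) ⟦ S a ∧ S b ⟧
        ind' (cong ⟦_⟧ t) (ind-ins es p S Sp) (nb₃ p S a≢b a≢c b≢c pa (∧-fst t) pb (∧-snd {S a} t) pc Sc) (bound S p S⊆Y pos Sp)
      go (inj₁ t) (inj₂ Sc) = linear 4 (λ i j s t → i ≐ j ⊕ t ⇒ t ≐ κ 1 ⇒ κ 1 ⊕ (j ⊕ κ 2) ≼ 2 ⊗ s ⇒ ⊢ i ⊕ κ 2 ≼ 2 ⊗ s)
        (ind E' S) (ind E S) (vcount S) ⟦ S a ∧ S b ⟧ ind' (cong ⟦_⟧ t)
        (≤∧≢⇒< (upper S S⊆Y pos) λ eq → noZ (S , (S⊆Y , eq) , ∧-fst t , ∧-snd {S a} t , Sp , Sc))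

    anchored' : Anchored E' Y'
    anchored' = case keep-c of λ
      { (inj₁ Yc) → anchored {E'} {Y'} (rem-⊆ p Y) (persist (λ Yc' → ⊥-elim (true≢false Yc Yc')))
      ; (inj₂ (inj₁ ac)) → anchored {E'} {Y'} (rem-⊆ p Y) (persist (λ _ → ac))
      ; (inj₂ (inj₂ (Yb , w , z , w≢p , z≢b , Yw , Yz , wz))) →
          b , z , a , w , (z≢b ∘ sym) , rem-not p Y Yb , rem-not p Y Yz , a' , rem-intro p Y w≢p Yw ,
          addE-new a b E₀ , addE-old a b E₀ (remV-intro E p wz w≢p (λ { refl → true≢false Yp Yz })) }
      where
      persist : (Y c ≡ false → E a c ≡ true) → ∀ w x → Y w ≡ true → Y x ≡ false → E w x ≡ true → ∃[ w' ] (Y' w' ≡ true × E' w' x ≡ true)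
      persist ac w x Yw Yx wx with w ≟ p
      ... | no w≢p = w , rem-intro p Y w≢p Yw , addE-old a b E₀ (remV-intro E p wx w≢p (λ { refl → true≢false Yp Yx }))
      ... | yes refl with only x wx
      ...   | inj₁ refl = ⊥-elim (true≢false Ya Yx)
      ...   | inj₂ (inj₁ refl) = a , a' , addE-new a b E₀
      ...   | inj₂ (inj₂ refl) = a , a' , addE-old a b E₀ (remV-intro E p (ac Yx) (p≢a ∘ sym) (ES-≢ es pc ∘ sym))

    ≢p : ∀ i j → E' i j ≡ true → i ≢ p
    ≢p i j h refl with addE-elim a b E₀ {i} {j} h
    ... | inj₁ k = proj₁ (proj₂ (remV-elim E p k)) refl
    ... | inj₂ (inj₁ (refl , _)) = p≢a refl
    ... | inj₂ (inj₂ (refl , _)) = p≢b refl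

    att : Attached E' (Y ᶜ) Y'
    att = record
      { es = es'
      ; covered = λ i j h → case true⊎false (Y i) of λ
          { (inj₁ Yi) → ∨-introʳ {not (Y i)} (rem-intro p Y (≢p i j h) Yi) ; (inj₂ Yi) → ∨-introˡ (not-true Yi) }
      ; disjoint = λ v h → rem-not p Y (not-true⁻ h)
      ; nonempty = vcount-pos Y' a a' ; full = full' ; lower = lower' ; upper = upper' ; attached = anchored' }

    outer : ∀ {i j} → E' i j ≡ true → Y' i ≡ false → Y i ≡ false
    outer {i} {j} h Y'i = ≢true⇒false (λ Yi → true≢false (rem-intro p Y (≢p i j h) Yi) Y'i)

    keep-D : ∀ i j → D i j ≡ true → E' i j ≡ true
    keep-D i j h = case induce-elim E (Y ᶜ) {i} {j} h of λ { (e , x , y) → addE-old a b E₀ (remV-intro E p e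
      (λ { refl → true≢false Yp (not-true⁻ x) }) (λ { refl → true≢false Yp (not-true⁻ y) })) }

    result : Connects E' (λ v → not (v == p))
    result = record
      { c-es = es'
      ; c-conn = attached-reduced att (rem-⊆ p Y) keep-D λ i j h x y → case addE-elim a b E₀ {i} {j} h of λ
          { (inj₁ k) → induce-intro E (Y ᶜ) (proj₁ (remV-elim E p k)) (not-true (outer h x)) (not-true (outer (ES-sym es' h) y))
          ; (inj₂ (inj₁ (refl , _))) → ⊥-elim (true≢false a' x)
          ; (inj₂ (inj₂ (_ , refl))) → ⊥-elim (true≢false a' y) }
      ; c-nbr = λ v v≢p → case true⊎false (Y v) of λ
          { (inj₁ Yv) → attached-nbr att {v} (rem-intro p Y (λ e → true≢false (==-true e) (not-true⁻ v≢p)) Yv)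
          ; (inj₂ Yv) → case grounded v Yv of λ { (w , h) → w , keep-D v w h } } }

  -- Two vertices and `3 + 3 − 1 = 5` edges disappear and one edge appears, a balance of
  -- `4 = 2 · 2`.
  module Reduce₂ {p a b c} (r : Reducible₂ E Y p a b c) where
    Yp = proj₁ r
    Ya = proj₁ (proj₂ r)
    Yb = proj₁ (proj₂ (proj₂ r))
    N = proj₁ (proj₂ (proj₂ (proj₂ r)))
    Na = proj₁ (proj₂ (proj₂ (proj₂ (proj₂ r))))
    bc = proj₂ (proj₂ (proj₂ (proj₂ (proj₂ r))))
    open Nbr3 N
    open Nbr3 Na using () renaming (pb to ab; pc to ac; only to only-a)
    ap = ES-sym es pa
    p≢a = ES-≢ es pa
    p≢b = ES-≢ es pb
    p≢c = ES-≢ es pc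

    E₀ E₁ E' : ES n
    E₀ = remV p E
    E₁ = remV a E₀
    E' = addE b c E₁
    Y' : VS n
    Y' = rem a (rem p Y)
    es₀ : IsES E₀
    es₀ = IsES-remV p es
    es₁ : IsES E₁
    es₁ = IsES-remV a es₀
    bc₁ : E₁ b c ≡ false
    bc₁ = remV-false E₀ a (remV-false E p bc)
    es' : IsES E'
    es' = IsES-addE b≢c es₁
    a₁ : rem p Y a ≡ true
    a₁ = rem-intro p Y (p≢a ∘ sym) Ya
    b' : Y' b ≡ true
    b' = rem-intro a (rem p Y) (a≢b ∘ sym) (rem-intro p Y (p≢b ∘ sym) Yb)
    Y'⊆Y : Y' ⊆ᵛ Y
    Y'⊆Y v h = rem-⊆ p Y v (rem-⊆ a (rem p Y) v h)
    dp : dg E p ≡ 3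
    dp = nbr3⇒dg N
    da : dg E a ≡ suc (dg E₀ a)
    da = dg-remV {E = E} (p≢a ∘ sym) ap

    inc₁ : ∀ S → inc E (ins p (ins a S)) ≡ inc E₁ S + 5
    inc₁ S = linear 6 (λ i i₀ i₁ dp da d₀ → i ≐ i₀ ⊕ dp ⇒ i₀ ≐ i₁ ⊕ d₀ ⇒ dp ≐ κ 3 ⇒ da ≐ κ 1 ⊕ d₀ ⇒ da ≐ κ 3 ⇒ ⊢ i ≐ i₁ ⊕ κ 5)
      (inc E (ins p (ins a S))) (inc E₀ (ins a S)) (inc E₁ S) (dg E p) (dg E a) (dg E₀ a)
      (inc-remV es p (ins a S)) (inc-remV es₀ a S) dp da (nbr3⇒dg Na)

    inc' : ∀ S → inc E' S ≡ inc E₁ S + ⟦ S b ∨ S c ⟧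
    inc' S = inc-addE es₁ S b≢c bc₁

    full' : inc E' Y' ≡ 2 * vcount Y' + 1
    full' = linear 8 (λ i i₁ j j' y y₁ y' t → i ≐ i₁ ⊕ t ⇒ t ≐ κ 1 ⇒ j' ≐ i₁ ⊕ κ 5 ⇒ j' ≐ j ⇒ j ≐ 2 ⊗ y ⊕ κ 1 ⇒ y ≐ κ 1 ⊕ y₁ ⇒ y₁ ≐ κ 1 ⊕ y' ⇒ ⊢ i ≐ 2 ⊗ y' ⊕ κ 1)
      (inc E' Y') (inc E₁ Y') (inc E Y) (inc E (ins p (ins a Y'))) (vcount Y) (vcount (rem p Y)) (vcount Y') ⟦ Y' b ∨ Y' c ⟧
      (inc' Y') (cong ⟦_⟧ (∨-introˡ {Y' b} {Y' c} b')) (inc₁ Y')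
      (inc-ext E (ins-⊆ p (ins-⊆ a Y'⊆Y Ya) Yp)
        (λ v h → case ins-elim p (rem p Y) {v} (⊆-ins-rem p Y v h) of λ
          { (inj₁ refl) → ins-self v (ins a Y')
          ; (inj₂ k) → ins-old p (ins a Y') {v} (⊆-ins-rem a (rem p Y) v k) }))
      full (vcount-rem p Y Yp) (vcount-rem a (rem p Y) a₁)

    module Sub (S : VS n) (S⊆ : S ⊆ᵛ Y') (pos : 1 ≤ vcount S) where
      Sa : S a ≡ false
      Sa = ≢true⇒false (λ h → true≢false (S⊆ a h) (rem-self a (rem p Y)))
      Sp : S p ≡ false
      Sp = ≢true⇒false (λ h → true≢false (rem-⊆ a (rem p Y) p (S⊆ p h)) (rem-self p Y))
      S⊆Y : S ⊆ᵛ Y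
      S⊆Y v h = Y'⊆Y v (S⊆ v h)
      pa∉ : ins a S p ≡ false
      pa∉ = ins-not a S p≢a Sp
      ap∉ : ins p S a ≡ false
      ap∉ = ins-not p S (p≢a ∘ sym) Sa
      size : vcount (ins p (ins a S)) ≡ 2 + vcount S
      size = trans (vcount-ins p (ins a S) pa∉) (cong suc (vcount-ins a S Sa))

      lower' : 2 * vcount S + 1 ≤ inc E' S
      lower' = go (true⊎false (S b ∨ S c))
        where
        go : S b ∨ S c ≡ true ⊎ S b ∨ S c ≡ false → 2 * vcount S + 1 ≤ inc E' S
        go (inj₁ t) = linear 6 (λ i i₁ j s s' t → i ≐ i₁ ⊕ t ⇒ t ≐ κ 1 ⇒ j ≐ i₁ ⊕ κ 5 ⇒ 2 ⊗ s' ⊕ κ 1 ≼ j ⇒ s' ≐ κ 2 ⊕ s ⇒ ⊢ 2 ⊗ s ⊕ κ 1 ≼ i)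
          (inc E' S) (inc E₁ S) (inc E (ins p (ins a S))) (vcount S) (vcount (ins p (ins a S))) ⟦ S b ∨ S c ⟧
          (inc' S) (cong ⟦_⟧ t) (inc₁ S)
          (lower (ins p (ins a S)) (ins-⊆ p (ins-⊆ a S⊆Y Ya) Yp) (vcount-pos (ins p (ins a S)) p (ins-self p (ins a S)))) size
        go (inj₂ t) = linear 8 (λ i i₁ i₀ j k k₀ s t → i ≐ i₁ ⊕ t ⇒ j ≐ i₀ ⊕ k ⇒ k ≐ κ 0 ⇒ i₀ ≐ i₁ ⊕ k₀ ⇒ k₀ ≐ κ 0 ⇒ 2 ⊗ s ⊕ κ 1 ≼ j ⇒ ⊢ 2 ⊗ s ⊕ κ 1 ≼ i)
          (inc E' S) (inc E₁ S) (inc E₀ S) (inc E S) (nb E p S) (nb E₀ a S) (vcount S) ⟦ S b ∨ S c ⟧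
          (inc' S) (inc-remV' es p S Sp)
          (vcount-∅ (λ w → E p w ∧ S w) λ w → ≢true⇒false λ h → case only w (∧-fst {E p w} h) of λ
            { (inj₁ refl) → true≢false (∧-snd {E p w} h) Sa
            ; (inj₂ (inj₁ refl)) → true≢false (∨-introˡ (∧-snd {E p w} h)) t
            ; (inj₂ (inj₂ refl)) → true≢false (∨-introʳ {S b} (∧-snd {E p w} h)) t })
          (inc-remV' es₀ a S Sa)
          (vcount-∅ (λ w → E₀ a w ∧ S w) λ w → ≢true⇒false λ h → case only-a w (∧-fst (∧-fst {E₀ a w} h)) of λ
            { (inj₁ refl) → true≢false (∧-snd {E₀ a w} h) Sp
            ; (inj₂ (inj₁ refl)) → true≢false (∨-introˡ (∧-snd {E₀ a w} h)) t
            ; (inj₂ (inj₂ refl)) → true≢false (∨-introʳ {S b} (∧-snd {E₀ a w} h)) t })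
          (lower S S⊆Y pos)

      ind' : ind E' S ≡ ind E S + ⟦ S b ∧ S c ⟧
      ind' = trans (ind-addE es₁ S b≢c bc₁) (cong (_+ ⟦ S b ∧ S c ⟧) (trans (ind-remV es₀ a S Sa) (ind-remV es p S Sp)))

      upper' : ind E' S + 2 ≤ 2 * vcount S
      upper' = go (true⊎false (S b ∧ S c))
        where
        go : S b ∧ S c ≡ true ⊎ S b ∧ S c ≡ false → ind E' S + 2 ≤ 2 * vcount S
        go (inj₂ t) = linear 4 (λ i j s t → i ≐ j ⊕ t ⇒ t ≐ κ 0 ⇒ j ⊕ κ 2 ≼ 2 ⊗ s ⇒ ⊢ i ⊕ κ 2 ≼ 2 ⊗ s)
          (ind E' S) (ind E S) (vcount S) ⟦ S b ∧ S c ⟧ ind' (cong ⟦_⟧ t) (upper S S⊆Y pos)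
        -- Adding `p` and then `a` to `S` brings two and then three edges, so the sparsity bound on
        -- the larger set leaves room for `bc` inside `S`.
        go (inj₁ t) = linear 9 (λ i j j₁ j₂ k₁ k₂ s s₁ t → i ≐ j ⊕ t ⇒ t ≐ κ 1 ⇒ j₁ ≐ j ⊕ k₁ ⇒ κ 2 ≼ k₁ ⇒ j₂ ≐ j₁ ⊕ k₂ ⇒ κ 3 ≼ k₂ ⇒
            j₂ ≼ 2 ⊗ s₁ ⇒ s₁ ≐ κ 1 ⊕ s ⇒ ⊢ i ⊕ κ 2 ≼ 2 ⊗ s)
          (ind E' S) (ind E S) (ind E (ins p S)) (ind E (ins a (ins p S))) (nb E p S) (nb E a (ins p S)) (vcount S) (vcount (ins p S)) ⟦ S b ∧ S c ⟧
          ind' (cong ⟦_⟧ t) (ind-ins es p S Sp) (nb₂ p S b≢c pb Sb pc Sc) (ind-ins es a (ins p S) ap∉)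
          (nb₃ a (ins p S) p≢b p≢c b≢c ap (ins-self p S) ab (ins-old p S Sb) ac (ins-old p S Sc))
          (bound (ins p S) a (ins-⊆ p S⊆Y Yp) (vcount-pos (ins p S) p (ins-self p S)) ap∉) (vcount-ins p S Sp)
          where
          Sb : S b ≡ true
          Sb = ∧-fst t
          Sc : S c ≡ true
          Sc = ∧-snd {S b} t

    keep-edge : ∀ {i j} → E i j ≡ true → i ≢ p → j ≢ p → i ≢ a → j ≢ a → E' i j ≡ true
    keep-edge e ip jp ia ja = addE-old b c E₁ (remV-intro E₀ a (remV-intro E p e ip jp) ia ja)

    anchored' : Anchored E' Y'
    anchored' = anchored {E'} {Y'} Y'⊆Y persist
      where
      persist : ∀ w x → Y w ≡ true → Y x ≡ false → E w x ≡ true → ∃[ w' ] (Y' w' ≡ true × E' w' x ≡ true)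
      persist w x Yw Yx wx with w ≟ p | w ≟ a
      ... | no w≢p | no w≢a = w , rem-intro a (rem p Y) w≢a (rem-intro p Y w≢p Yw) ,
            keep-edge wx w≢p (λ { refl → true≢false Yp Yx }) w≢a (λ { refl → true≢false Ya Yx })
      ... | yes refl | _ = case only x wx of λ
            { (inj₁ refl) → ⊥-elim (true≢false Ya Yx) ; (inj₂ (inj₁ refl)) → ⊥-elim (true≢false Yb Yx)
            ; (inj₂ (inj₂ refl)) → b , b' , addE-new b c E₁ }
      ... | no _ | yes refl = case only-a x wx of λ
            { (inj₁ refl) → ⊥-elim (true≢false Yp Yx) ; (inj₂ (inj₁ refl)) → ⊥-elim (true≢false Yb Yx)
            ; (inj₂ (inj₂ refl)) → b , b' , addE-new b c E₁ }

    old-or-new : ∀ {i j} → E' i j ≡ true → (E i j ≡ true × i ≢ p × i ≢ a) ⊎ (i ≡ b × j ≡ c) ⊎ (i ≡ c × j ≡ b)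
    old-or-new {i} {j} h = case addE-elim b c E₁ {i} {j} h of λ
      { (inj₂ k) → inj₂ k
      ; (inj₁ k) → case remV-elim E₀ a {i} {j} k of λ { (k₀ , ia , _) → case remV-elim E p {i} {j} k₀ of λ { (e , ip , _) → inj₁ (e , ip , ia) } } }

    ≢pa : ∀ i j → E' i j ≡ true → i ≢ p × i ≢ a
    ≢pa i j h = case old-or-new {i} {j} h of λ
      { (inj₁ (_ , ip , ia)) → ip , ia
      ; (inj₂ (inj₁ (refl , _))) → (p≢b ∘ sym) , (a≢b ∘ sym)
      ; (inj₂ (inj₂ (refl , _))) → (p≢c ∘ sym) , (a≢c ∘ sym) }

    into : ∀ {i j} → E' i j ≡ true → Y i ≡ true → Y' i ≡ true
    into {i} {j} h Yi = rem-intro a (rem p Y) (proj₂ (≢pa i j h)) (rem-intro p Y (proj₁ (≢pa i j h)) Yi)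

    att : Attached E' (Y ᶜ) Y'
    att = record
      { es = es'
      ; covered = λ i j h → case true⊎false (Y i) of λ
          { (inj₁ Yi) → ∨-introʳ {not (Y i)} (into {i} {j} h Yi) ; (inj₂ Yi) → ∨-introˡ (not-true Yi) }
      ; disjoint = λ v h → ≢true⇒false (λ k → true≢false (Y'⊆Y v k) (not-true⁻ h))
      ; nonempty = vcount-pos Y' b b' ; full = full'
      ; lower = λ S S⊆ pos → Sub.lower' S S⊆ pos ; upper = λ S S⊆ pos → Sub.upper' S S⊆ pos ; attached = anchored' }

    outer : ∀ {i j} → E' i j ≡ true → Y' i ≡ false → Y i ≡ false
    outer {i} {j} h Y'i = ≢true⇒false (λ Yi → true≢false (into {i} {j} h Yi) Y'i)

    keep-D : ∀ i j → D i j ≡ true → E' i j ≡ true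
    keep-D i j h = case induce-elim E (Y ᶜ) {i} {j} h of λ { (e , x , y) → keep-edge e
      (λ { refl → true≢false Yp (not-true⁻ x) }) (λ { refl → true≢false Yp (not-true⁻ y) })
      (λ { refl → true≢false Ya (not-true⁻ x) }) (λ { refl → true≢false Ya (not-true⁻ y) }) }

    result : Connects E' (λ v → not (v == p) ∧ not (v == a))
    result = record
      { c-es = es'
      ; c-conn = attached-reduced att Y'⊆Y keep-D λ i j h x y → case old-or-new {i} {j} h of λ
          { (inj₁ (e , _)) → induce-intro E (Y ᶜ) e (not-true (outer {i} {j} h x)) (not-true (outer {j} {i} (ES-sym es' h) y))
          ; (inj₂ (inj₁ (refl , _))) → ⊥-elim (true≢false b' x)
          ; (inj₂ (inj₂ (_ , refl))) → ⊥-elim (true≢false b' y) }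
      ; c-nbr = λ v h → case true⊎false (Y v) of λ
          { (inj₁ Yv) → attached-nbr att {v} (rem-intro a (rem p Y)
              (λ e → true≢false (==-true e) (not-true⁻ (∧-snd {not (v == p)} h)))
              (rem-intro p Y (λ e → true≢false (==-true e) (not-true⁻ (∧-fst h))) Yv))
          ; (inj₂ Yv) → case grounded v Yv of λ { (w , k) → w , keep-D v w k } } }

  -- `b` takes four edges with it and `da`, `dp` appear, a balance of two for one vertex. The
  -- triangle of `p`, `a` and `b` makes up for the lack of a condition on blocking sets.
  module Reduce₅ {p a b c d} (r : Reducible₅ E Y p a b c d) where
    Yp = proj₁ r
    Ya = proj₁ (proj₂ r)
    Yb = proj₁ (proj₂ (proj₂ r))
    N = proj₁ (proj₂ (proj₂ (proj₂ r)))
    Na = proj₁ (proj₂ (proj₂ (proj₂ (proj₂ r))))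
    bc = proj₁ (proj₂ (proj₂ (proj₂ (proj₂ (proj₂ r)))))
    Nb = proj₂ (proj₂ (proj₂ (proj₂ (proj₂ (proj₂ r)))))
    open Nbr3 N
    open Nbr3 Na using () renaming (pb to ab; pc to ac; only to only-a)
    open Nbr4 Nb using () renaming (pd to bd; only to only-b; a≢d to p≢d; b≢d to a≢d; c≢d to c≢d)
    ap = ES-sym es pa
    bp = ES-sym es pb
    ba = ES-sym es ab
    p≢a = ES-≢ es pa
    p≢b = ES-≢ es pb
    p≢c = ES-≢ es pc
    b≢d = ES-≢ es bd

    E₀ E₁ E' : ES n
    E₀ = remV b E
    E₁ = addE d a E₀
    E' = addE d p E₁
    Y' : VS n
    Y' = rem b Y
    es₀ : IsES E₀
    es₀ = IsES-remV b es
    da₀ : E₀ d a ≡ false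
    da₀ = ≢true⇒false λ h → case only-a d (ES-sym es (proj₁ (remV-elim E b h))) of λ
      { (inj₁ e) → p≢d (sym e) ; (inj₂ (inj₁ e)) → b≢d (sym e) ; (inj₂ (inj₂ e)) → c≢d (sym e) }
    es₁ : IsES E₁
    es₁ = IsES-addE (a≢d ∘ sym) es₀
    dp₁ : E₁ d p ≡ false
    dp₁ = ≢true⇒false λ h → case addE-elim d a E₀ {d} {p} h of λ
      { (inj₁ k) → case only d (ES-sym es (proj₁ (remV-elim E b k))) of λ
        { (inj₁ e) → a≢d (sym e) ; (inj₂ (inj₁ e)) → b≢d (sym e) ; (inj₂ (inj₂ e)) → c≢d (sym e) }
      ; (inj₂ (inj₁ (_ , e))) → p≢a e
      ; (inj₂ (inj₂ (e , _))) → a≢d (sym e) }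
    es' : IsES E'
    es' = IsES-addE (p≢d ∘ sym) es₁
    p' : Y' p ≡ true
    p' = rem-intro b Y p≢b Yp
    a' : Y' a ≡ true
    a' = rem-intro b Y a≢b Ya
    db : dg E b ≡ 4
    db = nbr4⇒dg Nb

    inc' : ∀ S → inc E' S ≡ inc E₀ S + ⟦ S d ∨ S a ⟧ + ⟦ S d ∨ S p ⟧
    inc' S = trans (inc-addE es₁ S (p≢d ∘ sym) dp₁) (cong (_+ ⟦ S d ∨ S p ⟧) (inc-addE es₀ S (a≢d ∘ sym) da₀))

    full' : inc E' Y' ≡ 2 * vcount Y' + 1
    full' = linear 9 (λ i i₀ j j' g y y' t u → i ≐ i₀ ⊕ t ⊕ u ⇒ t ≐ κ 1 ⇒ u ≐ κ 1 ⇒ j' ≐ i₀ ⊕ g ⇒ j' ≐ j ⇒ j ≐ 2 ⊗ y ⊕ κ 1 ⇒ g ≐ κ 4 ⇒ y ≐ κ 1 ⊕ y' ⇒ ⊢ i ≐ 2 ⊗ y' ⊕ κ 1)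
      (inc E' Y') (inc E₀ Y') (inc E Y) (inc E (ins b Y')) (dg E b) (vcount Y) (vcount Y') ⟦ Y' d ∨ Y' a ⟧ ⟦ Y' d ∨ Y' p ⟧
      (inc' Y') (cong ⟦_⟧ (∨-introʳ {Y' d} {Y' a} a')) (cong ⟦_⟧ (∨-introʳ {Y' d} {Y' p} p'))
      (inc-remV es b Y') (inc-ext E (ins-rem-⊆ b Y Yb) (⊆-ins-rem b Y)) full db (vcount-rem b Y Yb)

    module Sub (S : VS n) (S⊆ : S ⊆ᵛ Y') (pos : 1 ≤ vcount S) where
      Sb : S b ≡ false
      Sb = ≢true⇒false (λ h → true≢false (S⊆ b h) (rem-self b Y))
      S⊆Y : S ⊆ᵛ Y
      S⊆Y v h = rem-⊆ b Y v (S⊆ v h)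
      S⁺ : VS n
      S⁺ = ins b S
      S⁺⊆Y : S⁺ ⊆ᵛ Y
      S⁺⊆Y = ins-⊆ b S⊆Y Yb
      b∈S⁺ : S⁺ b ≡ true
      b∈S⁺ = ins-self b S
      size : vcount S⁺ ≡ suc (vcount S)
      size = vcount-ins b S Sb
      inc₀ : inc E S⁺ ≡ inc E₀ S + 4
      inc₀ = trans (inc-remV es b S) (cong (inc E₀ S +_) db)

      -- `x` is the one of `a`, `p` in `S` and `x'` the other. Once `b` has been added, `x'`
      -- contributes at most one edge and two to the bound, so `inc E S⁺` must be larger than
      -- `lower` alone tells.
      one-in : ∀ {x x'} → Y x' ≡ true → x' ≢ b → x ≢ b → dg E x' ≡ 3 → E x' b ≡ true → E x' x ≡ true → S x ≡ true → S x' ≡ false → 2 * vcount S ≤ inc E₀ S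
      one-in {x} {x'} Yx' x'≢b x≢b dx x'b x'x Sx Sx' = linear 7 (λ i₀ i j k s t u → i ≐ i₀ ⊕ κ 4 ⇒ j ⊕ k ≐ i ⊕ κ 3 ⇒ κ 2 ≼ k ⇒ 2 ⊗ u ⊕ κ 1 ≼ j ⇒ u ≐ κ 1 ⊕ t ⇒ t ≐ κ 1 ⊕ s ⇒ ⊢ 2 ⊗ s ≼ i₀)
        (inc E₀ S) (inc E S⁺) (inc E (ins x' S⁺)) (nb E x' S⁺) (vcount S) (vcount S⁺) (vcount (ins x' S⁺))
        inc₀ (trans (inc-ins es x' S⁺ x'∉) (cong (inc E S⁺ +_) dx)) (nb₂ x' S⁺ (x≢b ∘ sym) x'b b∈S⁺ x'x (ins-old b S Sx))
        (lower (ins x' S⁺) (ins-⊆ x' S⁺⊆Y Yx') (vcount-pos (ins x' S⁺) x' (ins-self x' S⁺))) (vcount-ins x' S⁺ x'∉) size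
        where
        x'∉ : S⁺ x' ≡ false
        x'∉ = ins-not b S x'≢b Sx'

      -- If `c` is in `S`, then `b`, `p` and `a` are added in turn; `p` brings at most one new edge
      -- and `a` none, while the bound grows by two each time.
      none-in : S a ≡ false → S p ≡ false → S d ≡ false → 2 * vcount S + 1 ≤ inc E₀ S
      none-in Sa Sp Sd = case true⊎false (S c) of λ
        { (inj₂ Sc) → linear 4 (λ i i₀ k s → i ≐ i₀ ⊕ k ⇒ k ≐ κ 0 ⇒ 2 ⊗ s ⊕ κ 1 ≼ i ⇒ ⊢ 2 ⊗ s ⊕ κ 1 ≼ i₀)
            (inc E S) (inc E₀ S) (nb E b S) (vcount S) (inc-remV' es b S Sb)
            (vcount-∅ (λ w → E b w ∧ S w) λ w → ≢true⇒false λ h → case only-b w (∧-fst {E b w} h) of λ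
              { (inj₁ refl) → true≢false (∧-snd {E b w} h) Sp
              ; (inj₂ (inj₁ refl)) → true≢false (∧-snd {E b w} h) Sa
              ; (inj₂ (inj₂ (inj₁ refl))) → true≢false (∧-snd {E b w} h) Sc
              ; (inj₂ (inj₂ (inj₂ refl))) → true≢false (∧-snd {E b w} h) Sd })
            (lower S S⊆Y pos)
        ; (inj₁ Sc) → linear 9 (λ i₀ i j₁ j₂ k₁ k₂ s t₁ t₂ → i ≐ i₀ ⊕ κ 4 ⇒ j₁ ⊕ k₁ ≐ i ⊕ κ 3 ⇒ κ 2 ≼ k₁ ⇒ j₂ ⊕ k₂ ≐ j₁ ⊕ κ 3 ⇒ κ 3 ≼ k₂ ⇒
              2 ⊗ t₂ ⊕ κ 1 ≼ j₂ ⇒ t₂ ≐ κ 1 ⊕ t₁ ⇒ t₁ ≐ κ 2 ⊕ s ⇒ ⊢ 2 ⊗ s ⊕ κ 1 ≼ i₀)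
            (inc E₀ S) (inc E S⁺) (inc E (ins p S⁺)) (inc E (ins a (ins p S⁺))) (nb E p S⁺) (nb E a (ins p S⁺)) (vcount S) (vcount (ins p S⁺)) (vcount (ins a (ins p S⁺)))
            inc₀ (trans (inc-ins es p S⁺ (p∉ Sp)) (cong (inc E S⁺ +_) (nbr3⇒dg N))) (nb₂ p S⁺ b≢c pb b∈S⁺ pc (ins-old b S Sc))
            (trans (inc-ins es a (ins p S⁺) (a∉ Sa)) (cong (inc E (ins p S⁺) +_) (nbr3⇒dg Na)))
            (nb₃ a (ins p S⁺) p≢b p≢c b≢c ap (ins-self p S⁺) ab (ins-old p S⁺ b∈S⁺) ac (ins-old p S⁺ {c} (ins-old b S {c} Sc)))
            (lower (ins a (ins p S⁺)) (ins-⊆ a (ins-⊆ p S⁺⊆Y Yp) Ya) (vcount-pos (ins a (ins p S⁺)) a (ins-self a (ins p S⁺))))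
            (vcount-ins a (ins p S⁺) (a∉ Sa)) (trans (vcount-ins p S⁺ (p∉ Sp)) (cong suc size)) }
        where
        p∉ : S p ≡ false → S⁺ p ≡ false
        p∉ h = ins-not b S p≢b h
        a∉ : S a ≡ false → ins p S⁺ a ≡ false
        a∉ h = ins-not p S⁺ (p≢a ∘ sym) (ins-not b S a≢b h)

      base-low : 2 * vcount S ≤ inc E₀ S + 1
      base-low = linear 4 (λ i i₀ s t → i ≐ i₀ ⊕ κ 4 ⇒ 2 ⊗ t ⊕ κ 1 ≼ i ⇒ t ≐ κ 1 ⊕ s ⇒ ⊢ 2 ⊗ s ≼ i₀ ⊕ κ 1) (inc E S⁺) (inc E₀ S) (vcount S) (vcount S⁺)
        inc₀ (lower S⁺ S⁺⊆Y (vcount-pos S⁺ b b∈S⁺)) size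

      lower' : 2 * vcount S + 1 ≤ inc E' S
      lower' = case true⊎false (S d) of λ
        { (inj₁ Sd) → plus₂ (∨-introˡ Sd) (∨-introˡ Sd)
        ; (inj₂ Sd) → case true⊎false (S a) of λ
          { (inj₁ Sa) → case true⊎false (S p) of λ
            { (inj₁ Sp) → plus₂ (∨-introʳ {S d} Sa) (∨-introʳ {S d} Sp)
            ; (inj₂ Sp) → linear 5 (λ i i₀ s t u → i ≐ i₀ ⊕ t ⊕ u ⇒ t ≐ κ 1 ⇒ 2 ⊗ s ≼ i₀ ⇒ ⊢ 2 ⊗ s ⊕ κ 1 ≼ i)
                (inc E' S) (inc E₀ S) (vcount S) ⟦ S d ∨ S a ⟧ ⟦ S d ∨ S p ⟧ (inc' S) (cong ⟦_⟧ (∨-introʳ {S d} Sa))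
                (one-in {a} {p} Yp p≢b a≢b (nbr3⇒dg N) pb pa Sa Sp) }
          ; (inj₂ Sa) → case true⊎false (S p) of λ
            { (inj₁ Sp) → linear 5 (λ i i₀ s t u → i ≐ i₀ ⊕ t ⊕ u ⇒ u ≐ κ 1 ⇒ 2 ⊗ s ≼ i₀ ⇒ ⊢ 2 ⊗ s ⊕ κ 1 ≼ i)
                (inc E' S) (inc E₀ S) (vcount S) ⟦ S d ∨ S a ⟧ ⟦ S d ∨ S p ⟧ (inc' S) (cong ⟦_⟧ (∨-introʳ {S d} Sp))
                (one-in {p} {a} Ya a≢b p≢b (nbr3⇒dg Na) ab ap Sp Sa)
            ; (inj₂ Sp) → linear 5 (λ i i₀ s t u → i ≐ i₀ ⊕ t ⊕ u ⇒ 2 ⊗ s ⊕ κ 1 ≼ i₀ ⇒ ⊢ 2 ⊗ s ⊕ κ 1 ≼ i)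
                (inc E' S) (inc E₀ S) (vcount S) ⟦ S d ∨ S a ⟧ ⟦ S d ∨ S p ⟧ (inc' S) (none-in Sa Sp Sd) } } }
        where
        plus₂ : S d ∨ S a ≡ true → S d ∨ S p ≡ true → 2 * vcount S + 1 ≤ inc E' S
        plus₂ t u = linear 5 (λ i i₀ s t u → i ≐ i₀ ⊕ t ⊕ u ⇒ t ≐ κ 1 ⇒ u ≐ κ 1 ⇒ 2 ⊗ s ≼ i₀ ⊕ κ 1 ⇒ ⊢ 2 ⊗ s ⊕ κ 1 ≼ i)
          (inc E' S) (inc E₀ S) (vcount S) ⟦ S d ∨ S a ⟧ ⟦ S d ∨ S p ⟧ (inc' S) (cong ⟦_⟧ t) (cong ⟦_⟧ u) base-low

      ind' : ind E' S ≡ ind E S + ⟦ S d ∧ S a ⟧ + ⟦ S d ∧ S p ⟧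
      ind' = trans (ind-addE es₁ S (p≢d ∘ sym) dp₁) (cong (_+ ⟦ S d ∧ S p ⟧)
        (trans (ind-addE es₀ S (a≢d ∘ sym) da₀) (cong (_+ ⟦ S d ∧ S a ⟧) (ind-remV es b S Sb))))

      -- Removing `v` costs at most one edge but lowers the bound by two.
      few : ∀ {v} (R : VS n) → R ⊆ᵛ Y → R v ≡ true → (∃[ u ] (u ≢ v × R u ≡ true)) → nb E v R ≤ 1 → ind E R + 3 ≤ 2 * vcount R
      few {v} R R⊆Y Rv (u , u≢v , Ru) le = linear 6 (λ i i' k k' r r' → i ≐ i' ⊕ k' ⇒ k' ≐ k ⇒ k ≼ κ 1 ⇒ r ≐ κ 1 ⊕ r' ⇒ i' ⊕ κ 2 ≼ 2 ⊗ r' ⇒ ⊢ i ⊕ κ 3 ≼ 2 ⊗ r)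
        (ind E R) (ind E (rem v R)) (nb E v R) (nb E v (rem v R)) (vcount R) (vcount (rem v R))
        (ind-rem es v R Rv) (nb-rem es v R) le (vcount-rem v R Rv)
        (upper (rem v R) (λ w h → R⊆Y w (rem-⊆ v R w h)) (vcount-pos (rem v R) u (rem-intro v R u≢v Ru)))

      upper' : ind E' S + 2 ≤ 2 * vcount S
      upper' = case true⊎false (S d) of λ
        { (inj₂ Sd) → plus 0 (cong (λ x → ⟦ x ∧ S a ⟧) Sd) 0 (cong (λ x → ⟦ x ∧ S p ⟧) Sd) (subst (λ x → x + 2 ≤ 2 * vcount S) (sym (+-identityʳ (ind E S))) (upper S S⊆Y pos))
        ; (inj₁ Sd) → case true⊎false (S a) of λ
          { (inj₂ Sa) → case true⊎false (S p) of λ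
            { (inj₂ Sp) → plus 0 (zeroʳ Sa) 0 (zeroʳ Sp) (subst (λ x → x + 2 ≤ 2 * vcount S) (sym (+-identityʳ (ind E S))) (upper S S⊆Y pos))
            ; (inj₁ Sp) → plus 0 (zeroʳ Sa) 1 (oneʳ Sd Sp) (linear 2 (λ i s → i ⊕ κ 3 ≼ 2 ⊗ s ⇒ ⊢ i ⊕ κ 1 ⊕ κ 2 ≼ 2 ⊗ s) (ind E S) (vcount S)
                (few {p} S S⊆Y Sp (d , (p≢d ∘ sym) , Sd) (vcount≤1 (λ w → E p w ∧ S w) c λ w h → case only w (∧-fst {E p w} h) of λ
                  { (inj₁ refl) → ⊥-elim (true≢false (∧-snd {E p w} h) Sa)
                  ; (inj₂ (inj₁ refl)) → ⊥-elim (true≢false (∧-snd {E p w} h) Sb)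
                  ; (inj₂ (inj₂ e)) → e }))) }
          ; (inj₁ Sa) → case true⊎false (S p) of λ
            { (inj₂ Sp) → plus 1 (oneʳ Sd Sa) 0 (zeroʳ Sp) (linear 2 (λ i s → i ⊕ κ 3 ≼ 2 ⊗ s ⇒ ⊢ i ⊕ κ 1 ⊕ κ 2 ≼ 2 ⊗ s) (ind E S) (vcount S)
                (few {a} S S⊆Y Sa (d , (a≢d ∘ sym) , Sd) (vcount≤1 (λ w → E a w ∧ S w) c λ w h → case only-a w (∧-fst {E a w} h) of λ
                  { (inj₁ refl) → ⊥-elim (true≢false (∧-snd {E a w} h) Sp)
                  ; (inj₂ (inj₁ refl)) → ⊥-elim (true≢false (∧-snd {E a w} h) Sb)
                  ; (inj₂ (inj₂ e)) → e })))
            ; (inj₁ Sp) → plus 1 (oneʳ Sd Sa) 1 (oneʳ Sd Sp) (both Sa Sp Sd (true⊎false (S c))) } } }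
        where
        zeroʳ : ∀ {x} → S x ≡ false → ⟦ S d ∧ S x ⟧ ≡ 0
        zeroʳ {x} h = trans (cong (λ y → ⟦ S d ∧ y ⟧) h) (cong ⟦_⟧ (𝔹.∧-zeroʳ (S d)))
        oneʳ : ∀ {x} → S d ≡ true → S x ≡ true → ⟦ S d ∧ S x ⟧ ≡ 1
        oneʳ h k = cong ⟦_⟧ (∧-intro h k)
        plus : ∀ j → ⟦ S d ∧ S a ⟧ ≡ j → ∀ k → ⟦ S d ∧ S p ⟧ ≡ k → ind E S + (j + k) + 2 ≤ 2 * vcount S → ind E' S + 2 ≤ 2 * vcount S
        plus j ej k ek le = linear 7 (λ i i₀ t u j k s → i ≐ i₀ ⊕ t ⊕ u ⇒ t ≐ j ⇒ u ≐ k ⇒ i₀ ⊕ (j ⊕ k) ⊕ κ 2 ≼ s ⇒ ⊢ i ⊕ κ 2 ≼ s)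
          (ind E' S) (ind E S) ⟦ S d ∧ S a ⟧ ⟦ S d ∧ S p ⟧ j k (2 * vcount S) ind' ej ek le
        both : S a ≡ true → S p ≡ true → S d ≡ true → S c ≡ true ⊎ S c ≡ false → ind E S + 2 + 2 ≤ 2 * vcount S
        both Sa Sp Sd (inj₁ Sc) = linear 4 (λ i j k s → j ≐ i ⊕ k ⇒ κ 4 ≼ k ⇒ j ≼ 2 ⊗ s ⇒ ⊢ i ⊕ κ 2 ⊕ κ 2 ≼ 2 ⊗ s)
          (ind E S) (ind E S⁺) (nb E b S) (vcount S) (ind-ins es b S Sb)
          (vcount≥4 (λ w → E b w ∧ S w) p≢a p≢c p≢d a≢c a≢d c≢d (∧-intro bp Sp) (∧-intro ba Sa) (∧-intro bc Sc) (∧-intro bd Sd))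
          (bound S b S⊆Y pos Sb)
        both Sa Sp Sd (inj₂ Sc) = linear 6 (λ i i' k k' s s' → i ≐ i' ⊕ k' ⇒ k' ≐ k ⇒ k ≼ κ 1 ⇒ s ≐ κ 1 ⊕ s' ⇒ i' ⊕ κ 3 ≼ 2 ⊗ s' ⇒ ⊢ i ⊕ κ 2 ⊕ κ 2 ≼ 2 ⊗ s)
          (ind E S) (ind E R) (nb E p S) (nb E p R) (vcount S) (vcount R)
          (ind-rem es p S Sp) (nb-rem es p S) (vcount≤1 (λ w → E p w ∧ S w) a λ w h → case only w (∧-fst {E p w} h) of λ
            { (inj₁ e) → e
            ; (inj₂ (inj₁ refl)) → ⊥-elim (true≢false (∧-snd {E p w} h) Sb)
            ; (inj₂ (inj₂ refl)) → ⊥-elim (true≢false (∧-snd {E p w} h) Sc) })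
          (vcount-rem p S Sp)
          (few {a} R (λ w h → S⊆Y w (rem-⊆ p S w h)) (rem-intro p S (p≢a ∘ sym) Sa) (d , (a≢d ∘ sym) , rem-intro p S (p≢d ∘ sym) Sd)
            -- `a` has no neighbour left in `R`, so its role as the only possible neighbour is
            -- vacuous.
            (vcount≤1 (λ w → E a w ∧ R w) a λ w h → case only-a w (∧-fst {E a w} h) of λ
              { (inj₁ refl) → ⊥-elim (rem-≢ p S (∧-snd {E a w} h) refl)
              ; (inj₂ (inj₁ refl)) → ⊥-elim (true≢false (rem-⊆ p S w (∧-snd {E a w} h)) Sb)
              ; (inj₂ (inj₂ refl)) → ⊥-elim (true≢false (rem-⊆ p S w (∧-snd {E a w} h)) Sc) }))
          where
          R : VS n
          R = rem p S

    keep-edge : ∀ {i j} → E i j ≡ true → i ≢ b → j ≢ b → E' i j ≡ true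
    keep-edge e ib jb = addE-old d p E₁ (addE-old d a E₀ (remV-intro E b e ib jb))

    anchored' : Anchored E' Y'
    anchored' = anchored {E'} {Y'} (rem-⊆ b Y) persist
      where
      persist : ∀ w x → Y w ≡ true → Y x ≡ false → E w x ≡ true → ∃[ w' ] (Y' w' ≡ true × E' w' x ≡ true)
      persist w x Yw Yx wx with w ≟ b
      ... | no w≢b = w , rem-intro b Y w≢b Yw , keep-edge wx w≢b (λ { refl → true≢false Yb Yx })
      ... | yes refl = case only-b x wx of λ
            { (inj₁ refl) → ⊥-elim (true≢false Yp Yx)
            ; (inj₂ (inj₁ refl)) → ⊥-elim (true≢false Ya Yx)
            ; (inj₂ (inj₂ (inj₁ refl))) → p , p' , keep-edge pc p≢b (b≢c ∘ sym)
            ; (inj₂ (inj₂ (inj₂ refl))) → p , p' , addE-new' d p E₁ }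

    old-or-new : ∀ {i j} → E' i j ≡ true → (E i j ≡ true × i ≢ b) ⊎ ((i ≡ d × (j ≡ p ⊎ j ≡ a)) ⊎ ((i ≡ p ⊎ i ≡ a) × j ≡ d))
    old-or-new {i} {j} h = case addE-elim d p E₁ {i} {j} h of λ
      { (inj₂ (inj₁ (e , f))) → inj₂ (inj₁ (e , inj₁ f))
      ; (inj₂ (inj₂ (e , f))) → inj₂ (inj₂ (inj₁ e , f))
      ; (inj₁ k) → case addE-elim d a E₀ {i} {j} k of λ
        { (inj₂ (inj₁ (e , f))) → inj₂ (inj₁ (e , inj₂ f))
        ; (inj₂ (inj₂ (e , f))) → inj₂ (inj₂ (inj₂ e , f))
        ; (inj₁ l) → case remV-elim E b {i} {j} l of λ { (e , ib , _) → inj₁ (e , ib) } } }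

    ≢b : ∀ i j → E' i j ≡ true → i ≢ b
    ≢b i j h = case old-or-new {i} {j} h of λ
      { (inj₁ (_ , ib)) → ib
      ; (inj₂ (inj₁ (refl , _))) → b≢d ∘ sym
      ; (inj₂ (inj₂ (inj₁ refl , _))) → p≢b
      ; (inj₂ (inj₂ (inj₂ refl , _))) → a≢b }

    att : Attached E' (Y ᶜ) Y'
    att = record
      { es = es'
      ; covered = λ i j h → case true⊎false (Y i) of λ
          { (inj₁ Yi) → ∨-introʳ {not (Y i)} (rem-intro b Y (≢b i j h) Yi) ; (inj₂ Yi) → ∨-introˡ (not-true Yi) }
      ; disjoint = λ v h → rem-not b Y (not-true⁻ h)
      ; nonempty = vcount-pos Y' a a' ; full = full'
      ; lower = λ S S⊆ pos → Sub.lower' S S⊆ pos ; upper = λ S S⊆ pos → Sub.upper' S S⊆ pos ; attached = anchored' }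

    outer : ∀ {i j} → E' i j ≡ true → Y' i ≡ false → Y i ≡ false
    outer {i} {j} h Y'i = ≢true⇒false (λ Yi → true≢false (rem-intro b Y (≢b i j h) Yi) Y'i)

    keep-D : ∀ i j → D i j ≡ true → E' i j ≡ true
    keep-D i j h = case induce-elim E (Y ᶜ) {i} {j} h of λ { (e , x , y) → keep-edge e
      (λ { refl → true≢false Yb (not-true⁻ x) }) (λ { refl → true≢false Yb (not-true⁻ y) }) }

    result : Connects E' (λ v → not (v == b))
    result = record
      { c-es = es'
      ; c-conn = attached-reduced att (rem-⊆ b Y) keep-D λ i j h x y → case old-or-new {i} {j} h of λ
          { (inj₁ (e , _)) → induce-intro E (Y ᶜ) e (not-true (outer {i} {j} h x)) (not-true (outer {j} {i} (ES-sym es' h) y))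
          ; (inj₂ (inj₁ (_ , inj₁ refl))) → ⊥-elim (true≢false p' y)
          ; (inj₂ (inj₁ (_ , inj₂ refl))) → ⊥-elim (true≢false a' y)
          ; (inj₂ (inj₂ (inj₁ refl , _))) → ⊥-elim (true≢false p' x)
          ; (inj₂ (inj₂ (inj₂ refl , _))) → ⊥-elim (true≢false a' x) }
      ; c-nbr = λ v v≢b → case true⊎false (Y v) of λ
          { (inj₁ Yv) → attached-nbr att {v} (rem-intro b Y (λ e → true≢false (==-true e) (not-true⁻ v≢b)) Yv)
          ; (inj₂ Yv) → case grounded v Yv of λ { (w , h) → w , keep-D v w h } } }

  within-D : ∀ i j → D i j ≡ true → (Y ᶜ) i ≡ true
  within-D i j h = proj₁ (proj₂ (induce-elim E (Y ᶜ) {i} {j} h))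

  -- No new vertex survives the removal of `p`, so connectedness comes from adding `ab` to the rigid
  -- part. If `ab` is already there it is deleted, and circuits through it are rerouted through `p`.
  module Reduce₃ {p a b c} (r : Reducible₃ E Y p a b c) where
    Yp = proj₁ r
    alone = proj₁ (proj₂ r)
    N = proj₂ (proj₂ r)
    open Nbr3 N
    p≢a = ES-≢ es pa
    p≢b = ES-≢ es pb
    p≢c = ES-≢ es pc

    outside : ∀ {x} → x ≢ p → Y x ≡ false
    outside {x} x≢p = ≢true⇒false (λ h → x≢p (alone x h))

    added : E a b ≡ false → Connects (addE a b (remV p E)) (λ v → not (v == p))
    added ab = record
      { c-es = IsES-addE a≢b (IsES-remV p es)
      ; c-conn = connected-ext {A = addE a b D} {addE a b (remV p E)}
          (λ i j h → case addE-elim a b D {i} {j} h of λ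
            { (inj₁ k) → addE-old a b (remV p E) (D⇒ i j k)
            ; (inj₂ (inj₁ (refl , refl))) → addE-new a b (remV p E) ; (inj₂ (inj₂ (refl , refl))) → addE-new' a b (remV p E) })
          (λ i j h → case addE-elim a b (remV p E) {i} {j} h of λ
            { (inj₁ k) → case remV-elim E p {i} {j} k of λ { (e , ip , jp) →
                addE-old a b D (induce-intro E (Y ᶜ) e (not-true (outside ip)) (not-true (outside jp))) }
            ; (inj₂ (inj₁ (refl , refl))) → addE-new a b D ; (inj₂ (inj₂ (refl , refl))) → addE-new' a b D })
          (add-edge-connected base within-D a≢b (not-true (outside (p≢a ∘ sym))) (not-true (outside (p≢b ∘ sym)))
            (cong (_∧ ((Y ᶜ) a ∧ (Y ᶜ) b)) ab))
      ; c-nbr = λ v h → case grounded v (outside (λ e → true≢false (==-true e) (not-true⁻ h))) of λ { (w , k) →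
          w , addE-old a b (remV p E) (D⇒ v w k) } }
      where
      D⇒ : ∀ i j → D i j ≡ true → remV p E i j ≡ true
      D⇒ i j h = case induce-elim E (Y ᶜ) {i} {j} h of λ { (e , x , y) → remV-intro E p e
        (λ { refl → true≢false Yp (not-true⁻ x) }) (λ { refl → true≢false Yp (not-true⁻ y) }) }

    deleted : E a b ≡ true → Connects (delE a b E) (λ _ → true)
    deleted ab = record
      { c-es = IsES-delE a b es
      ; c-conn = delete-edge-connected attached-self (Base.connected base) {a} {b} {c}
          (induce-intro E (Y ᶜ) ab (not-true (outside (p≢a ∘ sym))) (not-true (outside (p≢b ∘ sym))))
          (p , Yp , pa) (p , Yp , pb) (grounded c (outside (p≢c ∘ sym)))
          (λ w z Yw Yz wz → only z (subst (λ x → E x z ≡ true) (alone w Yw) wz))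
      ; c-nbr = λ v _ → nbr v }
      where
      keep : ∀ {i j} → E i j ≡ true → (i ≢ a × i ≢ b) ⊎ (j ≢ a × j ≢ b) → delE a b E i j ≡ true
      keep {i} {j} e h = ∧-intro e (not-true (edge-false a b {i} {j} λ
        { (inj₁ (refl , refl)) → case h of λ { (inj₁ (x , _)) → x refl ; (inj₂ (_ , x)) → x refl }
        ; (inj₂ (refl , refl)) → case h of λ { (inj₁ (_ , x)) → x refl ; (inj₂ (x , _)) → x refl } }))
      nbr : ∀ v → ∃[ w ] (delE a b E v w ≡ true)
      nbr v = case v ≟ p of λ
        { (yes refl) → a , keep pa (inj₁ (p≢a , p≢b))
        ; (no v≢p) → case v ≟ a of λ
          { (yes refl) → p , keep (ES-sym es pa) (inj₂ (p≢a , p≢b))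
          ; (no v≢a) → case v ≟ b of λ
            { (yes refl) → p , keep (ES-sym es pb) (inj₂ (p≢a , p≢b))
            ; (no v≢b) → case grounded v (outside v≢p) of λ { (w , h) → w , keep (∧-fst h) (inj₁ (v≢a , v≢b)) } } } }

  module Reduce₄ {p a b c} (r : Reducible₄ E Y p a b c) where
    Yp = proj₁ r
    Ya = proj₁ (proj₂ r)
    alone = proj₁ (proj₂ (proj₂ r))
    N = proj₁ (proj₂ (proj₂ (proj₂ r)))
    Na = proj₂ (proj₂ (proj₂ (proj₂ r)))
    open Nbr3 N
    open Nbr3 Na using () renaming (pb to ab; pc to ac; only to only-a)
    p≢a = ES-≢ es pa
    p≢b = ES-≢ es pb
    p≢c = ES-≢ es pc

    outside : ∀ {x} → x ≢ p → x ≢ a → Y x ≡ false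
    outside {x} x≢p x≢a = ≢true⇒false (λ h → case alone x h of λ { (inj₁ e) → x≢p e ; (inj₂ e) → x≢a e })
    Yb = outside (p≢b ∘ sym) (a≢b ∘ sym)
    Yc = outside (p≢c ∘ sym) (a≢c ∘ sym)

    E₁ : ES n
    E₁ = remV a (remV p E)

    added : E b c ≡ false → Connects (addE b c E₁) (λ v → not (v == p) ∧ not (v == a))
    added bc = record
      { c-es = IsES-addE b≢c (IsES-remV a (IsES-remV p es))
      ; c-conn = connected-ext {A = addE b c D} {addE b c E₁}
          (λ i j h → case addE-elim b c D {i} {j} h of λ
            { (inj₁ k) → addE-old b c E₁ (D⇒ i j k)
            ; (inj₂ (inj₁ (refl , refl))) → addE-new b c E₁ ; (inj₂ (inj₂ (refl , refl))) → addE-new' b c E₁ })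
          (λ i j h → case addE-elim b c E₁ {i} {j} h of λ
            { (inj₁ k) → case remV-elim (remV p E) a {i} {j} k of λ { (k' , ia , ja) → case remV-elim E p {i} {j} k' of λ { (e , ip , jp) →
                addE-old b c D (induce-intro E (Y ᶜ) e (not-true (outside ip ia)) (not-true (outside jp ja))) } }
            ; (inj₂ (inj₁ (refl , refl))) → addE-new b c D ; (inj₂ (inj₂ (refl , refl))) → addE-new' b c D })
          (add-edge-connected base within-D b≢c (not-true Yb) (not-true Yc) (cong (_∧ ((Y ᶜ) b ∧ (Y ᶜ) c)) bc))
      ; c-nbr = λ v h → case grounded v (outside (λ e → true≢false (==-true e) (not-true⁻ (∧-fst h)))
            (λ e → true≢false (==-true e) (not-true⁻ (∧-snd {not (v == p)} h)))) of λ { (w , k) →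
          w , addE-old b c E₁ (D⇒ v w k) } }
      where
      D⇒ : ∀ i j → D i j ≡ true → E₁ i j ≡ true
      D⇒ i j h = case induce-elim E (Y ᶜ) {i} {j} h of λ { (e , x , y) → remV-intro (remV p E) a (remV-intro E p e
        (λ { refl → true≢false Yp (not-true⁻ x) }) (λ { refl → true≢false Yp (not-true⁻ y) }))
        (λ { refl → true≢false Ya (not-true⁻ x) }) (λ { refl → true≢false Ya (not-true⁻ y) }) }

    deleted : E b c ≡ true → Connects (delE b c E) (λ _ → true)
    deleted bc = record
      { c-es = IsES-delE b c es
      ; c-conn = delete-edge-connected attached-self (Base.connected base) {b} {c} {b}
          (induce-intro E (Y ᶜ) bc (not-true Yb) (not-true Yc))
          -- There are only two old neighbours, so `b` also serves as the third one.
          (p , Yp , pb) (p , Yp , pc) (grounded b Yb) nbrs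
      ; c-nbr = λ v _ → nbr v }
      where
      nbrs : ∀ w z → Y w ≡ true → Y z ≡ false → E w z ≡ true → z ≡ b ⊎ z ≡ c ⊎ z ≡ b
      nbrs w z Yw Yz wz with alone w Yw
      ... | inj₁ refl = case only z wz of λ
            { (inj₁ refl) → ⊥-elim (true≢false Ya Yz) ; (inj₂ (inj₁ e)) → inj₁ e ; (inj₂ (inj₂ e)) → inj₂ (inj₁ e) }
      ... | inj₂ refl = case only-a z wz of λ
            { (inj₁ refl) → ⊥-elim (true≢false Yp Yz) ; (inj₂ (inj₁ e)) → inj₁ e ; (inj₂ (inj₂ e)) → inj₂ (inj₁ e) }
      keep : ∀ {i j} → E i j ≡ true → (i ≢ b × i ≢ c) ⊎ (j ≢ b × j ≢ c) → delE b c E i j ≡ true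
      keep {i} {j} e h = ∧-intro e (not-true (edge-false b c {i} {j} λ
        { (inj₁ (refl , refl)) → case h of λ { (inj₁ (x , _)) → x refl ; (inj₂ (_ , x)) → x refl }
        ; (inj₂ (refl , refl)) → case h of λ { (inj₁ (_ , x)) → x refl ; (inj₂ (x , _)) → x refl } }))
      nbr : ∀ v → ∃[ w ] (delE b c E v w ≡ true)
      nbr v = case v ≟ p of λ
        { (yes refl) → a , keep pa (inj₁ (p≢b , p≢c))
        ; (no v≢p) → case v ≟ a of λ
          { (yes refl) → p , keep (ES-sym es pa) (inj₁ (a≢b , a≢c))
          ; (no v≢a) → case v ≟ b of λ
            { (yes refl) → p , keep (ES-sym es pb) (inj₂ (p≢b , p≢c))
            ; (no v≢b) → case v ≟ c of λ
              { (yes refl) → p , keep (ES-sym es pc) (inj₂ (p≢b , p≢c))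
              ; (no v≢c) → case grounded v (outside v≢p v≢a) of λ { (w , h) → w , keep (∧-fst h) (inj₁ (v≢b , v≢c)) } } } } }

-- Removing an isolated vertex

sum-punch : ∀ {m} (p : Fin (suc m)) (f : Fin (suc m) → ℕ) → sumFin f ≡ f p + sumFin (λ i → f (punchIn p i))
sum-punch zero f = refl
sum-punch {suc m} (suc p) f = begin
  f zero + sumFin (λ i → f (suc i))                                    ≡⟨ cong (f zero +_) (sum-punch p (λ i → f (suc i))) ⟩
  f zero + (f (suc p) + sumFin (λ i → f (suc (punchIn p i))))          ≡⟨ linear 3 (λ x y z → ⊢ x ⊕ (y ⊕ z) ≐ y ⊕ (x ⊕ z)) (f zero) (f (suc p)) _ ⟩
  f (suc p) + (f zero + sumFin (λ i → f (suc (punchIn p i)))) ∎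
  where open ≡-Reasoning

module _ {m} (p : Fin (suc m)) where

  restrict : ES (suc m) → ES m
  restrict C i j = C (punchIn p i) (punchIn p j)

  vcount-punch : ∀ (S : VS (suc m)) → S p ≡ false → vcount (λ i → S (punchIn p i)) ≡ vcount S
  vcount-punch S Sp = sym (trans (sum-punch p (λ i → ⟦ S i ⟧)) (cong (λ x → ⟦ x ⟧ + vcount (λ i → S (punchIn p i))) Sp))

  ecount-double : ∀ {n} {C : ES n} → IsES C → sumFin (λ i → vcount (C i)) ≡ 2 * ecount C
  ecount-double {n} {C} es = trans (sum-cong (λ v → sym (nb-all C v))) (trans (handshake es (λ _ → true))
    (cong (2 *_) (ind-all C (λ _ → true) es (λ _ _ _ → refl))))

  IsES-restrict : ∀ {C} → IsES C → IsES (restrict C)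
  IsES-restrict (s , r) = (λ i j → s (punchIn p i) (punchIn p j)) , (λ i → r (punchIn p i))

  -- Twice the edge count is the sum of the degrees, which makes no reference to the order of the
  -- vertices; the comparison of indices under `punchIn` is thus avoided.
  ecount-punch : ∀ {C} → IsES C → (∀ w → C p w ≡ false) → ecount (restrict C) ≡ ecount C
  ecount-punch {C} es none = *-cancelˡ-≡ _ _ 2 (begin
    2 * ecount (restrict C)                            ≡⟨ sym (ecount-double (IsES-restrict es)) ⟩
    sumFin (λ i → vcount (restrict C i))               ≡⟨ sum-cong (λ i → vcount-punch (C (punchIn p i)) (ES-symᶠ es (none (punchIn p i)))) ⟩
    sumFin (λ i → vcount (C (punchIn p i)))            ≡⟨ cong (_+ sumFin (λ i → vcount (C (punchIn p i)))) (sym (vcount-∅ (C p) none)) ⟩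
    vcount (C p) + sumFin (λ i → vcount (C (punchIn p i))) ≡⟨ sym (sum-punch p (λ i → vcount (C i))) ⟩
    sumFin (λ i → vcount (C i))                        ≡⟨ ecount-double es ⟩
    2 * ecount C ∎)
    where open ≡-Reasoning

  -- The punched vertex is left out, so that sizes and induced counts agree.
  extend : VS m → VS (suc m)
  extend S w with p ≟ w
  ... | yes _ = false
  ... | no ne = S (punchOut ne)

  extend-self : ∀ S → extend S p ≡ false
  extend-self S with p ≟ p
  ... | yes _ = refl
  ... | no ne = ⊥-elim (ne refl)

  extend-punch : ∀ S i → extend S (punchIn p i) ≡ S i
  extend-punch S i with p ≟ punchIn p i
  ... | yes e = ⊥-elim (Fin.punchInᵢ≢i p i (sym e))
  ... | no ne = cong S (trans (Fin.punchOut-cong p refl) (Fin.punchOut-punchIn p))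

  ends-restrict : ∀ {C} → IsES C → (∀ w → C p w ≡ false) → ∀ i → ends (restrict C) i ≡ ends C (punchIn p i)
  ends-restrict {C} es none i = iff⇒≡
    (λ h → case ends-elim (restrict C) h of λ { (j , c) → ends-intro C c })
    (λ h → case ends-elim C h of λ { (w , c) → case p ≟ w of λ
      { (yes refl) → ⊥-elim (true≢false (ES-sym es c) (none _))
      ; (no ne) → ends-intro (restrict C) {i} {punchOut ne} (subst (λ x → C (punchIn p i) x ≡ true) (sym (Fin.punchIn-punchOut ne)) c) } })

  circ-restrict : ∀ {C} → IsCirc C → (∀ w → C p w ≡ false) → IsCirc (restrict C)
  circ-restrict {C} c none = record
    { circ-es = IsES-restrict es
    ; circ-count = trans (cong (_+ 1) (ecount-punch es none)) (trans (circ-count c) (cong (2 *_) (sym ends-count)))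
    ; circ-sparse = sparse }
    where
    es = circ-es c
    ends-p : ends C p ≡ false
    ends-p = ≢true⇒false (λ h → case ends-elim C h of λ { (w , k) → true≢false k (none w) })
    ends-count : vcount (ends (restrict C)) ≡ vcount (ends C)
    ends-count = trans (sum-cong (λ i → cong ⟦_⟧ (ends-restrict es none i))) (vcount-punch (ends C) ends-p)
    sparse : ∀ S → 1 ≤ vcount S → ¬ (ends (restrict C) ⊆ᵛ S) → ind (restrict C) S + 2 ≤ 2 * vcount S
    sparse S pos ¬sub = subst₂ (λ x y → x + 2 ≤ 2 * y) ind≡ size
        (circ-sparse c (extend S) (subst (1 ≤_) (sym size) pos)
          (λ sub → ¬sub (λ i h → trans (sym (extend-punch S i)) (sub (punchIn p i) (trans (sym (ends-restrict es none i)) h)))))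
      where
      size : vcount (extend S) ≡ vcount S
      size = trans (sym (vcount-punch (extend S) (extend-self S))) (sum-cong (λ i → cong ⟦_⟧ (extend-punch S i)))
      ind≡ : ind C (extend S) ≡ ind (restrict C) S
      ind≡ = trans (sym (ecount-punch (IsES-induce (extend S) es) (λ w → cong (_∧ (extend S p ∧ extend S w)) (none w))))
        (ecount-cong {A = restrict (induce C (extend S))} {induce (restrict C) S}
          (λ i j h → trans (sym (same i j)) h) (λ i j h → trans (same i j) h))
        where
        same : ∀ i j → restrict (induce C (extend S)) i j ≡ induce (restrict C) S i j
        same i j = cong₂ (λ x y → restrict C i j ∧ (x ∧ y)) (extend-punch S i) (extend-punch S j)

  connects-restrict : ∀ {E V} → Connects E V → (∀ w → E p w ≡ false) → Connects (restrict E) (λ i → V (punchIn p i))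
  connects-restrict {E} {V} c none = record
    { c-es = IsES-restrict (c-es c)
    ; c-conn = λ { (i , j) (k , l) e f → case c-conn c (punchIn p i , punchIn p j) (punchIn p k , punchIn p l) e f of λ
        { (C , circ , C⊆E , Ce , Cf) → restrict C ,
            circ-restrict circ (λ w → ≢true⇒false (λ h → true≢false (C⊆E p w h) (none w))) ,
            (λ i j h → C⊆E (punchIn p i) (punchIn p j) h) , Ce , Cf } }
    ; c-nbr = λ i h → case c-nbr c (punchIn p i) h of λ { (w , e) → case p ≟ w of λ
        { (yes refl) → ⊥-elim (true≢false (ES-sym (c-es c) e) (none _))
        ; (no ne) → punchOut ne , subst (λ x → E (punchIn p i) x ≡ true) (sym (Fin.punchIn-punchOut ne)) e } } }

-- From connected edge sets to admissible reductions

graph : ∀ {n} (E : ES n) → IsES E → Graph n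
graph E es = record { adj = E ; isES = es }

connects⇒MConnected : ∀ {n} {E : ES n} {V : VS n} (c : Connects E V) → (∀ v → V v ≡ true) → NonEmpty E →
  MConnected (graph E (c-es c))
connects⇒MConnected {E = E} c all (i , j , e) =
  (λ v → c-nbr c v (all v)) ,
  (case c-conn c (i , j) (i , j) e e of λ { (C , circ , C⊆E , Ce , _) →
    ≤-trans (s≤s (s≤s z≤n)) (≤-trans (circ-ecount≥3 circ Ce) (ecount-mono C⊆E)) }) ,
  λ a b c' d h k → case c-conn c (a , b) (c' , d) h k of λ { (C , circ , C⊆E , Ce , Cf) →
    ends C , C , ((circ-es circ , ends-within C) , (λ _ _ → refl) , C⊆E) , circ⇒Circuit22 circ , Ce , Cf }

Admissible : ∀ {n} → Graph n → Set
Admissible {n} G =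
  (∃[ m ] ∃[ G' ] (EdgeReduction {n} {m} G G' × MConnected G')) ⊎
  (∃[ G' ] (EdgeDeletion G G' × MConnected G')) ⊎
  (∃[ m ] ∃[ G' ] (K4Reduction {n} {m} G G' × MConnected G'))

edge-deletion : ∀ {n} (G : Graph n) {a b V} → adj G a b ≡ true → (c : Connects (delE a b (adj G)) V) → (∀ v → V v ≡ true) → Admissible G
edge-deletion G {a} {b} ab c all = inj₂ (inj₁ (graph (delE a b (adj G)) (c-es c) ,
  (a , b , ab , λ x y → mk⇔
    (λ h → ∧-fst h , λ { (inj₁ (refl , refl)) → true≢false (edge-self x y) (not-true⁻ (∧-snd {adj G x y} h))
                       ; (inj₂ (refl , refl)) → true≢false (edge-flip y x) (not-true⁻ (∧-snd {adj G x y} h)) })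
    (λ { (h , k) → ∧-intro h (not-true (edge-false a b {x} {y} k)) })) ,
  connects⇒MConnected c all (case c-nbr c a (all a) of λ { (w , h) → a , w , h })))

-- The edge p–a is contracted and the edge p–x dropped.  The merged vertex keeps the name a in E',
-- whereas in a generalised vertex split it is p = v₁ that the merged vertex turns into.
edge-reduction : ∀ {m} (G : Graph (suc m)) (E' : ES (suc m)) {p a x} → adj G p a ≡ true → adj G p x ≡ true → x ≢ a →
  (c : Connects E' (λ v → not (v == p))) → (∀ w → E' p w ≡ false) →
  (∀ i j → i ≢ p → j ≢ p → i ≢ a → j ≢ a → adj G i j ≡ E' i j) →
  (∀ j → j ≢ p → j ≢ a → (E' a j ≡ true → adj G a j ≡ true ⊎ (adj G p j ≡ true × j ≢ x)) ×
                          (adj G a j ≡ true ⊎ (adj G p j ≡ true × j ≢ x) → E' a j ≡ true)) →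
  (∀ j → adj G p j ≡ true → j ≢ x → adj G a j ≡ false) →
  Admissible G
edge-reduction {m} G E' {p} {a} {x} pa px x≢a c none same merged disj = inj₁ (m , graph (restrict p E') (IsES-restrict p (c-es c)) ,
  (v , N1 , N2 , x' , nbrs , disjoint , x'≢v , N1x , f , a , f-inj , f≢a , f-surj , away , at-v₁ , at-v₂ , subst (λ y → E y a ≡ true) (sym fv) pa) ,
  connects⇒MConnected (connects-restrict p c none) (λ i → not-true (≢⇒== (Fin.punchInᵢ≢i p i)))
    (case c-nbr (connects-restrict p c none) v (not-true (≢⇒== (Fin.punchInᵢ≢i p v))) of λ { (w , h) → v , w , h }))
  where
  E = adj G
  es = isES G
  p≢a = ES-≢ es pa
  p≢x = ES-≢ es px
  ι : Fin m → Fin (suc m)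
  ι = punchIn p
  v x' : Fin m
  v  = punchOut p≢a
  x' = punchOut p≢x
  ιv : ι v ≡ a
  ιv = Fin.punchIn-punchOut p≢a
  ιx : ι x' ≡ x
  ιx = Fin.punchIn-punchOut p≢x
  ι≢p : ∀ i → ι i ≢ p
  ι≢p i = Fin.punchInᵢ≢i p i
  ι≢a : ∀ {i} → i ≢ v → ι i ≢ a
  ι≢a i≢v e = i≢v (Fin.punchIn-injective p _ _ (trans e (sym ιv)))
  N1 N2 : VS m
  N1 i = E p (ι i) ∧ (not (ι i == a) ∧ not (ι i == x))
  N2 i = E a (ι i)
  N1-elim : ∀ {i} → N1 i ≡ true → E p (ι i) ≡ true × ι i ≢ a × ι i ≢ x
  N1-elim {i} h = ∧-fst h , (λ e → true≢false (==-true e) (not-true⁻ (∧-fst (∧-snd {E p (ι i)} h)))) ,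
    (λ e → true≢false (==-true e) (not-true⁻ (∧-snd {not (ι i == a)} (∧-snd {E p (ι i)} h))))
  N1-intro : ∀ {i} → E p (ι i) ≡ true → ι i ≢ a → ι i ≢ x → N1 i ≡ true
  N1-intro h k l = ∧-intro h (∧-intro (not-true (≢⇒== k)) (not-true (≢⇒== l)))
  nbrs : ∀ w → (restrict p E' v w ≡ true) ⇔ (N1 w ≡ true ⊎ N2 w ≡ true)
  nbrs w = mk⇔ to from
    where
    to : E' (ι v) (ι w) ≡ true → N1 w ≡ true ⊎ N2 w ≡ true
    to h = case proj₁ (merged (ι w) (ι≢p w) w≢a) (subst (λ y → E' y (ι w) ≡ true) ιv h) of λ
        { (inj₁ e) → inj₂ e ; (inj₂ (e , ne)) → inj₁ (N1-intro e w≢a ne) }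
      where
      w≢a : ι w ≢ a
      w≢a e = ES-≢ (c-es c) h (trans ιv (sym e))
    from : N1 w ≡ true ⊎ N2 w ≡ true → E' (ι v) (ι w) ≡ true
    from (inj₁ h) = case N1-elim h of λ { (e , na , nx) →
      subst (λ y → E' y (ι w) ≡ true) (sym ιv) (proj₂ (merged (ι w) (ι≢p w) na) (inj₂ (e , nx))) }
    from (inj₂ h) = subst (λ y → E' y (ι w) ≡ true) (sym ιv) (proj₂ (merged (ι w) (ι≢p w) (ES-≢ es h ∘ sym)) (inj₁ h))
  disjoint : ∀ w → N1 w ≡ true → N2 w ≡ false
  disjoint w h = case N1-elim h of λ { (e , _ , nx) → disj (ι w) e nx }
  x'≢v : x' ≢ v
  x'≢v e = x≢a (trans (sym ιx) (trans (cong ι e) ιv))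
  N1x : N1 x' ≡ false
  N1x = ≢true⇒false (λ h → proj₂ (proj₂ (N1-elim h)) ιx)
  f : Fin m → Fin (suc m)
  f i = if ι i == a then p else ι i
  fv : f v ≡ p
  fv = cong (λ b → if b then p else ι v) (==-true ιv)
  f-off : ∀ {i} → i ≢ v → f i ≡ ι i
  f-off {i} i≢v = cong (λ b → if b then p else ι i) (≢⇒== (ι≢a i≢v))
  f-inj : ∀ i j → f i ≡ f j → i ≡ j
  f-inj i j e with i ≟ v | j ≟ v
  ... | yes i≡v | yes j≡v = trans i≡v (sym j≡v)
  ... | yes refl | no j≢v = ⊥-elim (ι≢p j (trans (sym (f-off j≢v)) (trans (sym e) fv)))
  ... | no i≢v | yes refl = ⊥-elim (ι≢p i (trans (sym (f-off i≢v)) (trans e fv)))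
  ... | no i≢v | no j≢v = Fin.punchIn-injective p i j (trans (sym (f-off i≢v)) (trans e (f-off j≢v)))
  f≢a : ∀ i → f i ≢ a
  f≢a i e with i ≟ v
  ... | yes refl = p≢a (trans (sym fv) e)
  ... | no i≢v = ι≢a i≢v (trans (sym (f-off i≢v)) e)
  f-surj : ∀ w → w ≡ a ⊎ ∃[ i ] (f i ≡ w)
  f-surj w with w ≟ a | p ≟ w
  ... | yes e | _ = inj₁ e
  ... | no _ | yes refl = inj₂ (v , fv)
  ... | no w≢a | no p≢w = inj₂ (punchOut p≢w ,
      trans (f-off (λ e → w≢a (trans (sym (Fin.punchIn-punchOut p≢w)) (trans (cong ι e) ιv)))) (Fin.punchIn-punchOut p≢w))
  away : ∀ i j → i ≢ v → j ≢ v → E (f i) (f j) ≡ restrict p E' i j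
  away i j i≢v j≢v = trans (cong₂ E (f-off i≢v) (f-off j≢v)) (same (ι i) (ι j) (ι≢p i) (ι≢p j) (ι≢a i≢v) (ι≢a j≢v))
  at-v₁ : ∀ i → i ≢ v → (E (f v) (f i) ≡ true) ⇔ (N1 i ≡ true ⊎ i ≡ x')
  at-v₁ i i≢v = mk⇔
    (λ h → case ι i ≟ x of λ
      { (yes e) → inj₂ (Fin.punchIn-injective p i x' (trans e (sym ιx)))
      ; (no ne) → inj₁ (N1-intro (trans (sym (cong₂ E fv (f-off i≢v))) h) (ι≢a i≢v) ne) })
    (λ { (inj₁ h) → trans (cong₂ E fv (f-off i≢v)) (proj₁ (N1-elim h))
       ; (inj₂ refl) → trans (cong₂ E fv (trans (f-off i≢v) ιx)) px })
  at-v₂ : ∀ i → i ≢ v → E a (f i) ≡ N2 i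
  at-v₂ i i≢v = cong (E a) (f-off i≢v)

K4-reduction : ∀ {m} (G : Graph (suc m)) {p a b c} → Nbr3 (adj G) p a b c → Nbr3 (adj G) a p b c → adj G b c ≡ false →
  Connects (addE b c (remV a (remV p (adj G)))) (λ v → not (v == p) ∧ not (v == a)) → Admissible G
K4-reduction {zero} G {zero} {zero} N Na bc c = ⊥-elim (ES-≢ (isES G) (Nbr3.pa N) refl)
K4-reduction {suc m} G {p} {a} {b} {c} N Na bc con = inj₂ (inj₂ (m , graph (restrict a' (restrict p E')) (c-es con₂) ,
  (p , a , b , c , p≢a , pa , nbr3⇒dg N , nbr3⇒dg Na , b≢c , common , bc , f , f-inj , f-avoid , f-surj , spec) ,
  connects⇒MConnected con₂ all (case c-nbr con₂ b' (all b') of λ { (w , h) → b' , w , h })))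
  where
  open Nbr3 N
  open Nbr3 Na using () renaming (pb to ab; pc to ac; only to only-a)
  E = adj G
  es = isES G
  p≢a = ES-≢ es pa
  p≢b = ES-≢ es pb
  E₁ E' : ES (suc (suc m))
  E₁ = remV a (remV p E)
  E' = addE b c E₁
  a' : Fin (suc m)
  a' = punchOut p≢a
  ιa : punchIn p a' ≡ a
  ιa = Fin.punchIn-punchOut p≢a
  f : Fin m → Fin (suc (suc m))
  f i = punchIn p (punchIn a' i)
  f-avoid : ∀ i → f i ≢ p × f i ≢ a
  f-avoid i = Fin.punchInᵢ≢i p _ , λ e → Fin.punchInᵢ≢i a' i (Fin.punchIn-injective p _ _ (trans e (sym ιa)))
  f-inj : ∀ i j → f i ≡ f j → i ≡ j
  f-inj i j e = Fin.punchIn-injective a' i j (Fin.punchIn-injective p _ _ e)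
  f-surj : ∀ w → w ≡ p ⊎ w ≡ a ⊎ ∃[ i ] (f i ≡ w)
  f-surj w with p ≟ w
  ... | yes e = inj₁ (sym e)
  ... | no p≢w with a' ≟ punchOut p≢w
  ...   | yes e = inj₂ (inj₁ (trans (sym (Fin.punchIn-punchOut p≢w)) (trans (cong (punchIn p) (sym e)) ιa)))
  ...   | no ne = inj₂ (inj₂ (punchOut ne , trans (cong (punchIn p) (Fin.punchIn-punchOut ne)) (Fin.punchIn-punchOut p≢w)))
  pre : ∀ {w} → w ≢ p → w ≢ a → ∃[ i ] (f i ≡ w)
  pre {w} wp wa = case f-surj w of λ { (inj₁ e) → ⊥-elim (wp e) ; (inj₂ (inj₁ e)) → ⊥-elim (wa e) ; (inj₂ (inj₂ r)) → r }
  b' : Fin m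
  b' = proj₁ (pre (p≢b ∘ sym) (a≢b ∘ sym))
  none-p : ∀ w → E' p w ≡ false
  none-p w = ≢true⇒false λ h → case addE-elim b c E₁ {p} {w} h of λ
    { (inj₁ k) → proj₁ (proj₂ (remV-elim E p {p} {w} (proj₁ (remV-elim (remV p E) a {p} {w} k)))) refl
    ; (inj₂ (inj₁ (e , _))) → p≢b e ; (inj₂ (inj₂ (e , _))) → ES-≢ es pc e }
  none-a : ∀ w → E' a w ≡ false
  none-a w = ≢true⇒false λ h → case addE-elim b c E₁ {a} {w} h of λ
    { (inj₁ k) → proj₁ (proj₂ (remV-elim (remV p E) a {a} {w} k)) refl
    ; (inj₂ (inj₁ (e , _))) → a≢b e ; (inj₂ (inj₂ (e , _))) → a≢c e }
  con₁ = connects-restrict p con none-p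
  con₂ = connects-restrict a' con₁ (λ w → trans (cong (λ y → E' y (punchIn p w)) ιa) (none-a (punchIn p w)))
  all : ∀ i → not (f i == p) ∧ not (f i == a) ≡ true
  all i = ∧-intro (not-true (≢⇒== (proj₁ (f-avoid i)))) (not-true (≢⇒== (proj₂ (f-avoid i))))
  common : ∀ w → (E p w ≡ true × E a w ≡ true) ⇔ (w ≡ b ⊎ w ≡ c)
  common w = mk⇔
    (λ { (h , k) → case only w h of λ { (inj₁ refl) → ⊥-elim (ES-≢ es k refl) ; (inj₂ r) → r } })
    (λ { (inj₁ refl) → pb , ab ; (inj₂ refl) → pc , ac })
  spec : ∀ i j → (restrict a' (restrict p E') i j ≡ true) ⇔ (E (f i) (f j) ≡ true ⊎ (f i ≡ b × f j ≡ c) ⊎ (f i ≡ c × f j ≡ b))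
  spec i j = mk⇔
    (λ h → case addE-elim b c E₁ {f i} {f j} h of λ
      { (inj₁ k) → inj₁ (proj₁ (remV-elim E p {f i} {f j} (proj₁ (remV-elim (remV p E) a {f i} {f j} k)))) ; (inj₂ r) → inj₂ r })
    (λ { (inj₁ h) → addE-old b c E₁ {f i} {f j} (remV-intro (remV p E) a (remV-intro E p h (proj₁ (f-avoid i)) (proj₁ (f-avoid j))) (proj₂ (f-avoid i)) (proj₂ (f-avoid j)))
       ; (inj₂ (inj₁ (e , e'))) → subst₂ (λ y z → E' y z ≡ true) (sym e) (sym e') (addE-new b c E₁)
       ; (inj₂ (inj₂ (e , e'))) → subst₂ (λ y z → E' y z ≡ true) (sym e) (sym e') (addE-new' b c E₁) })

module _ {m} (G : Graph (suc m)) {Y : VS (suc m)} (ear : Ear (adj G) Y) (base : Base (induce (adj G) (Y ᶜ)) (Y ᶜ))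
  (grounded : ∀ v → Y v ≡ false → ∃[ w ] (induce (adj G) (Y ᶜ) v w ≡ true)) where
  open Realise ear base grounded
  private
    E = adj G
    es = isES G

  -- Deleting `p` and adding `ab` amounts to contracting `pa` after dropping `pc`: the merged vertex
  -- inherits `b` from `p`.
  one-reduction : ∀ {p a b c} → Nbr3 E p a b c → E a b ≡ false → Connects (addE a b (remV p E)) (λ v → not (v == p)) → Admissible G
  one-reduction {p} {a} {b} {c} N ab con = edge-reduction G (addE a b (remV p E)) {p} {a} {c} pa pc (a≢c ∘ sym) con
      none same merged disj
    where
    open Nbr3 N
    p≢a = ES-≢ es pa
    p≢b = ES-≢ es pb
    none : ∀ w → addE a b (remV p E) p w ≡ false
    none w = ≢true⇒false λ h → case addE-elim a b (remV p E) {p} {w} h of λ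
      { (inj₁ k) → proj₁ (proj₂ (remV-elim E p {p} {w} k)) refl
      ; (inj₂ (inj₁ (e , _))) → p≢a e ; (inj₂ (inj₂ (e , _))) → p≢b e }
    same : ∀ i j → i ≢ p → j ≢ p → i ≢ a → j ≢ a → E i j ≡ addE a b (remV p E) i j
    same i j ip jp ia ja = iff⇒≡ (λ h → addE-old a b (remV p E) (remV-intro E p h ip jp))
      (λ h → case addE-elim a b (remV p E) {i} {j} h of λ
        { (inj₁ k) → proj₁ (remV-elim E p {i} {j} k) ; (inj₂ (inj₁ (e , _))) → ⊥-elim (ia e) ; (inj₂ (inj₂ (_ , e))) → ⊥-elim (ja e) })
    merged : ∀ j → j ≢ p → j ≢ a → (addE a b (remV p E) a j ≡ true → E a j ≡ true ⊎ (E p j ≡ true × j ≢ c)) ×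
      (E a j ≡ true ⊎ (E p j ≡ true × j ≢ c) → addE a b (remV p E) a j ≡ true)
    merged j jp ja =
      (λ h → case addE-elim a b (remV p E) {a} {j} h of λ
        { (inj₁ k) → inj₁ (proj₁ (remV-elim E p {a} {j} k)) ; (inj₂ (inj₁ (_ , refl))) → inj₂ (pb , b≢c) ; (inj₂ (inj₂ (e , _))) → ⊥-elim (a≢b e) }) ,
      (λ { (inj₁ h) → addE-old a b (remV p E) (remV-intro E p h (p≢a ∘ sym) jp)
         ; (inj₂ (h , jc)) → case only j h of λ { (inj₁ e) → ⊥-elim (ja e) ; (inj₂ (inj₁ refl)) → addE-new a j (remV p E) ; (inj₂ (inj₂ e)) → ⊥-elim (jc e) } })
    disj : ∀ j → E p j ≡ true → j ≢ c → E a j ≡ false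
    disj j h jc = case only j h of λ { (inj₁ refl) → proj₂ es j ; (inj₂ (inj₁ refl)) → ab ; (inj₂ (inj₂ e)) → ⊥-elim (jc e) }

  -- The vertex `b` is merged into `d`, which inherits `p` and `a`. These are not adjacent to `d`,
  -- because all their neighbours are known.
  contraction : ∀ {p a b c d} → Nbr3 E p a b c → Nbr3 E a p b c → Nbr4 E b p a c d →
    Connects (addE d p (addE d a (remV b E))) (λ v → not (v == b)) → Admissible G
  contraction {p} {a} {b} {c} {d} N Na Nb con = edge-reduction G E' {b} {d} {c} bd bc c≢d con none same merged disj
    where
    open Nbr3 N
    open Nbr3 Na using () renaming (only to only-a)
    open Nbr4 Nb using () renaming (pa to bp; pb to ba; pc to bc; pd to bd; only to only-b; a≢d to p≢d; b≢d to a≢d; c≢d to c≢d; a≢c to p≢c)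
    E₀ E₁ E' : ES (suc m)
    E₀ = remV b E
    E₁ = addE d a E₀
    E' = addE d p E₁
    p≢b = ES-≢ es pb
    b≢d = ES-≢ es bd
    elim : ∀ {i j} → E' i j ≡ true → (E i j ≡ true × i ≢ b × j ≢ b) ⊎ (i ≡ d × (j ≡ p ⊎ j ≡ a)) ⊎ ((i ≡ p ⊎ i ≡ a) × j ≡ d)
    elim {i} {j} h = case addE-elim d p E₁ {i} {j} h of λ
      { (inj₂ (inj₁ (e , f))) → inj₂ (inj₁ (e , inj₁ f))
      ; (inj₂ (inj₂ (e , f))) → inj₂ (inj₂ (inj₁ e , f))
      ; (inj₁ k) → case addE-elim d a E₀ {i} {j} k of λ
        { (inj₂ (inj₁ (e , f))) → inj₂ (inj₁ (e , inj₂ f))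
        ; (inj₂ (inj₂ (e , f))) → inj₂ (inj₂ (inj₂ e , f))
        ; (inj₁ l) → inj₁ (remV-elim E b {i} {j} l) } }
    old : ∀ {i j} → E i j ≡ true → i ≢ b → j ≢ b → E' i j ≡ true
    old h ib jb = addE-old d p E₁ (addE-old d a E₀ (remV-intro E b h ib jb))
    none : ∀ w → E' b w ≡ false
    none w = ≢true⇒false λ h → case elim {b} {w} h of λ
      { (inj₁ (_ , e , _)) → e refl ; (inj₂ (inj₁ (e , _))) → b≢d e
      ; (inj₂ (inj₂ (inj₁ e , _))) → p≢b (sym e) ; (inj₂ (inj₂ (inj₂ e , _))) → a≢b (sym e) }
    same : ∀ i j → i ≢ b → j ≢ b → i ≢ d → j ≢ d → E i j ≡ E' i j
    same i j ib jb id' jd = iff⇒≡ (λ h → old h ib jb) (λ h → case elim {i} {j} h of λ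
      { (inj₁ (e , _)) → e ; (inj₂ (inj₁ (e , _))) → ⊥-elim (id' e) ; (inj₂ (inj₂ (_ , e))) → ⊥-elim (jd e) })
    merged : ∀ j → j ≢ b → j ≢ d → (E' d j ≡ true → E d j ≡ true ⊎ (E b j ≡ true × j ≢ c)) ×
      (E d j ≡ true ⊎ (E b j ≡ true × j ≢ c) → E' d j ≡ true)
    merged j jb jd =
      (λ h → case elim {d} {j} h of λ
        { (inj₁ (e , _)) → inj₁ e
        ; (inj₂ (inj₁ (_ , inj₁ refl))) → inj₂ (bp , p≢c)
        ; (inj₂ (inj₁ (_ , inj₂ refl))) → inj₂ (ba , a≢c)
        ; (inj₂ (inj₂ (_ , e))) → ⊥-elim (jd e) }) ,
      (λ { (inj₁ h) → old h (b≢d ∘ sym) jb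
         ; (inj₂ (h , jc)) → case only-b j h of λ
           { (inj₁ refl) → addE-new d j E₁ ; (inj₂ (inj₁ refl)) → addE-old d p E₁ {d} {j} (addE-new d j E₀)
           ; (inj₂ (inj₂ (inj₁ e))) → ⊥-elim (jc e) ; (inj₂ (inj₂ (inj₂ e))) → ⊥-elim (jd e) } })
    disj : ∀ j → E b j ≡ true → j ≢ c → E d j ≡ false
    disj j h jc = case only-b j h of λ
      { (inj₁ refl) → ≢true⇒false (λ k → case only d (ES-sym es k) of λ
          { (inj₁ e) → a≢d (sym e) ; (inj₂ (inj₁ e)) → b≢d (sym e) ; (inj₂ (inj₂ e)) → c≢d (sym e) })
      ; (inj₂ (inj₁ refl)) → ≢true⇒false (λ k → case only-a d (ES-sym es k) of λ
          { (inj₁ e) → p≢d (sym e) ; (inj₂ (inj₁ e)) → b≢d (sym e) ; (inj₂ (inj₂ e)) → c≢d (sym e) })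
      ; (inj₂ (inj₂ (inj₁ e))) → ⊥-elim (jc e)
      ; (inj₂ (inj₂ (inj₂ refl))) → proj₂ es j }

  ear-admissible : Admissible G
  ear-admissible = case reducible ear of λ
    { (p , a , b , c , inj₁ r@(_ , _ , N , ab , _)) → one-reduction N ab (Reduce₁.result r)
    ; (p , a , b , c , inj₂ (inj₁ r@(_ , _ , _ , N , Na , bc))) → K4-reduction G N Na bc (Reduce₂.result r)
    ; (p , a , b , c , inj₂ (inj₂ (inj₁ r@(_ , _ , N)))) → case true⊎false (E a b) of λ
      { (inj₁ ab) → edge-deletion G ab (Reduce₃.deleted r ab) (λ _ → refl)
      ; (inj₂ ab) → one-reduction N ab (Reduce₃.added r ab) }
    ; (p , a , b , c , inj₂ (inj₂ (inj₂ (inj₁ r@(_ , _ , _ , N , Na))))) → case true⊎false (E b c) of λ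
      { (inj₁ bc) → edge-deletion G bc (Reduce₄.deleted r bc) (λ _ → refl)
      ; (inj₂ bc) → K4-reduction G N Na bc (Reduce₄.added r bc) }
    ; (p , a , b , c , inj₂ (inj₂ (inj₂ (inj₂ (d , r@(_ , _ , _ , N , Na , bc , Nb)))))) → contraction N Na Nb (Reduce₅.result r) }

-- Ear decompositions

ecount-disjoint-∪ : ∀ {n} (A B : ES n) → (∀ i j → A i j ≡ true → B i j ≡ false) → ecount (A ∪ᵉ B) ≡ ecount A + ecount B
ecount-disjoint-∪ A B disj = trans (sym (+-identityʳ _)) (trans (cong (ecount (A ∪ᵉ B) +_)
  (sym (ecount-∅ {A = A ∩ᵉ B} (λ i j _ → ≢true⇒false (λ h → true≢false (∧-snd {A i j} h) (disj i j (∧-fst h))))))) (ecount-∪∩ A B))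

-- `minl` is condition (E3) at a chosen edge `p`: a circuit inside `D ∪ᵉ C` that misses `p` has a
-- strictly smaller part outside `D`.
module EarStep {n} {D C : ES n} (base : Base D (ends D)) (circ : IsCirc C)
  {e p : Edge n} (Ce : C ∋ e) (De : D ∋ e) (Cp : C ∋ p) (Dp : D ∌ p)
  (minl : ∀ Q → IsCirc Q → Q ⊆ᵉ (D ∪ᵉ C) → (∃[ f ] (Q ∋ f × D ∋ f)) → (∃[ g ] (Q ∋ g × D ∌ g)) → Q ∌ p → ⊥) where
  open Base base

  P : ES n
  P = C ∖ᵉ D
  V VC X N : VS n
  V  = ends D
  VC = ends C
  X  = VC ∩ᵛ V
  N  = VC ∖ᵛ V
  esC = circ-es circ
  esP : IsES P
  esP = IsES-∖ esC (proj₁ base-es)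
  Pp : P ∋ p
  Pp = ∧-intro Cp (not-true Dp)
  Pe : P ∌ e
  Pe = trans (cong (λ b → C (proj₁ e) (proj₂ e) ∧ not b) De) (𝔹.∧-zeroʳ _)
  p₁ p₂ : Fin n
  p₁ = proj₁ p
  p₂ = proj₂ p
  P⁻ B' : ES n
  P⁻ = delE p₁ p₂ P
  B' = basis ∪ᵉ P⁻
  es⁻ : IsES P⁻
  es⁻ = IsES-delE p₁ p₂ esP
  esB' : IsES B'
  esB' = IsES-∪ basis-es es⁻

  -- `C ∩ᵉ D` is a proper part of the circuit `C`, so it has at most `2|X| − 2` of the
  -- `2|X| + 2|N| − 1` edges.
  many-new : 2 * vcount N + 1 ≤ ecount P
  many-new = linear 6 (λ c q i x n v → c ≐ q ⊕ i ⇒ i ⊕ κ 2 ≼ 2 ⊗ x ⇒ c ⊕ κ 1 ≐ 2 ⊗ v ⇒ n ⊕ x ≐ v ⇒ ⊢ 2 ⊗ n ⊕ κ 1 ≼ q)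
    (ecount C) (ecount P) (ecount (C ∩ᵉ D)) (vcount X) (vcount N) (vcount VC)
    (ecount-∖∩ C D)
    (subst (λ x → x + 2 ≤ 2 * vcount X)
      (ind-all (C ∩ᵉ D) X (IsES-∩ esC base-es) (λ i j h → ∧-intro (ends-intro C (∧-fst h)) (ends-intro D (∧-snd {C i j} h))))
      (¬overfull⇒sparse (C ∩ᵉ D) (circ-proper-sparse circ (IsES-∩ esC base-es) (λ i j h → ∧-fst h) {p} Cp
        (trans (cong (C p₁ p₂ ∧_) Dp) (𝔹.∧-zeroʳ _))) X
        (vcount-pos X (proj₁ e) (∧-intro (ends-intro C Ce) (ends-intro D De)))))
    (circ-count circ) (vcount-∖∩ VC V)

  P⁻⊆ : ∀ i j → P⁻ i j ≡ true → C i j ≡ true × D i j ≡ false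
  P⁻⊆ i j h = ∧-fst (∧-fst {P i j} h) , not-true⁻ (∧-snd {C i j} (∧-fst {P i j} h))

  -- A circuit in `B'` would meet `D`, being otherwise a proper part of `C`; it would leave `D`, the
  -- basis being independent; and it would miss `p`. That contradicts minimality of the ear.
  indep : ¬ Overfull B'
  indep o = case overfull⇒circ esB' o of λ { (Q , q , Q⊆) → minl Q q (Q⊆DC Q⊆) (meets q Q⊆) (new q Q⊆) (avoids Q⊆) }
    where
    module _ {Q : ES n} where
      Q⊆DC : Q ⊆ᵉ B' → Q ⊆ᵉ (D ∪ᵉ C)
      Q⊆DC Q⊆ i j h = case ∨-elim {basis i j} (Q⊆ i j h) of λ
        { (inj₁ b) → ∨-introˡ (basis⊆ i j b) ; (inj₂ b) → ∨-introʳ {D i j} (proj₁ (P⁻⊆ i j b)) }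
      new : IsCirc Q → Q ⊆ᵉ B' → ∃[ g ] (Q ∋ g × D ∌ g)
      new q Q⊆ = case ⊆ᵉ⊎witness Q basis of λ
        { (inj₁ sub) → ⊥-elim (basis-indep (overfull-mono sub (circ-overfull q)))
        ; (inj₂ ((i , j) , Qg , bg)) → (i , j) , Qg , proj₂ (P⁻⊆ i j (∨-elimˡ (Q⊆ i j Qg) bg)) }
      meets : IsCirc Q → Q ⊆ᵉ B' → ∃[ f ] (Q ∋ f × D ∋ f)
      meets q Q⊆ = case ⊆ᵉ⊎witness Q P of λ
        { (inj₁ sub) → ⊥-elim (circ-proper-sparse circ (circ-es q) (λ i j h → ∧-fst (sub i j h)) {e} Ce
            (≢true⇒false (λ h → true≢false (sub (proj₁ e) (proj₂ e) h) Pe)) (circ-overfull q))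
        ; (inj₂ ((i , j) , Qf , Pf)) → (i , j) , Qf , (case ∨-elim {basis i j} (Q⊆ i j Qf) of λ
            { (inj₁ b) → basis⊆ i j b ; (inj₂ b) → ⊥-elim (true≢false (∧-fst {P i j} b) Pf) }) }
      avoids : Q ⊆ᵉ B' → Q ∌ p
      avoids Q⊆ = ≢true⇒false λ h → case ∨-elim {basis p₁ p₂} (Q⊆ p₁ p₂ h) of λ
        { (inj₁ b) → true≢false (basis⊆ p₁ p₂ b) Dp ; (inj₂ b) → true≢false b (delE-self P p₁ p₂) }

  B'-count : ecount B' + 1 ≡ ecount basis + ecount P
  B'-count = linear 4 (λ b' b q q⁻ → b' ≐ b ⊕ q⁻ ⇒ q ≐ κ 1 ⊕ q⁻ ⇒ ⊢ b' ⊕ κ 1 ≐ b ⊕ q) (ecount B') (ecount basis) (ecount P) (ecount P⁻)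
    (ecount-disjoint-∪ basis P⁻ (λ i j b → ≢true⇒false (λ h → true≢false (basis⊆ i j b) (proj₂ (P⁻⊆ i j h)))))
    (ecount-delE esP Pp)

  VN : vcount (V ∪ᵛ N) ≤ vcount V + vcount N
  VN = ≤-trans (m≤m+n _ _) (≤-reflexive (vcount-∪∩ V N))

  covers : ∀ i → V i ≡ true ⊎ VC i ≡ true → (V ∪ᵛ N) i ≡ true
  covers i (inj₁ h) = ∨-introˡ h
  covers i (inj₂ h) = case true⊎false (V i) of λ
    { (inj₁ v) → ∨-introˡ v ; (inj₂ v) → ∨-introʳ {V i} (∧-intro h (not-true v)) }

  -- Independence of `B'` gives the upper bound: the basis already has `2|V| − 2` edges, so at most
  -- `2|N|` further edges fit, and `p` is the one left out.
  new-count : ecount P ≡ 2 * vcount N + 1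
  new-count = ≤-antisym (linear 7 (λ t v n b b' q i → t ≼ v ⊕ n ⇒ i ⊕ κ 2 ≼ 2 ⊗ t ⇒ i ≐ b' ⇒ b' ⊕ κ 1 ≐ b ⊕ q ⇒ 2 ⊗ v ≼ b ⊕ κ 2 ⇒ ⊢ q ≼ 2 ⊗ n ⊕ κ 1)
      (vcount (V ∪ᵛ N)) (vcount V) (vcount N) (ecount basis) (ecount B') (ecount P) (ind B' (V ∪ᵛ N))
      VN (¬overfull⇒sparse B' indep (V ∪ᵛ N) (vcount-pos (V ∪ᵛ N) (proj₁ e) (∨-introˡ (ends-intro D De))))
      (ind-all B' (V ∪ᵛ N) esB' (λ i j h → covers i (case ∨-elim {basis i j} h of λ
        { (inj₁ b) → inj₁ (ends-intro D (basis⊆ i j b)) ; (inj₂ b) → inj₂ (ends-intro C (proj₁ (P⁻⊆ i j b))) })))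
      B'-count basis-count) many-new

  extended : ∀ {D'} → IsES D' → D' ⊆ᵉ (D ∪ᵉ C) → (D ∪ᵉ C) ⊆ᵉ D' → Base D' (ends D')
  extended {D'} es' D'⊆ ⊆D' = record
    { base-es = es' ; connected = conn ; basis = B' ; basis-es = esB'
    ; basis⊆ = λ i j h → ⊆D' i j (case ∨-elim {basis i j} h of λ
        { (inj₁ b) → ∨-introˡ (basis⊆ i j b) ; (inj₂ b) → ∨-introʳ {D i j} (proj₁ (P⁻⊆ i j b)) })
    ; basis-indep = indep
    ; basis-count = linear 7 (λ d t v n b b' q → d ≼ t ⇒ t ≼ v ⊕ n ⇒ b' ⊕ κ 1 ≐ b ⊕ q ⇒ 2 ⊗ n ⊕ κ 1 ≼ q ⇒ 2 ⊗ v ≼ b ⊕ κ 2 ⇒ ⊢ 2 ⊗ d ≼ b' ⊕ κ 2)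
        (vcount (ends D')) (vcount (V ∪ᵛ N)) (vcount V) (vcount N) (ecount basis) (ecount B') (ecount P)
        (vcount-mono {A = ends D'} {V ∪ᵛ N} (λ i h → case ends-elim D' h of λ { (j , d) → covers i (case ∨-elim {D i j} (D'⊆ i j d) of λ
          { (inj₁ x) → inj₁ (ends-intro D x) ; (inj₂ x) → inj₂ (ends-intro C x) }) }))
        VN B'-count many-new basis-count }
    where
    to-e : ∀ f → D' ∋ f → Linked D' f e
    to-e (i , j) h = case ∨-elim {D i j} (D'⊆ i j h) of λ
      { (inj₁ d) → linked-mono (λ i j x → ⊆D' i j (∨-introˡ x)) (connected (i , j) e d De)
      ; (inj₂ c) → C , circ , (λ i j x → ⊆D' i j (∨-introʳ {D i j} x)) , c , Ce }
    conn : Connected D'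
    conn f g Df Dg = linked-trans {f = e} (to-e f Df) (linked-sym (to-e g Dg))

-- A circuit without one of its edges is independent and has `2|V| − 2` edges.
circuit-base : ∀ {n} {C D : ES n} → IsCirc C → IsES D → C ⊆ᵉ D → D ⊆ᵉ C → Base D (ends D)
circuit-base {n} {C} {D} c esD C⊆D D⊆C = case ecount>0 C (linear 2 (λ e v → e ⊕ κ 1 ≐ 2 ⊗ v ⇒ κ 1 ≼ v ⇒ ⊢ κ 1 ≼ e)
      (ecount C) (vcount (ends C)) (circ-count c) (circ-ends-pos c)) of λ { (a , b , ab) → record
    { base-es = esD
    ; connected = λ e f De Df → C , c , C⊆D , D⊆C (proj₁ e) (proj₂ e) De , D⊆C (proj₁ f) (proj₂ f) Df
    ; basis = delE a b C ; basis-es = IsES-delE a b (circ-es c)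
    ; basis⊆ = λ i j h → C⊆D i j (delE-⊆ C a b i j h)
    ; basis-indep = circ-proper-sparse c (IsES-delE a b (circ-es c)) (delE-⊆ C a b) {a , b} ab (delE-self C a b)
    ; basis-count = linear 4 (λ d v e e' → d ≐ v ⇒ e ⊕ κ 1 ≐ 2 ⊗ v ⇒ e ≐ κ 1 ⊕ e' ⇒ ⊢ 2 ⊗ d ≼ e' ⊕ κ 2)
        (vcount (ends D)) (vcount (ends C)) (ecount C) (ecount (delE a b C))
        (vcount-cong {A = ends D} {ends C} (ends-mono {A = D} {C} D⊆C) (ends-mono {A = C} {D} C⊆D))
        (circ-count c) (ecount-delE (circ-es c) ab) } }

module Ears {n} (G : Graph n) (s : ℕ) (C : Fin (suc s) → ES n) (dec : EarDecomposition G (suc s) C) where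

  union : ℕ → ES n
  union k i j = anyFin (λ r → (toℕ r <ᵇ k) ∧ C r i j)

  <ᵇ-true : ∀ {a b} → a < b → (a <ᵇ b) ≡ true
  <ᵇ-true {a} {b} h = T⇒≡ (<⇒<ᵇ h)
    where
    T⇒≡ : ∀ {b} → T b → b ≡ true
    T⇒≡ {true} _ = refl

  <ᵇ-elim : ∀ {a b} → (a <ᵇ b) ≡ true → a < b
  <ᵇ-elim {a} {b} h = <ᵇ⇒< a b (subst T (sym h) _)

  union⇒InD : ∀ k {i j} → union k i j ≡ true → InD C k i j
  union⇒InD k {i} {j} h = case anyFin-elim _ h of λ { (r , x) → r , <ᵇ-elim (∧-fst x) , ∧-snd {toℕ r <ᵇ k} x }

  InD⇒union : ∀ k {i j} → InD C k i j → union k i j ≡ true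
  InD⇒union k {i} {j} (r , lt , c) = anyFin-intro (λ r → (toℕ r <ᵇ k) ∧ C r i j) r (∧-intro (<ᵇ-true lt) c)

  circ : ∀ r → IsCirc (C r)
  circ r = MCircuit⇒circ (proj₁ dec r)

  C⊆E : ∀ r → C r ⊆ᵉ adj G
  C⊆E r = proj₁ (proj₂ (proj₁ dec r))

  union-es : ∀ k → IsES (union k)
  union-es k = (λ i j → iff⇒≡ (flip i j) (flip j i)) , (λ i → ≢true⇒false (λ h → case union⇒InD k h of λ { (r , _ , c) →
      true≢false c (proj₂ (circ-es (circ r)) i) }))
    where
    flip : ∀ i j → union k i j ≡ true → union k j i ≡ true
    flip i j h = case union⇒InD k h of λ { (r , lt , c) → InD⇒union k (r , lt , ES-sym (circ-es (circ r)) c) }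

  minimal : ∀ r → 1 ≤ toℕ r → ∀ {p} → C r ∋ p → union (toℕ r) ∌ p →
    ∀ Q → IsCirc Q → Q ⊆ᵉ (union (toℕ r) ∪ᵉ C r) → (∃[ f ] (Q ∋ f × union (toℕ r) ∋ f)) → (∃[ g ] (Q ∋ g × union (toℕ r) ∌ g)) → Q ∌ p → ⊥
  minimal r pos {p} Cp Dp Q q Q⊆ ((i , j) , Qf , Df) ((k , l) , Qg , Dg) Qp =
    proj₂ (proj₂ (proj₂ (proj₂ dec) r pos)) (Q ,
      circ⇒MCircuit q (λ i j h → case ∨-elim {union (toℕ r) i j} (Q⊆ i j h) of λ
        { (inj₁ d) → case union⇒InD (toℕ r) d of λ { (r' , _ , c) → C⊆E r' i j c } ; (inj₂ c) → C⊆E r i j c }) ,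
      (i , j , Qf , union⇒InD (toℕ r) Df) ,
      (k , l , Qg , (λ d → true≢false (InD⇒union (toℕ r) d) Dg)) ,
      (λ i j h ¬d → ∨-elimˡ (Q⊆ i j h) (≢true⇒false (λ d → ¬d (union⇒InD (toℕ r) d)))) ,
      (proj₁ p , proj₂ p , Cp , (λ d → true≢false (InD⇒union (toℕ r) d) Dp) , (λ h → true≢false h Qp)))

  meeting : ∀ r → 1 ≤ toℕ r → ∃[ e ] (C r ∋ e × union (toℕ r) ∋ e)
  meeting r pos = case proj₁ (proj₂ (proj₂ dec) r pos) of λ { (i , j , c , d) → (i , j) , c , InD⇒union (toℕ r) d }

  leaving : ∀ r → 1 ≤ toℕ r → ∃[ p ] (C r ∋ p × union (toℕ r) ∌ p)
  leaving r pos = case proj₁ (proj₂ (proj₂ (proj₂ dec) r pos)) of λ { (i , j , c , ¬d) →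
    (i , j) , c , ≢true⇒false (λ d → ¬d (union⇒InD (toℕ r) d)) }

  union-suc : ∀ r → union (suc (toℕ r)) ⊆ᵉ (union (toℕ r) ∪ᵉ C r)
  union-suc r i j h = case union⇒InD (suc (toℕ r)) h of λ { (r' , lt , c) → case m≤n⇒m<n∨m≡n (≤-pred lt) of λ
    { (inj₁ lt') → ∨-introˡ (InD⇒union (toℕ r) (r' , lt' , c))
    ; (inj₂ eq) → ∨-introʳ {union (toℕ r) i j} (subst (λ x → C x i j ≡ true) (Fin.toℕ-injective eq) c) } }

  suc-union : ∀ r → (union (toℕ r) ∪ᵉ C r) ⊆ᵉ union (suc (toℕ r))
  suc-union r i j h = case ∨-elim {union (toℕ r) i j} h of λ
    { (inj₁ d) → case union⇒InD (toℕ r) d of λ { (r' , lt , c) → InD⇒union (suc (toℕ r)) (r' , m≤n⇒m≤1+n lt , c) }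
    ; (inj₂ c) → InD⇒union (suc (toℕ r)) (r , ≤-refl , c) }

  add-ear : ∀ k → suc k < suc s → Base (union (suc k)) (ends (union (suc k))) → Base (union (suc (suc k))) (ends (union (suc (suc k))))
  add-ear k lt prev = subst (λ x → Base (union x) (ends (union x))) (cong suc r≡)
      (case meeting r pos of λ { (e , Ce , De) → case leaving r pos of λ { (p , Cp , Dp) →
        EarStep.extended prev' (circ r) {e} {p} Ce De Cp Dp (minimal r pos {p} Cp Dp) (union-es (suc (toℕ r))) (union-suc r) (suc-union r) } })
    where
    r : Fin (suc s)
    r = fromℕ< lt
    r≡ : toℕ r ≡ suc k
    r≡ = Fin.toℕ-fromℕ< lt
    pos : 1 ≤ toℕ r
    pos = subst (1 ≤_) (sym r≡) (s≤s z≤n)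
    prev' : Base (union (toℕ r)) (ends (union (toℕ r)))
    prev' = subst (λ x → Base (union x) (ends (union x))) (sym r≡) prev

  union-base : ∀ k → 1 ≤ k → k ≤ s → Base (union k) (ends (union k))
  union-base (suc zero) _ _ = circuit-base (circ zero) (union-es 1)
    (λ i j h → InD⇒union 1 (zero , s≤s z≤n , h))
    (λ i j h → case union⇒InD 1 h of λ { (zero , _ , c) → c ; (suc r , s≤s () , c) })
  union-base (suc (suc k)) _ le = add-ear k (m≤n⇒m≤1+n le) (union-base (suc k) (s≤s z≤n) (≤-trans (n≤1+n _) le))

module LastEar {n} (E : ES n) (es : IsES E) (D C : ES n) (base : Base D (ends D)) (circ : IsCirc C)
  {e p : Edge n} (Ce : C ∋ e) (De : D ∋ e) (Cp : C ∋ p) (Dp : D ∌ p)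
  (minl : ∀ Q → IsCirc Q → Q ⊆ᵉ (D ∪ᵉ C) → (∃[ f ] (Q ∋ f × D ∋ f)) → (∃[ g ] (Q ∋ g × D ∌ g)) → Q ∌ p → ⊥)
  (E⊆ : E ⊆ᵉ (D ∪ᵉ C)) (⊆E : (D ∪ᵉ C) ⊆ᵉ E) (nbr : ∀ v → ∃[ w ] (E v w ≡ true)) where
  open EarStep base circ {e} {p} Ce De Cp Dp minl using (P; V; VC; N; esP; esC; Pp; new-count)
  open Base base

  Y : VS n
  Y = N

  Y-false⇒V : ∀ {v} → Y v ≡ false → V v ≡ true
  Y-false⇒V {v} Yv = case nbr v of λ { (w , h) → case ∨-elim {D v w} (E⊆ v w h) of λ
    { (inj₁ d) → ends-intro D d
    ; (inj₂ c) → ≢false⇒true (λ Vv → true≢false (∧-intro (ends-intro C c) (not-true Vv)) Yv) } }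

  V⇒Y-false : ∀ {v} → V v ≡ true → Y v ≡ false
  V⇒Y-false {v} Vv = ≢true⇒false (λ h → true≢false Vv (not-true⁻ (∧-snd {VC v} h)))

  D⊆E : D ⊆ᵉ E
  D⊆E i j h = ⊆E i j (∨-introˡ h)

  C⊆E : C ⊆ᵉ E
  C⊆E i j h = ⊆E i j (∨-introʳ {D i j} h)

  at-Y : ∀ {i j} → E i j ≡ true → Y i ≡ true ⊎ Y j ≡ true → P i j ≡ true
  at-Y {i} {j} h y = ∧-intro (∨-elimˡ (E⊆ i j h) Dij) (not-true Dij)
    where
    Dij : D i j ≡ false
    Dij = ≢true⇒false λ d → case y of λ
      { (inj₁ Yi) → true≢false Yi (V⇒Y-false (ends-intro D d)) ; (inj₂ Yj) → true≢false Yj (V⇒Y-false (ends-intro D (ES-sym base-es d))) }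

  -- The ends of an edge shared with the earlier ears: two vertices of the last ear outside `Y`.
  -- They show that the vertex sets to which sparsity of the circuit is applied are proper or
  -- nonempty.
  e₁ e₂ : Fin n
  e₁ = proj₁ e
  e₂ = proj₂ e
  Ye₁ : Y e₁ ≡ false
  Ye₁ = V⇒Y-false (ends-intro D De)
  Ye₂ : Y e₂ ≡ false
  Ye₂ = V⇒Y-false (ends-intro D (ES-sym base-es De))
  e₁≢e₂ : e₁ ≢ e₂
  e₁≢e₂ = ES-≢ esC Ce
  VCe₁ : VC e₁ ≡ true
  VCe₁ = ends-intro C Ce
  VCe₂ : VC e₂ ≡ true
  VCe₂ = ends-intro C (ES-sym esC Ce)

  edge-at : ∀ S → S ⊆ᵛ Y → touch E S ⊆ᵉ touch C S
  edge-at S S⊆Y i j h = case touch-elim E S {i} {j} h of λ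
    { (x , inj₁ s) → ∧-intro (∧-fst (at-Y x (inj₁ (S⊆Y i s)))) (∧-snd {E i j} h)
    ; (x , inj₂ s) → ∧-intro (∧-fst (at-Y x (inj₂ (S⊆Y j s)))) (∧-snd {E i j} h) }

  inc-C : ∀ S → S ⊆ᵛ Y → inc C S ≡ inc E S
  inc-C S S⊆Y = ecount-cong {A = touch C S} {touch E S} (λ i j h → ∧-intro (C⊆E i j (∧-fst h)) (∧-snd {C i j} h)) (edge-at S S⊆Y)

  ind-C : ∀ S → S ⊆ᵛ Y → ind C S ≡ ind E S
  ind-C S S⊆Y = ecount-cong {A = induce C S} {induce E S} (λ i j h → ∧-intro (C⊆E i j (∧-fst h)) (∧-snd {C i j} h))
    (λ i j h → case induce-elim E S {i} {j} h of λ { (x , y , z) → induce-intro C S (∧-fst (at-Y x (inj₁ (S⊆Y i y)))) y z })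

  -- The circuit spans at most `2|R| − 2` edges on its remaining vertices `R`; the others of its
  -- `2|R| + 2|S| − 1` edges are at `S`.
  lower : ∀ S → S ⊆ᵛ Y → 1 ≤ vcount S → 2 * vcount S + 1 ≤ inc E S
  lower S S⊆Y pos = subst (2 * vcount S + 1 ≤_) (inc-C S S⊆Y)
      (linear 8 (λ c i j j' t s v m → c ≐ i ⊕ j ⇒ j ≐ j' ⇒ j' ⊕ κ 2 ≼ 2 ⊗ t ⇒ c ⊕ κ 1 ≐ 2 ⊗ v ⇒ t ⊕ m ≐ v ⇒ m ≐ s ⇒ ⊢ 2 ⊗ s ⊕ κ 1 ≼ i)
        (ecount C) (inc C S) (ind C (S ᶜ)) (ind C R) (vcount R) (vcount S) (vcount VC) (vcount (VC ∩ᵛ S))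
        (split-touch C S) same
        (circ-sparse circ R (vcount-pos R e₁ (∧-intro VCe₁ (not-true (out Ye₁)))) (λ sub → case vcount>0 S pos of λ { (v , Sv) →
          true≢false Sv (not-true⁻ (∧-snd {VC v} (sub v (∧-fst (S⊆Y v Sv))))) }))
        (circ-count circ) (vcount-∖∩ VC S)
        (vcount-cong {A = VC ∩ᵛ S} {S} (λ v h → ∧-snd {VC v} h) (λ v h → ∧-intro (∧-fst (S⊆Y v h)) h)))
    where
    R : VS n
    R = VC ∖ᵛ S
    out : ∀ {v} → Y v ≡ false → S v ≡ false
    out {v} h = ≢true⇒false (λ k → true≢false (S⊆Y v k) h)
    same : ind C (S ᶜ) ≡ ind C R
    same = ecount-cong {A = induce C (S ᶜ)} {induce C R}
      (λ i j h → case induce-elim C (S ᶜ) {i} {j} h of λ { (x , y , z) →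
        induce-intro C R x (∧-intro (ends-intro C x) y) (∧-intro (ends-intro C (ES-sym esC x)) z) })
      (λ i j h → case induce-elim C R {i} {j} h of λ { (x , y , z) → induce-intro C (S ᶜ) x (∧-snd {VC i} y) (∧-snd {VC j} z) })

  upper : ∀ S → S ⊆ᵛ Y → 1 ≤ vcount S → ind E S + 2 ≤ 2 * vcount S
  upper S S⊆Y pos = subst (λ x → x + 2 ≤ 2 * vcount S) (ind-C S S⊆Y)
    (circ-sparse circ S pos (λ sub → true≢false (S⊆Y e₁ (sub e₁ VCe₁)) Ye₁))

  -- `ins x S` cannot contain both `e₁` and `e₂`, so it is a proper part of the circuit.
  upper⁺ : ∀ S x → S ⊆ᵛ Y → 1 ≤ vcount S → Y x ≡ false → ind E (ins x S) ≤ 2 * vcount S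
  upper⁺ S x S⊆Y pos Yx = linear 4 (λ i j s s' → i ≼ j ⇒ j ⊕ κ 2 ≼ 2 ⊗ s' ⇒ s' ≐ κ 1 ⊕ s ⇒ ⊢ i ≼ 2 ⊗ s)
      (ind E (ins x S)) (ind C (ins x S)) (vcount S) (vcount (ins x S))
      (ecount-mono {A = induce E (ins x S)} {induce C (ins x S)} within)
      (circ-sparse circ (ins x S) (vcount-pos (ins x S) x (ins-self x S)) (λ sub → e₁≢e₂
        (trans (only-x Ye₁ (sub e₁ VCe₁)) (sym (only-x Ye₂ (sub e₂ VCe₂))))))
      (vcount-ins x S (≢true⇒false (λ h → true≢false (S⊆Y x h) Yx)))
    where
    only-x : ∀ {v} → Y v ≡ false → ins x S v ≡ true → v ≡ x
    only-x {v} Yv h = case ins-elim x S {v} h of λ { (inj₁ e) → e ; (inj₂ k) → ⊥-elim (true≢false (S⊆Y v k) Yv) }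
    within : induce E (ins x S) ⊆ᵉ induce C (ins x S)
    within i j h = case induce-elim E (ins x S) {i} {j} h of λ { (d , y , z) → induce-intro C (ins x S) (∧-fst (at-Y d
      (case true⊎false (Y i) of λ
        { (inj₁ Yi) → inj₁ Yi
        ; (inj₂ Yi) → case true⊎false (Y j) of λ
          { (inj₁ Yj) → inj₂ Yj
          ; (inj₂ Yj) → ⊥-elim (ES-≢ es d (trans (only-x Yi y) (sym (only-x Yj z)))) } }))) y z }

  touch⊆P : touch E Y ⊆ᵉ P
  touch⊆P i j h = case touch-elim E Y {i} {j} h of λ { (x , y) → at-Y x y }

  full : 1 ≤ vcount Y → inc E Y ≡ 2 * vcount Y + 1
  full pos = ≤-antisym (≤-trans (ecount-mono touch⊆P) (≤-reflexive new-count)) (lower Y (λ _ h → h) pos)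

  -- The edges at `Y` are among the new edges `P` and equally many, so every new edge is at `Y`.
  -- Hence no edge outside `Y` is missing from `D`.
  D≐ : 1 ≤ vcount Y → induce E (Y ᶜ) ⊆ᵉ D
  D≐ pos i j h = case induce-elim E (Y ᶜ) {i} {j} h of λ { (x , y , z) → ≢false⇒true λ Dij →
    true≢false (∧-snd {E i j} (⊆ᵉ-by-count {A = touch E Y} {P} (IsES-touch Y es) esP touch⊆P
      (≤-reflexive (trans new-count (sym (full pos)))) i j (∧-intro (∨-elimˡ (E⊆ i j x) Dij) (not-true Dij))))
      (cong₂ _∨_ (not-true⁻ y) (not-true⁻ z)) }

  D⊆induce : D ⊆ᵉ induce E (Y ᶜ)
  D⊆induce i j h = induce-intro E (Y ᶜ) (D⊆E i j h) (not-true (V⇒Y-false (ends-intro D h)))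
    (not-true (V⇒Y-false (ends-intro D (ES-sym base-es h))))

  base' : 1 ≤ vcount Y → Base (induce E (Y ᶜ)) (Y ᶜ)
  base' pos = record
    { base-es = IsES-induce (Y ᶜ) es ; connected = connected-ext D⊆induce (D≐ pos) connected
    ; basis = basis ; basis-es = basis-es ; basis⊆ = λ i j h → D⊆induce i j (basis⊆ i j h) ; basis-indep = basis-indep
    ; basis-count = ≤-trans (*-monoʳ-≤ 2 (vcount-mono {A = Y ᶜ} {V} (λ v h → Y-false⇒V (not-true⁻ h)))) basis-count }

  grounded : ∀ v → Y v ≡ false → ∃[ w ] (induce E (Y ᶜ) v w ≡ true)
  grounded v Yv = case ends-elim D (Y-false⇒V Yv) of λ { (w , h) → w , D⊆induce v w h }

  cut : VS n → ES n
  cut S i j = C i j ∧ ((S i ∧ not (S j)) ∨ (not (S i) ∧ S j))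

  -- The edges leaving `S` number `inc − ind`, which is three; the separation consists of `S` and
  -- the rest of the last ear.
  three-edge-sep : ∀ S → S ⊆ᵛ Y → inc E S ≡ 2 * vcount S + 1 → ind E S + 2 ≡ 2 * vcount S → ThreeEdgeSep VC C S (VC ∖ᵛ S)
  three-edge-sep S S⊆Y crit tight = (λ v h → ∧-fst (S⊆Y v h)) , (λ v h → ∧-fst h) ,
      (λ v h → trans (cong (λ b → VC v ∧ not b) h) (𝔹.∧-zeroʳ _)) ,
      (λ v h → case true⊎false (S v) of λ { (inj₁ s) → inj₁ s ; (inj₂ s) → inj₂ (∧-intro h (not-true s)) }) ,
      cut S , ((λ i j → cong₂ _∧_ (proj₁ esC i j) (swap (S i) (S j))) , (λ i → cong (_∧ ((S i ∧ not (S i)) ∨ (not (S i) ∧ S i))) (proj₂ esC i))) ,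
      (λ i j h → ∧-fst h) , three , spec
    where
    swap : ∀ a b → (a ∧ not b) ∨ (not a ∧ b) ≡ (b ∧ not a) ∨ (not b ∧ a)
    swap = cases (∀𝔹? λ a → ∀𝔹? λ b → _ 𝔹.≟ _)
    aux : ∀ c a b → ⟦ c ∧ (a ∨ b) ⟧ ≡ ⟦ c ∧ (a ∧ b) ⟧ + ⟦ c ∧ ((a ∧ not b) ∨ (not a ∧ b)) ⟧
    aux = cases (∀𝔹? λ c → ∀𝔹? λ a → ∀𝔹? λ b → _ ℕ.≟ _)
    three : ecount (cut S) ≡ 3
    three = linear 6 (λ i j k i' j' s → i ≐ j ⊕ k ⇒ i ≐ i' ⇒ j ≐ j' ⇒ i' ≐ 2 ⊗ s ⊕ κ 1 ⇒ j' ⊕ κ 2 ≐ 2 ⊗ s ⇒ ⊢ k ≐ κ 3)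
      (inc C S) (ind C S) (ecount (cut S)) (inc E S) (ind E S) (vcount S)
      (ecount₁≡₂ {A = touch C S} {induce C S} {cut S} (λ i j _ → aux (C i j) (S i) (S j))) (inc-C S S⊆Y) (ind-C S S⊆Y) crit tight
    boole : ∀ a b → (true ∧ (a ∧ b)) ∨ (true ∧ ((true ∧ not a) ∧ (true ∧ not b))) ≡ not (true ∧ ((a ∧ not b) ∨ (not a ∧ b)))
    boole = cases (∀𝔹? λ a → ∀𝔹? λ b → _ 𝔹.≟ _)
    spec : ∀ i j → (induce C S i j ∨ induce C (VC ∖ᵛ S) i j ≡ true) ⇔ (C i j ≡ true × cut S i j ≡ false)
    spec i j with C i j in eq
    ... | false = mk⇔ (λ ()) (λ { (() , _) })
    ... | true rewrite ends-intro C eq | ends-intro C (ES-sym esC eq) = mk⇔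
          (λ h → refl , not-true⁻ (trans (sym (boole (S i) (S j))) h))
          (λ { (_ , h) → trans (boole (S i) (S j)) (not-true h) })

  ear : 1 ≤ vcount Y →
    ¬ (∃[ S ] (ThreeEdgeSep VC C S (VC ∖ᵛ S) × 2 ≤ vcount S × 2 ≤ vcount (VC ∖ᵛ S) × S ⊆ᵛ Y)) → Ear E Y
  ear pos no-sep = record
    { es = es ; nonempty = pos ; full = full pos ; lower = lower ; upper = upper ; upper⁺ = upper⁺
    ; no-3-cut = λ S S⊆Y two crit → subst (_≤ 2 * vcount S) (sym (+-suc (ind E S) 2))
        (≤∧≢⇒< (upper S S⊆Y (≤-trans (s≤s z≤n) two)) λ tight → no-sep (S , three-edge-sep S S⊆Y crit tight , two ,
          vcount≥2 (VC ∖ᵛ S) e₁≢e₂ (outer S⊆Y VCe₁ Ye₁) (outer S⊆Y VCe₂ Ye₂) , S⊆Y)) }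
    where
    outer : ∀ {S v} → S ⊆ᵛ Y → VC v ≡ true → Y v ≡ false → (VC ∖ᵛ S) v ≡ true
    outer {S} {v} S⊆Y c y = ∧-intro c (not-true (≢true⇒false (λ h → true≢false (S⊆Y v h) y)))

  -- Without new vertices the last ear is a single edge.
  trivial-ear : vcount Y ≡ 0 → Connects (delE (proj₁ p) (proj₂ p) E) (λ _ → true)
  trivial-ear none = record
    { c-es = IsES-delE p₁ p₂ es
    ; c-conn = connected-ext D⊆ ⊆D connected
    ; c-nbr = λ v _ → case ends-elim D (Y-false⇒V (vcount≡0 Y none v)) of λ { (w , h) → w , D⊆ v w h } }
    where
    p₁ p₂ : Fin n
    p₁ = proj₁ p
    p₂ = proj₂ p
    D⊆ : D ⊆ᵉ delE p₁ p₂ E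
    D⊆ i j h = ∧-intro (D⊆E i j h) (not-true (edge-false p₁ p₂ {i} {j} λ
      { (inj₁ (refl , refl)) → true≢false h Dp ; (inj₂ (refl , refl)) → true≢false (ES-sym base-es h) Dp }))
    ⊆D : delE p₁ p₂ E ⊆ᵉ D
    ⊆D i j h = ≢false⇒true λ Dij → linear 3 (λ q q' n → q ≐ κ 1 ⊕ q' ⇒ q ≐ 2 ⊗ n ⊕ κ 1 ⇒ n ≐ κ 0 ⇒ κ 1 ≼ q' ⇒ ⊢⊥)
      (ecount P) (ecount (delE p₁ p₂ P)) (vcount Y) (ecount-delE esP Pp) new-count none
      (ecount-pos (IsES-delE p₁ p₂ esP) {i} {j} (∧-intro (∧-intro (∨-elimˡ (E⊆ i j (∧-fst h)) Dij) (not-true Dij)) (∧-snd {E i j} h)))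

theorem6p5 : ∀ {n} (G : Graph n) (s : ℕ) (C : Fin (suc s) → ES n) →
    MConnected G → 1 ≤ s → EarDecomposition G (suc s) C →
    ¬ (∃[ W1 ] ∃[ W2 ]
    (ThreeEdgeSep (ends (C (fromℕ s))) (C (fromℕ s)) W1 W2 ×
    2 ≤ vcount W1 × 2 ≤ vcount W2 ×
    (IsSubgraph W1 (induce (C (fromℕ s)) W1)
    (earY s C) (induce (C (fromℕ s)) (earY s C)) ⊎
    IsSubgraph W2 (induce (C (fromℕ s)) W2)
    (earY s C) (induce (C (fromℕ s)) (earY s C))))) →
    (∃[ m ] ∃[ G' ] (EdgeReduction {n} {m} G G' × MConnected G')) ⊎
    (∃[ G' ] (EdgeDeletion G G' × MConnected G')) ⊎
    (∃[ m ] ∃[ G' ] (K4Reduction {n} {m} G G' × MConnected G'))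
theorem6p5 {zero} G s C (_ , () , _) _ _ _
theorem6p5 {suc m} G s C (nbr , _) 1≤s dec no-sep =
  case meeting r pos of λ { (e , Ce , De) → case leaving r pos of λ { (p , Cp , Dp) → main {e} {p} Ce De Cp Dp } }
  where
  open Ears G s C dec
  r : Fin (suc s)
  r = fromℕ s
  r≡s : toℕ r ≡ s
  r≡s = Fin.toℕ-fromℕ s
  pos : 1 ≤ toℕ r
  pos = subst (1 ≤_) (sym r≡s) 1≤s
  D : ES (suc m)
  D = union (toℕ r)
  base : Base D (ends D)
  base = subst (λ k → Base (union k) (ends (union k))) (sym r≡s) (union-base s 1≤s ≤-refl)
  E⊆ : adj G ⊆ᵉ (D ∪ᵉ C r)
  E⊆ i j h = union-suc r i j (subst (λ k → union (suc k) i j ≡ true) (sym r≡s)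
    (InD⇒union (suc s) (Equivalence.to (proj₁ (proj₂ dec) i j) h)))
  ⊆E : (D ∪ᵉ C r) ⊆ᵉ adj G
  ⊆E i j h = case ∨-elim {D i j} h of λ
    { (inj₁ d) → case union⇒InD (toℕ r) d of λ { (r' , _ , c) → C⊆E r' i j c } ; (inj₂ c) → C⊆E r i j c }
  main : ∀ {e p} → C r ∋ e → D ∋ e → C r ∋ p → D ∌ p → Admissible G
  main {e} {p} Ce De Cp Dp = case 1 ≤? vcount Y of λ
      { (no none) → edge-deletion G (⊆E (proj₁ p) (proj₂ p) (∨-introʳ {D (proj₁ p) (proj₂ p)} Cp))
          -- Here the single new edge is deleted. In the other case the hypothesis on separations is
          -- applied with `S` as the part inside `Y`.
          (trivial-ear (n<1⇒n≡0 (≰⇒> none))) (λ _ → refl)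
      ; (yes some) → ear-admissible G (ear some λ { (S , sep , two , two' , S⊆Y) → no-sep (S , _ , sep , two , two' ,
          inj₁ ((IsES-induce S (circ-es (circ r)) , (λ i j h → proj₁ (proj₂ (induce-elim (C r) S {i} {j} h)))) ,
            (λ v h → Y⊆earY v (S⊆Y v h)) ,
            (λ i j h → case induce-elim (C r) S {i} {j} h of λ { (x , y , z) →
              induce-intro (C r) (earY s C) x (Y⊆earY i (S⊆Y i y)) (Y⊆earY j (S⊆Y j z)) }))) })
          (base' some) grounded }
    where
    open LastEar (adj G) (isES G) D (C r) base (circ r) {e} {p} Ce De Cp Dp (minimal r pos {p} Cp Dp) E⊆ ⊆E nbr
      using (Y; trivial-ear; ear; base'; grounded)
    Y⊆earY : Y ⊆ᵛ earY s C
    Y⊆earY v h = ∧-intro (∧-fst h) (not-true (≢true⇒false λ k → case anyFin-elim _ k of λ { (r' , x) →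
      case ends-elim (C r') (∧-snd {toℕ r' <ᵇ s} x) of λ { (w , c) →
        true≢false (ends-intro D (InD⇒union (toℕ r) (r' , subst (toℕ r' <_) (sym r≡s) (<ᵇ-elim (∧-fst x)) , c)))
          (not-true⁻ (∧-snd {ends (C r) v} h)) } }))
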